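{- For every $\varepsilon>0$ there is a uniform-distribution learning algorithm for convex sets in $\{0,\pm1\}^n$ which achieves error at most $\varepsilon$ with time and sample complexity $3^{\widetilde O(n^{3/4}/\varepsilon)}$, where the $\widetilde O(\cdot)$ hides a factor of $\log^{1/4} n$.
   Context: A set $S\subseteq\{0,\pm1\}^n$ is convex if $S=\mathrm{Conv}(S)\cap\{0,\pm1\}^n$, where $\mathrm{Conv}(S)\subseteq\mathbb{R}^n$ is the convex hull. For $S,T\subseteq\{0,\pm1\}^n$, $\mathrm{dist}(S,T)=|S\,\Delta\,T|/3^n$, where $S\,\Delta\,T$ is the symmetric difference. A uniform-distribution learning algorithm for convex sets with error at most $\varepsilon$ receives labelled examples $(x,\mathbf 1[x\in S])$ of an unknown convex set $S\subseteq\{0,\pm1\}^n$, with the points $x$ drawn independently and uniformly from $\{0,\pm1\}^n$, and must output, with probability at least $2/3$, a set $T\subseteq\{0,\pm1\}^n$ with $\mathrm{dist}(S,T)\le\varepsilon$. The output $T$ need not be convex. The sample complexity is the number of labelled examples used. -}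

module Defs where

open import Algebra.Definitions.RawMonoid using (sum)
open import Algebra.Definitions.RawSemiring using (_^_)
open import Data.Bool.Base using (Bool; true; false; _xor_)
import Data.Bool.Properties as Bool
open import Data.Fin.Base using (Fin; zero)
open import Data.Integer.Base using (+_)
open import Data.List.Base using (List; []; _∷_; cartesianProductWith; filter; length)
open import Data.Nat.Base as ℕ using (ℕ; zero; suc; _+_; _*_; _≤_; NonZero)
open import Data.Nat.Logarithm using (⌈log₂_⌉)
open import Data.Nat.Properties using (m^n≢0)
open import Data.Product.Base using (Σ-syntax; ∃-syntax; _×_)
open import Data.Rational.Base as ℚ using (ℚ; 0ℚ; 1ℚ)
import Data.Rational.Properties as ℚ
open import Data.Vec.Base as Vec using (Vec; []; _∷_; lookup; replicate; _[_]≔_)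
open import Function.Bundles using (_⇔_)
open import Level using (0ℓ)
open import Relation.Binary.PropositionalEquality.Core using (_≡_)
open import Relation.Unary using (Pred; Decidable)

------------------------------------------------------------------------
-- The ternary cube and its convex subsets

data Trit : Set where
  −1ᵗ 0ᵗ +1ᵗ : Trit

⟦_⟧ : Trit → ℚ
⟦ −1ᵗ ⟧ = ℚ.- 1ℚ
⟦ 0ᵗ ⟧  = 0ℚ
⟦ +1ᵗ ⟧ = 1ℚ

Point : ℕ → Set
Point n = Vec Trit n

Subset : ℕ → Set
Subset n = Point n → Bool

∑ : ∀ {k} → (Fin k → ℚ) → ℚ
∑ = sum ℚ.+-0-rawMonoid

-- Rational weights suffice: the weights expressing a rational point as a
-- convex combination of rational points solve a rational linear program,
-- so a rational point of the real convex hull is already in this one.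
Conv : ∀ {n} → Subset n → Pred (Fin n → ℚ) 0ℓ
Conv {n} S v =
  ∃[ k ] Σ[ p ∈ (Fin k → Point n) ] Σ[ w ∈ (Fin k → ℚ) ]
    (∀ i → S (p i) ≡ true)
  × (∀ i → 0ℚ ℚ.≤ w i)
  × ∑ w ≡ 1ℚ
  × (∀ j → ∑ (λ i → w i ℚ.* ⟦ lookup (p i) j ⟧) ≡ v j)

Convex : ∀ {n} → Subset n → Set
Convex S = ∀ x → S x ≡ true ⇔ Conv S (λ j → ⟦ lookup x j ⟧)

------------------------------------------------------------------------
-- Distance and probability, by counting

vectors : ∀ {A : Set} → List A → (m : ℕ) → List (Vec A m)
vectors xs zero    = [] ∷ []
vectors xs (suc m) = cartesianProductWith _∷_ xs (vectors xs m)

points : (n : ℕ) → List (Point n)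
points = vectors (−1ᵗ ∷ 0ᵗ ∷ +1ᵗ ∷ [])

dist : ∀ {n} → Subset n → Subset n → ℚ
dist {n} S T =
  (+ length (filter (λ x → (S x xor T x) Bool.≟ true) (points n))) ℚ./ (3 ℕ.^ n)
  where instance _ = m^n≢0 3 n

-- The probability of P for m independent uniform points.
Pr : ∀ {n m} {P : Pred (Vec (Point n) m) 0ℓ} → Decidable P → ℚ
Pr {n} {m} P? =
  (+ length (filter P? (vectors (points n) m))) ℚ./ ((3 ℕ.^ n) ℕ.^ m)
  where instance _ = m^n≢0 3 n
                 _ = m^n≢0 (3 ℕ.^ n) m

------------------------------------------------------------------------
-- The model of computation: Jones's WHILE language over binary trees,
-- which simulates and is simulated by Turing machines with polynomial
-- overhead, extended with a command that requests a labelled example.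
-- Trees are thought of as shared pointer structures, so every elementary
-- operation, including copying a register, has unit cost.

infixr 5 _∙_

data Tree : Set where
  nil : Tree
  _∙_ : Tree → Tree → Tree

data Exp (k : ℕ) : Set where
  var  : Fin k → Exp k
  nil  : Exp k
  cons : Exp k → Exp k → Exp k
  hd   : Exp k → Exp k
  tl   : Exp k → Exp k

infix  6 _≔_
infixr 5 _⨾_

data Cmd (k : ℕ) : Set where
  _≔_           : Fin k → Exp k → Cmd k
  draw          : Fin k → Cmd k
  _⨾_           : Cmd k → Cmd k → Cmd k
  if_then_else_ : Exp k → Cmd k → Cmd k → Cmd k
  while_loop_   : Exp k → Cmd k → Cmd k

head tail : Tree → Tree
head nil     = nil
head (l ∙ r) = l
tail nil     = nil
tail (l ∙ r) = r

eval : ∀ {k} → Exp k → Vec Tree k → Tree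
eval (var i)    ρ = lookup ρ i
eval nil        ρ = nil
eval (cons a b) ρ = eval a ρ ∙ eval b ρ
eval (hd a)     ρ = head (eval a ρ)
eval (tl a)     ρ = tail (eval a ρ)

cost : ∀ {k} → Exp k → ℕ
cost (var i)    = 1
cost nil        = 1
cost (cons a b) = suc (cost a + cost b)
cost (hd a)     = suc (cost a)
cost (tl a)     = suc (cost a)

truth : Tree → Bool
truth nil     = false
truth (_ ∙ _) = true

infix 4 _∣_

-- The registers, and the examples that have not been requested yet.
record State (k : ℕ) : Set where
  constructor _∣_
  field
    registers : Vec Tree k
    supply    : List Tree

infix 3 ⟨_,_⟩⇓[_]_

-- ⟨ c , s ⟩⇓[ t ] s′ : started in s, the command c halts in s′ after
-- exactly t units of time.  A draw from an empty supply does not halt.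
data ⟨_,_⟩⇓[_]_ {k : ℕ} : Cmd k → State k → ℕ → State k → Set where
  assign : ∀ {i e ρ es} →
    ⟨ i ≔ e , ρ ∣ es ⟩⇓[ suc (cost e) ] ((ρ [ i ]≔ eval e ρ) ∣ es)
  draw : ∀ {i ρ e es} →
    ⟨ draw i , ρ ∣ e ∷ es ⟩⇓[ 1 ] ((ρ [ i ]≔ e) ∣ es)
  seq : ∀ {c d s s′ s″ t t′} →
    ⟨ c , s ⟩⇓[ t ] s′ → ⟨ d , s′ ⟩⇓[ t′ ] s″ →
    ⟨ c ⨾ d , s ⟩⇓[ t + t′ ] s″
  if-true : ∀ {e c d ρ es s′ t} → truth (eval e ρ) ≡ true →
    ⟨ c , ρ ∣ es ⟩⇓[ t ] s′ →
    ⟨ if e then c else d , ρ ∣ es ⟩⇓[ suc (cost e + t) ] s′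
  if-false : ∀ {e c d ρ es s′ t} → truth (eval e ρ) ≡ false →
    ⟨ d , ρ ∣ es ⟩⇓[ t ] s′ →
    ⟨ if e then c else d , ρ ∣ es ⟩⇓[ suc (cost e + t) ] s′
  while-true : ∀ {e c ρ es s′ s″ t t′} → truth (eval e ρ) ≡ true →
    ⟨ c , ρ ∣ es ⟩⇓[ t ] s′ → ⟨ while e loop c , s′ ⟩⇓[ t′ ] s″ →
    ⟨ while e loop c , ρ ∣ es ⟩⇓[ suc (cost e + t + t′) ] s″
  while-false : ∀ {e c ρ es} → truth (eval e ρ) ≡ false →
    ⟨ while e loop c , ρ ∣ es ⟩⇓[ suc (cost e) ] (ρ ∣ es)

-- Register 0 holds the input at the start and the output at the end; the
-- other registers start out as nil.
record Program : Set where
  field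
    auxiliary : ℕ
    body      : Cmd (suc auxiliary)

-- On this input and supply of examples, P halts within time t, with this
-- output.
Computes : Program → (input : Tree) (supply : List Tree) (t : ℕ)
           (output : Tree) → Set
Computes P input supply t output =
  ∃[ t′ ] ∃[ ρ ] ∃[ unused ]
    t′ ≤ t
  × ⟨ body , (input ∷ replicate auxiliary nil) ∣ supply ⟩⇓[ t′ ]
      ((output ∷ ρ) ∣ unused)
  where open Program P

encodeℕ : ℕ → Tree
encodeℕ zero    = nil
encodeℕ (suc n) = nil ∙ encodeℕ n

encodeBool : Bool → Tree
encodeBool false = nil
encodeBool true  = nil ∙ nil

encodeTrit : Trit → Tree
encodeTrit 0ᵗ  = nil
encodeTrit +1ᵗ = nil ∙ nil
encodeTrit −1ᵗ = (nil ∙ nil) ∙ nil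

encodePoint : ∀ {n} → Point n → Tree
encodePoint []      = nil
encodePoint (a ∷ x) = encodeTrit a ∙ encodePoint x

examples : ∀ {n m} → Subset n → Vec (Point n) m → List Tree
examples S xs = Vec.toList (Vec.map (λ x → encodePoint x ∙ encodeBool (S x)) xs)

------------------------------------------------------------------------
-- Learning algorithms

-- The set output by the learner is too large to be listed, so learning
-- produces a representation of it: a tree r standing for the set of all x
-- that the second program accepts on input (r , x).
record Algorithm : Set where
  field
    learner   : Program
    evaluator : Program

-- In dimension n, A learns convex sets with error at most ε using at most
-- m examples; learning, and deciding membership of any one point in the
-- set that was output, take time at most t each.
Learns : Algorithm → (ε : ℚ) (n m t : ℕ) → Set
Learns A ε n m t =
  (S : Subset n) → Convex S →
  Σ[ rep ∈ (Vec (Point n) m → Tree) ]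
  Σ[ T ∈ (Vec (Point n) m → Subset n) ]
    (∀ xs → Computes learner (encodeℕ n) (examples S xs) t (rep xs))
  × (∀ xs x → ∃[ answer ] (Computes evaluator (rep xs ∙ encodePoint x) [] t answer
                           × truth answer ≡ T xs x))
  × (+ 2 ℚ./ 3) ℚ.≤ Pr (λ xs → dist S (T xs) ℚ.≤? ε)
  where open Algorithm A

-- N ≤ C · 3 ^ (C · n^(3/4) · log^(1/4) n / ε), with the fourth power of
-- the bound on the exponent cleared of roots and fractions.  The leading C
-- only matters when the exponent is near 0, that is, for large ε; log is
-- taken as ⌈log₂ (1 + n)⌉, within a constant factor of log n for n ≥ 2
-- and positive at n = 1.
Bounded : (C : ℕ) (ε : ℚ) (n N : ℕ) → Set
Bounded C ε n N =
  ∃[ e ] N ≤ C * 3 ℕ.^ e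
       × pow ((+ e ℚ./ 1) ℚ.* ε) 4
           ℚ.≤ (+ (C ℕ.^ 4 * n ℕ.^ 3 * ⌈log₂ suc n ⌉) ℚ./ 1)
  where pow = _^_ ℚ.+-*-rawSemiring

-- The learner stores random examples, and a point is classified by the sign
-- of the sum of their ±-labels, weighted by the kernel of the projection
-- onto the Efron-Stein components of degree < d.  The expected error is at
-- most the energy of the set above degree d plus the norm of the kernel
-- divided by the number of examples, up to a constant; this energy is at
-- most the noise sensitivity, for a noise moving coordinates between zero
-- and nonzero.
--
-- Distribute the n coordinates at random among M blocks and among those
-- that stay fixed during a walk, which switches the blocks on in a random
-- order and with random signs.  When the walk leaves a convex set, it is at
-- a point separated from the set by a functional, so it does not return if
-- the functional stays nonnegative along the rest of the walk.  By the
-- argument of Sparre Andersen (cut at the minimum of the partial sums, ties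
-- being broken by a perturbation) this has probability at least
-- 1/√(4 M + 1).  As there is at most one last exit, the expected number of
-- exits among the M steps is O(√M).  The steps of the walk are pairs of
-- points at various displacements from the centre of the window, and a pair
-- at the centre is dominated by two pairs at symmetric displacements, by
-- the inequality of the arithmetic and geometric means; hence no
-- concentration inequality is needed, and no logarithm is lost.
--
-- So the energy above degree d is at most ε for d of order √n/ε².  If
-- d = n/λ² the kernel has norm 2^O(n/λ), and λ of order ε n^(1/4) leaves
-- the exponent n^(3/4)/ε.

module Submission where

-- All probabilities are cleared to counts: sums over signed permutations, over labellings of the
-- coordinates and over points, so that only integer inequalities remain. How many arrangements of
-- given steps persist is not computed directly; a convolution identity shows that, in the absence
-- of ties, it depends on the number of steps alone, and it is bounded for powers of three as steps.
-- The labels are weighted so that the law of one step of the walk depends only on how many steps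
-- precede it. With a window of 2 s² + 1 steps, O(s) of them change membership on average. So a step
-- at the centre, which erases nonzero coordinates at rate 1/(2 m) where m² ≥ 2 n s⁴, does so with
-- probability at most 9/s. Passing to energy costs a factor 8, whence 72/s. With s = 432 q and 1/q
-- ≤ ε this is 1/(6 q), half of the expected error 1/(3 q) that Markov's inequality can afford. The
-- machine works in unary and obtains its parameters by halving: λ is 2ᵃ, the degree bound 1 + n/4ᵃ,
-- and the sample size 16 to the power q + 1 + n/2ᵃ, where a is the first value with n/16ᵃ ≤ R, and
-- R + 1 = 288 s⁴.

-- Sums over lists.

module FiniteSums where

  open import Algebra.Bundles using (CommutativeSemiring)
  open import Data.List.Base
    using (List; []; _∷_; _++_; map; concatMap; cartesianProductWith)
  open import Data.List.Membership.Propositional using (_∈_)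
  open import Data.List.Relation.Unary.Any using (here; there)
  open import Data.Nat.Base as ℕ using (suc)
  open import Data.Vec.Base using (Vec; []; _∷_)
  open import Level using (0ℓ)
  open import Relation.Binary.PropositionalEquality.Core as ≡ using (_≡_)
  open import Function.Base using (_∘_)
  open import Defs using (vectors)

  module ListSum (R : CommutativeSemiring 0ℓ 0ℓ) where
    open CommutativeSemiring R
    open import Relation.Binary.Reasoning.Setoid setoid

    private variable
      A B C : Set

    Σ : List A → (A → Carrier) → Carrier
    Σ []       f = 0#
    Σ (x ∷ xs) f = f x + Σ xs f

    Σ-cong-∈ : ∀ (xs : List A) {f g : A → Carrier} →
               (∀ {x} → x ∈ xs → f x ≈ g x) → Σ xs f ≈ Σ xs g
    Σ-cong-∈ []       h = refl
    Σ-cong-∈ (x ∷ xs) h = +-cong (h (here ≡.refl)) (Σ-cong-∈ xs (h ∘ there))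

    Σ-cong : ∀ (xs : List A) {f g : A → Carrier} →
             (∀ x → f x ≈ g x) → Σ xs f ≈ Σ xs g
    Σ-cong xs h = Σ-cong-∈ xs (λ {x} _ → h x)

    Σ-++ : ∀ (xs ys : List A) (f : A → Carrier) →
           Σ (xs ++ ys) f ≈ Σ xs f + Σ ys f
    Σ-++ []       ys f = sym (+-identityˡ _)
    Σ-++ (x ∷ xs) ys f = trans (+-congˡ (Σ-++ xs ys f)) (sym (+-assoc _ _ _))

    Σ-map : ∀ (h : A → B) (xs : List A) (f : B → Carrier) →
            Σ (map h xs) f ≈ Σ xs (f ∘ h)
    Σ-map h []       f = refl
    Σ-map h (x ∷ xs) f = +-congˡ (Σ-map h xs f)

    Σ-concatMap : ∀ (h : A → List B) (xs : List A) (f : B → Carrier) →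
                  Σ (concatMap h xs) f ≈ Σ xs (λ x → Σ (h x) f)
    Σ-concatMap h []       f = refl
    Σ-concatMap h (x ∷ xs) f =
      trans (Σ-++ (h x) (concatMap h xs) f) (+-congˡ (Σ-concatMap h xs f))

    Σ-product : ∀ (h : A → B → C) (xs : List A) (ys : List B)
                (f : C → Carrier) →
                Σ (cartesianProductWith h xs ys) f ≈
                Σ xs (λ x → Σ ys (λ y → f (h x y)))
    Σ-product h []       ys f = refl
    Σ-product h (x ∷ xs) ys f =
      trans (Σ-++ (map (h x) ys) _ f)
            (+-cong (Σ-map (h x) ys f) (Σ-product h xs ys f))

    Σ-vectors : ∀ (xs : List A) m (f : Vec A (suc m) → Carrier) →
                Σ (vectors xs (suc m)) f ≈
                Σ xs (λ x → Σ (vectors xs m) (λ v → f (x ∷ v)))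
    Σ-vectors xs m f = Σ-product _∷_ xs (vectors xs m) f

    +-interchange : ∀ a b c d → (a + b) + (c + d) ≈ (a + c) + (b + d)
    +-interchange a b c d = begin
      (a + b) + (c + d)  ≈⟨ +-assoc a b (c + d) ⟩
      a + (b + (c + d))  ≈⟨ +-congˡ (+-assoc b c d) ⟨
      a + ((b + c) + d)  ≈⟨ +-congˡ (+-congʳ (+-comm b c)) ⟩
      a + ((c + b) + d)  ≈⟨ +-congˡ (+-assoc c b d) ⟩
      a + (c + (b + d))  ≈⟨ +-assoc a c (b + d) ⟨
      (a + c) + (b + d)  ∎

    Σ-+ : ∀ (xs : List A) (f g : A → Carrier) →
          Σ xs (λ x → f x + g x) ≈ Σ xs f + Σ xs g
    Σ-+ []       f g = sym (+-identityˡ 0#)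
    Σ-+ (x ∷ xs) f g =
      trans (+-congˡ (Σ-+ xs f g)) (+-interchange (f x) (g x) _ _)

    Σ-*ˡ : ∀ (xs : List A) c (f : A → Carrier) →
           Σ xs (λ x → c * f x) ≈ c * Σ xs f
    Σ-*ˡ []       c f = sym (zeroʳ c)
    Σ-*ˡ (x ∷ xs) c f =
      trans (+-congˡ (Σ-*ˡ xs c f)) (sym (distribˡ c (f x) _))

    Σ-*ʳ : ∀ (xs : List A) c (f : A → Carrier) →
           Σ xs (λ x → f x * c) ≈ Σ xs f * c
    Σ-*ʳ xs c f =
      trans (Σ-cong xs (λ x → *-comm (f x) c))
            (trans (Σ-*ˡ xs c f) (*-comm c _))

    Σ-0 : ∀ (xs : List A) → Σ xs (λ _ → 0#) ≈ 0#
    Σ-0 []       = refl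
    Σ-0 (x ∷ xs) = trans (+-identityˡ _) (Σ-0 xs)

    Σ-swap : ∀ (xs : List A) (ys : List B) (f : A → B → Carrier) →
             Σ xs (λ x → Σ ys (f x)) ≈ Σ ys (λ y → Σ xs (λ x → f x y))
    Σ-swap []       ys f = sym (Σ-0 ys)
    Σ-swap (x ∷ xs) ys f =
      trans (+-congˡ (Σ-swap xs ys f)) (sym (Σ-+ ys (f x) _))

-- Cutting, splitting and shuffling words.

module Words where

  open import Data.Bool.Base using (Bool; true; false)
  open import Data.List.Base using (List; []; _∷_; _++_; [_]; map; concatMap; length)
  open import Data.List.Membership.Propositional using (_∈_)
  open import Data.List.Relation.Unary.Any using (here; there)
  open import Data.Nat.Base
  open import Data.Nat.Properties
  open import Data.Nat.Tactic.RingSolver using (solve-∀)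
  open import Data.Product.Base using (_×_; _,_; map₁; map₂)
  open import Function.Base using (_∘_)
  open import Relation.Binary.PropositionalEquality hiding ([_]; J)
  open FiniteSums using (module ListSum)

  open ListSum +-*-commutativeSemiring public

  private variable
    A : Set

  𝟙 : Bool → ℕ
  𝟙 true  = 1
  𝟙 false = 0

  Σ-mono-∈ : ∀ (xs : List A) {f g : A → ℕ} →
             (∀ {x} → x ∈ xs → f x ≤ g x) → Σ xs f ≤ Σ xs g
  Σ-mono-∈ []       h = z≤n
  Σ-mono-∈ (x ∷ xs) h = +-mono-≤ (h (here refl)) (Σ-mono-∈ xs (h ∘ there))

  Σ-mono : ∀ (xs : List A) {f g : A → ℕ} → (∀ x → f x ≤ g x) → Σ xs f ≤ Σ xs g
  Σ-mono xs h = Σ-mono-∈ xs (λ {x} _ → h x)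

  Σ-const : ∀ (xs : List A) c → Σ xs (λ _ → c) ≡ length xs * c
  Σ-const []       c = refl
  Σ-const (x ∷ xs) c = cong (c +_) (Σ-const xs c)

  cuts : List A → List (List A × List A)
  cuts []      = [ [] , [] ]
  cuts (x ∷ w) = ([] , x ∷ w) ∷ map (map₁ (x ∷_)) (cuts w)

  splits : List A → List (List A × List A)
  splits []      = [ [] , [] ]
  splits (x ∷ L) = map (map₁ (x ∷_)) (splits L) ++ map (map₂ (x ∷_)) (splits L)

  insertions : A → List A → List (List A)
  insertions x []      = [ [ x ] ]
  insertions x (y ∷ w) = (x ∷ y ∷ w) ∷ map (y ∷_) (insertions x w)

  Σ-cuts-∷ : ∀ (x : A) w (F : List A × List A → ℕ) →
             Σ (cuts (x ∷ w)) F ≡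
             F ([] , x ∷ w) + Σ (cuts w) (λ (u , v) → F (x ∷ u , v))
  Σ-cuts-∷ x w F = cong (F ([] , x ∷ w) +_) (Σ-map (map₁ (x ∷_)) (cuts w) F)

  Σ-splits-∷ : ∀ (x : A) L (F : List A × List A → ℕ) →
               Σ (splits (x ∷ L)) F ≡
               Σ (splits L) (λ (P , Q) → F (x ∷ P , Q) + F (P , x ∷ Q))
  Σ-splits-∷ x L F = begin
    Σ (splits (x ∷ L)) F
      ≡⟨ Σ-++ (map (map₁ (x ∷_)) (splits L)) _ F ⟩
    Σ (map (map₁ (x ∷_)) (splits L)) F + Σ (map (map₂ (x ∷_)) (splits L)) F
      ≡⟨ cong₂ _+_ (Σ-map (map₁ (x ∷_)) (splits L) F)
                   (Σ-map (map₂ (x ∷_)) (splits L) F) ⟩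
    Σ (splits L) (λ (P , Q) → F (x ∷ P , Q)) +
    Σ (splits L) (λ (P , Q) → F (P , x ∷ Q))
      ≡⟨ Σ-+ (splits L) _ _ ⟨
    Σ (splits L) (λ (P , Q) → F (x ∷ P , Q) + F (P , x ∷ Q)) ∎
    where open ≡-Reasoning

  Σ-insertions-∷ : ∀ (x y : A) w (F : List A → ℕ) →
                   Σ (insertions x (y ∷ w)) F ≡
                   F (x ∷ y ∷ w) + Σ (insertions x w) (F ∘ (y ∷_))
  Σ-insertions-∷ x y w F =
    cong (F (x ∷ y ∷ w) +_) (Σ-map (y ∷_) (insertions x w) F)

  -- Cutting a word into which x has been inserted amounts to cutting the
  -- word and inserting x into one of the two halves.
  cut-insertions : ∀ (x : A) w (F : List A × List A → ℕ) →
    Σ (insertions x w) (λ w′ → Σ (cuts w′) F) ≡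
    Σ (cuts w) (λ (u , v) → Σ (insertions x u) (λ u′ → F (u′ , v)) +
                            Σ (insertions x v) (λ v′ → F (u , v′)))
  cut-insertions x [] F =
    lemma (F ([] , x ∷ [])) (F (x ∷ [] , []))
    where
    lemma : ∀ a b → a + (b + 0) + 0 ≡ b + 0 + (a + 0) + 0
    lemma = solve-∀
  cut-insertions x (y ∷ w) F = begin
    Σ (insertions x (y ∷ w)) (λ w′ → Σ (cuts w′) F)
      ≡⟨ Σ-insertions-∷ x y w _ ⟩
    Σ (cuts (x ∷ y ∷ w)) F + Σ (insertions x w) (λ w′ → Σ (cuts (y ∷ w′)) F)
      ≡⟨ cong₂ _+_
           (trans (Σ-cuts-∷ x (y ∷ w) F)
                  (cong (a +_) (Σ-cuts-∷ y w (λ (u , v) → F (x ∷ u , v)))))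
           (trans (Σ-cong (insertions x w) (λ w′ → Σ-cuts-∷ y w′ F))
                  (Σ-+ (insertions x w) _ _)) ⟩
    (a + (b + c)) + (d + Σ (insertions x w) (λ w′ → Σ (cuts w′) G))
      ≡⟨ cong (λ z → (a + (b + c)) + (d + z)) (cut-insertions x w G) ⟩
    (a + (b + c)) + (d + e)
      ≡⟨ lemma a b c d e ⟩
    ((b + 0) + (a + d)) + (c + e)
      ≡⟨ cong₂ (λ p q → ((b + 0) + p) + q)
           (Σ-insertions-∷ x y w (λ v′ → F ([] , v′)))
           (trans (Σ-cong (cuts w) (λ (u , v) →
                     trans (cong (_+ Σ (insertions x v) (λ v′ → F (y ∷ u , v′)))
                             (Σ-insertions-∷ x y u (λ u′ → F (u′ , v))))
                           (+-assoc (F (x ∷ y ∷ u , v)) _ _)))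
                  (Σ-+ (cuts w) _ _)) ⟨
    (Σ (insertions x []) (λ u′ → F (u′ , y ∷ w)) +
     Σ (insertions x (y ∷ w)) (λ v′ → F ([] , v′))) +
    Σ (cuts w) (λ (u , v) → Σ (insertions x (y ∷ u)) (λ u′ → F (u′ , v)) +
                            Σ (insertions x v) (λ v′ → F (y ∷ u , v′)))
      ≡⟨ Σ-cuts-∷ y w _ ⟨
    Σ (cuts (y ∷ w)) (λ (u , v) → Σ (insertions x u) (λ u′ → F (u′ , v)) +
                                  Σ (insertions x v) (λ v′ → F (u , v′))) ∎
    where
    open ≡-Reasoning
    G : List _ × List _ → ℕ
    G (u , v) = F (y ∷ u , v)
    a b c d e : ℕ
    a = F ([] , x ∷ y ∷ w)
    b = F (x ∷ [] , y ∷ w)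
    c = Σ (cuts w) (λ (u , v) → F (x ∷ y ∷ u , v))
    d = Σ (insertions x w) (λ w′ → F ([] , y ∷ w′))
    e = Σ (cuts w) (λ (u , v) → Σ (insertions x u) (λ u′ → G (u′ , v)) +
                                Σ (insertions x v) (λ v′ → G (u , v′)))
    lemma : ∀ a b c d e →
            (a + (b + c)) + (d + e) ≡ ((b + 0) + (a + d)) + (c + e)
    lemma = solve-∀

  module Arrangements {X : Set} (neg : X → X) where

    -- The signed permutations of a list, counted with multiplicity. They are generated by insertion
    -- because insertions interact simply with cuts.
    arr : List X → List (List X)
    arr []      = [ [] ]
    arr (x ∷ L) = concatMap (λ w → insertions x w ++ insertions (neg x) w) (arr L)

    Σ-arr-∷ : ∀ x L (F : List X → ℕ) →
              Σ (arr (x ∷ L)) F ≡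
              Σ (arr L) (λ w → Σ (insertions x w) F + Σ (insertions (neg x) w) F)
    Σ-arr-∷ x L F =
      trans (Σ-concatMap _ (arr L) F) (Σ-cong (arr L) (λ w → Σ-++ (insertions x w) _ F))

    -- A signed permutation cut in two amounts to a choice of the entries of the first half and
    -- independent signed permutations of both halves. This independence lets the future of a walk
    -- be random while its past is held fixed.
    cut-arr : ∀ L (F : List X × List X → ℕ) →
      Σ (arr L) (λ w → Σ (cuts w) F) ≡
      Σ (splits L) (λ (P , Q) → Σ (arr P) (λ u → Σ (arr Q) (λ v → F (u , v))))
    cut-arr []      F = cong (_+ 0) (cong (_+ 0) (sym (+-identityʳ _)))
    cut-arr (x ∷ L) F = begin
      Σ (arr (x ∷ L)) (λ w → Σ (cuts w) F)
        ≡⟨ Σ-arr-∷ x L _ ⟩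
      Σ (arr L) (λ w → Σ (insertions x w) (λ w′ → Σ (cuts w′) F) +
                       Σ (insertions (neg x) w) (λ w′ → Σ (cuts w′) F))
        ≡⟨ Σ-cong (arr L) (λ w →
             trans (cong₂ _+_ (cut-insertions x w F) (cut-insertions (neg x) w F))
                   (sym (Σ-+ (cuts w) _ _))) ⟩
      Σ (arr L) (λ w → Σ (cuts w) G)
        ≡⟨ cut-arr L G ⟩
      Σ (splits L) (λ (P , Q) → Σ (arr P) (λ u → Σ (arr Q) (λ v → G (u , v))))
        ≡⟨ Σ-cong (splits L) (λ (P , Q) → step P Q) ⟩
      Σ (splits L) (λ (P , Q) → H (x ∷ P , Q) + H (P , x ∷ Q))
        ≡⟨ Σ-splits-∷ x L H ⟨
      Σ (splits (x ∷ L)) H ∎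
      where
      open ≡-Reasoning
      I : X → List X × List X → ℕ
      I y (u , v) = Σ (insertions y u) (λ u′ → F (u′ , v))
      J : X → List X × List X → ℕ
      J y (u , v) = Σ (insertions y v) (λ v′ → F (u , v′))
      G : List X × List X → ℕ
      G p = (I x p + J x p) + (I (neg x) p + J (neg x) p)
      H : List X × List X → ℕ
      H (P , Q) = Σ (arr P) (λ u → Σ (arr Q) (λ v → F (u , v)))
      swap : ∀ u Q y →
        Σ (arr Q) (λ v → I y (u , v)) ≡ Σ (insertions y u) (λ u′ → Σ (arr Q) (λ v → F (u′ , v)))
      swap u Q y = Σ-swap (arr Q) (insertions y u) (λ v u′ → F (u′ , v))
      step : ∀ P Q → Σ (arr P) (λ u → Σ (arr Q) (λ v → G (u , v))) ≡
                     H (x ∷ P , Q) + H (P , x ∷ Q)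
      step P Q = begin
        Σ (arr P) (λ u → Σ (arr Q) (λ v → G (u , v)))
          ≡⟨ Σ-cong (arr P) (λ u → begin
               Σ (arr Q) (λ v → G (u , v))
                 ≡⟨ Σ-cong (arr Q) (λ v → +-interchange (I x (u , v)) _ _ _) ⟩
               Σ (arr Q) (λ v → (I x (u , v) + I (neg x) (u , v)) +
                                (J x (u , v) + J (neg x) (u , v)))
                 ≡⟨ Σ-+ (arr Q) _ _ ⟩
               Σ (arr Q) (λ v → I x (u , v) + I (neg x) (u , v)) +
               Σ (arr Q) (λ v → J x (u , v) + J (neg x) (u , v))
                 ≡⟨ cong₂ _+_
                      (trans (Σ-+ (arr Q) _ _) (cong₂ _+_ (swap u Q x) (swap u Q (neg x))))
                      (sym (Σ-arr-∷ x Q (λ v → F (u , v)))) ⟩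
               _ ∎) ⟩
        Σ (arr P) (λ u → (Σ (insertions x u) (λ u′ → Σ (arr Q) (λ v → F (u′ , v))) +
                          Σ (insertions (neg x) u) (λ u′ → Σ (arr Q) (λ v → F (u′ , v)))) +
                         Σ (arr (x ∷ Q)) (λ v → F (u , v)))
          ≡⟨ Σ-+ (arr P) _ _ ⟩
        _ ≡⟨ cong (_+ H (P , x ∷ Q)) (Σ-arr-∷ x P _) ⟨
        H (x ∷ P , Q) + H (P , x ∷ Q) ∎

-- Sparre Andersen's argument: walks that stay above their starting point.

module PersistentWalks where

  open import Algebra.Structures using (IsAbelianGroup)
  open import Data.Bool.Base using (Bool; true; false; _∧_; not; if_then_else_)
  open import Data.Empty using (⊥-elim)
  open import Data.List.Base using (List; []; _∷_; _++_; [_]; map; length)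
  open import Data.List.Membership.Propositional using (_∈_)
  open import Data.List.Membership.Propositional.Properties
    using (∈-map⁻; ∈-++⁻; ∈-concatMap⁻)
  open import Data.List.Relation.Unary.Any using (here; there)
  open import Data.List.Properties using (length-map)
  open import Data.Nat.Base
  open import Data.Nat.Induction using (<-rec)
  open import Data.Nat.Properties
  open import Data.Nat.Tactic.RingSolver using (solve-∀)
  open import Data.Product.Base using (_×_; _,_; proj₁; proj₂; ∃-syntax; map₁)
  open import Data.Sum.Base using (_⊎_; inj₁; inj₂)
  open import Function.Base using (_∘_)
  open import Relation.Binary.Definitions using (tri<; tri≈; tri>)
  open import Relation.Binary.PropositionalEquality hiding ([_]; J)
  open Words

  private variable
    A : Set

  ∧-true : ∀ {a b} → a ∧ b ≡ true → a ≡ true × b ≡ true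
  ∧-true {true} {true} _ = refl , refl

  true-∧ : ∀ {a b} → a ≡ true → b ≡ true → a ∧ b ≡ true
  true-∧ refl refl = refl

  ∈-insertions-∷ : ∀ {x y : A} {w w′} → w′ ∈ insertions x (y ∷ w) →
    w′ ≡ x ∷ y ∷ w ⊎ ∃[ w″ ] (w″ ∈ insertions x w × w′ ≡ y ∷ w″)
  ∈-insertions-∷ (here eq) = inj₁ eq
  ∈-insertions-∷ (there i) = inj₂ (∈-map⁻ _ i)

  ∈-cuts-∷ : ∀ {x : A} {w u v} → (u , v) ∈ cuts (x ∷ w) →
    (u ≡ [] × v ≡ x ∷ w) ⊎ ∃[ u′ ] ((u′ , v) ∈ cuts w × u ≡ x ∷ u′)
  ∈-cuts-∷ (here refl) = inj₁ (refl , refl)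
  ∈-cuts-∷ (there i) with ∈-map⁻ _ i
  ... | (u′ , v′) , j , refl = inj₂ (u′ , j , refl)

  ∈-cuts : ∀ {w u v : List A} → (u , v) ∈ cuts w → w ≡ u ++ v
  ∈-cuts {w = []}    (here refl) = refl
  ∈-cuts {w = x ∷ w} i with ∈-cuts-∷ {x = x} {w} i
  ... | inj₁ (refl , refl)     = refl
  ... | inj₂ (u′ , j , refl) = cong (x ∷_) (∈-cuts j)

  ∈-splits-∷ : ∀ {x : A} {L P Q} → (P , Q) ∈ splits (x ∷ L) →
    (∃[ P′ ] ((P′ , Q) ∈ splits L × P ≡ x ∷ P′)) ⊎
    (∃[ Q′ ] ((P , Q′) ∈ splits L × Q ≡ x ∷ Q′))
  ∈-splits-∷ {x = x} {L} i with ∈-++⁻ (map (map₁ (x ∷_)) (splits L)) i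
  ... | inj₁ j with ∈-map⁻ _ j
  ...   | (P′ , _) , k , refl = inj₁ (P′ , k , refl)
  ∈-splits-∷ i | inj₂ j with ∈-map⁻ _ j
  ...   | (_ , Q′) , k , refl = inj₂ (Q′ , k , refl)

  length-insertions : ∀ (x : A) w → length (insertions x w) ≡ suc (length w)
  length-insertions x []      = refl
  length-insertions x (y ∷ w) = cong suc (trans (length-map (y ∷_) (insertions x w)) (length-insertions x w))

  ∈-insertions-length : ∀ {x : A} {w w′} → w′ ∈ insertions x w → length w′ ≡ suc (length w)
  ∈-insertions-length {w = []}    (here refl) = refl
  ∈-insertions-length {w = y ∷ w} i with ∈-insertions-∷ {x = _} {y} {w} i
  ... | inj₁ refl             = refl
  ... | inj₂ (_ , j , refl) = cong suc (∈-insertions-length {w = w} j)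

  splits-length : ∀ {L P Q : List A} → (P , Q) ∈ splits L → length P + length Q ≡ length L
  splits-length {L = []} (here refl) = refl
  splits-length {L = x ∷ L} i with ∈-splits-∷ {x = x} {L} i
  ... | inj₁ (_ , j , refl) = cong suc (splits-length {L = L} j)
  ... | inj₂ (_ , j , refl) = trans (+-suc _ _) (cong suc (splits-length {L = L} j))

  splits-full : ∀ {L P : List A} {Q} → (P , Q) ∈ splits L → length P ≡ length L → P ≡ L
  splits-full {L = []} (here refl) _ = refl
  splits-full {L = x ∷ L} i eq with ∈-splits-∷ {x = x} {L} i
  ... | inj₁ (_ , j , refl) = cong (x ∷_) (splits-full j (suc-injective eq))
  ... | inj₂ (Q′ , j , refl) =
        ⊥-elim (<-irrefl eq (s≤s (≤-trans (m≤m+n _ _) (≤-reflexive (splits-length {L = L} j)))))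

  splits-full′ : ∀ {L P : List A} {Q} → (P , Q) ∈ splits L → length Q ≡ length L → Q ≡ L
  splits-full′ {L = []} (here refl) _ = refl
  splits-full′ {L = x ∷ L} i eq with ∈-splits-∷ {x = x} {L} i
  ... | inj₂ (_ , j , refl) = cong (x ∷_) (splits-full′ j (suc-injective eq))
  ... | inj₁ (P′ , j , refl) =
        ⊥-elim (<-irrefl eq (s≤s (≤-trans (m≤n+m _ (length P′)) (≤-reflexive (splits-length {L = L} j)))))

  -- 2ᶻ z!, the number of signed permutations of z entries.
  arrangements : ℕ → ℕ
  arrangements zero    = 1
  arrangements (suc z) = 2 * suc z * arrangements z

  module _ {X : Set} {neg : X → X} where
    open Arrangements neg

    ∈-arr-∷ : ∀ {x L w′} → w′ ∈ arr (x ∷ L) →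
      ∃[ w ] (w ∈ arr L × (w′ ∈ insertions x w ⊎ w′ ∈ insertions (neg x) w))
    ∈-arr-∷ {x} {L} i with Data.List.Membership.Propositional.find (∈-concatMap⁻ _ {xs = arr L} i)
    ... | w , j , k = w , j , ∈-++⁻ (insertions x w) k

    ∈-arr-length : ∀ {L w} → w ∈ arr L → length w ≡ length L
    ∈-arr-length {[]}    (here refl) = refl
    ∈-arr-length {x ∷ L} i with ∈-arr-∷ {x = x} {L} i
    ... | w , j , inj₁ k = trans (∈-insertions-length {w = w} k) (cong suc (∈-arr-length {L} j))
    ... | w , j , inj₂ k = trans (∈-insertions-length {w = w} k) (cong suc (∈-arr-length {L} j))

    arr-count : ∀ L → Σ (arr L) (λ _ → 1) ≡ arrangements (length L)
    arr-count []      = refl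
    arr-count (x ∷ L) = begin
      Σ (arr (x ∷ L)) (λ _ → 1)
        ≡⟨ Σ-arr-∷ x L _ ⟩
      Σ (arr L) (λ w → Σ (insertions x w) (λ _ → 1) + Σ (insertions (neg x) w) (λ _ → 1))
        ≡⟨ Σ-cong-∈ (arr L) (λ {w} j → trans (cong₂ _+_ (count x w) (count (neg x) w))
             (trans (cong (λ z → suc z + suc z) (∈-arr-length {L} j)) (lemma (length L)))) ⟩
      Σ (arr L) (λ _ → 2 * suc (length L) * 1)
        ≡⟨ Σ-*ˡ (arr L) (2 * suc (length L)) (λ _ → 1) ⟩
      2 * suc (length L) * Σ (arr L) (λ _ → 1)
        ≡⟨ cong (2 * suc (length L) *_) (arr-count L) ⟩
      arrangements (length (x ∷ L)) ∎
      where
      open ≡-Reasoning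
      count : ∀ y w → Σ (insertions y w) (λ _ → 1) ≡ suc (length w)
      count y w = trans (Σ-const (insertions y w) 1)
                        (trans (*-identityʳ _) (length-insertions y w))
      lemma : ∀ k → suc k + suc k ≡ 2 * suc k * 1
      lemma = solve-∀

  module _ {X Y : Set} {negX : X → X} {negY : Y → Y} (h : X → Y)
           (h-neg : ∀ x → h (negX x) ≡ negY (h x)) where
    open Arrangements

    Σ-insertions-map : ∀ x w (F : List Y → ℕ) →
      Σ (insertions (h x) (map h w)) F ≡ Σ (insertions x w) (F ∘ map h)
    Σ-insertions-map x []      F = refl
    Σ-insertions-map x (y ∷ w) F =
      trans (Σ-insertions-∷ (h x) (h y) (map h w) F)
        (trans (cong (F (h x ∷ h y ∷ map h w) +_) (Σ-insertions-map x w (F ∘ (h y ∷_))))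
               (sym (Σ-insertions-∷ x y w (F ∘ map h))))

    Σ-arr-map : ∀ L (F : List Y → ℕ) →
      Σ (arr negY (map h L)) F ≡ Σ (arr negX L) (F ∘ map h)
    Σ-arr-map []      F = refl
    Σ-arr-map (x ∷ L) F = begin
      Σ (arr negY (h x ∷ map h L)) F
        ≡⟨ Σ-arr-∷ negY (h x) (map h L) F ⟩
      Σ (arr negY (map h L)) (λ w → Σ (insertions (h x) w) F + Σ (insertions (negY (h x)) w) F)
        ≡⟨ Σ-arr-map L _ ⟩
      Σ (arr negX L) (λ w → Σ (insertions (h x) (map h w)) F +
                            Σ (insertions (negY (h x)) (map h w)) F)
        ≡⟨ Σ-cong (arr negX L) (λ w → cong₂ _+_ (Σ-insertions-map x w F)
             (trans (cong (λ y → Σ (insertions y (map h w)) F) (sym (h-neg x)))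
                    (Σ-insertions-map (negX x) w F))) ⟩
      Σ (arr negX L) (λ w → Σ (insertions x w) (F ∘ map h) + Σ (insertions (negX x) w) (F ∘ map h))
        ≡⟨ Σ-arr-∷ negX x L (F ∘ map h) ⟨
      Σ (arr negX (x ∷ L)) (F ∘ map h) ∎
      where open ≡-Reasoning

  <ᵇ-cases : ∀ i z → ((i <ᵇ z) ≡ true × i < z) ⊎ ((i <ᵇ z) ≡ false × z ≤ i)
  <ᵇ-cases i       zero    = inj₂ (refl , z≤n)
  <ᵇ-cases zero    (suc z) = inj₁ (refl , s≤s z≤n)
  <ᵇ-cases (suc i) (suc z) with <ᵇ-cases i z
  ... | inj₁ (e , lt) = inj₁ (e , s≤s lt)
  ... | inj₂ (e , ge) = inj₂ (e , s≤s ge)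

  -- The binomial convolution, that is, the sum of C(z, i) F i (z - i) over i, unfolded by Pascal's
  -- rule.
  convolve : (ℕ → ℕ → ℕ) → ℕ → ℕ
  convolve F zero    = F 0 0
  convolve F (suc z) = convolve (λ i j → F (suc i) j + F i (suc j)) z

  Σ-splits-length : ∀ (L : List A) (F : ℕ → ℕ → ℕ) →
    Σ (splits L) (λ (P , Q) → F (length P) (length Q)) ≡ convolve F (length L)
  Σ-splits-length []      F = +-identityʳ _
  Σ-splits-length (x ∷ L) F = trans (Σ-splits-∷ x L _) (Σ-splits-length L _)

  convolve-mono : ∀ z {F G : ℕ → ℕ → ℕ} → (∀ i j → F i j ≤ G i j) → convolve F z ≤ convolve G z
  convolve-mono zero    h = h 0 0
  convolve-mono (suc z) h = convolve-mono z (λ i j → +-mono-≤ (h (suc i) j) (h i (suc j)))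

  -- The pair (z , 0) has binomial coefficient 1, so a strict inequality there survives in the sum.
  convolve-mono-< : ∀ z {F G : ℕ → ℕ → ℕ} → (∀ i j → F i j ≤ G i j) → F z 0 < G z 0 →
                    convolve F z < convolve G z
  convolve-mono-< zero    h h< = h<
  convolve-mono-< (suc z) h h< =
    convolve-mono-< z (λ i j → +-mono-≤ (h (suc i) j) (h i (suc j))) (+-mono-<-≤ h< (h z 1))

  module OrderedGroup {V : Set} {_⊕_ : V → V → V} {𝟘 : V} {⊝_ : V → V}
                      (isAbelianGroup : IsAbelianGroup _≡_ _⊕_ 𝟘 ⊝_)
                      (pos : V → Bool)
                      (pos-⊕ : ∀ {a b} → pos a ≡ true → pos b ≡ true → pos (a ⊕ b) ≡ true)
                      (pos-⊝ : ∀ a → a ≢ 𝟘 → pos (⊝ a) ≡ not (pos a)) where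
    open IsAbelianGroup isAbelianGroup
      using (inverseˡ; inverseʳ; isGroup) renaming (assoc to ⊕-assoc; comm to ⊕-comm; identityˡ to ⊕-identityˡ; identityʳ to ⊕-identityʳ)
    open import Algebra.Bundles using (AbelianGroup)
    private
      bundle : AbelianGroup _ _
      bundle = record { isAbelianGroup = isAbelianGroup }
    open import Algebra.Properties.AbelianGroup bundle using (⁻¹-∙-comm; ⁻¹-involutive)
    open Arrangements ⊝_

    total : List V → V
    total []      = 𝟘
    total (x ∷ w) = x ⊕ total w

    stays : V → List V → Bool
    stays c []      = true
    stays c (x ∷ w) = pos (c ⊕ x) ∧ stays (c ⊕ x) w

    -- All nonempty suffixes have negative total: the walk along u ends strictly below all its
    -- earlier points. If moreover `stays 𝟘` holds for the rest v, the end of u is the strict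
    -- minimum of the walk along u ++ v.
    falls : List V → Bool
    falls []      = true
    falls (x ∷ u) = falls u ∧ pos (⊝ (x ⊕ total u))

    stays-++ : ∀ c u v → stays c (u ++ v) ≡ stays c u ∧ stays (c ⊕ total u) v
    stays-++ c []      v = cong (λ z → stays z v) (sym (⊕-identityʳ c))
    stays-++ c (x ∷ u) v with pos (c ⊕ x)
    ... | true  = trans (stays-++ (c ⊕ x) u v)
                        (cong (λ z → stays (c ⊕ x) u ∧ stays z v) (⊕-assoc c x (total u)))
    ... | false = refl

    stays-total : ∀ c u → pos c ≡ true → stays c u ≡ true → pos (c ⊕ total u) ≡ true
    stays-total c []      p _ = trans (cong pos (⊕-identityʳ c)) p
    stays-total c (x ∷ u) _ s with ∧-true s
    ... | p , s′ = trans (cong pos (sym (⊕-assoc c x _))) (stays-total (c ⊕ x) u p s′)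

    stays-shift : ∀ c d v → pos d ≡ true → stays c v ≡ true → stays (d ⊕ c) v ≡ true
    stays-shift c d []      _ _ = refl
    stays-shift c d (x ∷ v) p s with ∧-true s
    ... | q , s′ = true-∧ (trans (cong pos (⊕-assoc d c x)) (pos-⊕ p q))
                          (trans (cong (λ z → stays z v) (⊕-assoc d c x))
                                 (stays-shift (c ⊕ x) d v p s′))

    falls-stays : ∀ c u → falls u ≡ true → pos (c ⊕ total u) ≡ true →
                  pos c ≡ true × stays c u ≡ true
    falls-stays c []      f p = trans (cong pos (sym (⊕-identityʳ c))) p , refl
    falls-stays c (x ∷ u) f p with ∧-true f
    ... | f′ , q = trans (cong pos (sym cancel)) (pos-⊕ p q) , true-∧ (proj₁ ih) (proj₂ ih)
      where
      cancel : (c ⊕ (x ⊕ total u)) ⊕ (⊝ (x ⊕ total u)) ≡ c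
      cancel = trans (⊕-assoc c _ _) (trans (cong (c ⊕_) (inverseʳ _)) (⊕-identityʳ c))
      ih = falls-stays (c ⊕ x) u f′ (trans (cong pos (⊕-assoc c x _)) p)

    -- No nonempty contiguous block sums to 𝟘; equivalently, the partial sums are distinct, so the
    -- minimum is attained only once.
    data BlockFree : List V → Set where
      []  : BlockFree []
      _∷_ : ∀ {x w} → (∀ {u v} → (u , v) ∈ cuts w → x ⊕ total u ≢ 𝟘) →
            BlockFree w → BlockFree (x ∷ w)

    -- If the walk u ++ v is lowest at the cut, a further step x in front either leaves the minimum
    -- there or moves it to the new start, depending on the sign of `x ⊕ total u`. That the two
    -- cases exclude each other keeps the number of minima at 1.
    stays-∷-cut : ∀ x u v → falls u ≡ true → stays 𝟘 v ≡ true → x ⊕ total u ≢ 𝟘 →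
                  pos (⊝ (x ⊕ total u)) ≡ not (stays 𝟘 (x ∷ u ++ v))
    stays-∷-cut x u v f s nz with pos (x ⊕ total u) in eq
    ... | true = trans (pos-⊝ _ nz) (trans (cong not eq) (cong not (sym both)))
      where
      p : pos ((𝟘 ⊕ x) ⊕ total u) ≡ true
      p = trans (cong (λ z → pos (z ⊕ total u)) (⊕-identityˡ x)) eq
      fs = falls-stays (𝟘 ⊕ x) u f p
      both : stays 𝟘 (x ∷ u ++ v) ≡ true
      both = true-∧ (proj₁ fs) (trans (stays-++ (𝟘 ⊕ x) u v)
        (true-∧ (proj₂ fs) (trans (cong (λ z → stays z v) (sym (⊕-identityʳ _)))
                                  (stays-shift 𝟘 _ v p s))))
    ... | false = trans (pos-⊝ _ nz) (trans (cong not eq) (cong not (sym neither)))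
      where
      neither : stays 𝟘 (x ∷ u ++ v) ≡ false
      neither with stays 𝟘 (x ∷ u ++ v) in e
      ... | false = refl
      ... | true with ∧-true e
      ...   | p , s′ with ∧-true (trans (sym (stays-++ (𝟘 ⊕ x) u v)) s′)
      ...     | s″ , _ = trans (sym (stays-total (𝟘 ⊕ x) u p s″))
                               (trans (cong (λ z → pos (z ⊕ total u)) (⊕-identityˡ x)) eq)

    -- The cut is the position at which the partial sum is least.
    unique-minimum : ∀ w → BlockFree w →
      Σ (cuts w) (λ (u , v) → 𝟙 (falls u) * 𝟙 (stays 𝟘 v)) ≡ 1
    unique-minimum []      _        = refl
    unique-minimum (x ∷ w) (h ∷ bf) = begin
      Σ (cuts (x ∷ w)) (λ (u , v) → 𝟙 (falls u) * 𝟙 (stays 𝟘 v))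
        ≡⟨ Σ-cuts-∷ x w _ ⟩
      𝟙 (stays 𝟘 (x ∷ w)) + 0 + Σ (cuts w) (λ (u , v) → 𝟙 (falls (x ∷ u)) * 𝟙 (stays 𝟘 v))
        ≡⟨ cong₂ _+_ (+-identityʳ _) (Σ-cong-∈ (cuts w) (λ {(u , v)} i → term u v i)) ⟩
      𝟙 (stays 𝟘 (x ∷ w)) + Σ (cuts w) (λ (u , v) → 𝟙 (falls u) * 𝟙 (stays 𝟘 v) * c)
        ≡⟨ cong (𝟙 (stays 𝟘 (x ∷ w)) +_)
             (trans (Σ-*ʳ (cuts w) c _) (cong (_* c) (unique-minimum w bf))) ⟩
      𝟙 (stays 𝟘 (x ∷ w)) + 1 * c
        ≡⟨ complement (stays 𝟘 (x ∷ w)) ⟩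
      1 ∎
      where
      open ≡-Reasoning
      c = 𝟙 (not (stays 𝟘 (x ∷ w)))
      complement : ∀ b → 𝟙 b + 1 * 𝟙 (not b) ≡ 1
      complement true  = refl
      complement false = refl
      term : ∀ u v → (u , v) ∈ cuts w →
             𝟙 (falls (x ∷ u)) * 𝟙 (stays 𝟘 v) ≡ 𝟙 (falls u) * 𝟙 (stays 𝟘 v) * c
      term u v i with falls u in f | stays 𝟘 v in s
      ... | false | _     = refl
      ... | true  | false = trans (*-zeroʳ (𝟙 (pos (⊝ (x ⊕ total u))))) refl
      ... | true  | true  = trans (*-identityʳ _)
        (trans (cong 𝟙 (trans (stays-∷-cut x u v f s (h i))
                              (cong (λ z → not (stays 𝟘 (x ∷ z))) (sym (∈-cuts i)))))
               (sym (+-identityʳ _)))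

    -- Time reversal combined with a change of signs. It exchanges ending at the minimum with
    -- staying above the start, and it permutes the signed permutations of a list.
    mirror : List V → List V
    mirror []      = []
    mirror (x ∷ w) = mirror w ++ [ ⊝ x ]

    total-mirror : ∀ w → total (mirror w) ≡ ⊝ (total w)
    total-mirror []      = sym (trans (sym (⊕-identityʳ _)) (inverseˡ 𝟘))
    total-mirror (x ∷ w) = begin
      total (mirror w ++ [ ⊝ x ])     ≡⟨ total-snoc (mirror w) (⊝ x) ⟩
      total (mirror w) ⊕ (⊝ x)        ≡⟨ cong (_⊕ (⊝ x)) (total-mirror w) ⟩
      (⊝ total w) ⊕ (⊝ x)             ≡⟨ ⊕-comm _ _ ⟩
      (⊝ x) ⊕ (⊝ total w)             ≡⟨ ⁻¹-∙-comm x (total w) ⟩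
      ⊝ (x ⊕ total w)                 ∎
      where
      open ≡-Reasoning
      total-snoc : ∀ u y → total (u ++ [ y ]) ≡ total u ⊕ y
      total-snoc []      y = trans (⊕-identityʳ y) (sym (⊕-identityˡ y))
      total-snoc (z ∷ u) y = trans (cong (z ⊕_) (total-snoc u y)) (sym (⊕-assoc z _ y))

    falls-mirror : ∀ w → falls w ≡ stays 𝟘 (mirror w)
    falls-mirror []      = refl
    falls-mirror (x ∷ w) = begin
      falls w ∧ pos (⊝ (x ⊕ total w))
        ≡⟨ cong₂ _∧_ (falls-mirror w) (cong pos (sym last)) ⟩
      stays 𝟘 (mirror w) ∧ pos ((𝟘 ⊕ total (mirror w)) ⊕ (⊝ x))
        ≡⟨ cong (stays 𝟘 (mirror w) ∧_) (∧-true′ _) ⟩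
      stays 𝟘 (mirror w) ∧ stays (𝟘 ⊕ total (mirror w)) [ ⊝ x ]
        ≡⟨ stays-++ 𝟘 (mirror w) _ ⟨
      stays 𝟘 (mirror w ++ [ ⊝ x ]) ∎
      where
      open ≡-Reasoning
      ∧-true′ : ∀ b → b ≡ b ∧ true
      ∧-true′ true  = refl
      ∧-true′ false = refl
      last : (𝟘 ⊕ total (mirror w)) ⊕ (⊝ x) ≡ ⊝ (x ⊕ total w)
      last = trans (cong (_⊕ (⊝ x)) (trans (⊕-identityˡ _) (total-mirror w)))
                   (trans (⊕-comm _ _) (⁻¹-∙-comm x (total w)))

    Σ-insertions-snoc : ∀ (x : V) w y (F : List V → ℕ) →
      Σ (insertions x (w ++ [ y ])) F ≡
      Σ (insertions x w) (λ w′ → F (w′ ++ [ y ])) + F (w ++ y ∷ x ∷ [])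
    Σ-insertions-snoc x []      y F = lemma (F (x ∷ y ∷ [])) (F (y ∷ x ∷ []))
      where
      lemma : ∀ a b → a + (b + 0) ≡ a + 0 + b
      lemma = solve-∀
    Σ-insertions-snoc x (z ∷ w) y F = begin
      Σ (insertions x (z ∷ w ++ [ y ])) F
        ≡⟨ Σ-insertions-∷ x z (w ++ [ y ]) F ⟩
      F (x ∷ z ∷ w ++ [ y ]) + Σ (insertions x (w ++ [ y ])) (F ∘ (z ∷_))
        ≡⟨ cong (F (x ∷ z ∷ w ++ [ y ]) +_) (Σ-insertions-snoc x w y (F ∘ (z ∷_))) ⟩
      F (x ∷ z ∷ w ++ [ y ]) + (Σ (insertions x w) (λ w′ → F (z ∷ w′ ++ [ y ])) + F (z ∷ w ++ y ∷ x ∷ []))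
        ≡⟨ +-assoc (F (x ∷ z ∷ w ++ [ y ])) _ _ ⟨
      F (x ∷ z ∷ w ++ [ y ]) + Σ (insertions x w) (λ w′ → F (z ∷ w′ ++ [ y ])) + F (z ∷ w ++ y ∷ x ∷ [])
        ≡⟨ cong (_+ F (z ∷ w ++ y ∷ x ∷ [])) (Σ-insertions-∷ x z w (λ w′ → F (w′ ++ [ y ]))) ⟨
      Σ (insertions x (z ∷ w)) (λ w′ → F (w′ ++ [ y ])) + F (z ∷ w ++ y ∷ x ∷ []) ∎
      where open ≡-Reasoning

    Σ-insertions-mirror : ∀ x w (F : List V → ℕ) →
      Σ (insertions x w) (F ∘ mirror) ≡ Σ (insertions (⊝ x) (mirror w)) F
    Σ-insertions-mirror x []      F = refl
    Σ-insertions-mirror x (y ∷ w) F = begin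
      Σ (insertions x (y ∷ w)) (F ∘ mirror)
        ≡⟨ Σ-insertions-∷ x y w _ ⟩
      F ((mirror w ++ [ ⊝ y ]) ++ [ ⊝ x ]) + Σ (insertions x w) (λ w′ → F (mirror w′ ++ [ ⊝ y ]))
        ≡⟨ cong₂ _+_ (cong F (++-assoc (mirror w)))
                     (Σ-insertions-mirror x w (λ w′ → F (w′ ++ [ ⊝ y ]))) ⟩
      F (mirror w ++ (⊝ y) ∷ (⊝ x) ∷ []) + Σ (insertions (⊝ x) (mirror w)) (λ w′ → F (w′ ++ [ ⊝ y ]))
        ≡⟨ +-comm (F (mirror w ++ (⊝ y) ∷ (⊝ x) ∷ [])) _ ⟩
      Σ (insertions (⊝ x) (mirror w)) (λ w′ → F (w′ ++ [ ⊝ y ])) + F (mirror w ++ (⊝ y) ∷ (⊝ x) ∷ [])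
        ≡⟨ Σ-insertions-snoc (⊝ x) (mirror w) (⊝ y) F ⟨
      Σ (insertions (⊝ x) (mirror w ++ [ ⊝ y ])) F ∎
      where
      open ≡-Reasoning
      ++-assoc : ∀ u {a b : V} → (u ++ [ a ]) ++ [ b ] ≡ u ++ a ∷ b ∷ []
      ++-assoc []      = refl
      ++-assoc (z ∷ u) = cong (z ∷_) (++-assoc u)

    Σ-arr-mirror : ∀ L (F : List V → ℕ) → Σ (arr L) (F ∘ mirror) ≡ Σ (arr L) F
    Σ-arr-mirror []      F = refl
    Σ-arr-mirror (x ∷ L) F = begin
      Σ (arr (x ∷ L)) (F ∘ mirror)
        ≡⟨ Σ-arr-∷ x L _ ⟩
      Σ (arr L) (λ w → Σ (insertions x w) (F ∘ mirror) + Σ (insertions (⊝ x) w) (F ∘ mirror))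
        ≡⟨ Σ-cong (arr L) (λ w → cong₂ _+_ (Σ-insertions-mirror x w F)
             (trans (Σ-insertions-mirror (⊝ x) w F)
                    (cong (λ z → Σ (insertions z (mirror w)) F) (⁻¹-involutive x)))) ⟩
      Σ (arr L) (λ w → Σ (insertions (⊝ x) (mirror w)) F + Σ (insertions x (mirror w)) F)
        ≡⟨ Σ-arr-mirror L (λ w → Σ (insertions (⊝ x) w) F + Σ (insertions x w) F) ⟩
      Σ (arr L) (λ w → Σ (insertions (⊝ x) w) F + Σ (insertions x w) F)
        ≡⟨ Σ-cong (arr L) (λ w → +-comm (Σ (insertions (⊝ x) w) F) _) ⟩
      Σ (arr L) (λ w → Σ (insertions x w) F + Σ (insertions (⊝ x) w) F)
        ≡⟨ Σ-arr-∷ x L F ⟨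
      Σ (arr (x ∷ L)) F ∎
      where open ≡-Reasoning

    -- SignedSum b L s: s is a sum of entries of L with signs, over a set of
    -- positions which is nonempty if b is true.
    data SignedSum : Bool → List V → V → Set where
      none  : SignedSum false [] 𝟘
      skip  : ∀ {b x L s} → SignedSum b L s → SignedSum b (x ∷ L) s
      plus  : ∀ {b x L s t} → SignedSum b L s → t ≡ x ⊕ s → SignedSum true (x ∷ L) t
      minus : ∀ {b x L s t} → SignedSum b L s → t ≡ (⊝ x) ⊕ s → SignedSum true (x ∷ L) t

    Independent : List V → Set
    Independent L = ∀ {s} → SignedSum true L s → s ≢ 𝟘

    exchange : ∀ a b c → a ⊕ (b ⊕ c) ≡ b ⊕ (a ⊕ c)
    exchange a b c = trans (sym (⊕-assoc a b c)) (trans (cong (_⊕ c) (⊕-comm a b)) (⊕-assoc b a c))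

    SignedSum-swap : ∀ {b x y L s} → SignedSum b (y ∷ x ∷ L) s → SignedSum b (x ∷ y ∷ L) s
    SignedSum-swap (skip (skip p))             = skip (skip p)
    SignedSum-swap (skip (plus p e))           = plus (skip p) e
    SignedSum-swap (skip (minus p e))          = minus (skip p) e
    SignedSum-swap (plus (skip p) e)           = skip (plus p e)
    SignedSum-swap (plus (plus p refl) refl)   = plus (plus p refl) (exchange _ _ _)
    SignedSum-swap (plus (minus p refl) refl)  = minus (plus p refl) (exchange _ _ _)
    SignedSum-swap (minus (skip p) e)          = skip (minus p e)
    SignedSum-swap (minus (plus p refl) refl)  = plus (minus p refl) (exchange _ _ _)
    SignedSum-swap (minus (minus p refl) refl) = minus (minus p refl) (exchange _ _ _)

    SignedSum-map : ∀ {x L L′} → (∀ {b s} → SignedSum b L s → SignedSum b L′ s) →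
                    ∀ {b s} → SignedSum b (x ∷ L) s → SignedSum b (x ∷ L′) s
    SignedSum-map h (skip p)    = skip (h p)
    SignedSum-map h (plus p e)  = plus (h p) e
    SignedSum-map h (minus p e) = minus (h p) e

    SignedSum-neg : ∀ {x L b s} → SignedSum b ((⊝ x) ∷ L) s → SignedSum b (x ∷ L) s
    SignedSum-neg (skip p)    = skip p
    SignedSum-neg (plus p e)  = minus p e
    SignedSum-neg {x} (minus {s = s} p e) = plus p (trans e (cong (_⊕ s) (⁻¹-involutive x)))

    SignedSum-insertions : ∀ {x w w′} → w′ ∈ insertions x w →
      ∀ {b s} → SignedSum b w′ s → SignedSum b (x ∷ w) s
    SignedSum-insertions {w = []}    (here refl) p = p
    SignedSum-insertions {w = y ∷ w} i p with ∈-insertions-∷ {x = _} {y} {w} i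
    ... | inj₁ refl             = p
    ... | inj₂ (w″ , j , refl) = SignedSum-swap (SignedSum-map (SignedSum-insertions j) p)

    SignedSum-arr : ∀ {L w} → w ∈ arr L → ∀ {b s} → SignedSum b w s → SignedSum b L s
    SignedSum-arr {[]}    (here refl) p = p
    SignedSum-arr {x ∷ L} i p with ∈-arr-∷ {x = x} {L} i
    ... | w , j , inj₁ k = SignedSum-map (SignedSum-arr j) (SignedSum-insertions k p)
    ... | w , j , inj₂ k = SignedSum-map (SignedSum-arr j) (SignedSum-neg (SignedSum-insertions k p))

    SignedSum-prefix : ∀ {w u v} → (u , v) ∈ cuts w → ∃[ b ] SignedSum b w (total u)
    SignedSum-prefix {[]}    (here refl) = false , none
    SignedSum-prefix {x ∷ w} i with ∈-cuts-∷ {x = x} {w} i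
    ... | inj₁ (refl , refl)    = false , skip (empty w)
      where
      empty : ∀ w → SignedSum false w 𝟘
      empty []      = none
      empty (x ∷ w) = skip (empty w)
    ... | inj₂ (u′ , j , refl) = true , plus (proj₂ (SignedSum-prefix j)) refl

    independent⇒blockFree : ∀ w → Independent w → BlockFree w
    independent⇒blockFree []      _   = []
    independent⇒blockFree (x ∷ w) ind =
      (λ i → ind (plus (proj₂ (SignedSum-prefix i)) refl)) ∷
      independent⇒blockFree w (ind ∘ skip)

    Independent-splits : ∀ {L P Q} → (P , Q) ∈ splits L → Independent L →
                         Independent P × Independent Q
    Independent-splits i ind = ind ∘ left i , ind ∘ right i
      where
      left : ∀ {L P Q} → (P , Q) ∈ splits L → ∀ {b s} → SignedSum b P s → SignedSum b L s
      left {[]}    (here refl) p = p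
      left {x ∷ L} i p with ∈-splits-∷ {x = x} {L} i
      ... | inj₁ (_ , j , refl) = SignedSum-map (left j) p
      ... | inj₂ (_ , j , refl) = skip (left j p)
      right : ∀ {L P Q} → (P , Q) ∈ splits L → ∀ {b s} → SignedSum b Q s → SignedSum b L s
      right {[]}    (here refl) p = p
      right {x ∷ L} i p with ∈-splits-∷ {x = x} {L} i
      ... | inj₁ (_ , j , refl) = skip (right j p)
      ... | inj₂ (_ , j , refl) = SignedSum-map (right j) p

    persistent : List V → ℕ
    persistent L = Σ (arr L) (𝟙 ∘ stays 𝟘)

    -- Cutting each arrangement at its only minimum leaves a falling walk followed by a persistent
    -- one, and time reversal makes the first half persistent as well. The halves are independent by
    -- `cut-arr`, so products of persistent counts add up to the number of all arrangements.
    persistent-splits : ∀ L → Independent L →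
      Σ (splits L) (λ (P , Q) → persistent P * persistent Q) ≡ arrangements (length L)
    persistent-splits L ind = begin
      Σ (splits L) (λ (P , Q) → persistent P * persistent Q)
        ≡⟨ Σ-cong (splits L) (λ (P , Q) → begin
             persistent P * persistent Q
               ≡⟨ cong (_* persistent Q) (Σ-arr-mirror P (𝟙 ∘ stays 𝟘)) ⟨
             Σ (arr P) (𝟙 ∘ stays 𝟘 ∘ mirror) * persistent Q
               ≡⟨ cong (_* persistent Q) (Σ-cong (arr P) (λ w → cong 𝟙 (sym (falls-mirror w)))) ⟩
             Σ (arr P) (𝟙 ∘ falls) * persistent Q
               ≡⟨ Σ-*ʳ (arr P) (persistent Q) _ ⟨
             Σ (arr P) (λ u → 𝟙 (falls u) * persistent Q)
               ≡⟨ Σ-cong (arr P) (λ u → sym (Σ-*ˡ (arr Q) (𝟙 (falls u)) _)) ⟩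
             Σ (arr P) (λ u → Σ (arr Q) (λ v → 𝟙 (falls u) * 𝟙 (stays 𝟘 v))) ∎) ⟩
      Σ (splits L) (λ (P , Q) → Σ (arr P) (λ u → Σ (arr Q) (λ v → 𝟙 (falls u) * 𝟙 (stays 𝟘 v))))
        ≡⟨ cut-arr L _ ⟨
      Σ (arr L) (λ w → Σ (cuts w) (λ (u , v) → 𝟙 (falls u) * 𝟙 (stays 𝟘 v)))
        ≡⟨ Σ-cong-∈ (arr L) (λ {w} i → unique-minimum w
             (independent⇒blockFree w (ind ∘ SignedSum-arr i))) ⟩
      Σ (arr L) (λ _ → 1)
        ≡⟨ arr-count L ⟩
      arrangements (length L) ∎
      where open ≡-Reasoning

    -- The identity above determines the number of persistent arrangements
    -- from those of shorter lists, so that it depends on the length only.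
    module Universality (canon : ℕ → List V)
                        (length-canon : ∀ z → length (canon z) ≡ z)
                        (independent-canon : ∀ z → Independent (canon z)) where

      ν : ℕ → ℕ
      ν z = persistent (canon z)

      private
        Universal : ℕ → Set
        Universal z = ∀ L → length L ≡ z → Independent L → persistent L ≡ ν z

        -- What is known at stage z of the induction about the persistent count for length i: it is
        -- `ν i` below z, and an unknown c at z itself.
        H : ℕ → ℕ → ℕ → ℕ
        H z c i = if i <ᵇ z then ν i else c

        H-mono : ∀ z {c c′} → c ≤ c′ → ∀ i → H z c i ≤ H z c′ i
        H-mono z c≤c′ i with i <ᵇ z
        ... | true  = ≤-refl
        ... | false = c≤c′

        H-z : ∀ z c → H z c z ≡ c
        H-z z c with <ᵇ-cases z z
        ... | inj₁ (_ , z<z) = ⊥-elim (<-irrefl refl z<z)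
        ... | inj₂ (e , _)   = cong (λ b → if b then ν z else c) e

        value : ∀ z → (∀ {y} → y < z → Universal y) → ∀ L → length L ≡ z → Independent L →
                convolve (λ i j → H z (persistent L) i * H z (persistent L) j) z ≡ arrangements z
        value z rec L refl ind = begin
          convolve (λ i j → H z c i * H z c j) z
            ≡⟨ Σ-splits-length L _ ⟨
          Σ (splits L) (λ (P , Q) → H z c (length P) * H z c (length Q))
            ≡⟨ Σ-cong-∈ (splits L) (λ {(P , Q)} i → cong₂ _*_
                 (part P (≤-trans (m≤m+n _ _) (≤-reflexive (splits-length {L = L} i)))
                         (splits-full i) (proj₁ (Independent-splits i ind)))
                 (part Q (≤-trans (m≤n+m _ (length P)) (≤-reflexive (splits-length {L = L} i)))
                         (splits-full′ i) (proj₂ (Independent-splits i ind)))) ⟩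
          Σ (splits L) (λ (P , Q) → persistent P * persistent Q)
            ≡⟨ persistent-splits L ind ⟩
          arrangements z ∎
          where
          open ≡-Reasoning
          c = persistent L
          part : ∀ P → length P ≤ z → (length P ≡ z → P ≡ L) → Independent P →
                 H z c (length P) ≡ persistent P
          part P le full indP with <ᵇ-cases (length P) z
          ... | inj₁ (e , lt) = trans (cong (λ b → if b then ν (length P) else c) e)
                                      (sym (rec lt P refl indP))
          ... | inj₂ (e , ge) = trans (cong (λ b → if b then ν (length P) else c) e)
                                      (cong persistent (sym (full (≤-antisym le ge))))

        -- The unknown occurs in the two extreme splits, multiplied by the count 1 of the empty
        -- list. Hence the convolution increases strictly with c, and its known value
        -- `arrangements z` determines c.
        strict : ∀ z {c c′} → 0 < z → c < c′ →
                 convolve (λ i j → H z c i * H z c j) z < convolve (λ i j → H z c′ i * H z c′ j) z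
        strict z {c} {c′} z>0 c<c′ =
          convolve-mono-< z (λ i j → *-mono-≤ (H-mono z (<⇒≤ c<c′) i) (H-mono z (<⇒≤ c<c′) j))
            (subst₂ _<_ (sym (end c)) (sym (end c′)) c<c′)
          where
          end : ∀ c → H z c z * H z c 0 ≡ c
          end c = trans (cong₂ _*_ (H-z z c) (base z>0)) (*-identityʳ c)
            where
            base : ∀ {z} → 0 < z → H z c 0 ≡ 1
            base (s≤s _) with canon 0 | length-canon 0
            ... | [] | _ = refl

        universal′ : ∀ z → Universal z
        universal′ = <-rec Universal go
          where
          go : ∀ z → (∀ {y} → y < z → Universal y) → Universal z
          go zero rec [] _ _ with canon 0 | length-canon 0
          ... | [] | _ = refl
          go (suc z) rec L eq ind with <-cmp (persistent L) (ν (suc z))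
          ... | tri≈ _ e _ = e
          ... | tri< lt _ _ = ⊥-elim (<-irrefl
                (trans (value (suc z) rec L eq ind)
                       (sym (value (suc z) rec (canon (suc z)) (length-canon (suc z)) (independent-canon (suc z)))))
                (strict (suc z) (s≤s z≤n) lt))
          ... | tri> _ _ gt = ⊥-elim (<-irrefl
                (trans (value (suc z) rec (canon (suc z)) (length-canon (suc z)) (independent-canon (suc z)))
                       (sym (value (suc z) rec L eq ind)))
                (strict (suc z) (s≤s z≤n) gt))

      universal : ∀ L → Independent L → persistent L ≡ ν (length L)
      universal L = universal′ (length L) L refl

-- Breaking ties by powers of three, and the bound 1/√(4 z + 1).

module TieBreaking where

  open import Algebra.Structures using (IsAbelianGroup)
  open import Data.Bool.Base using (Bool; true; false; _∧_; not)
  open import Data.Empty using (⊥-elim)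
  open import Data.Integer.Base as ℤ using (ℤ; +_; -[1+_]; +[1+_]; 0ℤ; 1ℤ)
  import Data.Integer.Properties as ℤ
  open import Data.List.Base using (List; []; _∷_; [_]; map; length; replicate)
  open import Data.List.Properties using (length-map; length-replicate; map-∘)
  open import Data.Nat.Base
  open import Data.Nat.Properties
  open import Data.Nat.Tactic.RingSolver using (solve-∀)
  open import Data.Product.Base using (_×_; _,_; proj₁; proj₂; ∃-syntax)
  open import Function.Base using (_∘_)
  open import Relation.Binary.PropositionalEquality hiding ([_]; J)
  open import Relation.Nullary using (yes; no)
  open Words
  open PersistentWalks

  V : Set
  V = ℤ × ℤ

  infixl 6 _⊕_
  _⊕_ : V → V → V
  (a , b) ⊕ (c , d) = a ℤ.+ c , b ℤ.+ d

  𝟘 : V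
  𝟘 = 0ℤ , 0ℤ

  ⊝_ : V → V
  ⊝ (a , b) = ℤ.- a , ℤ.- b

  ⊕-isAbelianGroup : IsAbelianGroup _≡_ _⊕_ 𝟘 ⊝_
  ⊕-isAbelianGroup = record
    { isGroup = record
      { isMonoid = record
        { isSemigroup = record
          { isMagma = record { isEquivalence = isEquivalence ; ∙-cong = cong₂ _⊕_ }
          ; assoc = λ (a , b) (c , d) (e , f) → cong₂ _,_ (ℤ.+-assoc a c e) (ℤ.+-assoc b d f)
          }
        ; identity = (λ (a , b) → cong₂ _,_ (ℤ.+-identityˡ a) (ℤ.+-identityˡ b))
                   , (λ (a , b) → cong₂ _,_ (ℤ.+-identityʳ a) (ℤ.+-identityʳ b))
        }
      ; inverse = (λ (a , b) → cong₂ _,_ (ℤ.+-inverseˡ a) (ℤ.+-inverseˡ b))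
                , (λ (a , b) → cong₂ _,_ (ℤ.+-inverseʳ a) (ℤ.+-inverseʳ b))
      ; ⁻¹-cong = cong ⊝_
      }
    ; comm = λ (a , b) (c , d) → cong₂ _,_ (ℤ.+-comm a c) (ℤ.+-comm b d)
    }

  posℤ : ℤ → Bool
  posℤ +[1+ _ ] = true
  posℤ _        = false

  -- Positivity in the lexicographic order: the second component breaks ties.
  pos : V → Bool
  pos (+[1+ _ ] , _) = true
  pos (+ zero   , b) = posℤ b
  pos (-[1+ _ ] , _) = false

  posℤ-+ : ∀ {a b} → posℤ a ≡ true → posℤ b ≡ true → posℤ (a ℤ.+ b) ≡ true
  posℤ-+ {+[1+ _ ]} {+[1+ _ ]} _ _ = refl

  pos-⊕ : ∀ {a b} → pos a ≡ true → pos b ≡ true → pos (a ⊕ b) ≡ true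
  pos-⊕ {+[1+ _ ] , _} {+[1+ _ ] , _} _ _ = refl
  pos-⊕ {+[1+ _ ] , _} {+ zero   , _} _ _ = refl
  pos-⊕ {+ zero   , _} {+[1+ _ ] , _} _ _ = refl
  pos-⊕ {+ zero   , b} {+ zero   , d} p q = posℤ-+ {b} {d} p q

  pos-⊝ : ∀ a → a ≢ 𝟘 → pos (⊝ a) ≡ not (pos a)
  pos-⊝ (+[1+ _ ] , _)        _ = refl
  pos-⊝ (-[1+ _ ] , _)        _ = refl
  pos-⊝ (+ zero , +[1+ _ ])   _ = refl
  pos-⊝ (+ zero , -[1+ _ ])   _ = refl
  pos-⊝ (+ zero , + zero)     h = ⊥-elim (h refl)

  open OrderedGroup ⊕-isAbelianGroup pos (λ {a} {b} → pos-⊕ {a} {b}) pos-⊝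
  open Arrangements

  triple : V → V
  triple (a , b) = a , + 3 ℤ.* b

  -- The second components are 1, 3, 9, .... A nonempty signed sum of distinct powers of three is
  -- nonzero, so no two partial sums of an arrangement can tie.
  withTiebreak : List ℤ → List V
  withTiebreak []      = []
  withTiebreak (b ∷ L) = (b , 1ℤ) ∷ map triple (withTiebreak L)

  triple-⊕ : ∀ a b → triple (a ⊕ b) ≡ triple a ⊕ triple b
  triple-⊕ (_ , b) (_ , d) = cong (_ ,_) (ℤ.*-distribˡ-+ (+ 3) b d)

  triple-⊝ : ∀ a → triple (⊝ a) ≡ ⊝ triple a
  triple-⊝ (_ , b) = cong (_ ,_) (sym (ℤ.neg-distribʳ-* (+ 3) b))

  SignedSum-triple : ∀ {b L s} → SignedSum b (map triple L) s →
                     ∃[ s′ ] (SignedSum b L s′ × s ≡ triple s′)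
  SignedSum-triple {L = []}    none = 𝟘 , none , refl
  SignedSum-triple {L = x ∷ L} (skip p) with SignedSum-triple p
  ... | s′ , q , e = s′ , skip q , e
  SignedSum-triple {L = x ∷ L} (plus p refl) with SignedSum-triple p
  ... | s′ , q , refl = x ⊕ s′ , plus q refl , sym (triple-⊕ x s′)
  SignedSum-triple {L = x ∷ L} (minus p refl) with SignedSum-triple p
  ... | s′ , q , refl = (⊝ x) ⊕ s′ , minus q refl ,
        trans (cong (_⊕ triple s′) (sym (triple-⊝ x))) (sym (triple-⊕ (⊝ x) s′))

  -- Uniqueness of balanced ternary notation: if the first entry is used, the sum is 1 or -1 modulo
  -- 3; if not, it is three times a sum over the remaining entries.
  withTiebreak-second : ∀ L {s} → SignedSum true (withTiebreak L) s → proj₂ s ≢ 0ℤ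
  withTiebreak-second (b ∷ L) (skip p) with SignedSum-triple p
  ... | (_ , k) , q , refl = withTiebreak-second L q ∘ three k
    where
    three : ∀ k → + 3 ℤ.* k ≡ 0ℤ → k ≡ 0ℤ
    three (+ zero) _ = refl
  withTiebreak-second (b ∷ L) (plus p refl) with SignedSum-triple p
  ... | (_ , k) , q , refl = no-third k
    where
    no-third : ∀ k → 1ℤ ℤ.+ + 3 ℤ.* k ≢ 0ℤ
    no-third (+ zero)   ()
    no-third (+[1+ n ]) ()
    -- `+-suc` brings a second `suc` of 3 (n + 1) to the front, so that 1 - 3 (n + 1) reduces to a
    -- negative number and the equation becomes absurd.
    no-third (-[1+ n ]) e with trans (cong (λ z → 1 ℤ.⊖ suc z) (sym (+-suc n (n + 1 * suc n)))) e
    ... | ()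
  withTiebreak-second (b ∷ L) (minus p refl) with SignedSum-triple p
  ... | (_ , k) , q , refl = no-third k
    where
    no-third : ∀ k → -[1+ 0 ] ℤ.+ + 3 ℤ.* k ≢ 0ℤ
    no-third (+ zero)   ()
    no-third (+[1+ n ]) e with trans (cong +_ (sym (+-suc n (n + 1 * suc n)))) e
    ... | ()
    no-third (-[1+ n ]) ()

  withTiebreak-independent : ∀ L → Independent (withTiebreak L)
  withTiebreak-independent L p e = withTiebreak-second L p (cong proj₂ e)

  length-withTiebreak : ∀ L → length (withTiebreak L) ≡ length L
  length-withTiebreak []      = refl
  length-withTiebreak (b ∷ L) =
    cong suc (trans (length-map triple (withTiebreak L)) (length-withTiebreak L))

  -- The steps are powers of three and nothing else, so `canonical (suc z)` is a tiny step followed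
  -- by `canonical z` tripled. This self-similarity gives a recursion for `ν`.
  canonical : ℕ → List V
  canonical z = withTiebreak (replicate z 0ℤ)

  length-canonical : ∀ z → length (canonical z) ≡ z
  length-canonical z = trans (length-withTiebreak (replicate z 0ℤ)) (length-replicate z)

  open Universality canonical length-canonical (λ z → withTiebreak-independent (replicate z 0ℤ))

  tiny : ℤ → V
  tiny ε = 0ℤ , ε

  data Unit : ℤ → Set where
    +1ᵘ : Unit 1ℤ
    −1ᵘ : Unit -[1+ 0 ]

  pos-triple-tiny : ∀ {c ε} → Unit ε → pos c ≡ true → pos (triple c ⊕ tiny ε) ≡ true
  pos-triple-tiny {+[1+ _ ] , _}          _   _ = refl
  pos-triple-tiny {+ zero , +[1+ n ]}     +1ᵘ _ = refl
  pos-triple-tiny {+ zero , +[1+ n ]}     −1ᵘ _ =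
    cong (λ z → posℤ (+ z)) (+-suc n (n + 1 * suc n))

  pos-triple : ∀ {c} → pos c ≡ true → pos (triple c) ≡ true
  pos-triple {+[1+ _ ] , _}      _ = refl
  pos-triple {+ zero , +[1+ n ]} _ = refl

  ⊕-swapʳ : ∀ a b c → (a ⊕ b) ⊕ c ≡ (a ⊕ c) ⊕ b
  ⊕-swapʳ a b c = trans (assoc a b c) (trans (cong (a ⊕_) (comm b c)) (sym (assoc a c b)))
    where open IsAbelianGroup ⊕-isAbelianGroup using (assoc; comm)

  stays-triple : ∀ c w → stays c w ≡ true → stays (triple c) (map triple w) ≡ true
  stays-triple c []      _ = refl
  stays-triple c (x ∷ w) s with ∧-true s
  ... | p , s′ = true-∧ (trans (cong pos (sym (triple-⊕ c x))) (pos-triple {c ⊕ x} p))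
                        (trans (cong (λ z → stays z (map triple w)) (sym (triple-⊕ c x)))
                               (stays-triple (c ⊕ x) w s′))

  stays-triple-tiny : ∀ {ε} → Unit ε → ∀ c w → stays c w ≡ true →
                      stays (triple c ⊕ tiny ε) (map triple w) ≡ true
  stays-triple-tiny e c []      _ = refl
  stays-triple-tiny {ε} e c (x ∷ w) s with ∧-true s
  ... | p , s′ = true-∧ (trans (cong pos eq) (pos-triple-tiny {c ⊕ x} e p))
                        (trans (cong (λ z → stays z (map triple w)) eq)
                               (stays-triple-tiny e (c ⊕ x) w s′))
    where
    eq : (triple c ⊕ tiny ε) ⊕ triple x ≡ triple (c ⊕ x) ⊕ tiny ε
    eq = trans (⊕-swapʳ (triple c) (tiny ε) (triple x)) (cong (_⊕ tiny ε) (sym (triple-⊕ c x)))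

  -- After tripling, a positive partial sum is still positive when 1 is taken from its second
  -- component. So the tiny step fits into every place with either sign, even at the front, because
  -- c itself is positive.
  tiny-insertions : ∀ {ε} → Unit ε → ∀ c w → pos c ≡ true → stays c w ≡ true →
    Σ (insertions (tiny ε) (map triple w)) (𝟙 ∘ stays (triple c)) ≡ suc (length w)
  tiny-insertions e c []      p s rewrite pos-triple-tiny {c} e p = refl
  tiny-insertions {ε} e c (x ∷ w) p s with ∧-true s
  ... | q , s′ = begin
    Σ (insertions (tiny ε) (map triple (x ∷ w))) (𝟙 ∘ stays (triple c))
      ≡⟨ Σ-insertions-∷ (tiny ε) (triple x) (map triple w) _ ⟩
    𝟙 (stays (triple c) (tiny ε ∷ map triple (x ∷ w))) +
    Σ (insertions (tiny ε) (map triple w)) (λ w′ → 𝟙 (stays (triple c) (triple x ∷ w′)))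
      ≡⟨ cong₂ _+_
           (cong 𝟙 (true-∧ (pos-triple-tiny {c} e p) (stays-triple-tiny e c (x ∷ w) s)))
           (Σ-cong (insertions (tiny ε) (map triple w)) (λ w′ → cong 𝟙
             (trans (cong₂ (λ a b → a ∧ stays b w′)
                      (trans (cong pos (sym (triple-⊕ c x))) (pos-triple {c ⊕ x} q))
                      (sym (triple-⊕ c x))) refl))) ⟩
    1 + Σ (insertions (tiny ε) (map triple w)) (𝟙 ∘ stays (triple (c ⊕ x)))
      ≡⟨ cong suc (tiny-insertions e (c ⊕ x) w q s′) ⟩
    suc (length (x ∷ w)) ∎
    where open ≡-Reasoning

  -- A persistent walk remains so when it is scaled up and a tiny step is
  -- inserted, except for a negative step at the very beginning.
  tiny-insertions₀ : ∀ w →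
    (2 * length w + 1) * 𝟙 (stays 𝟘 w) ≤
    Σ (insertions (tiny 1ℤ) (map triple w)) (𝟙 ∘ stays 𝟘) +
    Σ (insertions (tiny -[1+ 0 ]) (map triple w)) (𝟙 ∘ stays 𝟘)
  tiny-insertions₀ [] = ≤-refl
  tiny-insertions₀ (x ∷ w) with stays 𝟘 (x ∷ w) in s
  ... | false = ≤-trans (≤-reflexive (*-zeroʳ (2 * length (x ∷ w) + 1))) z≤n
  ... | true with ∧-true s
  ...   | q , s′ = begin
    (2 * suc (length w) + 1) * 1
      ≡⟨ lemma (length w) ⟩
    (1 + suc (length w)) + (0 + suc (length w))
      ≤⟨ +-mono-≤ (part +1ᵘ first) (part −1ᵘ z≤n) ⟩
    Σ (insertions (tiny 1ℤ) (map triple (x ∷ w))) (𝟙 ∘ stays 𝟘) +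
    Σ (insertions (tiny -[1+ 0 ]) (map triple (x ∷ w))) (𝟙 ∘ stays 𝟘) ∎
    where
    open ≤-Reasoning
    lemma : ∀ k → (2 * suc k + 1) * 1 ≡ (1 + suc k) + (0 + suc k)
    lemma = solve-∀
    first : 1 ≤ 𝟙 (stays 𝟘 (tiny 1ℤ ∷ map triple (x ∷ w)))
    first = ≤-reflexive (sym (cong 𝟙 (stays-triple-tiny +1ᵘ 𝟘 (x ∷ w) s)))
    part : ∀ {ε m} → Unit ε → m ≤ 𝟙 (stays 𝟘 (tiny ε ∷ map triple (x ∷ w))) →
           m + suc (length w) ≤ Σ (insertions (tiny ε) (map triple (x ∷ w))) (𝟙 ∘ stays 𝟘)
    part {ε} {m} e h = ≤-trans
      (+-mono-≤ h (≤-reflexive (trans (sym (tiny-insertions e (𝟘 ⊕ x) w q s′))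
        (Σ-cong (insertions (tiny ε) (map triple w)) (λ w′ → cong 𝟙 (sym
          (cong₂ (λ a b → a ∧ stays b w′)
                 (trans (cong pos (sym (triple-⊕ 𝟘 x))) (pos-triple {𝟘 ⊕ x} q))
                 (sym (triple-⊕ 𝟘 x)))))))))
      (≤-reflexive (sym (Σ-insertions-∷ (tiny ε) (triple x) (map triple w) _)))

  -- The tiny step has z + 1 places and two signs; of these 2 z + 2 insertions into a persistent
  -- walk only the negative one at the front is lost.
  ν-step : ∀ z → (2 * z + 1) * ν z ≤ ν (suc z)
  ν-step z = begin
    (2 * z + 1) * ν z
      ≡⟨ Σ-*ˡ (arr ⊝_ (canonical z)) (2 * z + 1) _ ⟨
    Σ (arr ⊝_ (canonical z)) (λ w → (2 * z + 1) * 𝟙 (stays 𝟘 w))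
      ≤⟨ Σ-mono-∈ (arr ⊝_ (canonical z)) (λ {w} i → ≤-trans
           (≤-reflexive (cong (λ k → (2 * k + 1) * 𝟙 (stays 𝟘 w))
             (sym (trans (∈-arr-length {L = canonical z} i) (length-canonical z)))))
           (tiny-insertions₀ w)) ⟩
    Σ (arr ⊝_ (canonical z)) (λ w →
      Σ (insertions (tiny 1ℤ) (map triple w)) (𝟙 ∘ stays 𝟘) +
      Σ (insertions (tiny -[1+ 0 ]) (map triple w)) (𝟙 ∘ stays 𝟘))
      ≡⟨ Σ-arr-map triple triple-⊝ (canonical z) _ ⟨
    Σ (arr ⊝_ (map triple (canonical z))) (λ w →
      Σ (insertions (tiny 1ℤ) w) (𝟙 ∘ stays 𝟘) + Σ (insertions (tiny -[1+ 0 ]) w) (𝟙 ∘ stays 𝟘))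
      ≡⟨ Σ-arr-∷ ⊝_ (tiny 1ℤ) (map triple (canonical z)) _ ⟨
    ν (suc z) ∎
    where open ≤-Reasoning

  -- By `ν-step`, ν z is at least (2 z - 1)!!, and (2 z - 1)!! / (2ᶻ z!) is the central binomial
  -- probability C(2 z, z) / 4ᶻ. The factor 4 z + 1 suits the induction: in its step the two sides
  -- of the polynomial inequality differ by (ν z)² only.
  ν-bound : ∀ z → arrangements z * arrangements z ≤ (4 * z + 1) * (ν z * ν z)
  ν-bound zero    = ≤-refl
  ν-bound (suc z) = begin
    (2 * suc z * t) * (2 * suc z * t)
      ≡⟨ lemma₁ z t ⟩
    (2 * suc z * (2 * suc z)) * (t * t)
      ≤⟨ *-monoʳ-≤ (2 * suc z * (2 * suc z)) (ν-bound z) ⟩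
    (2 * suc z * (2 * suc z)) * ((4 * z + 1) * (ν z * ν z))
      ≤⟨ m≤n+m _ (ν z * ν z) ⟩
    ν z * ν z + (2 * suc z * (2 * suc z)) * ((4 * z + 1) * (ν z * ν z))
      ≡⟨ lemma₂ z (ν z) ⟩
    (4 * suc z + 1) * (((2 * z + 1) * ν z) * ((2 * z + 1) * ν z))
      ≤⟨ *-monoʳ-≤ (4 * suc z + 1) (*-mono-≤ (ν-step z) (ν-step z)) ⟩
    (4 * suc z + 1) * (ν (suc z) * ν (suc z)) ∎
    where
    open ≤-Reasoning
    t = arrangements z
    lemma₁ : ∀ z t → (2 * suc z * t) * (2 * suc z * t) ≡ (2 * suc z * (2 * suc z)) * (t * t)
    lemma₁ = solve-∀
    lemma₂ : ∀ z v → v * v + (2 * suc z * (2 * suc z)) * ((4 * z + 1) * (v * v)) ≡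
                     (4 * suc z + 1) * (((2 * z + 1) * v) * ((2 * z + 1) * v))
    lemma₂ = solve-∀

  nonneg : ℤ → Bool
  nonneg (+ _)    = true
  nonneg -[1+ _ ] = false

  staysNonneg : ℤ → List ℤ → Bool
  staysNonneg c []      = true
  staysNonneg c (x ∷ w) = nonneg (c ℤ.+ x) ∧ staysNonneg (c ℤ.+ x) w

  stays⇒staysNonneg : ∀ c w → 𝟙 (stays c w) ≤ 𝟙 (staysNonneg (proj₁ c) (map proj₁ w))
  stays⇒staysNonneg c []      = ≤-refl
  stays⇒staysNonneg (c , d) ((x , y) ∷ w) with c ℤ.+ x | d ℤ.+ y
  ... | -[1+ _ ] | _  = z≤n
  ... | +[1+ n ] | d′ = stays⇒staysNonneg (+[1+ n ] , d′) w
  ... | + zero   | d′ with posℤ d′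
  ...   | true  = stays⇒staysNonneg (0ℤ , d′) w
  ...   | false = z≤n

  square-cancel-≤ : ∀ {a b} → a * a ≤ b * b → a ≤ b
  square-cancel-≤ {a} {b} h with a ≤? b
  ... | yes p = p
  ... | no ¬p = ⊥-elim (<-irrefl refl (<-≤-trans (*-mono-< (≰⇒> ¬p) (≰⇒> ¬p)) h))

  -- With tie-breaks attached, L has as many persistent arrangements as the canonical list of its
  -- length. Forgetting the tie-breaks then weakens positive partial sums to nonnegative ones, which
  -- arbitrary integer steps permit.
  persistence : ∀ κ L → 4 * length L + 1 ≤ κ * κ →
    arrangements (length L) ≤ κ * Σ (arr (λ z → ℤ.- z) L) (𝟙 ∘ staysNonneg 0ℤ)
  persistence κ L h = begin
    arrangements (length L)
      ≤⟨ square-cancel-≤ (≤-trans (ν-bound (length L))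
           (≤-trans (*-monoˡ-≤ _ h) (≤-reflexive (lemma κ (ν (length L)))))) ⟩
    κ * ν (length L)
      ≡⟨ cong (λ z → κ * ν z) (length-withTiebreak L) ⟨
    κ * ν (length (withTiebreak L))
      ≡⟨ cong (κ *_) (universal (withTiebreak L) (withTiebreak-independent L)) ⟨
    κ * persistent (withTiebreak L)
      ≤⟨ *-monoʳ-≤ κ (Σ-mono (arr ⊝_ (withTiebreak L)) (stays⇒staysNonneg 𝟘)) ⟩
    κ * Σ (arr ⊝_ (withTiebreak L)) (𝟙 ∘ staysNonneg 0ℤ ∘ map proj₁)
      ≡⟨ cong (κ *_) (Σ-arr-map proj₁ (λ _ → refl) (withTiebreak L) _) ⟨
    κ * Σ (arr (λ z → ℤ.- z) (map proj₁ (withTiebreak L))) (𝟙 ∘ staysNonneg 0ℤ)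
      ≡⟨ cong (λ M → κ * Σ (arr (λ z → ℤ.- z) M) (𝟙 ∘ staysNonneg 0ℤ)) (forget L) ⟩
    κ * Σ (arr (λ z → ℤ.- z) L) (𝟙 ∘ staysNonneg 0ℤ) ∎
    where
    open ≤-Reasoning
    lemma : ∀ k v → k * k * (v * v) ≡ (k * v) * (k * v)
    lemma = solve-∀
    forget : ∀ L → map proj₁ (withTiebreak L) ≡ L
    forget []      = refl
    forget (b ∷ L) = cong (b ∷_) (trans (sym (map-∘ (withTiebreak L))) (forget L))

-- Exits of a random walk from a separable set.

module ExitCounting where

  open import Data.Bool.Base using (Bool; true; false; _∧_; _∨_; not; _xor_)
  open import Data.Empty using (⊥-elim)
  open import Data.Fin.Base using (Fin; zero; suc)
  open import Data.Fin.Properties as Fin using (_≟_)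
  open import Data.Integer.Base as ℤ using (ℤ; -[1+_]; 0ℤ)
  import Data.Integer.Properties as ℤ
  open import Data.List.Base using (List; []; _∷_; _++_; map; length; null; allFin)
  open import Data.List.Membership.Propositional using (_∈_)
  open import Data.List.Properties using (length-map; map-tabulate; length-tabulate)
  open import Data.List.Relation.Unary.Any using (here)
  open import Data.Nat.Base
  open import Data.Nat.Properties hiding (_≟_)
  open import Data.Nat.Tactic.RingSolver using (solve-∀)
  open import Data.Product.Base using (_×_; _,_; Σ-syntax)
  open import Data.Sum.Base using (_⊎_; inj₁; inj₂)
  open import Data.Vec.Base using (_∷_; []; lookup; replicate; _[_]≔_)
  open import Data.Vec.Properties using (lookup∘updateAt; lookup∘updateAt′; lookup-replicate)
  open import Function.Base using (_∘_; id)
  open import Relation.Binary.PropositionalEquality hiding ([_]; J)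
  open import Relation.Nullary using (yes; no; does)
  open import Defs using (Point; Trit; −1ᵗ; 0ᵗ; +1ᵗ)
  open Words
  open PersistentWalks
  open TieBreaking using (persistence; staysNonneg)

  Σ-allFin : ∀ {n} (F : Fin (suc n) → ℕ) → Σ (allFin (suc n)) F ≡ F zero + Σ (allFin n) (F ∘ suc)
  Σ-allFin {n} F = cong (F zero +_)
    (trans (cong (λ xs → Σ xs F) (sym (map-tabulate id suc))) (Σ-map suc (allFin n) F))

  module _ {X : Set} {neg : X → X} (φ : X → ℕ) (φ-neg : ∀ x → φ (neg x) ≡ φ x) where
    open Arrangements neg

    Σ-∈-insertions : ∀ {x w w′} → w′ ∈ insertions x w → Σ w′ φ ≡ φ x + Σ w φ
    Σ-∈-insertions {x} {[]}    (here refl) = refl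
    Σ-∈-insertions {x} {y ∷ w} i with ∈-insertions-∷ {x = x} {y} {w} i
    ... | inj₁ refl            = refl
    ... | inj₂ (w″ , j , refl) = trans (cong (φ y +_) (Σ-∈-insertions {x} {w} j)) (lemma (φ y) (φ x) (Σ w φ))
      where
      lemma : ∀ a b c → a + (b + c) ≡ b + (a + c)
      lemma = solve-∀

    Σ-∈-arr : ∀ {L w} → w ∈ arr L → Σ w φ ≡ Σ L φ
    Σ-∈-arr {[]}    (here refl) = refl
    Σ-∈-arr {x ∷ L} i with ∈-arr-∷ {x = x} {L} i
    ... | w , j , inj₁ k = trans (Σ-∈-insertions {x} {w} k) (cong (φ x +_) (Σ-∈-arr {L} j))
    ... | w , j , inj₂ k = trans (Σ-∈-insertions {neg x} {w} k) (cong₂ _+_ (φ-neg x) (Σ-∈-arr {L} j))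

    Σ-∈-splits : ∀ {L P Q} → (P , Q) ∈ splits L → Σ P φ + Σ Q φ ≡ Σ L φ
    Σ-∈-splits {[]} (here refl) = refl
    Σ-∈-splits {x ∷ L} {P₀} i with ∈-splits-∷ {x = x} {L} i
    ... | inj₁ (P , j , refl) = trans (+-assoc (φ x) _ _) (cong (φ x +_) (Σ-∈-splits {L} j))
    ... | inj₂ (Q , j , refl) = trans (lemma (Σ P₀ φ) (φ x) (Σ Q φ)) (cong (φ x +_) (Σ-∈-splits {L} j))
      where
      lemma : ∀ a b c → a + (b + c) ≡ b + (a + c)
      lemma = solve-∀

  Step : ℕ → Set
  Step M = Fin M × Bool

  flip : ∀ {M} → Step M → Step M
  flip (j , s) = j , not s

  signTrit : Bool → Trit
  signTrit true  = +1ᵗ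
  signTrit false = −1ᵗ

  step : ∀ {M} → Point M → Step M → Point M
  step y (j , s) = y [ j ]≔ signTrit s

  run : ∀ {M} → Point M → List (Step M) → Point M
  run y []      = y
  run y (e ∷ w) = run (step y e) w

  origin : ∀ {M} → Point M
  origin = replicate _ 0ᵗ

  occurs : ∀ {M} → Fin M → Step M → ℕ
  occurs j (i , _) = 𝟙 (does (i ≟ j))

  nonzero : Trit → ℕ
  nonzero 0ᵗ  = 0
  nonzero +1ᵗ = 1
  nonzero −1ᵗ = 1

  steps : ∀ M → List (Step M)
  steps M = map (_, true) (allFin M)

  length-steps : ∀ M → length (steps M) ≡ M
  length-steps M = trans (length-map (_, true) (allFin M)) (length-tabulate {n = M} id)

  occurs-once : ∀ {M} (j : Fin M) → Σ (steps M) (occurs j) ≡ 1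
  occurs-once {M} j = trans (Σ-map (_, true) (allFin M) (occurs j)) (go j)
    where
    go : ∀ {n} (j : Fin n) → Σ (allFin n) (λ i → 𝟙 (does (i ≟ j))) ≡ 1
    go {suc n} zero    = trans (Σ-allFin {n} (λ i → 𝟙 (does (i ≟ zero)))) (cong suc (Σ-0 (allFin n)))
    go {suc n} (suc j) = trans (Σ-allFin {n} (λ i → 𝟙 (does (i ≟ suc j)))) (go j)

  -- Each coordinate is switched on at most once, past and future taken together. Hence every step
  -- acts on a zero coordinate, where a separating functional changes by an amount independent of
  -- the rest of the point.
  record Admissible {M} (y : Point M) (w : List (Step M)) : Set where
    constructor admissible
    field bound : ∀ j → nonzero (lookup y j) + Σ w (occurs j) ≤ 1

  open Admissible

  occurs-self : ∀ {M} (j : Fin M) s → occurs j (j , s) ≡ 1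
  occurs-self j s with j ≟ j
  ... | yes _ = refl
  ... | no ¬p = ⊥-elim (¬p refl)

  admissible-head : ∀ {M y} {j : Fin M} {s w} → Admissible y ((j , s) ∷ w) → lookup y j ≡ 0ᵗ
  admissible-head {y = y} {j} {s} {w} adm = zero-trit (lookup y j)
    (n≤0⇒n≡0 (+-cancelʳ-≤ 1 _ 0 (≤-trans (+-monoʳ-≤ (nonzero (lookup y j))
      (≤-trans (≤-reflexive (sym (occurs-self j s))) (m≤m+n _ (Σ w (occurs j))))) (bound adm j))))
    where
    zero-trit : ∀ t → nonzero t ≡ 0 → t ≡ 0ᵗ
    zero-trit 0ᵗ _ = refl

  nonzero-step : ∀ {M} (y : Point M) e j → nonzero (lookup (step y e) j) ≤ nonzero (lookup y j) + occurs j e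
  nonzero-step y (i , s) j with i ≟ j
  ... | yes refl = ≤-trans (≤-reflexive (cong nonzero (lookup∘updateAt j y)))
                           (≤-trans (unit s) (m≤n+m 1 _))
    where
    unit : ∀ s → nonzero (signTrit s) ≤ 1
    unit true  = ≤-refl
    unit false = ≤-refl
  ... | no i≢j = ≤-trans (≤-reflexive (cong nonzero (lookup∘updateAt′ j i (i≢j ∘ sym) y))) (m≤m+n _ 0)

  admissible-tail : ∀ {M y} {e : Step M} {w} → Admissible y (e ∷ w) → Admissible (step y e) w
  admissible-tail {y = y} {e} {w} adm .bound j = ≤-trans (+-monoˡ-≤ (Σ w (occurs j)) (nonzero-step y e j))
    (≤-trans (≤-reflexive (+-assoc (nonzero (lookup y j)) (occurs j e) (Σ w (occurs j)))) (bound adm j))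

  admissible-run : ∀ {M y} (u : List (Step M)) {v} → Admissible y (u ++ v) → Admissible (run y u) v
  admissible-run []      adm = adm
  admissible-run (e ∷ u) adm = admissible-run u (admissible-tail {e = e} adm)

  admissible-origin : ∀ {M} {w : List (Step M)} → (∀ j → Σ w (occurs j) ≤ 1) → Admissible origin w
  admissible-origin h .bound j rewrite lookup-replicate j 0ᵗ = h j

  signed : Bool → ℤ → ℤ
  signed true  z = z
  signed false z = ℤ.- z

  module _ {M : ℕ} (f : Point M → Bool) where
    open Arrangements (flip {M})

    leaves : Point M → Step M → ℕ
    leaves y e = 𝟙 (f y ∧ not (f (step y e)))

    exits : Point M → List (Step M) → ℕ
    exits y []      = 0
    exits y (e ∷ w) = leaves y e + exits (step y e) w

    -- The indicator that the final step of the walk is an exit; its sum over all prefixes is the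
    -- number of exits.
    exitAt : Point M → List (Step M) → ℕ
    exitAt y []      = 0
    exitAt y (e ∷ u) = 𝟙 (null u) * leaves y e + exitAt (step y e) u

    avoids : Point M → List (Step M) → Bool
    avoids y []      = true
    avoids y (e ∷ v) = not (f (step y e)) ∧ avoids (step y e) v

    Σ-cuts-null : ∀ w (F : List (Step M) × List (Step M) → ℕ) →
                  Σ (cuts w) (λ (u , v) → 𝟙 (null u) * F (u , v)) ≡ F ([] , w)
    Σ-cuts-null []      F = trans (+-identityʳ _) (+-identityʳ _)
    Σ-cuts-null (e ∷ w) F = trans (Σ-cuts-∷ e w _)
      (trans (cong₂ _+_ (+-identityʳ _) (Σ-0 (cuts w))) (+-identityʳ _))

    exits-cuts : ∀ y w → exits y w ≡ Σ (cuts w) (λ (u , v) → exitAt y u)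
    exits-cuts y []      = refl
    exits-cuts y (e ∷ w) = begin
      leaves y e + exits (step y e) w
        ≡⟨ cong₂ _+_ (sym (Σ-cuts-null w (λ _ → leaves y e))) (exits-cuts (step y e) w) ⟩
      Σ (cuts w) (λ (u , v) → 𝟙 (null u) * leaves y e) + Σ (cuts w) (λ (u , v) → exitAt (step y e) u)
        ≡⟨ Σ-+ (cuts w) _ _ ⟨
      Σ (cuts w) (λ (u , v) → exitAt y (e ∷ u))
        ≡⟨ Σ-cuts-∷ e w (λ (u , v) → exitAt y u) ⟨
      Σ (cuts (e ∷ w)) (λ (u , v) → exitAt y u) ∎
      where open ≡-Reasoning

    -- An exit without later return is the last exit, so at most one cut counts. The right side is
    -- sharper than 1 for the sake of the induction: a walk that starts outside and never enters has
    -- no exit at all.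
    last-exit : ∀ y w →
      Σ (cuts w) (λ (u , v) → exitAt y u * 𝟙 (avoids (run y u) v)) ≤ 𝟙 (f y ∨ not (avoids y w))
    last-exit y []      = z≤n
    last-exit y (e ∷ w) = begin
      Σ (cuts (e ∷ w)) (λ (u , v) → exitAt y u * 𝟙 (avoids (run y u) v))
        ≡⟨ Σ-cuts-∷ e w (λ (u , v) → exitAt y u * 𝟙 (avoids (run y u) v)) ⟩
      Σ (cuts w) (λ (u , v) → (𝟙 (null u) * leaves y e + exitAt y′ u) * 𝟙 (avoids (run y′ u) v))
        ≡⟨ Σ-cong (cuts w) (λ (u , v) → lemma (𝟙 (null u)) (leaves y e) (exitAt y′ u) (𝟙 (avoids (run y′ u) v))) ⟩
      Σ (cuts w) (λ (u , v) → 𝟙 (null u) * (leaves y e * 𝟙 (avoids (run y′ u) v)) +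
                              exitAt y′ u * 𝟙 (avoids (run y′ u) v))
        ≡⟨ Σ-+ (cuts w) _ _ ⟩
      Σ (cuts w) (λ (u , v) → 𝟙 (null u) * (leaves y e * 𝟙 (avoids (run y′ u) v))) + A
        ≡⟨ cong (_+ A) (Σ-cuts-null w (λ (u , v) → leaves y e * 𝟙 (avoids (run y′ u) v))) ⟩
      leaves y e * 𝟙 (avoids y′ w) + A
        ≤⟨ +-monoʳ-≤ (leaves y e * 𝟙 (avoids y′ w)) (last-exit y′ w) ⟩
      leaves y e * 𝟙 (avoids y′ w) + 𝟙 (f y′ ∨ not (avoids y′ w))
        ≤⟨ table (f y) (f y′) (avoids y′ w) ⟩
      𝟙 (f y ∨ not (not (f y′) ∧ avoids y′ w)) ∎
      where
      open ≤-Reasoning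
      y′ = step y e
      A = Σ (cuts w) (λ (u , v) → exitAt y′ u * 𝟙 (avoids (run y′ u) v))
      lemma : ∀ n l x s → (n * l + x) * s ≡ n * (l * s) + x * s
      lemma = solve-∀
      table : ∀ a b c → 𝟙 (a ∧ not b) * 𝟙 c + 𝟙 (b ∨ not c) ≤ 𝟙 (a ∨ not (not b ∧ c))
      table true  true  _     = ≤-refl
      table true  false true  = ≤-refl
      table true  false false = ≤-refl
      table false true  _     = ≤-refl
      table false false true  = ≤-refl
      table false false false = ≤-refl

    exitAt-outside : ∀ y u → exitAt y u ≡ 0 ⊎ f (run y u) ≡ false
    exitAt-outside y []      = inj₁ refl
    exitAt-outside y (e ∷ u) with exitAt-outside (step y e) u
    ... | inj₂ out = inj₂ out
    exitAt-outside y (e ∷ x ∷ u) | inj₁ z = inj₁ z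
    exitAt-outside y (e ∷ []) | inj₁ _ with f y | f (step y e)
    ... | true  | false = inj₂ refl
    ... | true  | true  = inj₁ refl
    ... | false | _     = inj₁ refl

    -- Outside points are separated from f by functionals which are affine
    -- in each coordinate separately along admissible walks.
    Separable : Set
    Separable = ∀ y → f y ≡ false →
      Σ[ ℓ ∈ (Point M → ℤ) ] Σ[ b ∈ (Fin M → ℤ) ]
        (∀ z j s → lookup z j ≡ 0ᵗ → ℓ (step z (j , s)) ≡ ℓ z ℤ.+ signed s (b j))
      × (∀ z → f z ≡ true → ℓ z ℤ.< ℓ y)

    module _ (separable : Separable) where

      weight : (Fin M → ℤ) → Step M → ℤ
      weight b (j , s) = signed s (b j)

      weight-flip : ∀ b e → weight b (flip e) ≡ ℤ.- weight b e
      weight-flip b (j , true)  = refl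
      weight-flip b (j , false) = sym (ℤ.neg-involutive (b j))

      -- The set lies strictly below the level of y, so the walk is outside as long as the
      -- functional is not below that level; c is the increment accumulated since y.
      avoids-staysNonneg : ∀ (ℓ : Point M → ℤ) b y →
        (∀ z j s → lookup z j ≡ 0ᵗ → ℓ (step z (j , s)) ≡ ℓ z ℤ.+ signed s (b j)) →
        (∀ z → f z ≡ true → ℓ z ℤ.< ℓ y) →
        ∀ z c v → ℓ z ≡ ℓ y ℤ.+ c → Admissible z v →
        𝟙 (staysNonneg c (map (weight b) v)) ≤ 𝟙 (avoids z v)
      avoids-staysNonneg ℓ b y aff sep z c []      e adm = ≤-refl
      avoids-staysNonneg ℓ b y aff sep z c ((j , s) ∷ v) e adm
        with c ℤ.+ signed s (b j) in eq
      ... | -[1+ _ ] = z≤n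
      ... | ℤ.+ k = ≤-trans (avoids-staysNonneg ℓ b y aff sep z′ (ℤ.+ k) v e′ (admissible-tail adm))
                          (≤-reflexive (cong 𝟙 (sym (cong (λ o → not o ∧ avoids z′ v) outside))))
        where
        z′ = step z (j , s)
        e′ : ℓ z′ ≡ ℓ y ℤ.+ ℤ.+ k
        e′ = trans (aff z j s (admissible-head adm))
               (trans (cong (ℤ._+ _) e)
                 (trans (ℤ.+-assoc (ℓ y) c _) (cong (λ t → ℓ y ℤ.+ t) eq)))
        outside : f z′ ≡ false
        outside with f z′ in fz
        ... | false = refl
        ... | true  = ⊥-elim (ℤ.<-irrefl refl (ℤ.<-≤-trans (sep z′ fz)
                        (ℤ.≤-trans (ℤ.i≤i+j (ℓ y) (ℤ.+ k)) (ℤ.≤-reflexive (sym e′)))))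

      -- Once the past u ends with an exit, the functional separating that point is fixed, while the
      -- remaining steps still come in all signed orders. By `persistence` a fraction of at least
      -- 1/κ of the continuations never returns, and such a continuation makes the exit the last
      -- one, of which a walk has at most one.
      exits-bound : ∀ κ → 4 * M + 1 ≤ κ * κ →
        Σ (arr (steps M)) (exits origin) ≤ κ * Σ (arr (steps M)) (λ _ → 1)
      exits-bound κ hκ = begin
        Σ (arr L) (exits origin)
          ≡⟨ Σ-cong (arr L) (exits-cuts origin) ⟩
        Σ (arr L) (λ w → Σ (cuts w) (λ (u , v) → exitAt origin u))
          ≡⟨ cut-arr L _ ⟩
        Σ (splits L) (λ (P , Q) → Σ (arr P) (λ u → Σ (arr Q) (λ v → exitAt origin u)))
          ≤⟨ Σ-mono-∈ (splits L) (λ {(P , Q)} i → Σ-mono-∈ (arr P) (λ j → afterExit i j)) ⟩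
        Σ (splits L) (λ (P , Q) → Σ (arr P) (λ u → κ * G Q u))
          ≡⟨ Σ-cong (splits L) (λ (P , Q) → Σ-*ˡ (arr P) κ (G Q)) ⟩
        Σ (splits L) (λ (P , Q) → κ * Σ (arr P) (G Q))
          ≡⟨ Σ-*ˡ (splits L) κ _ ⟩
        κ * Σ (splits L) (λ (P , Q) → Σ (arr P) (G Q))
          ≡⟨ cong (κ *_) (cut-arr L _) ⟨
        κ * Σ (arr L) (λ w → Σ (cuts w) (λ (u , v) → exitAt origin u * 𝟙 (avoids (run origin u) v)))
          ≤⟨ *-monoʳ-≤ κ (Σ-mono (arr L) (λ w → ≤-trans (last-exit origin w) (𝟙≤1 _))) ⟩
        κ * Σ (arr L) (λ _ → 1) ∎
        where
        open ≤-Reasoning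
        L = steps M
        𝟙≤1 : ∀ b → 𝟙 b ≤ 1
        𝟙≤1 true  = ≤-refl
        𝟙≤1 false = z≤n
        G : List (Step M) → List (Step M) → ℕ
        G Q u = Σ (arr Q) (λ v → exitAt origin u * 𝟙 (avoids (run origin u) v))
        afterExit : ∀ {P Q u} → (P , Q) ∈ splits L → u ∈ arr P →
                    Σ (arr Q) (λ v → exitAt origin u) ≤ κ * G Q u
        afterExit {P} {Q} {u} i j with exitAt-outside origin u
        ... | inj₁ e rewrite e = ≤-trans (≤-reflexive (Σ-0 (arr Q))) z≤n
        ... | inj₂ out with separable (run origin u) out
        ...   | ℓ , b , aff , sep = begin
          Σ (arr Q) (λ v → x)
            ≡⟨ trans (Σ-cong (arr Q) (λ _ → sym (*-identityʳ x))) (Σ-*ˡ (arr Q) x _) ⟩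
          x * Σ (arr Q) (λ _ → 1)
            ≡⟨ cong (x *_) (trans (arr-count Q) (cong arrangements (sym (length-map (weight b) Q)))) ⟩
          x * arrangements (length (map (weight b) Q))
            ≤⟨ *-monoʳ-≤ x (persistence κ (map (weight b) Q)
                 (≤-trans (+-monoˡ-≤ 1 (*-monoʳ-≤ 4 lenQ)) hκ)) ⟩
          x * (κ * Σ (Arrangements.arr (λ z → ℤ.- z) (map (weight b) Q)) (𝟙 ∘ staysNonneg 0ℤ))
            ≡⟨ cong (λ t → x * (κ * t)) (Σ-arr-map (weight b) (weight-flip b) Q _) ⟩
          x * (κ * Σ (arr Q) (λ v → 𝟙 (staysNonneg 0ℤ (map (weight b) v))))
            ≤⟨ *-monoʳ-≤ x (*-monoʳ-≤ κ (Σ-mono-∈ (arr Q) (λ {v} k →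
                 avoids-staysNonneg ℓ b _ aff sep _ 0ℤ v (sym (ℤ.+-identityʳ _)) (admissible-rest v k)))) ⟩
          x * (κ * Σ (arr Q) (λ v → 𝟙 (avoids (run origin u) v)))
            ≡⟨ lemma x κ _ ⟩
          κ * (x * Σ (arr Q) (λ v → 𝟙 (avoids (run origin u) v)))
            ≡⟨ cong (κ *_) (Σ-*ˡ (arr Q) x _) ⟨
          κ * G Q u ∎
          where
          x = exitAt origin u
          lemma : ∀ a b c → a * (b * c) ≡ b * (a * c)
          lemma = solve-∀
          lenQ : length (map (weight b) Q) ≤ M
          lenQ = ≤-trans (≤-reflexive (length-map (weight b) Q))
                   (≤-trans (m≤n+m _ (length P))
                     (≤-reflexive (trans (splits-length {L = L} i) (length-steps M))))
          admissible-rest : ∀ v → v ∈ arr Q → Admissible (run origin u) v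
          admissible-rest v k = admissible-run u (admissible-origin {w = u ++ v} (λ l →
            ≤-reflexive (trans (Σ-++ u v (occurs l))
              (trans (cong₂ _+_ (Σ-∈-arr (occurs l) (λ _ → refl) {P} j) (Σ-∈-arr (occurs l) (λ _ → refl) {Q} k))
                (trans (Σ-∈-splits {neg = flip} (occurs l) (λ _ → refl) {L} i) (occurs-once l))))))

    changes : Point M → List (Step M) → ℕ
    changes y []      = 0
    changes y (e ∷ w) = 𝟙 (f y xor f (step y e)) + changes (step y e) w

    -- Exits and entrances alternate. The term `𝟙 (f y)` accounts for a start inside the set, where
    -- an exit must precede the first entrance.
    changes≤exits : ∀ y w → changes y w + 𝟙 (f y) ≤ 2 * exits y w + 1
    changes≤exits y []      = 𝟙≤1 (f y)
      where
      𝟙≤1 : ∀ b → 𝟙 b ≤ 1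
      𝟙≤1 true  = ≤-refl
      𝟙≤1 false = z≤n
    changes≤exits y (e ∷ w) with f y | f (step y e) | changes≤exits (step y e) w
    ... | true  | true  | ih = ih
    ... | false | false | ih = ih
    ... | true  | false | ih = ≤-trans (s≤s (+-monoˡ-≤ 1 (≤-trans (m≤m+n _ 0) ih))) (≤-reflexive (lemma (exits (step y e) w)))
      where
      lemma : ∀ x → suc (2 * x + 1 + 1) ≡ 2 * suc x + 1
      lemma = solve-∀
    ... | false | true  | ih = ≤-trans (≤-reflexive (lemma (changes (step y e) w))) ih
      where
      lemma : ∀ x → suc x + 0 ≡ x + 1
      lemma = solve-∀

-- Averaging walks over random labellings of the coordinates.

module WindowAveraging where

  open import Data.Bool.Base using (Bool; true; false; _xor_)
  open import Data.Fin.Base using (Fin; zero; suc)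
  open import Data.Fin.Properties as Fin using (_≟_)
  open import Data.Integer.Base as ℤ using (ℤ; 0ℤ; 1ℤ; -1ℤ)
  import Data.Integer.Properties as ℤ
  import Data.Integer.Tactic.RingSolver as ℤSolver
  open import Data.List.Base using (List; []; _∷_; _++_; map; length; allFin; cartesianProductWith)
    renaming (replicate to replicateᴸ)
  open import Data.List.Membership.Propositional using (_∈_)
  open import Data.List.Properties using (length-map; length-++; length-replicate; length-tabulate)
  open import Data.Nat.Base
  open import Data.Nat.Properties hiding (_≟_)
  open import Data.Nat.Tactic.RingSolver using (solve-∀)
  open import Data.Product.Base using (_×_; _,_; Σ-syntax)
  open import Data.Vec.Base as Vec using (Vec; _∷_; []; lookup; replicate)
  open import Data.Vec.Properties using (lookup∘updateAt; lookup∘updateAt′)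
  open import Function.Base using (_∘_; id)
  open import Relation.Binary.PropositionalEquality hiding ([_]; J)
  open import Relation.Nullary using (yes; no)
  open import Defs using (Point; Trit; −1ᵗ; 0ᵗ; +1ᵗ; Subset; vectors)
  open Words
  open PersistentWalks
  open ExitCounting

  tritℤ : Trit → ℤ
  tritℤ −1ᵗ = -1ℤ
  tritℤ 0ᵗ  = 0ℤ
  tritℤ +1ᵗ = 1ℤ

  dot : ∀ {n} → Vec ℤ n → Point n → ℤ
  dot []      []      = 0ℤ
  dot (a ∷ c) (t ∷ x) = a ℤ.* tritℤ t ℤ.+ dot c x

  LinearlySeparable : ∀ {n} → Subset n → Set
  LinearlySeparable {n} f = ∀ x → f x ≡ false →
    Σ[ a ∈ Vec ℤ n ] (∀ s → f s ≡ true → dot a s ℤ.< dot a x)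

  -- The sum of h v x over the pairs v ≤ x of points, each coordinate of
  -- which has weight α if v and x agree in a sign, β if it vanishes in v
  -- only, and γ if it vanishes in both.
  pairSum : ∀ (α β γ : ℕ) {n} → (Point n → Point n → ℕ) → ℕ
  pairSum α β γ {zero}  h = h [] []
  pairSum α β γ {suc n} h =
    α * (pairSum α β γ (λ v x → h (+1ᵗ ∷ v) (+1ᵗ ∷ x)) + pairSum α β γ (λ v x → h (−1ᵗ ∷ v) (−1ᵗ ∷ x))) +
    β * (pairSum α β γ (λ v x → h (0ᵗ ∷ v) (+1ᵗ ∷ x)) + pairSum α β γ (λ v x → h (0ᵗ ∷ v) (−1ᵗ ∷ x))) +
    γ * pairSum α β γ (λ v x → h (0ᵗ ∷ v) (0ᵗ ∷ x))

  -- A coordinate is nonzero throughout, zero throughout, or a member of one of the M blocks. Labels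
  -- are later paired with a sign, which for `active` is relative to the sign of the block and for
  -- `off` just doubles the weight.
  data Label (M : ℕ) : Set where
    on off : Label M
    active : Fin M → Label M

  negTrit : Trit → Trit
  negTrit −1ᵗ = +1ᵗ
  negTrit 0ᵗ  = 0ᵗ
  negTrit +1ᵗ = −1ᵗ

  signedTrit : Bool → Trit → Trit
  signedTrit true  t = t
  signedTrit false t = negTrit t

  value : ∀ {M} → Point M → Label M × Bool → Trit
  value y (on , s)       = signTrit s
  value y (off , s)      = 0ᵗ
  value y (active j , s) = signedTrit s (lookup y j)

  embed : ∀ {M n} → Vec (Label M × Bool) n → Point M → Point n
  embed ω y = Vec.map (value y) ω

  module _ {M : ℕ} where

    coefficient : ℤ → Label M × Bool → Fin M → ℤ
    coefficient a (active i , s) j with i ≟ j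
    ... | yes _ = a ℤ.* tritℤ (signTrit s)
    ... | no  _ = 0ℤ
    coefficient a (on , s)  j = 0ℤ
    coefficient a (off , s) j = 0ℤ

    coefficients : ∀ {n} → Vec ℤ n → Vec (Label M × Bool) n → Fin M → ℤ
    coefficients []      []      j = 0ℤ
    coefficients (a ∷ c) (l ∷ ω) j = coefficient a l j ℤ.+ coefficients c ω j

    signed-+ : ∀ s a b → signed s (a ℤ.+ b) ≡
                         signed s a ℤ.+ signed s b
    signed-+ true  a b = refl
    signed-+ false a b = ℤ.neg-distrib-+ a b

    -- Switching on block j changes the functional by the signed sum of the coefficients in that
    -- block, whatever the other blocks do; this is the affinity required in `Separable`.
    dot-step : ∀ {n} (a : Vec ℤ n) (ω : Vec (Label M × Bool) n) z j s → lookup z j ≡ 0ᵗ →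
      dot a (embed ω (step z (j , s))) ≡ dot a (embed ω z) ℤ.+ signed s (coefficients a ω j)
    dot-step []      []      z j true  e = refl
    dot-step []      []      z j false e = refl
    dot-step (a ∷ c) (l ∷ ω) z j s e = begin
      a ℤ.* tritℤ (value (step z (j , s)) l) ℤ.+ dot c (embed ω (step z (j , s)))
        ≡⟨ cong₂ ℤ._+_ (head-step l) (dot-step c ω z j s e) ⟩
      (a ℤ.* tritℤ (value z l) ℤ.+ sg (coefficient a l j)) ℤ.+
      (dot c (embed ω z) ℤ.+ sg (coefficients c ω j))
        ≡⟨ lemma (a ℤ.* tritℤ (value z l)) (sg (coefficient a l j)) _ _ ⟩
      (a ℤ.* tritℤ (value z l) ℤ.+ dot c (embed ω z)) ℤ.+
      (sg (coefficient a l j) ℤ.+ sg (coefficients c ω j))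
        ≡⟨ cong (λ t → dot (a ∷ c) (embed (l ∷ ω) z) ℤ.+ t) (signed-+ s (coefficient a l j) _) ⟨
      dot (a ∷ c) (embed (l ∷ ω) z) ℤ.+ sg (coefficients (a ∷ c) (l ∷ ω) j) ∎
      where
      open ≡-Reasoning
      sg : ℤ → ℤ
      sg = signed s
      lemma : ∀ p q r t → (p ℤ.+ q) ℤ.+ (r ℤ.+ t) ≡ (p ℤ.+ r) ℤ.+ (q ℤ.+ t)
      lemma = ℤSolver.solve-∀
      sg-0 : ∀ s → signed s 0ℤ ≡ 0ℤ
      sg-0 true  = refl
      sg-0 false = refl
      signs : ∀ s s′ → a ℤ.* tritℤ (signedTrit s′ (signTrit s)) ≡
                       a ℤ.* tritℤ (signedTrit s′ 0ᵗ) ℤ.+ signed s (a ℤ.* tritℤ (signTrit s′))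
      signs true  true  = pf a where pf : ∀ a → a ℤ.* 1ℤ ≡ a ℤ.* 0ℤ ℤ.+ a ℤ.* 1ℤ
                                     pf = ℤSolver.solve-∀
      signs true  false = pf a where pf : ∀ a → a ℤ.* -1ℤ ≡ a ℤ.* 0ℤ ℤ.+ a ℤ.* -1ℤ
                                     pf = ℤSolver.solve-∀
      signs false true  = pf a where pf : ∀ a → a ℤ.* -1ℤ ≡ a ℤ.* 0ℤ ℤ.+ ℤ.- (a ℤ.* 1ℤ)
                                     pf = ℤSolver.solve-∀
      signs false false = pf a where pf : ∀ a → a ℤ.* 1ℤ ≡ a ℤ.* 0ℤ ℤ.+ ℤ.- (a ℤ.* -1ℤ)
                                     pf = ℤSolver.solve-∀
      fixed : ∀ t → t ≡ t ℤ.+ sg 0ℤ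
      fixed t = trans (sym (ℤ.+-identityʳ t)) (cong (λ r → t ℤ.+ r) (sym (sg-0 s)))
      head-step : ∀ l → a ℤ.* tritℤ (value (step z (j , s)) l) ≡
                        a ℤ.* tritℤ (value z l) ℤ.+ sg (coefficient a l j)
      head-step (on , s′)  = fixed _
      head-step (off , s′) = fixed _
      head-step (active i , s′) with i ≟ j
      ... | yes refl = trans (cong (λ t → a ℤ.* tritℤ (signedTrit s′ t)) (lookup∘updateAt j z))
                         (trans (signs s s′)
                           (cong (λ t → a ℤ.* tritℤ (signedTrit s′ t) ℤ.+ sg (a ℤ.* tritℤ (signTrit s′))) (sym e)))
      ... | no i≢j = trans (cong (λ t → a ℤ.* tritℤ (signedTrit s′ t)) (lookup∘updateAt′ i j i≢j z)) (fixed _)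

    separable-embed : ∀ {n} {f : Subset n} → LinearlySeparable f →
                      (ω : Vec (Label M × Bool) n) → Separable (f ∘ embed ω)
    separable-embed sep ω y out with sep (embed ω y) out
    ... | a , h = dot a ∘ embed ω , coefficients a ω , dot-step a ω , λ z → h (embed ω z)

  -- Multiplicities serve as probabilities. A block that has been switched on acts like one more
  -- `on` label and a block still off like one more `off` label, so the steps of a walk run through
  -- a window of consecutive weights.
  config : ℕ → ℕ → ∀ M → List (Label M × Bool)
  config a c M = cartesianProductWith _,_
    (replicateᴸ a on ++ map active (allFin M) ++ replicateᴸ c off) (true ∷ false ∷ [])

  nonzeros zeros : ∀ {M} → Point M → ℕ
  nonzeros []      = 0
  nonzeros (t ∷ y) = nonzero t + nonzeros y
  zeros []       = 0
  zeros (0ᵗ ∷ y) = suc (zeros y)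
  zeros (_ ∷ y)  = zeros y

  zeros-step : ∀ {M} (y : Point M) j s → lookup y j ≡ 0ᵗ → zeros y ≡ suc (zeros (step y (j , s)))
  zeros-step (0ᵗ ∷ y)  zero    true  refl = refl
  zeros-step (0ᵗ ∷ y)  zero    false refl = refl
  zeros-step (0ᵗ ∷ y)  (suc j) s     e    = cong suc (zeros-step y j s e)
  zeros-step (+1ᵗ ∷ y) (suc j) s     e    = zeros-step y j s e
  zeros-step (−1ᵗ ∷ y) (suc j) s     e    = zeros-step y j s e

  nonzeros-step : ∀ {M} (y : Point M) j s → lookup y j ≡ 0ᵗ → nonzeros (step y (j , s)) ≡ suc (nonzeros y)
  nonzeros-step (0ᵗ ∷ y)  zero    true  refl = refl
  nonzeros-step (0ᵗ ∷ y)  zero    false refl = refl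
  nonzeros-step (t ∷ y)   (suc j) s     e    =
    trans (cong (nonzero t +_) (nonzeros-step y j s e)) (+-suc (nonzero t) _)

  Σ-replicate : ∀ {A : Set} k (x : A) (F : A → ℕ) → Σ (replicateᴸ k x) F ≡ k * F x
  Σ-replicate zero    x F = refl
  Σ-replicate (suc k) x F = cong (F x +_) (Σ-replicate k x F)

  module _ (φ : Trit → Trit → ℕ) where

    agree rise rest : ℕ
    agree = φ +1ᵗ +1ᵗ + φ −1ᵗ −1ᵗ
    rise  = φ 0ᵗ +1ᵗ + φ 0ᵗ −1ᵗ
    rest  = φ 0ᵗ 0ᵗ

    both : Trit → Trit → ℕ
    both t t′ = φ t t′ + (φ (negTrit t) (negTrit t′) + 0)

    Σ-diagonal : ∀ {M} (y : Point M) →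
      Σ (allFin M) (λ i → both (lookup y i) (lookup y i)) ≡ nonzeros y * agree + zeros y * (2 * rest)
    Σ-diagonal []      = refl
    Σ-diagonal {suc M} (t ∷ y) = trans (Σ-allFin {M} (λ i → both (lookup (t ∷ y) i) (lookup (t ∷ y) i)))
      (trans (cong (both t t +_) (Σ-diagonal y)) (go t))
      where
      go : ∀ t → both t t + (nonzeros y * agree + zeros y * (2 * rest)) ≡
                 nonzeros (t ∷ y) * agree + zeros (t ∷ y) * (2 * rest)
      go 0ᵗ  = lemma rest (nonzeros y * agree) (zeros y * (2 * rest))
        where
        lemma : ∀ a b c → a + (a + 0) + (b + c) ≡ b + (2 * a + c)
        lemma = solve-∀
      go +1ᵗ = lemma (φ +1ᵗ +1ᵗ) (φ −1ᵗ −1ᵗ) (nonzeros y * agree) (zeros y * (2 * rest))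
        where
        lemma : ∀ p q b c → p + (q + 0) + (b + c) ≡ p + q + b + c
        lemma = solve-∀
      go −1ᵗ = lemma (φ +1ᵗ +1ᵗ) (φ −1ᵗ −1ᵗ) (nonzeros y * agree) (zeros y * (2 * rest))
        where
        lemma : ∀ p q b c → q + (p + 0) + (b + c) ≡ p + q + b + c
        lemma = solve-∀

    Σ-step : ∀ {M} (y : Point M) j s → lookup y j ≡ 0ᵗ →
      Σ (allFin M) (λ i → both (lookup y i) (lookup (step y (j , s)) i)) ≡
      nonzeros y * agree + rise + zeros (step y (j , s)) * (2 * rest)
    Σ-step {suc M} (0ᵗ ∷ y) zero s refl =
      trans (Σ-allFin {M} (λ i → both (lookup (0ᵗ ∷ y) i) (lookup (step (0ᵗ ∷ y) (zero , s)) i)))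
            (trans (cong (both 0ᵗ (signTrit s) +_) (Σ-diagonal y)) (go s))
      where
      lemma : ∀ p q b c → p + (q + 0) + (b + c) ≡ b + (p + q) + c
      lemma = solve-∀
      lemma′ : ∀ p q b c → q + (p + 0) + (b + c) ≡ b + (p + q) + c
      lemma′ = solve-∀
      go : ∀ s → both 0ᵗ (signTrit s) + (nonzeros y * agree + zeros y * (2 * rest)) ≡
                 nonzeros (0ᵗ ∷ y) * agree + rise + zeros (step (0ᵗ ∷ y) (zero , s)) * (2 * rest)
      go true  = lemma  (φ 0ᵗ +1ᵗ) (φ 0ᵗ −1ᵗ) (nonzeros y * agree) (zeros y * (2 * rest))
      go false = lemma′ (φ 0ᵗ +1ᵗ) (φ 0ᵗ −1ᵗ) (nonzeros y * agree) (zeros y * (2 * rest))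
    Σ-step {suc M} (t ∷ y) (suc j) s e =
      trans (Σ-allFin {M} (λ i → both (lookup (t ∷ y) i) (lookup (step (t ∷ y) (suc j , s)) i)))
            (trans (cong (both t t +_) (Σ-step y j s e)) (go t))
      where
      Z = zeros (step y (j , s))
      go : ∀ t → both t t + (nonzeros y * agree + rise + Z * (2 * rest)) ≡
                 nonzeros (t ∷ y) * agree + rise + zeros (t ∷ step y (j , s)) * (2 * rest)
      go 0ᵗ  = lemma rest (nonzeros y * agree) rise (Z * (2 * rest))
        where
        lemma : ∀ a b r c → a + (a + 0) + (b + r + c) ≡ b + r + (2 * a + c)
        lemma = solve-∀
      go +1ᵗ = lemma (φ +1ᵗ +1ᵗ) (φ −1ᵗ −1ᵗ) (nonzeros y * agree) rise (Z * (2 * rest))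
        where
        lemma : ∀ p q b r c → p + (q + 0) + (b + r + c) ≡ p + q + b + r + c
        lemma = solve-∀
      go −1ᵗ = lemma (φ +1ᵗ +1ᵗ) (φ −1ᵗ −1ᵗ) (nonzeros y * agree) rise (Z * (2 * rest))
        where
        lemma : ∀ p q b r c → q + (p + 0) + (b + r + c) ≡ p + q + b + r + c
        lemma = solve-∀

    -- Labels are grouped by the values before and after the step. Only the block that is switched
    -- on changes, and each other label contributes both of its signs, so the total depends on the
    -- point through its numbers of nonzero and zero coordinates.
    Σ-config : ∀ a c {M} (y : Point M) j s → lookup y j ≡ 0ᵗ →
      Σ (config a c M) (λ l → φ (value y l) (value (step y (j , s)) l)) ≡
      (a + nonzeros y) * agree + 1 * rise + (2 * (c + zeros (step y (j , s)))) * rest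
    Σ-config a c {M} y j s e = begin
      Σ (config a c M) F
        ≡⟨ Σ-product _,_ (ons ++ acts ++ offs) (true ∷ false ∷ []) F ⟩
      Σ (ons ++ acts ++ offs) G
        ≡⟨ Σ-++ ons (acts ++ offs) G ⟩
      Σ ons G + Σ (acts ++ offs) G
        ≡⟨ cong (Σ ons G +_) (Σ-++ acts offs G) ⟩
      Σ ons G + (Σ acts G + Σ offs G)
        ≡⟨ cong₂ _+_ (Σ-replicate a on G)
             (cong₂ _+_ (trans (Σ-map active (allFin M) G) (Σ-step y j s e)) (Σ-replicate c off G)) ⟩
      a * (φ +1ᵗ +1ᵗ + (φ −1ᵗ −1ᵗ + 0)) +
      (nonzeros y * agree + rise + zeros y′ * (2 * rest) + c * (rest + (rest + 0)))
        ≡⟨ lemma a c (nonzeros y) (zeros y′) (φ +1ᵗ +1ᵗ) (φ −1ᵗ −1ᵗ) rise rest ⟩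
      (a + nonzeros y) * agree + 1 * rise + (2 * (c + zeros y′)) * rest ∎
      where
      open ≡-Reasoning
      y′   = step y (j , s)
      ons  = replicateᴸ a on
      acts = map active (allFin M)
      offs = replicateᴸ c off
      F : Label M × Bool → ℕ
      F l = φ (value y l) (value y′ l)
      G : Label M → ℕ
      G l = F (l , true) + (F (l , false) + 0)
      lemma : ∀ a c k z p q r t →
        a * (p + (q + 0)) + (k * (p + q) + r + z * (2 * t) + c * (t + (t + 0))) ≡
        (a + k) * (p + q) + 1 * r + (2 * (c + z)) * t
      lemma = solve-∀

  -- The coordinates are labelled independently, so a step of the walk induces a product weight on
  -- pairs of points. The order and the signs of the earlier steps no longer matter.
  Σ-assignments : ∀ a c {M} (y : Point M) j s → lookup y j ≡ 0ᵗ → ∀ n (h : Point n → Point n → ℕ) →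
    Σ (vectors (config a c M) n) (λ ω → h (embed ω y) (embed ω (step y (j , s)))) ≡
    pairSum (a + nonzeros y) 1 (2 * (c + zeros (step y (j , s)))) h
  Σ-assignments a c y j s e zero    h = +-identityʳ _
  Σ-assignments a c {M} y j s e (suc n) h = begin
    Σ (vectors (config a c M) (suc n)) (λ ω → h (embed ω y) (embed ω y′))
      ≡⟨ Σ-vectors (config a c M) n (λ ω → h (embed ω y) (embed ω y′)) ⟩
    Σ (config a c M) (λ l → Σ (vectors (config a c M) n) (λ ω →
      h (value y l ∷ embed ω y) (value y′ l ∷ embed ω y′)))
      ≡⟨ Σ-cong (config a c M) (λ l →
           Σ-assignments a c y j s e n (λ v x → h (value y l ∷ v) (value y′ l ∷ x))) ⟩
    Σ (config a c M) (λ l → φ (value y l) (value y′ l))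
      ≡⟨ Σ-config φ a c y j s e ⟩
    pairSum (a + nonzeros y) 1 (2 * (c + zeros y′)) h ∎
    where
    open ≡-Reasoning
    y′ = step y (j , s)
    φ : Trit → Trit → ℕ
    φ t t′ = pairSum (a + nonzeros y) 1 (2 * (c + zeros y′)) (λ v x → h (t ∷ v) (t′ ∷ x))

  disagree : ∀ {n} → Subset n → Point n → Point n → ℕ
  disagree f v x = 𝟙 (f v xor f x)

  -- The total over a walk with k blocks to come: with each step the first weight rises by 1 and the
  -- third falls by 2.
  windowSum : ∀ {n} → Subset n → (a c k : ℕ) → ℕ
  windowSum f a c zero    = 0
  windowSum f a c (suc k) = pairSum a 1 (2 * (c + k)) (disagree f) + windowSum f (suc a) c k

  Σ-changes : ∀ {n} (f : Subset n) a c {M} (y : Point M) w → Admissible y w → zeros y ≡ length w →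
    Σ (vectors (config a c M) n) (λ ω → changes (f ∘ embed ω) y w) ≡ windowSum f (a + nonzeros y) c (length w)
  Σ-changes {n} f a c {M} y [] adm len = Σ-0 (vectors (config a c M) n)
  Σ-changes {n} f a c {M} y ((j , s) ∷ w) adm len = begin
    Σ Ω (λ ω → disagree f (embed ω y) (embed ω y′) + changes (f ∘ embed ω) y′ w)
      ≡⟨ Σ-+ Ω _ _ ⟩
    Σ Ω (λ ω → disagree f (embed ω y) (embed ω y′)) + Σ Ω (λ ω → changes (f ∘ embed ω) y′ w)
      ≡⟨ cong₂ _+_ (Σ-assignments a c y j s free n (disagree f))
                   (Σ-changes f a c y′ w (admissible-tail adm) len′) ⟩
    pairSum (a + nonzeros y) 1 (2 * (c + zeros y′)) (disagree f) + windowSum f (a + nonzeros y′) c (length w)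
      ≡⟨ cong₂ (λ k b → pairSum (a + nonzeros y) 1 (2 * (c + k)) (disagree f) + windowSum f b c (length w))
           len′ (trans (cong (a +_) (nonzeros-step y j s free)) (+-suc a _)) ⟩
    windowSum f (a + nonzeros y) c (length ((j , s) ∷ w)) ∎
    where
    open ≡-Reasoning
    Ω    = vectors (config a c M) n
    y′   = step y (j , s)
    free = admissible-head adm
    len′ : zeros y′ ≡ length w
    len′ = suc-injective (trans (sym (zeros-step y j s free)) len)

  length-product : ∀ {A B C : Set} (h : A → B → C) xs ys →
                   length (cartesianProductWith h xs ys) ≡ length xs * length ys
  length-product h []       ys = refl
  length-product h (x ∷ xs) ys = trans (length-++ (map (h x) ys))
    (cong₂ _+_ (length-map (h x) ys) (length-product h xs ys))

  length-vectors : ∀ {A : Set} (xs : List A) n → length (vectors xs n) ≡ length xs ^ n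
  length-vectors xs zero    = refl
  length-vectors xs (suc n) = trans (length-product _∷_ xs (vectors xs n)) (cong (length xs *_) (length-vectors xs n))

  length-config : ∀ a c M → length (config a c M) ≡ 2 * (a + M + c)
  length-config a c M = begin
    length (config a c M)
      ≡⟨ length-product _,_ (ons ++ acts ++ offs) _ ⟩
    length (ons ++ acts ++ offs) * 2
      ≡⟨ cong (_* 2) (trans (length-++ ons) (cong₂ _+_ (length-replicate a)
           (trans (length-++ acts) (cong₂ _+_ (trans (length-map active (allFin M)) (length-tabulate {n = M} id))
                                              (length-replicate c))))) ⟩
    (a + (M + c)) * 2
      ≡⟨ lemma a M c ⟩
    2 * (a + M + c) ∎
    where
    open ≡-Reasoning
    ons : List (Label M)
    ons  = replicateᴸ a on
    acts = map active (allFin M)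
    offs : List (Label M)
    offs = replicateᴸ c off
    lemma : ∀ a b c → (a + (b + c)) * 2 ≡ 2 * (a + b + c)
    lemma = solve-∀

  arrangements>0 : ∀ z → NonZero (arrangements z)
  arrangements>0 zero    = _
  arrangements>0 (suc z) = m*n≢0 (2 * suc z) (arrangements z) {{_}} {{arrangements>0 z}}

  -- Double counting of pairs of a walk and a labelling: every walk gives the same `windowSum`,
  -- while for every labelling the walks have at most 2 κ + 1 changes on average.
  window-bound : ∀ {n} {f : Subset n} → LinearlySeparable f → ∀ κ a c M → 4 * M + 1 ≤ κ * κ →
    windowSum f a c M ≤ (2 * κ + 1) * (2 * (a + M + c)) ^ n
  window-bound {n} {f} sep κ a c M hκ =
    *-cancelˡ-≤ (arrangements M) {{arrangements>0 M}} (begin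
    arrangements M * windowSum f a c M
      ≡⟨ cong (_* windowSum f a c M) count ⟨
    Σ W (λ _ → 1) * windowSum f a c M
      ≡⟨ Σ-*ʳ W (windowSum f a c M) _ ⟨
    Σ W (λ _ → 1 * windowSum f a c M)
      ≡⟨ Σ-cong-∈ W (λ {w} i → trans (*-identityˡ _) (sym (along w i))) ⟩
    Σ W (λ w → Σ Ω (λ ω → changes (f ∘ embed ω) origin w))
      ≡⟨ Σ-swap W Ω _ ⟩
    Σ Ω (λ ω → Σ W (λ w → changes (f ∘ embed ω) origin w))
      ≤⟨ Σ-mono Ω perAssignment ⟩
    Σ Ω (λ _ → (2 * κ + 1) * arrangements M)
      ≡⟨ Σ-const Ω _ ⟩
    length Ω * ((2 * κ + 1) * arrangements M)
      ≡⟨ cong (_* ((2 * κ + 1) * arrangements M))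
           (trans (length-vectors (config a c M) n) (cong (_^ n) (length-config a c M))) ⟩
    (2 * (a + M + c)) ^ n * ((2 * κ + 1) * arrangements M)
      ≡⟨ lemma ((2 * (a + M + c)) ^ n) (2 * κ + 1) (arrangements M) ⟩
    arrangements M * ((2 * κ + 1) * (2 * (a + M + c)) ^ n) ∎)
    where
    open ≤-Reasoning
    W = Arrangements.arr flip (steps M)
    Ω = vectors (config a c M) n
    lemma : ∀ x y z → x * (y * z) ≡ z * (y * x)
    lemma = solve-∀
    count : Σ W (λ _ → 1) ≡ arrangements M
    count = trans (arr-count (steps M)) (cong arrangements (length-steps M))
    zeros-origin : ∀ M → zeros (origin {M}) ≡ M
    zeros-origin zero    = refl
    zeros-origin (suc M) = cong suc (zeros-origin M)
    nonzeros-origin : ∀ M → nonzeros (origin {M}) ≡ 0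
    nonzeros-origin zero    = refl
    nonzeros-origin (suc M) = nonzeros-origin M
    len : ∀ w → w ∈ W → length w ≡ M
    len w i = trans (∈-arr-length {L = steps M} i) (length-steps M)
    along : ∀ w → w ∈ W → Σ Ω (λ ω → changes (f ∘ embed ω) origin w) ≡ windowSum f a c M
    along w i = trans
      (Σ-changes f a c origin w
        (admissible-origin (λ j → ≤-reflexive (trans (Σ-∈-arr (occurs j) (λ _ → refl) {steps M} i) (occurs-once j))))
        (trans (zeros-origin M) (sym (len w i))))
      (cong₂ (λ b k → windowSum f b c k) (trans (cong (a +_) (nonzeros-origin M)) (+-identityʳ a)) (len w i))
    perAssignment : ∀ ω → Σ W (λ w → changes (f ∘ embed ω) origin w) ≤ (2 * κ + 1) * arrangements M
    perAssignment ω = begin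
      Σ W (changes g origin)
        ≤⟨ Σ-mono W (λ w → ≤-trans (m≤m+n _ _) (changes≤exits g origin w)) ⟩
      Σ W (λ w → 2 * exits g origin w + 1)
        ≡⟨ trans (Σ-+ W _ _) (cong₂ _+_ (Σ-*ˡ W 2 _) count) ⟩
      2 * Σ W (exits g origin) + arrangements M
        ≤⟨ +-monoˡ-≤ (arrangements M) (*-monoʳ-≤ 2 (≤-trans
             (exits-bound g (separable-embed sep ω) κ hκ) (≤-reflexive (cong (κ *_) count)))) ⟩
      2 * (κ * arrangements M) + arrangements M
        ≡⟨ lemma′ κ (arrangements M) ⟩
      (2 * κ + 1) * arrangements M ∎
      where
      g = f ∘ embed ω
      lemma′ : ∀ k t → 2 * (k * t) + t ≡ (2 * k + 1) * t
      lemma′ = solve-∀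

-- Arithmetic of rational fractions.

module Fractions where

  open import Data.Integer.Base as ℤ using (ℤ; +_; 1ℤ)
  import Data.Integer.Properties as ℤ
  open import Data.Integer.Tactic.RingSolver using (solve-∀)
  open import Data.Nat.Base as ℕ using (ℕ; suc; NonZero)
  import Data.Nat.Properties as ℕ
  open import Data.Rational.Base as ℚ using (ℚ; _/_; toℚᵘ)
  import Data.Rational.Properties as ℚ
  open import Data.Rational.Unnormalised.Base as ℚᵘ using (ℚᵘ; mkℚᵘ; *≡*; *≤*)
  import Data.Rational.Unnormalised.Properties as ℚᵘ
  open import Relation.Binary.PropositionalEquality

  toℚᵘ-/ : ∀ i n → toℚᵘ (i / suc n) ℚᵘ.≃ mkℚᵘ i n
  toℚᵘ-/ i n = ℚ.toℚᵘ-fromℚᵘ (mkℚᵘ i n)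

  /-≡ : ∀ i j m n .{{_ : NonZero m}} .{{_ : NonZero n}} → i ℤ.* + n ≡ j ℤ.* + m → i / m ≡ j / n
  /-≡ i j (suc m) (suc n) e = ℚ.fromℚᵘ-cong {mkℚᵘ i m} {mkℚᵘ j n} (*≡* e)

  /-≤ : ∀ i j m n .{{_ : NonZero m}} .{{_ : NonZero n}} → i ℤ.* + n ℤ.≤ j ℤ.* + m → i / m ℚ.≤ j / n
  /-≤ i j (suc m) (suc n) h = ℚ.toℚᵘ-cancel-≤
    (ℚᵘ.≤-respˡ-≃ (ℚᵘ.≃-sym (toℚᵘ-/ i m)) (ℚᵘ.≤-respʳ-≃ (ℚᵘ.≃-sym (toℚᵘ-/ j n)) (*≤* h)))

  /-* : ∀ i j m n .{{_ : NonZero m}} .{{_ : NonZero n}} .{{_ : NonZero (m ℕ.* n)}} →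
        (i / m) ℚ.* (j / n) ≡ (i ℤ.* j) / (m ℕ.* n)
  /-* i j (suc m) (suc n) = ℚ.toℚᵘ-injective (begin
    toℚᵘ ((i / suc m) ℚ.* (j / suc n))
      ≈⟨ ℚ.toℚᵘ-homo-* (i / suc m) (j / suc n) ⟩
    toℚᵘ (i / suc m) ℚᵘ.* toℚᵘ (j / suc n)
      ≈⟨ ℚᵘ.*-cong (toℚᵘ-/ i m) (toℚᵘ-/ j n) ⟩
    mkℚᵘ i m ℚᵘ.* mkℚᵘ j n
      ≈⟨ toℚᵘ-/ (i ℤ.* j) _ ⟨
    toℚᵘ ((i ℤ.* j) / (suc m ℕ.* suc n)) ∎)
    where open import Relation.Binary.Reasoning.Setoid ℚᵘ.≃-setoid

  /-+ : ∀ i j → (i / 1) ℚ.+ (j / 1) ≡ (i ℤ.+ j) / 1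
  /-+ i j = ℚ.toℚᵘ-injective (begin
    toℚᵘ ((i / 1) ℚ.+ (j / 1))
      ≈⟨ ℚ.toℚᵘ-homo-+ (i / 1) (j / 1) ⟩
    toℚᵘ (i / 1) ℚᵘ.+ toℚᵘ (j / 1)
      ≈⟨ ℚᵘ.+-cong (toℚᵘ-/ i 0) (toℚᵘ-/ j 0) ⟩
    mkℚᵘ i 0 ℚᵘ.+ mkℚᵘ j 0
      ≈⟨ *≡* (lemma i j) ⟩
    mkℚᵘ (i ℤ.+ j) 0
      ≈⟨ toℚᵘ-/ (i ℤ.+ j) 0 ⟨
    toℚᵘ ((i ℤ.+ j) / 1) ∎)
    where
    open import Relation.Binary.Reasoning.Setoid ℚᵘ.≃-setoid
    lemma : ∀ i j → (i ℤ.* 1ℤ ℤ.+ j ℤ.* 1ℤ) ℤ.* 1ℤ ≡ (i ℤ.+ j) ℤ.* 1ℤ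
    lemma = solve-∀

-- Integral separating functionals for convex sets.

module Separation where

  open import Data.Bool.Base using (Bool; true)
  import Data.Bool.Properties as Bool
  open import Data.Fin.Base using (Fin; zero; suc)
  open import Data.Integer.Base as ℤ using (ℤ; +_; -[1+_]; +[1+_]; 0ℤ; 1ℤ; ∣_∣)
  import Data.Integer.Properties as ℤ
  open import Data.Integer.Tactic.RingSolver using (solve-∀)
  open import Data.List.Base using (List; []; _∷_; _++_; map; filter; cartesianProductWith)
  open import Data.List.Membership.Propositional using (_∈_)
  open import Data.List.Membership.Propositional.Properties
    using (∈-map⁻; ∈-map⁺; ∈-++⁻; ∈-++⁺ˡ; ∈-++⁺ʳ; ∈-cartesianProductWith⁻; ∈-cartesianProductWith⁺; ∈-filter⁺; ∈-filter⁻)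
  open import Data.List.Relation.Unary.Any using (here; there)
  open import Data.Nat.Base as ℕ using (ℕ; zero; suc)
  import Data.Nat.Properties as ℕ
  open import Data.Product.Base using (_×_; _,_; proj₁; proj₂; Σ-syntax; ∃-syntax)
  open import Data.Rational.Base as ℚ using (ℚ; 0ℚ; 1ℚ)
  import Data.Rational.Properties as ℚ
  open import Data.Rational.Unnormalised.Base as ℚᵘ using (ℚᵘ; mkℚᵘ; *≤*; ↥_; ↧_)
  import Data.Rational.Unnormalised.Properties as ℚᵘ
  open import Data.Sum.Base using (_⊎_; inj₁; inj₂)
  open import Data.Vec.Base as Vec using (Vec; []; _∷_; lookup)
  open import Function.Base using (_∘_)
  open import Function.Bundles using (Equivalence)
  open import Relation.Binary.PropositionalEquality hiding ([_]; J)
  open import Defs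
  open WindowAveraging using (tritℤ; dot; LinearlySeparable)
  open Fractions

  infixl 6 _+ᵛ_
  _+ᵛ_ : ∀ {d} → Vec ℤ d → Vec ℤ d → Vec ℤ d
  _+ᵛ_ = Vec.zipWith ℤ._+_

  scale : ∀ {d} → ℤ → Vec ℤ d → Vec ℤ d
  scale k = Vec.map (k ℤ.*_)

  zeroᵛ : ∀ {d} → Vec ℤ d
  zeroᵛ = Vec.replicate _ 0ℤ

  inner : ∀ {d} → Vec ℤ d → Vec ℤ d → ℤ
  inner []      []      = 0ℤ
  inner (a ∷ u) (b ∷ v) = a ℤ.* b ℤ.+ inner u v

  inner-+ : ∀ {d} (a u v : Vec ℤ d) → inner a (u +ᵛ v) ≡ inner a u ℤ.+ inner a v
  inner-+ []      []      []      = refl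
  inner-+ (a ∷ c) (x ∷ u) (y ∷ v) =
    trans (cong (λ t → a ℤ.* (x ℤ.+ y) ℤ.+ t) (inner-+ c u v)) (lemma a x y (inner c u) (inner c v))
    where
    lemma : ∀ a x y p q → a ℤ.* (x ℤ.+ y) ℤ.+ (p ℤ.+ q) ≡ (a ℤ.* x ℤ.+ p) ℤ.+ (a ℤ.* y ℤ.+ q)
    lemma = solve-∀

  inner-scale : ∀ {d} k (a u : Vec ℤ d) → inner a (scale k u) ≡ k ℤ.* inner a u
  inner-scale k []      []      = sym (ℤ.*-zeroʳ k)
  inner-scale k (a ∷ c) (x ∷ u) =
    trans (cong (λ t → a ℤ.* (k ℤ.* x) ℤ.+ t) (inner-scale k c u)) (lemma k a x (inner c u))
    where
    lemma : ∀ k a x p → a ℤ.* (k ℤ.* x) ℤ.+ k ℤ.* p ≡ k ℤ.* (a ℤ.* x ℤ.+ p)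
    lemma = solve-∀

  inner-scaleˡ : ∀ {d} k (a u : Vec ℤ d) → inner (scale k a) u ≡ k ℤ.* inner a u
  inner-scaleˡ k []      []      = sym (ℤ.*-zeroʳ k)
  inner-scaleˡ k (a ∷ c) (x ∷ u) =
    trans (cong (λ t → (k ℤ.* a) ℤ.* x ℤ.+ t) (inner-scaleˡ k c u)) (lemma k a x (inner c u))
    where
    lemma : ∀ k a x p → (k ℤ.* a) ℤ.* x ℤ.+ k ℤ.* p ≡ k ℤ.* (a ℤ.* x ℤ.+ p)
    lemma = solve-∀

  -- The sums of nonempty finite families of elements of G.
  data Cone {d} (G : List (Vec ℤ d)) : Vec ℤ d → Set where
    gen : ∀ {v} → v ∈ G → Cone G v
    add : ∀ {u v w} → Cone G u → Cone G v → w ≡ u +ᵛ v → Cone G w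

  Cone-scale : ∀ {d} {G : List (Vec ℤ d)} k {v} → Cone G v → Cone G (scale (+ suc k) v)
  Cone-scale {G = G} zero {v} c = subst (Cone G) (sym (one v)) c
    where
    one : ∀ {d} (v : Vec ℤ d) → scale (+ 1) v ≡ v
    one []      = refl
    one (x ∷ v) = cong₂ _∷_ (ℤ.*-identityˡ x) (one v)
  Cone-scale (suc k) {v} c = add c (Cone-scale k c) (next v)
    where
    next : ∀ {d} (v : Vec ℤ d) → scale (+ suc (suc k)) v ≡ v +ᵛ scale (+ suc k) v
    next []      = refl
    next (x ∷ v) = cong₂ _∷_ (ℤ.suc-* (+ suc k) x) (next v)

  Cone-⊆ : ∀ {d e} {G : List (Vec ℤ d)} {H : List (Vec ℤ e)} (h : Vec ℤ d → Vec ℤ e) →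
    (∀ u v → h (u +ᵛ v) ≡ h u +ᵛ h v) → (∀ {v} → v ∈ G → Cone H (h v)) → ∀ {v} → Cone G v → Cone H (h v)
  Cone-⊆ h hom inc (gen i)        = inc i
  Cone-⊆ h hom inc (add c c′ refl) = add (Cone-⊆ h hom inc c) (Cone-⊆ h hom inc c′) (hom _ _)

  module _ {d : ℕ} where

    Signed : Set
    Signed = ℕ × Vec ℤ d

    level : List (Vec ℤ (suc d)) → List (Vec ℤ d)
    level []                  = []
    level ((+ zero ∷ v) ∷ G)  = v ∷ level G
    level ((+[1+ _ ] ∷ v) ∷ G) = level G
    level ((-[1+ _ ] ∷ v) ∷ G) = level G

    above below : List (Vec ℤ (suc d)) → List Signed
    above []                   = []
    above ((+ zero ∷ v) ∷ G)   = above G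
    above ((+[1+ p ] ∷ v) ∷ G) = (p , v) ∷ above G
    above ((-[1+ _ ] ∷ v) ∷ G) = above G
    below []                   = []
    below ((+ zero ∷ v) ∷ G)   = below G
    below ((+[1+ _ ] ∷ v) ∷ G) = below G
    below ((-[1+ n ] ∷ v) ∷ G) = (n , v) ∷ below G

    ∈-level : ∀ G {v} → v ∈ level G → (0ℤ ∷ v) ∈ G
    ∈-level ((+ zero ∷ v) ∷ G)   (here refl) = here refl
    ∈-level ((+ zero ∷ v) ∷ G)   (there i)   = there (∈-level G i)
    ∈-level ((+[1+ _ ] ∷ v) ∷ G) i           = there (∈-level G i)
    ∈-level ((-[1+ _ ] ∷ v) ∷ G) i           = there (∈-level G i)

    ∈-above : ∀ G {p v} → (p , v) ∈ above G → (+[1+ p ] ∷ v) ∈ G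
    ∈-above ((+ zero ∷ v) ∷ G)   i           = there (∈-above G i)
    ∈-above ((+[1+ _ ] ∷ v) ∷ G) (here refl) = here refl
    ∈-above ((+[1+ _ ] ∷ v) ∷ G) (there i)   = there (∈-above G i)
    ∈-above ((-[1+ _ ] ∷ v) ∷ G) i           = there (∈-above G i)

    ∈-below : ∀ G {n v} → (n , v) ∈ below G → (-[1+ n ] ∷ v) ∈ G
    ∈-below ((+ zero ∷ v) ∷ G)   i           = there (∈-below G i)
    ∈-below ((+[1+ _ ] ∷ v) ∷ G) i           = there (∈-below G i)
    ∈-below ((-[1+ _ ] ∷ v) ∷ G) (here refl) = here refl
    ∈-below ((-[1+ _ ] ∷ v) ∷ G) (there i)   = there (∈-below G i)

    classify : ∀ G {t v} → (t ∷ v) ∈ G →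
      (t ≡ 0ℤ × v ∈ level G) ⊎ (∃[ p ] (t ≡ +[1+ p ] × (p , v) ∈ above G)) ⊎
      (∃[ n ] (t ≡ -[1+ n ] × (n , v) ∈ below G))
    classify ((+ zero ∷ v) ∷ G)   (here refl) = inj₁ (refl , here refl)
    classify ((+[1+ p ] ∷ v) ∷ G) (here refl) = inj₂ (inj₁ (p , refl , here refl))
    classify ((-[1+ n ] ∷ v) ∷ G) (here refl) = inj₂ (inj₂ (n , refl , here refl))
    classify ((+ zero ∷ v) ∷ G)   (there i) with classify G i
    ... | inj₁ (e , j)                 = inj₁ (e , there j)
    ... | inj₂ (inj₁ x)                = inj₂ (inj₁ x)
    ... | inj₂ (inj₂ x)                = inj₂ (inj₂ x)
    classify ((+[1+ _ ] ∷ v) ∷ G) (there i) with classify G i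
    ... | inj₁ x                       = inj₁ x
    ... | inj₂ (inj₁ (p , e , j))      = inj₂ (inj₁ (p , e , there j))
    ... | inj₂ (inj₂ x)                = inj₂ (inj₂ x)
    classify ((-[1+ _ ] ∷ v) ∷ G) (there i) with classify G i
    ... | inj₁ x                       = inj₁ x
    ... | inj₂ (inj₁ x)                = inj₂ (inj₁ x)
    ... | inj₂ (inj₂ (n , e , j))      = inj₂ (inj₂ (n , e , there j))

    -- The pairs stand for vectors with first coordinates p + 1 and -(n + 1); these positive
    -- multiples make the first coordinates cancel.
    combine : Signed → Signed → Vec ℤ d
    combine (p , u) (n , v) = scale (+ suc n) u +ᵛ scale (+ suc p) v

    eliminated : List (Vec ℤ (suc d)) → List (Vec ℤ d)
    eliminated G = level G ++ cartesianProductWith combine (above G) (below G)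

    Cone-eliminated : ∀ G {v} → Cone (eliminated G) v → Cone G (0ℤ ∷ v)
    Cone-eliminated G = Cone-⊆ (0ℤ ∷_) (λ _ _ → refl) lift
      where
      cancel : ∀ p n → 0ℤ ≡ (+ suc n) ℤ.* (+ suc p) ℤ.+ (+ suc p) ℤ.* -[1+ n ]
      cancel p n = sym (trans (cong (λ t → t ℤ.+ (+ suc p) ℤ.* -[1+ n ]) (ℤ.*-comm (+ suc n) (+ suc p)))
        (trans (sym (ℤ.*-distribˡ-+ (+ suc p) (+ suc n) -[1+ n ]))
               (trans (cong ((+ suc p) ℤ.*_) (ℤ.+-inverseʳ (+ suc n))) (ℤ.*-zeroʳ (+ suc p)))))
      lift : ∀ {v} → v ∈ eliminated G → Cone G (0ℤ ∷ v)
      lift i with ∈-++⁻ (level G) i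
      ... | inj₁ j = gen (∈-level G j)
      ... | inj₂ j with ∈-cartesianProductWith⁻ combine (above G) (below G) j
      ...   | (p , u) , (n , v) , a , b , refl =
        add (Cone-scale n (gen (∈-above G a))) (Cone-scale p (gen (∈-below G b)))
            (cong (_∷ combine (p , u) (n , v)) (cancel p n))

  minimum : ∀ q Q → Σ[ m ∈ ℚᵘ ] (m ∈ q ∷ Q × (∀ {e} → e ∈ q ∷ Q → m ℚᵘ.≤ e))
  minimum q []      = q , here refl , λ { (here refl) → ℚᵘ.≤-refl }
  minimum q (r ∷ Q) with minimum r Q
  ... | m , i , least with ℚᵘ.≤-total q m
  ...   | inj₁ q≤m = q , here refl , λ { (here refl) → ℚᵘ.≤-refl ; (there j) → ℚᵘ.≤-trans q≤m (least j) }
  ...   | inj₂ m≤q = m , there i   , λ { (here refl) → m≤q ; (there j) → least j }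

  bound : List ℚᵘ → ℕ
  bound []      = 1
  bound (q ∷ Q) = ∣ ↥ q ∣ ℕ.+ bound Q

  bound>0 : ∀ Q → 1 ℕ.≤ bound Q
  bound>0 []      = ℕ.≤-refl
  bound>0 (q ∷ Q) = ℕ.≤-trans (bound>0 Q) (ℕ.m≤n+m _ ∣ ↥ q ∣)

  bound-∈ : ∀ {Q q} → q ∈ Q → ∣ ↥ q ∣ ℕ.< bound Q
  bound-∈ {q ∷ Q} (here refl) = ℕ.≤-trans (ℕ.≤-reflexive (ℕ.+-comm 1 _)) (ℕ.+-monoʳ-≤ ∣ ↥ q ∣ (bound>0 Q))
  bound-∈ {r ∷ Q} (there i)   = ℕ.≤-trans (bound-∈ i) (ℕ.m≤n+m _ ∣ ↥ r ∣)

  big-dominates : ∀ B n c → ∣ c ∣ ℕ.< B → 0ℤ ℤ.< (+ suc n) ℤ.* (+ B) ℤ.+ c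
  big-dominates B n (+ k)    h = ℤ.<-≤-trans (ℤ.+<+ (ℕ.≤-trans (ℕ.≤-trans (ℕ.s≤s ℕ.z≤n) h) (ℕ.≤-trans (ℕ.m≤m+n B (n ℕ.* B)) (ℕ.m≤m+n _ k))))
                                             (ℤ.≤-reflexive (cong (ℤ._+ (+ k)) (ℤ.pos-* (suc n) B)))
  big-dominates B n -[1+ k ] h = ℤ.<-≤-trans
    (subst (0ℤ ℤ.<_) (sym (ℤ.⊖-≥ (ℕ.<⇒≤ lt))) (ℤ.+<+ (ℕ.m<n⇒0<n∸m lt)))
    (ℤ.≤-reflexive (cong (ℤ._+ -[1+ k ]) (ℤ.pos-* (suc n) B)))
    where
    lt : suc k ℕ.< suc n ℕ.* B
    lt = ℕ.≤-trans h (ℕ.m≤m+n B (n ℕ.* B))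

  -- The inequality -p < n, cleared of denominators: the lower bound -p leaves room below the upper
  -- bound n.
  Compatible : ℚᵘ → ℚᵘ → Set
  Compatible p n = 0ℤ ℤ.< ↧ n ℤ.* ↥ p ℤ.+ ↧ p ℤ.* ↥ n

  -- A number strictly between all −p and all n, as a fraction: the mediant
  -- of the largest −p and the least n.
  between : ∀ P N → (∀ {p n} → p ∈ P → n ∈ N → Compatible p n) →
    Σ[ α ∈ ℤ ] Σ[ k ∈ ℕ ]
      (∀ {p} → p ∈ P → 0ℤ ℤ.< α ℤ.* ↧ p ℤ.+ (+ suc k) ℤ.* ↥ p)
    × (∀ {n} → n ∈ N → 0ℤ ℤ.< (ℤ.- α) ℤ.* ↧ n ℤ.+ (+ suc k) ℤ.* ↥ n)
  between P N compat = α , p ℕ.+ suc n , below-all , above-all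
    where
    B : ℕ
    B = bound (P ++ N)
    top : ℚᵘ
    -- A fraction exceeding the absolute value of all the others. Added to both lists it is
    -- compatible with everything, and it makes the minima exist when there are no bounds on one
    -- side.
    top = mkℚᵘ (+ B) 0
    B>0 : 0ℤ ℤ.< 1ℤ ℤ.* (+ B) ℤ.+ 1ℤ ℤ.* (+ B)
    B>0 = subst (0ℤ ℤ.<_) (cong₂ ℤ._+_ (sym (ℤ.*-identityˡ (+ B))) (sym (ℤ.*-identityˡ (+ B))))
            (ℤ.+<+ (ℕ.≤-trans (bound>0 (P ++ N)) (ℕ.m≤m+n B B)))
    small : ∀ {q} → q ∈ P ++ N → ∣ 1ℤ ℤ.* ↥ q ∣ ℕ.< B
    small {q} i = subst (λ t → ∣ t ∣ ℕ.< B) (sym (ℤ.*-identityˡ (↥ q))) (bound-∈ i)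
    compat⁺ : ∀ {p n} → p ∈ top ∷ P → n ∈ top ∷ N → Compatible p n
    compat⁺ (here refl) (here refl) = B>0
    compat⁺ {n = n} (here refl) (there j) =
      big-dominates B (ℚᵘ.denominator-1 n) (1ℤ ℤ.* ↥ n) (small (∈-++⁺ʳ P j))
    compat⁺ {p = p} (there i) (here refl) =
      subst (0ℤ ℤ.<_) (ℤ.+-comm (↧ p ℤ.* (+ B)) (1ℤ ℤ.* ↥ p))
        (big-dominates B (ℚᵘ.denominator-1 p) (1ℤ ℤ.* ↥ p) (small (∈-++⁺ˡ i)))
    compat⁺ (there i) (there j) = compat i j
    minP = minimum top P
    minN = minimum top N
    a = ↥ (proj₁ minP)
    p = ℚᵘ.denominator-1 (proj₁ minP)
    c = ↥ (proj₁ minN)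
    n = ℚᵘ.denominator-1 (proj₁ minN)
    α = c ℤ.- a
    -- Compatibility of q and r times the denominator of e, plus q ≤ e times the sum of the
    -- denominators of q and r, is the desired inequality up to the positive factor `↧ q`.
    key : ∀ q r e → 0ℤ ℤ.< ↧ r ℤ.* ↥ q ℤ.+ ↧ q ℤ.* ↥ r → q ℚᵘ.≤ e →
          0ℤ ℤ.< (↥ r ℤ.- ↥ q) ℤ.* ↧ e ℤ.+ (↧ q ℤ.+ ↧ r) ℤ.* ↥ e
    key q r e pos (*≤* le) = ℤ.*-cancelˡ-<-nonNeg (↧ q) (begin-strict
      ↧ q ℤ.* 0ℤ
        ≡⟨ ℤ.*-zeroʳ (↧ q) ⟩
      0ℤ
        ≡⟨ ℤ.*-zeroʳ (↧ e) ⟨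
      ↧ e ℤ.* 0ℤ
        <⟨ ℤ.*-monoˡ-<-pos (↧ e) pos ⟩
      ↧ e ℤ.* (↧ r ℤ.* ↥ q ℤ.+ ↧ q ℤ.* ↥ r)
        ≡⟨ lemma₁ (↥ q) (↥ r) (↧ e) (↧ q) (↧ r) ⟩
      ↧ q ℤ.* ((↥ r ℤ.- ↥ q) ℤ.* ↧ e) ℤ.+ (↧ q ℤ.+ ↧ r) ℤ.* (↥ q ℤ.* ↧ e)
        ≤⟨ ℤ.+-monoʳ-≤ (↧ q ℤ.* ((↥ r ℤ.- ↥ q) ℤ.* ↧ e)) (ℤ.*-monoˡ-≤-nonNeg (↧ q ℤ.+ ↧ r) le) ⟩
      ↧ q ℤ.* ((↥ r ℤ.- ↥ q) ℤ.* ↧ e) ℤ.+ (↧ q ℤ.+ ↧ r) ℤ.* (↥ e ℤ.* ↧ q)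
        ≡⟨ lemma₂ (↥ q) (↥ r) (↧ e) (↥ e) (↧ q) (↧ r) ⟩
      ↧ q ℤ.* ((↥ r ℤ.- ↥ q) ℤ.* ↧ e ℤ.+ (↧ q ℤ.+ ↧ r) ℤ.* ↥ e) ∎)
      where
      open ℤ.≤-Reasoning
      lemma₁ : ∀ a c d p n → d ℤ.* (n ℤ.* a ℤ.+ p ℤ.* c) ≡
                             p ℤ.* ((c ℤ.- a) ℤ.* d) ℤ.+ (p ℤ.+ n) ℤ.* (a ℤ.* d)
      lemma₁ = solve-∀
      lemma₂ : ∀ a c d u p n → p ℤ.* ((c ℤ.- a) ℤ.* d) ℤ.+ (p ℤ.+ n) ℤ.* (u ℤ.* p) ≡
                               p ℤ.* ((c ℤ.- a) ℤ.* d ℤ.+ (p ℤ.+ n) ℤ.* u)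
      lemma₂ = solve-∀
    positive : 0ℤ ℤ.< (+ suc n) ℤ.* a ℤ.+ (+ suc p) ℤ.* c
    positive = compat⁺ (proj₁ (proj₂ minP)) (proj₁ (proj₂ minN))
    below-all : ∀ {e} → e ∈ P → 0ℤ ℤ.< α ℤ.* ↧ e ℤ.+ (+ suc (p ℕ.+ suc n)) ℤ.* ↥ e
    below-all {e} i = key (proj₁ minP) (proj₁ minN) e positive (proj₂ (proj₂ minP) (there i))
    above-all : ∀ {e} → e ∈ N → 0ℤ ℤ.< (ℤ.- α) ℤ.* ↧ e ℤ.+ (+ suc (p ℕ.+ suc n)) ℤ.* ↥ e
    above-all {e} i = subst (0ℤ ℤ.<_)
      (cong₂ (λ s t → s ℤ.* ↧ e ℤ.+ t ℤ.* ↥ e) (lemma a c) (ℤ.+-comm (+ suc n) (+ suc p)))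
      (key (proj₁ minN) (proj₁ minP) e (subst (0ℤ ℤ.<_) (ℤ.+-comm ((+ suc n) ℤ.* a) ((+ suc p) ℤ.* c)) positive)
           (proj₂ (proj₂ minN) (there i)))
      where
      lemma : ∀ a c → a ℤ.- c ≡ ℤ.- (c ℤ.- a)
      lemma = solve-∀

  -- Gordan's theorem, by Fourier-Motzkin elimination.
  gordan : ∀ d (G : List (Vec ℤ d)) →
           (Σ[ a ∈ Vec ℤ d ] (∀ {g} → g ∈ G → 0ℤ ℤ.< inner a g)) ⊎ Cone G zeroᵛ
  gordan zero    []       = inj₁ ([] , λ ())
  gordan zero    ([] ∷ G) = inj₂ (gen (here refl))
  gordan (suc d) G with gordan d (eliminated G)
  ... | inj₂ c       = inj₂ (Cone-eliminated G c)
  -- Back substitution: the bounds on the eliminated coordinate are met by α / (k + 1), and the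
  -- other coordinates are multiplied by the denominator to keep the functional integral.
  ... | inj₁ (a , h) = inj₁ (α ∷ scale (+ suc k) a , positive)
    where
    value : ℕ × Vec ℤ d → ℚᵘ
    value (p , v) = mkℚᵘ (inner a v) p
    compat : ∀ {p n} → p ∈ map value (above G) → n ∈ map value (below G) → Compatible p n
    compat i j with ∈-map⁻ value i | ∈-map⁻ value j
    ... | (p , u) , i′ , refl | (n , v) , j′ , refl =
      subst (0ℤ ℤ.<_)
        (trans (inner-+ a (scale (+ suc n) u) (scale (+ suc p) v))
               (cong₂ ℤ._+_ (inner-scale (+ suc n) a u) (inner-scale (+ suc p) a v)))
        (h (∈-++⁺ʳ (level G) (∈-cartesianProductWith⁺ combine i′ j′)))
    sol = between (map value (above G)) (map value (below G)) compat
    α = proj₁ sol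
    k = proj₁ (proj₂ sol)
    positive : ∀ {g} → g ∈ G → 0ℤ ℤ.< inner (α ∷ scale (+ suc k) a) g
    positive {t ∷ v} i with classify G i
    ... | inj₁ (refl , j) = subst (0ℤ ℤ.<_)
      (sym (trans (cong₂ ℤ._+_ (ℤ.*-zeroʳ α) (inner-scaleˡ (+ suc k) a v)) (ℤ.+-identityˡ _)))
      (subst (ℤ._< (+ suc k) ℤ.* inner a v) (ℤ.*-zeroʳ (+ suc k))
             (ℤ.*-monoˡ-<-pos (+ suc k) (h (∈-++⁺ˡ j))))
    ... | inj₂ (inj₁ (p , refl , j)) = subst (0ℤ ℤ.<_)
      (cong (λ t → α ℤ.* +[1+ p ] ℤ.+ t) (sym (inner-scaleˡ (+ suc k) a v)))
      (proj₁ (proj₂ (proj₂ sol)) (∈-map⁺ value j))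
    ... | inj₂ (inj₂ (n , refl , j)) = subst (0ℤ ℤ.<_)
      (cong₂ ℤ._+_ (trans (sym (ℤ.neg-distribˡ-* α +[1+ n ])) (ℤ.neg-distribʳ-* α +[1+ n ]))
                   (sym (inner-scaleˡ (+ suc k) a v)))
      (proj₂ (proj₂ (proj₂ sol)) (∈-map⁺ value j))

  difference : ∀ {n} → Point n → Point n → Vec ℤ n
  difference []      []      = []
  difference (t ∷ x) (s ∷ y) = (tritℤ t ℤ.- tritℤ s) ∷ difference x y

  inner-difference : ∀ {n} (a : Vec ℤ n) x y → inner a (difference x y) ≡ dot a x ℤ.- dot a y
  inner-difference []      []      []      = refl
  inner-difference (a ∷ c) (t ∷ x) (s ∷ y) =
    trans (cong (λ r → a ℤ.* (tritℤ t ℤ.- tritℤ s) ℤ.+ r) (inner-difference c x y))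
          (lemma a (tritℤ t) (tritℤ s) (dot c x) (dot c y))
    where
    lemma : ∀ a t s p q → a ℤ.* (t ℤ.- s) ℤ.+ (p ℤ.- q) ≡ (a ℤ.* t ℤ.+ p) ℤ.- (a ℤ.* s ℤ.+ q)
    lemma = solve-∀

  ∈-vectors : ∀ {A : Set} {xs : List A} {n} (v : Vec A n) → (∀ i → lookup v i ∈ xs) → v ∈ vectors xs n
  ∈-vectors []      h = here refl
  ∈-vectors (x ∷ v) h = ∈-cartesianProductWith⁺ _∷_ (h zero) (∈-vectors v (h ∘ suc))

  ∈-points : ∀ {n} (x : Point n) → x ∈ points n
  ∈-points x = ∈-vectors x (λ i → trit (lookup x i))
    where
    trit : ∀ t → t ∈ −1ᵗ ∷ 0ᵗ ∷ +1ᵗ ∷ []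
    trit −1ᵗ = here refl
    trit 0ᵗ  = there (here refl)
    trit +1ᵗ = there (there (here refl))

  total : ∀ {n} → List (Point n) → Fin n → ℤ
  total []       j = 0ℤ
  total (p ∷ ps) j = tritℤ (lookup p j) ℤ.+ total ps j

  module _ {n : ℕ} (f : Subset n) (x : Point n) where

    gaps : List (Vec ℤ n)
    gaps = map (difference x) (filter (λ s → f s Bool.≟ true) (points n))

    -- k points of f, with k ≥ 1, whose sum falls short of k x by v.
    record Shortfall (v : Vec ℤ n) : Set where
      field
        k      : ℕ
        family : Vec (Point n) (suc k)
        inside : ∀ i → f (lookup family i) ≡ true
        deficit : ∀ j → (+ suc k) ℤ.* tritℤ (lookup x j) ≡ total (Vec.toList family) j ℤ.+ lookup v j

    open Shortfall

    cone-shortfall : ∀ {v} → Cone gaps v → Shortfall v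
    cone-shortfall (gen i) with ∈-map⁻ (difference x) i
    ... | s , j , refl = record
      { k = 0 ; family = s ∷ []
      ; inside = λ { zero → proj₂ (∈-filter⁻ (λ s → f s Bool.≟ true) {xs = points n} j) }
      ; deficit = λ l → trans (lemma (tritℤ (lookup x l)) (tritℤ (lookup s l)))
          (cong (λ t → tritℤ (lookup s l) ℤ.+ 0ℤ ℤ.+ t) (sym (lookup-difference x s l)))
      }
      where
      lemma : ∀ a b → 1ℤ ℤ.* a ≡ b ℤ.+ 0ℤ ℤ.+ (a ℤ.- b)
      lemma = solve-∀
      lookup-difference : ∀ {n} (x y : Point n) l → lookup (difference x y) l ≡ tritℤ (lookup x l) ℤ.- tritℤ (lookup y l)
      lookup-difference (_ ∷ _) (_ ∷ _) zero    = refl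
      lookup-difference (_ ∷ x) (_ ∷ y) (suc l) = lookup-difference x y l
    cone-shortfall (add {u} {v} cu cv refl) with cone-shortfall cu | cone-shortfall cv
    ... | su | sv = record
      { k = su .k ℕ.+ suc (sv .k) ; family = su .family Vec.++ sv .family
      ; inside = inside-++ (su .family) (su .inside)
      ; deficit = λ l → begin
          (+ suc (su .k ℕ.+ suc (sv .k))) ℤ.* tritℤ (lookup x l)
            ≡⟨ ℤ.*-distribʳ-+ (tritℤ (lookup x l)) (+ suc (su .k)) (+ suc (sv .k)) ⟩
          (+ suc (su .k)) ℤ.* tritℤ (lookup x l) ℤ.+ (+ suc (sv .k)) ℤ.* tritℤ (lookup x l)
            ≡⟨ cong₂ ℤ._+_ (su .deficit l) (sv .deficit l) ⟩
          (total (Vec.toList (su .family)) l ℤ.+ lookup u l) ℤ.+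
          (total (Vec.toList (sv .family)) l ℤ.+ lookup v l)
            ≡⟨ lemma (total (Vec.toList (su .family)) l) (lookup u l) (total (Vec.toList (sv .family)) l) (lookup v l) ⟩
          (total (Vec.toList (su .family)) l ℤ.+ total (Vec.toList (sv .family)) l) ℤ.+
          (lookup u l ℤ.+ lookup v l)
            ≡⟨ cong₂ ℤ._+_ (total-++ (su .family) (sv .family) l) (lookup-+ u v l) ⟨
          total (Vec.toList (su .family Vec.++ sv .family)) l ℤ.+ lookup (u +ᵛ v) l ∎
      }
      where
      open ≡-Reasoning
      lemma : ∀ a b c d → (a ℤ.+ b) ℤ.+ (c ℤ.+ d) ≡ (a ℤ.+ c) ℤ.+ (b ℤ.+ d)
      lemma = solve-∀
      lookup-+ : ∀ {n} (u v : Vec ℤ n) l → lookup (u +ᵛ v) l ≡ lookup u l ℤ.+ lookup v l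
      lookup-+ (_ ∷ _) (_ ∷ _) zero    = refl
      lookup-+ (_ ∷ u) (_ ∷ v) (suc l) = lookup-+ u v l
      total-++ : ∀ {a b} (p : Vec (Point n) a) (q : Vec (Point n) b) l →
                 total (Vec.toList (p Vec.++ q)) l ≡ total (Vec.toList p) l ℤ.+ total (Vec.toList q) l
      total-++ []      q l = sym (ℤ.+-identityˡ _)
      total-++ (p ∷ ps) q l = trans (cong (λ t → tritℤ (lookup p l) ℤ.+ t) (total-++ ps q l))
                                    (sym (ℤ.+-assoc (tritℤ (lookup p l)) _ _))
      inside-++ : ∀ {a} (p : Vec (Point n) a) → (∀ i → f (lookup p i) ≡ true) →
                  ∀ i → f (lookup (p Vec.++ sv .family) i) ≡ true
      inside-++ []       h i       = sv .inside i
      inside-++ (p ∷ ps) h zero    = h zero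
      inside-++ (p ∷ ps) h (suc i) = inside-++ ps (h ∘ suc) i

    shortfall⇒Conv : Shortfall zeroᵛ → Conv f (λ j → ⟦ lookup x j ⟧)
    shortfall⇒Conv s = suc (s .k) , lookup (s .family) , (λ _ → w) , s .inside , (λ _ → w≥0) , ones , average
      where
      open ≡-Reasoning
      w : ℚ
      w = 1ℤ ℚ./ suc (s .k)
      w≥0 : 0ℚ ℚ.≤ w
      w≥0 = /-≤ 0ℤ 1ℤ 1 (suc (s .k)) (ℤ.+≤+ ℕ.z≤n)
      cancel : ∀ t → w ℚ.* (((+ suc (s .k)) ℤ.* t) ℚ./ 1) ≡ t ℚ./ 1
      cancel t = trans (/-* 1ℤ ((+ suc (s .k)) ℤ.* t) (suc (s .k)) 1)
        (/-≡ (1ℤ ℤ.* ((+ suc (s .k)) ℤ.* t)) t (suc (s .k) ℕ.* 1) 1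
          (trans (lemma (+ suc (s .k)) t) (cong (λ m → t ℤ.* (+ m)) (sym (ℕ.*-identityʳ (suc (s .k)))))))
        where
        lemma : ∀ k t → (1ℤ ℤ.* (k ℤ.* t)) ℤ.* 1ℤ ≡ t ℤ.* k
        lemma = solve-∀
      ∑-const : ∀ m → ∑ {m} (λ _ → w) ≡ w ℚ.* ((+ m) ℚ./ 1)
      ∑-const zero    = sym (ℚ.*-zeroʳ w)
      ∑-const (suc m) = begin
        w ℚ.+ ∑ {m} (λ _ → w)                  ≡⟨ cong₂ ℚ._+_ (sym (ℚ.*-identityʳ w)) (∑-const m) ⟩
        w ℚ.* 1ℚ ℚ.+ w ℚ.* ((+ m) ℚ./ 1)        ≡⟨ ℚ.*-distribˡ-+ w 1ℚ _ ⟨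
        w ℚ.* (1ℚ ℚ.+ (+ m) ℚ./ 1)              ≡⟨ cong (w ℚ.*_) (/-+ 1ℤ (+ m)) ⟩
        w ℚ.* ((+ suc m) ℚ./ 1)                 ∎
      ones : ∑ {suc (s .k)} (λ _ → w) ≡ 1ℚ
      ones = trans (∑-const (suc (s .k))) (trans (cong (λ t → w ℚ.* (t ℚ./ 1)) (sym (ℤ.*-identityʳ (+ suc (s .k))))) (cancel 1ℤ))
      ⟦⟧-/ : ∀ t → ⟦ t ⟧ ≡ tritℤ t ℚ./ 1
      ⟦⟧-/ −1ᵗ = refl
      ⟦⟧-/ 0ᵗ  = refl
      ⟦⟧-/ +1ᵗ = refl
      ∑-total : ∀ {m} (p : Vec (Point n) m) j → ∑ (λ i → w ℚ.* ⟦ lookup (lookup p i) j ⟧) ≡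
                                                w ℚ.* (total (Vec.toList p) j ℚ./ 1)
      ∑-total []       j = sym (ℚ.*-zeroʳ w)
      ∑-total (p ∷ ps) j = begin
        w ℚ.* ⟦ lookup p j ⟧ ℚ.+ ∑ (λ i → w ℚ.* ⟦ lookup (lookup ps i) j ⟧)
          ≡⟨ cong₂ ℚ._+_ (cong (w ℚ.*_) (⟦⟧-/ (lookup p j))) (∑-total ps j) ⟩
        w ℚ.* (tritℤ (lookup p j) ℚ./ 1) ℚ.+ w ℚ.* (total (Vec.toList ps) j ℚ./ 1)
          ≡⟨ ℚ.*-distribˡ-+ w _ _ ⟨
        w ℚ.* (tritℤ (lookup p j) ℚ./ 1 ℚ.+ total (Vec.toList ps) j ℚ./ 1)
          ≡⟨ cong (w ℚ.*_) (/-+ (tritℤ (lookup p j)) (total (Vec.toList ps) j)) ⟩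
        w ℚ.* (total (Vec.toList (p ∷ ps)) j ℚ./ 1) ∎
      lookup-zeroᵛ : ∀ {n} (j : Fin n) → lookup (zeroᵛ {n}) j ≡ 0ℤ
      lookup-zeroᵛ zero    = refl
      lookup-zeroᵛ (suc j) = lookup-zeroᵛ j
      average : ∀ j → ∑ (λ i → w ℚ.* ⟦ lookup (lookup (s .family) i) j ⟧) ≡ ⟦ lookup x j ⟧
      average j = begin
        ∑ (λ i → w ℚ.* ⟦ lookup (lookup (s .family) i) j ⟧)
          ≡⟨ ∑-total (s .family) j ⟩
        w ℚ.* (total (Vec.toList (s .family)) j ℚ./ 1)
          ≡⟨ cong (λ t → w ℚ.* (t ℚ./ 1)) (sym (trans (s .deficit j)
               (trans (cong (λ t → total (Vec.toList (s .family)) j ℤ.+ t) (lookup-zeroᵛ j)) (ℤ.+-identityʳ (total (Vec.toList (s .family)) j))))) ⟩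
        w ℚ.* (((+ suc (s .k)) ℤ.* tritℤ (lookup x j)) ℚ./ 1)
          ≡⟨ cancel (tritℤ (lookup x j)) ⟩
        tritℤ (lookup x j) ℚ./ 1
          ≡⟨ ⟦⟧-/ (lookup x j) ⟨
        ⟦ lookup x j ⟧ ∎

  -- Gordan's alternative is applied to the differences x - s with s in the set. Either a functional
  -- is positive on all of them, or a nonempty sum of them vanishes. In the latter case x is the
  -- average, with equal weights and repetitions allowed, of points of the set, contrary to
  -- convexity.
  convex⇒separable : ∀ {n} {f : Subset n} → Convex f → LinearlySeparable f
  convex⇒separable {n} {f} convex x out with gordan n (gaps f x)
  ... | inj₁ (a , h) = a , λ s fs → ℤ.≰⇒> (λ le → ℤ.<⇒≱
        (subst (0ℤ ℤ.<_) (inner-difference a x s)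
          (h (∈-map⁺ (difference x) (∈-filter⁺ (λ s → f s Bool.≟ true) (∈-points s) fs))))
        (ℤ.i≤j⇒i-j≤0 le))
  ... | inj₂ c with trans (sym out) (Equivalence.from (convex x) (shortfall⇒Conv f x (cone-shortfall f x c)))
  ...   | ()

-- Noise sensitivity at the centre of the window.

module NoiseSensitivity where

  open import Data.Nat.Base
  open import Data.Nat.Properties
  open import Data.Nat.Tactic.RingSolver using (solve-∀)
  open import Data.Sum.Base using (inj₁; inj₂)
  open import Data.Vec.Base using ([]; _∷_)
  open import Function.Base using (_∘_)
  open import Relation.Binary.PropositionalEquality hiding ([_]; J)
  open import Defs using (Point; Trit; −1ᵗ; 0ᵗ; +1ᵗ; Subset)
  open TieBreaking using (square-cancel-≤)
  open WindowAveraging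

  slice : ∀ {n} → Trit → Trit → (Point (suc n) → Point (suc n) → ℕ) → Point n → Point n → ℕ
  slice t t′ h v x = h (t ∷ v) (t′ ∷ x)

  -- As pairSum with β = 1, with an arbitrary weight depending on the number
  -- of coordinates of the first and of the third kind.
  countSum : ∀ n → (ℕ → ℕ → ℕ) → (Point n → Point n → ℕ) → ℕ
  countSum zero    c h = c 0 0 * h [] []
  countSum (suc n) c h =
    (countSum n (λ p r → c (suc p) r) (slice +1ᵗ +1ᵗ h) + countSum n (λ p r → c (suc p) r) (slice −1ᵗ −1ᵗ h)) +
    (countSum n c (slice 0ᵗ +1ᵗ h) + countSum n c (slice 0ᵗ −1ᵗ h)) +
    countSum n (λ p r → c p (suc r)) (slice 0ᵗ 0ᵗ h)

  cong₅ : ∀ (a b c d e : ℕ) {a′ b′ c′ d′ e′} → a ≡ a′ → b ≡ b′ → c ≡ c′ → d ≡ d′ → e ≡ e′ →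
          (a + b) + (c + d) + e ≡ (a′ + b′) + (c′ + d′) + e′
  cong₅ a b c d e refl refl refl refl refl = refl

  countSum-cong : ∀ n {c d : ℕ → ℕ → ℕ} → (∀ p r → c p r ≡ d p r) → ∀ h → countSum n c h ≡ countSum n d h
  countSum-cong zero        e h = cong (_* h [] []) (e 0 0)
  countSum-cong (suc n) {c} e h = cong₅ _ _ _ _ _
    (countSum-cong n (e ∘ suc) (slice +1ᵗ +1ᵗ h)) (countSum-cong n (e ∘ suc) (slice −1ᵗ −1ᵗ h))
    (countSum-cong n e (slice 0ᵗ +1ᵗ h)) (countSum-cong n e (slice 0ᵗ −1ᵗ h))
    (countSum-cong n (λ p r → e p (suc r)) (slice 0ᵗ 0ᵗ h))

  countSum-* : ∀ n k c h → countSum n (λ p r → k * c p r) h ≡ k * countSum n c h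
  countSum-* zero    k c h = *-assoc k (c 0 0) (h [] [])
  countSum-* (suc n) k c h = trans (cong₅ _ _ _ _ _
    (countSum-* n k (c ∘ suc) (slice +1ᵗ +1ᵗ h)) (countSum-* n k (c ∘ suc) (slice −1ᵗ −1ᵗ h))
    (countSum-* n k c (slice 0ᵗ +1ᵗ h)) (countSum-* n k c (slice 0ᵗ −1ᵗ h))
    (countSum-* n k (λ p r → c p (suc r)) (slice 0ᵗ 0ᵗ h)))
    (lemma k (countSum n (c ∘ suc) (slice +1ᵗ +1ᵗ h)) (countSum n (c ∘ suc) (slice −1ᵗ −1ᵗ h))
             (countSum n c (slice 0ᵗ +1ᵗ h)) (countSum n c (slice 0ᵗ −1ᵗ h))
             (countSum n (λ p r → c p (suc r)) (slice 0ᵗ 0ᵗ h)))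
    where
    lemma : ∀ k a b c d e → (k * a + k * b) + (k * c + k * d) + k * e ≡ k * ((a + b) + (c + d) + e)
    lemma = solve-∀

  countSum-mono-+ : ∀ n {c d e : ℕ → ℕ → ℕ} → (∀ p r → p + r ≤ n → c p r ≤ d p r + e p r) →
    ∀ h → countSum n c h ≤ countSum n d h + countSum n e h
  countSum-mono-+ zero    {c} {d} {e} le h =
    ≤-trans (*-monoˡ-≤ (h [] []) (le 0 0 z≤n)) (≤-reflexive (*-distribʳ-+ (h [] []) (d 0 0) (e 0 0)))
  countSum-mono-+ (suc n) {c} {d} {e} le h = ≤-trans
    (+-mono-≤ (+-mono-≤ (+-mono-≤ (countSum-mono-+ n {c ∘ suc} {d ∘ suc} {e ∘ suc} up (slice +1ᵗ +1ᵗ h))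
                                  (countSum-mono-+ n {c ∘ suc} {d ∘ suc} {e ∘ suc} up (slice −1ᵗ −1ᵗ h)))
                        (+-mono-≤ (countSum-mono-+ n {c} {d} {e} same (slice 0ᵗ +1ᵗ h))
                                  (countSum-mono-+ n {c} {d} {e} same (slice 0ᵗ −1ᵗ h))))
              (countSum-mono-+ n {c̃} {d̃} {ẽ} right (slice 0ᵗ 0ᵗ h)))
    (≤-reflexive (lemma
      (countSum n (d ∘ suc) (slice +1ᵗ +1ᵗ h)) (countSum n (e ∘ suc) (slice +1ᵗ +1ᵗ h))
      (countSum n (d ∘ suc) (slice −1ᵗ −1ᵗ h)) (countSum n (e ∘ suc) (slice −1ᵗ −1ᵗ h))
      (countSum n d (slice 0ᵗ +1ᵗ h)) (countSum n e (slice 0ᵗ +1ᵗ h))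
      (countSum n d (slice 0ᵗ −1ᵗ h)) (countSum n e (slice 0ᵗ −1ᵗ h))
      (countSum n d̃ (slice 0ᵗ 0ᵗ h)) (countSum n ẽ (slice 0ᵗ 0ᵗ h))))
    where
    c̃ d̃ ẽ : ℕ → ℕ → ℕ
    c̃ p r = c p (suc r)
    d̃ p r = d p (suc r)
    ẽ p r = e p (suc r)
    up : ∀ p r → p + r ≤ n → c (suc p) r ≤ d (suc p) r + e (suc p) r
    up p r l = le (suc p) r (s≤s l)
    same : ∀ p r → p + r ≤ n → c p r ≤ d p r + e p r
    same p r l = le p r (m≤n⇒m≤1+n l)
    right : ∀ p r → p + r ≤ n → c p (suc r) ≤ d p (suc r) + e p (suc r)
    right p r l = le p (suc r) (≤-trans (≤-reflexive (+-suc p r)) (s≤s l))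
    lemma : ∀ a a′ b b′ c c′ d d′ e e′ →
      ((a + a′) + (b + b′)) + ((c + c′) + (d + d′)) + (e + e′) ≡
      ((a + b) + (c + d) + e) + ((a′ + b′) + (c′ + d′) + e′)
    lemma = solve-∀

  -- The sum of two displaced product weights is not a product weight; expanding by the numbers of
  -- coordinates of each kind permits a comparison pair by pair.
  pairSum-countSum : ∀ n α γ (h : Point n → Point n → ℕ) →
                     pairSum α 1 γ h ≡ countSum n (λ p r → α ^ p * γ ^ r) h
  pairSum-countSum zero    α γ h = sym (*-identityˡ _)
  pairSum-countSum (suc n) α γ h = trans
    (lemma α γ (pairSum α 1 γ (slice +1ᵗ +1ᵗ h)) (pairSum α 1 γ (slice −1ᵗ −1ᵗ h))
           (pairSum α 1 γ (slice 0ᵗ +1ᵗ h)) (pairSum α 1 γ (slice 0ᵗ −1ᵗ h)) (pairSum α 1 γ (slice 0ᵗ 0ᵗ h)))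
    (cong₅ _ _ _ _ _ (up (slice +1ᵗ +1ᵗ h)) (up (slice −1ᵗ −1ᵗ h))
      (pairSum-countSum n α γ (slice 0ᵗ +1ᵗ h)) (pairSum-countSum n α γ (slice 0ᵗ −1ᵗ h))
      (trans (cong (γ *_) (pairSum-countSum n α γ (slice 0ᵗ 0ᵗ h)))
             (trans (sym (countSum-* n γ _ (slice 0ᵗ 0ᵗ h)))
                    (countSum-cong n (λ p r → swap γ (α ^ p) (γ ^ r)) (slice 0ᵗ 0ᵗ h)))))
    where
    lemma : ∀ α γ a b c d e → α * (a + b) + 1 * (c + d) + γ * e ≡ (α * a + α * b) + (c + d) + γ * e
    lemma = solve-∀
    up : ∀ h′ → α * pairSum α 1 γ h′ ≡ countSum n (λ p r → α ^ suc p * γ ^ r) h′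
    up h′ = trans (cong (α *_) (pairSum-countSum n α γ h′))
      (trans (sym (countSum-* n α _ h′)) (countSum-cong n (λ p r → sym (*-assoc α (α ^ p) (γ ^ r))) h′))
    swap : ∀ g a b → g * (a * b) ≡ a * (g * b)
    swap = solve-∀

  am-gm : ∀ a b → 4 * (a * b) ≤ (a + b) * (a + b)
  am-gm a b with ≤-total a b
  ... | inj₁ a≤b = subst (λ z → 4 * (a * z) ≤ (a + z) * (a + z)) (m+[n∸m]≡n a≤b) (ordered a (b ∸ a))
    where
    lemma : ∀ a d → 4 * (a * (a + d)) + d * d ≡ (a + (a + d)) * (a + (a + d))
    lemma = solve-∀
    ordered : ∀ a d → 4 * (a * (a + d)) ≤ (a + (a + d)) * (a + (a + d))
    ordered a d = ≤-trans (m≤m+n _ (d * d)) (≤-reflexive (lemma a d))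
  ... | inj₂ b≤a = subst (λ z → 4 * (z * b) ≤ (z + b) * (z + b)) (m+[n∸m]≡n b≤a) (ordered b (a ∸ b))
    where
    lemma : ∀ b d → 4 * ((b + d) * b) + d * d ≡ ((b + d) + b) * ((b + d) + b)
    lemma = solve-∀
    ordered : ∀ b d → 4 * ((b + d) * b) ≤ ((b + d) + b) * ((b + d) + b)
    ordered b d = ≤-trans (m≤m+n _ (d * d)) (≤-reflexive (lemma b d))

  -- The weight of a pair at the centre is at most the sum of its weights at
  -- two symmetric displacements by j, because it is at most about their
  -- geometric mean.
  module Displacement (m j α₁ α₂ γ₁ γ₂ : ℕ)
                      (α γ : ℕ) (wα wγ : ℕ)
                      (eα : α * α ≡ α₁ * α₂ + wα) (eγ : γ * γ ≡ γ₁ * γ₂ + wγ)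
                      (hα : wα * (m * m) ≤ j * j * (α * α))
                      (hγ : wγ * (m * m) ≤ j * j * (γ * γ)) where

    -- AB ≥ (1 - k j²/m²) X² without division, where X² and AB are products of k factors.
    Close : ℕ → ℕ → ℕ → Set
    Close k X² AB = m * m * X² ≤ m * m * AB + k * (j * j) * X²

    -- One more coordinate replaces a factor u + w by u, a relative loss of at most j²/m². As in
    -- Bernoulli's inequality, the losses add up at worst.
    close-* : ∀ {k X² AB} u w → w * (m * m) ≤ j * j * (u + w) → Close k X² AB →
              Close (suc k) (X² * (u + w)) (AB * u)
    close-* {k} {X²} {AB} u w hw h = begin
      m * m * (X² * (u + w))
        ≡⟨ lemma₁ (m * m) X² u w ⟩
      m * m * X² * u + X² * (w * (m * m))
        ≤⟨ +-mono-≤ (*-monoˡ-≤ u h) (*-monoʳ-≤ X² hw) ⟩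
      (m * m * AB + k * (j * j) * X²) * u + X² * (j * j * (u + w))
        ≤⟨ m≤m+n _ (k * (j * j) * X² * w) ⟩
      (m * m * AB + k * (j * j) * X²) * u + X² * (j * j * (u + w)) + k * (j * j) * X² * w
        ≡⟨ lemma₂ (m * m) (j * j) k X² AB u w ⟩
      m * m * (AB * u) + suc k * (j * j) * (X² * (u + w)) ∎
      where
      open ≤-Reasoning
      lemma₁ : ∀ M X u w → M * (X * (u + w)) ≡ M * X * u + X * (w * M)
      lemma₁ = solve-∀
      lemma₂ : ∀ M J k X A u w → (M * A + k * J * X) * u + X * (J * (u + w)) + k * J * X * w ≡
                                 M * (A * u) + suc k * J * (X * (u + w))
      lemma₂ = solve-∀

    X A B : ℕ → ℕ → ℕ
    X p r = α ^ p * γ ^ r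
    A p r = α₁ ^ p * γ₁ ^ r
    B p r = α₂ ^ p * γ₂ ^ r

    close : ∀ p r → Close (p + r) (X p r * X p r) (A p r * B p r)
    close zero    zero    = m≤m+n _ 0
    close zero    (suc r) = subst₂ (Close (suc r))
      (trans (cong (X 0 r * X 0 r *_) (sym eγ)) (lemma γ (γ ^ r))) (lemma′ γ₁ γ₂ (γ₁ ^ r) (γ₂ ^ r))
      (close-* {r} (γ₁ * γ₂) wγ (subst (λ z → wγ * (m * m) ≤ j * j * z) eγ hγ) (close 0 r))
      where
      lemma : ∀ g x → (1 * x) * (1 * x) * (g * g) ≡ (1 * (g * x)) * (1 * (g * x))
      lemma = solve-∀
      lemma′ : ∀ g h x y → (1 * x) * (1 * y) * (g * h) ≡ (1 * (g * x)) * (1 * (h * y))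
      lemma′ = solve-∀
    close (suc p) r       = subst₂ (Close (suc (p + r)))
      (trans (cong (X p r * X p r *_) (sym eα)) (lemma α (α ^ p) (γ ^ r)))
      (lemma′ α₁ α₂ (α₁ ^ p) (α₂ ^ p) (γ₁ ^ r) (γ₂ ^ r))
      (close-* {p + r} (α₁ * α₂) wα (subst (λ z → wα * (m * m) ≤ j * j * z) eα hα) (close p r))
      where
      lemma : ∀ g x y → (x * y) * (x * y) * (g * g) ≡ (g * x * y) * (g * x * y)
      lemma = solve-∀
      lemma′ : ∀ g h x y z w → (x * z) * (y * w) * (g * h) ≡ (g * x * z) * (h * y * w)
      lemma′ = solve-∀

    -- With at most n factors the total loss is at most 1/2, so X² ≤ 2 A B, which is below 4 A B ≤
    -- (A + B)².
    dominated : ∀ n → 1 ≤ m → 2 * n * (j * j) ≤ m * m → ∀ p r → p + r ≤ n → X p r ≤ A p r + B p r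
    dominated n m>0 small p r le = square-cancel-≤ (≤-trans half (am-gm (A p r) (B p r)))
      where
      open ≤-Reasoning
      X² = X p r * X p r
      AB = A p r * B p r
      lemma : ∀ M x → 2 * (M * x) ≡ M * x + M * x
      lemma = solve-∀
      shuffle : ∀ k J x → 2 * (k * J * x) ≡ 2 * k * J * x
      shuffle = solve-∀
      twice : m * m * X² + m * m * X² ≤ 2 * (m * m * AB) + m * m * X²
      twice = begin
        m * m * X² + m * m * X²                               ≡⟨ lemma (m * m) X² ⟨
        2 * (m * m * X²)                                      ≤⟨ *-monoʳ-≤ 2 (close p r) ⟩
        2 * (m * m * AB + (p + r) * (j * j) * X²)             ≡⟨ *-distribˡ-+ 2 (m * m * AB) _ ⟩
        2 * (m * m * AB) + 2 * ((p + r) * (j * j) * X²)       ≡⟨ cong (2 * (m * m * AB) +_) (shuffle (p + r) (j * j) X²) ⟩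
        2 * (m * m * AB) + 2 * (p + r) * (j * j) * X²         ≤⟨ +-monoʳ-≤ (2 * (m * m * AB)) (*-monoˡ-≤ X²
                                                                   (≤-trans (*-monoˡ-≤ (j * j) (*-monoʳ-≤ 2 le)) small)) ⟩
        2 * (m * m * AB) + m * m * X²                         ∎
      half : X² ≤ 4 * AB
      half = ≤-trans (*-cancelˡ-≤ (m * m) {{m*n≢0 m m {{>-nonZero m>0}} {{>-nonZero m>0}}}}
          (≤-trans (+-cancelʳ-≤ (m * m * X²) _ _ twice) (≤-reflexive (comm (m * m) AB))))
          (*-monoˡ-≤ AB {2} {4} (s≤s (s≤s z≤n)))
        where
        comm : ∀ M a → 2 * (M * a) ≡ M * (2 * a)
        comm = solve-∀

  windowSum-last : ∀ {n} (f : Subset n) a c k →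
    windowSum f a c (suc k) ≡ windowSum f a (suc c) k + pairSum (a + k) 1 (2 * c) (disagree f)
  windowSum-last f a c zero    = trans (+-identityʳ _)
    (cong₂ (λ x y → pairSum x 1 (2 * y) (disagree f)) (sym (+-identityʳ a)) (+-identityʳ c))
  windowSum-last f a c (suc k) = trans
    (cong₂ _+_ (cong (λ z → pairSum a 1 (2 * z) (disagree f)) (+-suc c k))
               (trans (windowSum-last f (suc a) c k)
                      (cong (λ z → windowSum f (suc a) (suc c) k + pairSum z 1 (2 * c) (disagree f)) (sym (+-suc a k)))))
    (sym (+-assoc (pairSum a 1 (2 * (suc c + k)) (disagree f)) _ _))

  -- The two outermost steps of the window pay for one step at the centre, and the induction goes on
  -- with the smaller window. A displacement by j shifts the first weight, at least m at the centre,
  -- by j, and the third weight, equal to 2 m, by 2 j; so both have relative square loss at most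
  -- j²/m².
  centre-window : ∀ {n} (f : Subset n) m k a c → 1 ≤ m → 2 * n * (k * k) ≤ m * m →
    m ≤ a + k → c + k ≡ m →
    k * pairSum (a + k) 1 (2 * (c + k)) (disagree f) ≤ windowSum f a c (suc (2 * k))
  centre-window {n} f m zero    a c m>0 small ha hc = z≤n
  centre-window {n} f m (suc k) a c m>0 small ha hc = begin
    suc k * pairSum (a + suc k) 1 (2 * (c + suc k)) D
      ≡⟨⟩
    centre + k * centre
      ≤⟨ +-mono-≤ displaced inner ⟩
    (low + high) + windowSum f (suc a) (suc c) (suc (2 * k))
      ≡⟨ lemma low high _ ⟩
    low + (windowSum f (suc a) (suc c) (suc (2 * k)) + high)
      ≡⟨ cong₂ _+_ (cong (λ z → pairSum a 1 (2 * (c + z)) D) (sym twice))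
           (cong (windowSum f (suc a) (suc c) (suc (2 * k)) +_)
                 (cong (λ z → pairSum z 1 (2 * c) D) (+-suc a (suc (2 * k))))) ⟩
    pairSum a 1 (2 * (c + 2 * suc k)) D + (windowSum f (suc a) (suc c) (suc (2 * k)) + pairSum (suc a + suc (2 * k)) 1 (2 * c) D)
      ≡⟨ cong (pairSum a 1 (2 * (c + 2 * suc k)) D +_) (windowSum-last f (suc a) c (suc (2 * k))) ⟨
    pairSum a 1 (2 * (c + 2 * suc k)) D + windowSum f (suc a) c (suc (suc (2 * k)))
      ≡⟨ cong (λ z → pairSum a 1 (2 * (c + 2 * suc k)) D + windowSum f (suc a) c z) (sym twice) ⟩
    windowSum f a c (suc (2 * suc k)) ∎
    where
    open ≤-Reasoning
    D = disagree f
    j = suc k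
    centre = pairSum (a + j) 1 (2 * (c + j)) D
    low  = pairSum a 1 (2 * (c + suc (suc (2 * k)))) D
    high = pairSum (a + suc (suc (2 * k))) 1 (2 * c) D
    twice : 2 * suc k ≡ suc (suc (2 * k))
    twice = tw k where
      tw : ∀ k → 2 * suc k ≡ suc (suc (2 * k))
      tw = solve-∀
    lemma : ∀ a b c → (a + b) + c ≡ a + (c + b)
    lemma = solve-∀
    eα : ∀ a k → (a + suc k) * (a + suc k) ≡ a * (a + suc (suc (2 * k))) + suc k * suc k
    eα = solve-∀
    eγ : ∀ c k → (2 * (c + suc k)) * (2 * (c + suc k)) ≡
                 (2 * (c + suc (suc (2 * k)))) * (2 * c) + 4 * (suc k * suc k)
    eγ = solve-∀
    hγ : 4 * (j * j) * (m * m) ≤ j * j * ((2 * (c + j)) * (2 * (c + j)))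
    hγ = ≤-reflexive (trans (h (j * j) m) (cong (λ z → j * j * ((2 * z) * (2 * z))) (sym hc)))
      where
      h : ∀ J m → 4 * J * (m * m) ≡ J * ((2 * m) * (2 * m))
      h = solve-∀
    open Displacement m j a (a + suc (suc (2 * k))) (2 * (c + suc (suc (2 * k)))) (2 * c)
      (a + j) (2 * (c + j)) (j * j) (4 * (j * j)) (eα a k) (eγ c k)
      (*-monoʳ-≤ (j * j) (*-mono-≤ ha ha)) hγ
    displaced : centre ≤ low + high
    displaced = begin
      centre
        ≡⟨ pairSum-countSum n (a + j) (2 * (c + j)) D ⟩
      countSum n X D
        ≤⟨ countSum-mono-+ n {X} {A} {B} (dominated n m>0 small) D ⟩
      countSum n A D + countSum n B D
        ≡⟨ cong₂ _+_ (pairSum-countSum n a _ D) (pairSum-countSum n (a + suc (suc (2 * k))) (2 * c) D) ⟨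
      low + high ∎
    inner : k * centre ≤ windowSum f (suc a) (suc c) (suc (2 * k))
    inner = ≤-trans (≤-reflexive (cong₂ (λ x y → k * pairSum x 1 (2 * y) D) (+-suc a k) (+-suc c k)))
      (centre-window f m k (suc a) (suc c) m>0
        (≤-trans (*-monoʳ-≤ (2 * n) (*-mono-≤ (n≤1+n k) (n≤1+n k))) small)
        (≤-trans ha (≤-reflexive (+-suc a k))) (trans (sym (+-suc c k)) hc))

  -- A window of 2 s² + 1 steps admits κ = 4 s, so s² steps at the centre contribute at most 8 s +
  -- 1. The central weights 2 m - 1, 1 and 2 m give every value of the upper coordinate the total
  -- weight 2 m, so the upper point is uniform.
  noise-bound : ∀ {n} {f : Subset n} → LinearlySeparable f → ∀ s m → 1 ≤ n → 1 ≤ s →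
    2 * n * ((s * s) * (s * s)) ≤ m * m →
    s * s * pairSum (2 * m ∸ 1) 1 (2 * m) (disagree f) ≤ (8 * s + 1) * (6 * m) ^ n
  noise-bound {n} {f} sep s m n>0 s>0 small = begin
    k * pairSum (2 * m ∸ 1) 1 (2 * m) D
      ≡⟨ cong₂ (λ x y → k * pairSum x 1 (2 * y) D) (sym a+k) (sym c+k) ⟩
    k * pairSum (a + k) 1 (2 * (c + k)) D
      ≤⟨ centre-window f m k a c m>0 small (≤-trans m≤2m∸1 (≤-reflexive (sym a+k))) c+k ⟩
    windowSum f a c (suc (2 * k))
      ≤⟨ window-bound sep (4 * s) a c (suc (2 * k)) hκ ⟩
    (2 * (4 * s) + 1) * (2 * (a + suc (2 * k) + c)) ^ n
      ≡⟨ cong₂ (λ x y → (x + 1) * y ^ n) (sym (*-assoc 2 4 s)) total ⟩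
    (8 * s + 1) * (6 * m) ^ n ∎
    where
    open ≤-Reasoning
    k = s * s
    D = disagree f
    k>0 : 1 ≤ k
    k>0 = *-mono-≤ s>0 s>0
    k≤m : k ≤ m
    k≤m = square-cancel-≤ (≤-trans (m≤n*m (k * k) (2 * n) {{m*n≢0 2 n {{_}} {{>-nonZero n>0}}}}) small)
    m>0 : 1 ≤ m
    m>0 = ≤-trans k>0 k≤m
    c = m ∸ k
    c+k : c + k ≡ m
    c+k = m∸n+n≡m k≤m
    split : m + (m ∸ 1) ≡ 2 * m ∸ 1
    split = trans (sym (+-∸-assoc m m>0)) (cong (_∸ 1) (cong (m +_) (sym (+-identityʳ m))))
    m≤2m∸1 : m ≤ 2 * m ∸ 1
    m≤2m∸1 = ≤-trans (m≤m+n m _) (≤-reflexive split)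
    a = 2 * m ∸ 1 ∸ k
    a+k : a + k ≡ 2 * m ∸ 1
    a+k = m∸n+n≡m (≤-trans k≤m m≤2m∸1)
    total : 2 * (a + suc (2 * k) + c) ≡ 6 * m
    total = begin-equality
      2 * (a + suc (2 * k) + c)         ≡⟨ lemma₁ a k c ⟩
      2 * (suc (a + k) + (c + k))       ≡⟨ cong₂ (λ x y → 2 * (suc x + y)) a+k c+k ⟩
      2 * (suc (2 * m ∸ 1) + m)         ≡⟨ cong (λ x → 2 * (x + m)) (m+[n∸m]≡n (≤-trans m>0 (m≤m+n m _))) ⟩
      2 * (2 * m + m)                   ≡⟨ lemma₂ m ⟩
      6 * m                             ∎
      where
      lemma₁ : ∀ a k c → 2 * (a + suc (2 * k) + c) ≡ 2 * (suc (a + k) + (c + k))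
      lemma₁ = solve-∀
      lemma₂ : ∀ m → 2 * (2 * m + m) ≡ 6 * m
      lemma₂ = solve-∀
    hκ : 4 * suc (2 * k) + 1 ≤ 4 * s * (4 * s)
    hκ = begin
      4 * suc (2 * k) + 1     ≡⟨ lemma₁ k ⟩
      8 * k + 5 * 1           ≤⟨ +-monoʳ-≤ (8 * k) (*-monoʳ-≤ 5 k>0) ⟩
      8 * k + 5 * k           ≤⟨ m≤m+n _ (3 * k) ⟩
      8 * k + 5 * k + 3 * k   ≡⟨ lemma₂ s ⟩
      4 * s * (4 * s)         ∎
      where
      lemma₁ : ∀ k → 4 * suc (2 * k) + 1 ≡ 8 * k + 5 * 1
      lemma₁ = solve-∀
      lemma₂ : ∀ s → 8 * (s * s) + 5 * (s * s) + 3 * (s * s) ≡ 4 * s * (4 * s)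
      lemma₂ = solve-∀

-- The Efron-Stein decomposition in integers.

module EfronStein where

  open import Data.Integer.Base hiding (suc; pred)
  open import Data.Integer.Properties
  open import Data.Integer.Tactic.RingSolver using (solve-∀)
  open import Data.Nat.Base as ℕ using (ℕ; zero; suc)
  open import Data.Vec.Base using ([]; _∷_)
  open import Function.Base using (_∘_)
  open import Relation.Binary.PropositionalEquality hiding ([_]; J)
  open import Defs using (Point; Trit; −1ᵗ; 0ᵗ; +1ᵗ)

  private variable
    n : ℕ

  Fn : ℕ → Set
  Fn n = Point n → ℤ

  at : Trit → Fn (suc n) → Fn n
  at t g x = g (t ∷ x)

  cube : Fn n → ℤ
  cube {zero}  g = g []
  cube {suc n} g = cube (at −1ᵗ g) + cube (at 0ᵗ g) + cube (at +1ᵗ g)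

  cube-cong : {g h : Fn n} → (∀ x → g x ≡ h x) → cube g ≡ cube h
  cube-cong {zero}  e = e []
  cube-cong {suc n} e =
    cong₂ _+_ (cong₂ _+_ (cube-cong (e ∘ (−1ᵗ ∷_))) (cube-cong (e ∘ (0ᵗ ∷_)))) (cube-cong (e ∘ (+1ᵗ ∷_)))

  cube-+ : (g h : Fn n) → cube (λ x → g x + h x) ≡ cube g + cube h
  cube-+ {zero}  g h = refl
  cube-+ {suc n} g h = trans
    (cong₂ _+_ (cong₂ _+_ (cube-+ (at −1ᵗ g) (at −1ᵗ h)) (cube-+ (at 0ᵗ g) (at 0ᵗ h))) (cube-+ (at +1ᵗ g) (at +1ᵗ h)))
    (lemma (cube (at −1ᵗ g)) (cube (at −1ᵗ h)) (cube (at 0ᵗ g)) (cube (at 0ᵗ h)) (cube (at +1ᵗ g)) (cube (at +1ᵗ h)))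
    where
    lemma : ∀ a a′ b b′ c c′ → (a + a′) + (b + b′) + (c + c′) ≡ (a + b + c) + (a′ + b′ + c′)
    lemma = solve-∀

  cube-* : ∀ k (g : Fn n) → cube (λ x → k * g x) ≡ k * cube g
  cube-* {zero}  k g = refl
  cube-* {suc n} k g = trans
    (cong₂ _+_ (cong₂ _+_ (cube-* k (at −1ᵗ g)) (cube-* k (at 0ᵗ g))) (cube-* k (at +1ᵗ g)))
    (lemma k (cube (at −1ᵗ g)) (cube (at 0ᵗ g)) (cube (at +1ᵗ g)))
    where
    lemma : ∀ k a b c → k * a + k * b + k * c ≡ k * (a + b + c)
    lemma = solve-∀

  sum₃ : Fn (suc n) → Fn n
  sum₃ g x = at −1ᵗ g x + at 0ᵗ g x + at +1ᵗ g x

  diff₁ diff₂ diff₃ : Fn (suc n) → Fn n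
  diff₁ g x = at −1ᵗ g x - at 0ᵗ g x
  diff₂ g x = at 0ᵗ g x - at +1ᵗ g x
  diff₃ g x = at −1ᵗ g x - at +1ᵗ g x

  -- The squared norms of the components of g in the Efron-Stein
  -- decomposition, scaled by 9ⁿ; the component of a set of i coordinates out
  -- of i + o has weight c i o.
  energy : ∀ n → (ℕ → ℕ → ℤ) → Fn n → ℤ
  energy zero    c g = c 0 0 * (g [] * g [])
  energy (suc n) c g =
    energy n (λ i o → c i (suc o)) (sum₃ g) +
    (energy n (c ∘ suc) (diff₁ g) + energy n (c ∘ suc) (diff₂ g) + energy n (c ∘ suc) (diff₃ g))

  cong₄ : ∀ (a b c d : ℤ) {a′ b′ c′ d′} → a ≡ a′ → b ≡ b′ → c ≡ c′ → d ≡ d′ →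
          a + (b + c + d) ≡ a′ + (b′ + c′ + d′)
  cong₄ a b c d refl refl refl refl = refl

  energy-cong : ∀ n {c d : ℕ → ℕ → ℤ} {g h} → (∀ i o → c i o ≡ d i o) → (∀ x → g x ≡ h x) →
                energy n c g ≡ energy n d h
  energy-cong zero    e e′ = cong₂ _*_ (e 0 0) (cong₂ _*_ (e′ []) (e′ []))
  energy-cong (suc n) e e′ = cong₄ _ _ _ _
    (energy-cong n (λ i o → e i (suc o)) (λ x → cong₂ _+_ (cong₂ _+_ (e′ (−1ᵗ ∷ x)) (e′ (0ᵗ ∷ x))) (e′ (+1ᵗ ∷ x))))
    (energy-cong n (e ∘ suc) (λ x → cong₂ _-_ (e′ (−1ᵗ ∷ x)) (e′ (0ᵗ ∷ x))))
    (energy-cong n (e ∘ suc) (λ x → cong₂ _-_ (e′ (0ᵗ ∷ x)) (e′ (+1ᵗ ∷ x))))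
    (energy-cong n (e ∘ suc) (λ x → cong₂ _-_ (e′ (−1ᵗ ∷ x)) (e′ (+1ᵗ ∷ x))))

  square-nonNeg : ∀ a → 0ℤ ≤ a * a
  square-nonNeg (+ k)    = subst (0ℤ ≤_) (pos-* k k) (+≤+ ℕ.z≤n)
  square-nonNeg -[1+ k ] = +≤+ ℕ.z≤n

  energy-mono : ∀ n {c d : ℕ → ℕ → ℤ} → (∀ i o → c i o ≤ d i o) → ∀ g → energy n c g ≤ energy n d g
  energy-mono zero    h g = *-monoʳ-≤-nonNeg (g [] * g []) {{nonNegative (square-nonNeg (g []))}} (h 0 0)
  energy-mono (suc n) h g =
    +-mono-≤ (energy-mono n (λ i o → h i (suc o)) (sum₃ g))
      (+-mono-≤ (+-mono-≤ (energy-mono n (h ∘ suc) (diff₁ g)) (energy-mono n (h ∘ suc) (diff₂ g)))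
                (energy-mono n (h ∘ suc) (diff₃ g)))

  energy-* : ∀ n k (c : ℕ → ℕ → ℤ) g → energy n (λ i o → k * c i o) g ≡ k * energy n c g
  energy-* zero    k c g = *-assoc k (c 0 0) (g [] * g [])
  energy-* (suc n) k c g = trans (cong₄ _ _ _ _
    (energy-* n k _ (sum₃ g)) (energy-* n k _ (diff₁ g)) (energy-* n k _ (diff₂ g)) (energy-* n k _ (diff₃ g)))
    (lemma k (energy n (λ i o → c i (suc o)) (sum₃ g)) (energy n (c ∘ suc) (diff₁ g))
             (energy n (c ∘ suc) (diff₂ g)) (energy n (c ∘ suc) (diff₃ g)))
    where
    lemma : ∀ k a b c d → k * a + (k * b + k * c + k * d) ≡ k * (a + (b + c + d))
    lemma = solve-∀

  energy-+ : ∀ n (c d : ℕ → ℕ → ℤ) g → energy n (λ i o → c i o + d i o) g ≡ energy n c g + energy n d g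
  energy-+ zero    c d g = *-distribʳ-+ (g [] * g []) (c 0 0) (d 0 0)
  energy-+ (suc n) c d g = trans (cong₄ _ _ _ _
    (energy-+ n _ _ (sum₃ g)) (energy-+ n _ _ (diff₁ g)) (energy-+ n _ _ (diff₂ g)) (energy-+ n _ _ (diff₃ g)))
    (lemma (energy n (λ i o → c i (suc o)) (sum₃ g)) (energy n (λ i o → d i (suc o)) (sum₃ g))
           (energy n (c ∘ suc) (diff₁ g)) (energy n (d ∘ suc) (diff₁ g))
           (energy n (c ∘ suc) (diff₂ g)) (energy n (d ∘ suc) (diff₂ g))
           (energy n (c ∘ suc) (diff₃ g)) (energy n (d ∘ suc) (diff₃ g)))
    where
    lemma : ∀ a a′ b b′ c c′ d d′ → (a + a′) + ((b + b′) + (c + c′) + (d + d′)) ≡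
                                    (a + (b + c + d)) + (a′ + (b′ + c′ + d′))
    lemma = solve-∀

  -- Energy is a weighted sum of squares of linear forms, and for single numbers p, q, r the claim
  -- is a polynomial identity. It expresses the orthogonality of the sum of three values to their
  -- differences.
  energy-parallelogram : ∀ n c (p q r : Fn n) →
    energy n c (λ x → p x + q x + r x) +
    (energy n c (λ x → p x - q x) + energy n c (λ x → q x - r x) + energy n c (λ x → p x - r x)) ≡
    + 3 * (energy n c p + energy n c q + energy n c r)
  energy-parallelogram zero c p q r = lemma (c 0 0) (p []) (q []) (r [])
    where
    lemma : ∀ c p q r →
      c * ((p + q + r) * (p + q + r)) +
      (c * ((p - q) * (p - q)) + c * ((q - r) * (q - r)) + c * ((p - r) * (p - r))) ≡
      + 3 * (c * (p * p) + c * (q * q) + c * (r * r))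
    lemma = solve-∀
  energy-parallelogram (suc n) c p q r = begin
    energy (suc n) c (λ x → p x + q x + r x) +
    (energy (suc n) c (λ x → p x - q x) + energy (suc n) c (λ x → q x - r x) + energy (suc n) c (λ x → p x - r x))
      ≡⟨ cong₄ _ _ _ _
           (cong₄ _ _ _ _ (plus sum₃ sum-plus) (plus diff₁ (diff-plus −1ᵗ 0ᵗ)) (plus diff₂ (diff-plus 0ᵗ +1ᵗ)) (plus diff₃ (diff-plus −1ᵗ +1ᵗ)))
           (minus p q) (minus q r) (minus p r) ⟩
    (S₁ sum₃ + (S diff₁ + S diff₂ + S diff₃)) +
    ((D₁ sum₃ p q + (D diff₁ p q + D diff₂ p q + D diff₃ p q)) +
     (D₁ sum₃ q r + (D diff₁ q r + D diff₂ q r + D diff₃ q r)) +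
     (D₁ sum₃ p r + (D diff₁ p r + D diff₂ p r + D diff₃ p r)))
      ≡⟨ shuffle (S₁ sum₃) (S diff₁) (S diff₂) (S diff₃)
                 (D₁ sum₃ p q) (D diff₁ p q) (D diff₂ p q) (D diff₃ p q)
                 (D₁ sum₃ q r) (D diff₁ q r) (D diff₂ q r) (D diff₃ q r)
                 (D₁ sum₃ p r) (D diff₁ p r) (D diff₂ p r) (D diff₃ p r) ⟩
    (S₁ sum₃ + (D₁ sum₃ p q + D₁ sum₃ q r + D₁ sum₃ p r)) +
    ((S diff₁ + (D diff₁ p q + D diff₁ q r + D diff₁ p r)) +
     (S diff₂ + (D diff₂ p q + D diff₂ q r + D diff₂ p r)) +
     (S diff₃ + (D diff₃ p q + D diff₃ q r + D diff₃ p r)))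
      ≡⟨ cong₄ _ _ _ _ (energy-parallelogram n c₁ (sum₃ p) (sum₃ q) (sum₃ r))
           (energy-parallelogram n c₂ (diff₁ p) (diff₁ q) (diff₁ r))
           (energy-parallelogram n c₂ (diff₂ p) (diff₂ q) (diff₂ r))
           (energy-parallelogram n c₂ (diff₃ p) (diff₃ q) (diff₃ r)) ⟩
    + 3 * (E₁ sum₃ p + E₁ sum₃ q + E₁ sum₃ r) +
    (+ 3 * (E diff₁ p + E diff₁ q + E diff₁ r) + + 3 * (E diff₂ p + E diff₂ q + E diff₂ r) +
     + 3 * (E diff₃ p + E diff₃ q + E diff₃ r))
      ≡⟨ collect (E₁ sum₃ p) (E diff₁ p) (E diff₂ p) (E diff₃ p)
                 (E₁ sum₃ q) (E diff₁ q) (E diff₂ q) (E diff₃ q)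
                 (E₁ sum₃ r) (E diff₁ r) (E diff₂ r) (E diff₃ r) ⟩
    + 3 * (energy (suc n) c p + energy (suc n) c q + energy (suc n) c r) ∎
    where
    open ≡-Reasoning
    c₁ c₂ : ℕ → ℕ → ℤ
    c₁ i o = c i (suc o)
    c₂ = c ∘ suc
    E₁ E : (Fn (suc n) → Fn n) → Fn (suc n) → ℤ
    E₁ op p = energy n c₁ (op p)
    E  op p = energy n c₂ (op p)
    S₁ S : (Fn (suc n) → Fn n) → ℤ
    S₁ op = energy n c₁ (λ x → op p x + op q x + op r x)
    S  op = energy n c₂ (λ x → op p x + op q x + op r x)
    D₁ D : (Fn (suc n) → Fn n) → Fn (suc n) → Fn (suc n) → ℤ
    D₁ op p q = energy n c₁ (λ x → op p x - op q x)
    D  op p q = energy n c₂ (λ x → op p x - op q x)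
    plus : ∀ {c} (op : Fn (suc n) → Fn n) → (∀ x → op (λ y → p y + q y + r y) x ≡ op p x + op q x + op r x) →
           energy n c (op (λ y → p y + q y + r y)) ≡ energy n c (λ x → op p x + op q x + op r x)
    plus op e = energy-cong n (λ _ _ → refl) e
    sum-plus : ∀ x → sum₃ (λ y → p y + q y + r y) x ≡ sum₃ p x + sum₃ q x + sum₃ r x
    sum-plus x = lemma (p (−1ᵗ ∷ x)) (q (−1ᵗ ∷ x)) (r (−1ᵗ ∷ x)) (p (0ᵗ ∷ x)) (q (0ᵗ ∷ x)) (r (0ᵗ ∷ x))
                       (p (+1ᵗ ∷ x)) (q (+1ᵗ ∷ x)) (r (+1ᵗ ∷ x))
      where
      lemma : ∀ a b c d e f g h i → (a + b + c) + (d + e + f) + (g + h + i) ≡ (a + d + g) + (b + e + h) + (c + f + i)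
      lemma = solve-∀
    diff-plus : ∀ s t x → (p (s ∷ x) + q (s ∷ x) + r (s ∷ x)) - (p (t ∷ x) + q (t ∷ x) + r (t ∷ x)) ≡
                          (p (s ∷ x) - p (t ∷ x)) + (q (s ∷ x) - q (t ∷ x)) + (r (s ∷ x) - r (t ∷ x))
    diff-plus s t x = lemma (p (s ∷ x)) (q (s ∷ x)) (r (s ∷ x)) (p (t ∷ x)) (q (t ∷ x)) (r (t ∷ x))
      where
      lemma : ∀ a b c d e f → (a + b + c) - (d + e + f) ≡ (a - d) + (b - e) + (c - f)
      lemma = solve-∀
    minus : ∀ p q → energy (suc n) c (λ x → p x - q x) ≡
                    D₁ sum₃ p q + (D diff₁ p q + D diff₂ p q + D diff₃ p q)
    minus p q = cong₄ _ _ _ _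
      (energy-cong n (λ _ _ → refl) (λ x → lemma (p (−1ᵗ ∷ x)) (q (−1ᵗ ∷ x)) (p (0ᵗ ∷ x)) (q (0ᵗ ∷ x)) (p (+1ᵗ ∷ x)) (q (+1ᵗ ∷ x))))
      (energy-cong n (λ _ _ → refl) (λ x → lemma′ (p (−1ᵗ ∷ x)) (q (−1ᵗ ∷ x)) (p (0ᵗ ∷ x)) (q (0ᵗ ∷ x))))
      (energy-cong n (λ _ _ → refl) (λ x → lemma′ (p (0ᵗ ∷ x)) (q (0ᵗ ∷ x)) (p (+1ᵗ ∷ x)) (q (+1ᵗ ∷ x))))
      (energy-cong n (λ _ _ → refl) (λ x → lemma′ (p (−1ᵗ ∷ x)) (q (−1ᵗ ∷ x)) (p (+1ᵗ ∷ x)) (q (+1ᵗ ∷ x))))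
      where
      lemma : ∀ a b c d e f → (a - b) + (c - d) + (e - f) ≡ (a + c + e) - (b + d + f)
      lemma = solve-∀
      lemma′ : ∀ a b c d → (a - b) - (c - d) ≡ (a - c) - (b - d)
      lemma′ = solve-∀
    shuffle : ∀ a₁ a₂ a₃ a₄ b₁ b₂ b₃ b₄ c₁ c₂ c₃ c₄ d₁ d₂ d₃ d₄ →
      (a₁ + (a₂ + a₃ + a₄)) + ((b₁ + (b₂ + b₃ + b₄)) + (c₁ + (c₂ + c₃ + c₄)) + (d₁ + (d₂ + d₃ + d₄))) ≡
      (a₁ + (b₁ + c₁ + d₁)) + ((a₂ + (b₂ + c₂ + d₂)) + (a₃ + (b₃ + c₃ + d₃)) + (a₄ + (b₄ + c₄ + d₄)))
    shuffle = solve-∀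
    collect : ∀ a₁ a₂ a₃ a₄ b₁ b₂ b₃ b₄ c₁ c₂ c₃ c₄ →
      + 3 * (a₁ + b₁ + c₁) + (+ 3 * (a₂ + b₂ + c₂) + + 3 * (a₃ + b₃ + c₃) + + 3 * (a₄ + b₄ + c₄)) ≡
      + 3 * ((a₁ + (a₂ + a₃ + a₄)) + (b₁ + (b₂ + b₃ + b₄)) + (c₁ + (c₂ + c₃ + c₄)))
    collect = solve-∀

  parseval : ∀ n (g : Fn n) → energy n (λ _ _ → 1ℤ) g ≡ (+ 3) ^ n * cube (λ x → g x * g x)
  parseval zero    g = refl
  parseval (suc n) g = begin
    energy (suc n) (λ _ _ → 1ℤ) g
      ≡⟨ energy-parallelogram n (λ _ _ → 1ℤ) (at −1ᵗ g) (at 0ᵗ g) (at +1ᵗ g) ⟩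
    + 3 * (energy n _ (at −1ᵗ g) + energy n _ (at 0ᵗ g) + energy n _ (at +1ᵗ g))
      ≡⟨ cong (+ 3 *_) (cong₂ _+_ (cong₂ _+_ (parseval n (at −1ᵗ g)) (parseval n (at 0ᵗ g))) (parseval n (at +1ᵗ g))) ⟩
    + 3 * ((+ 3) ^ n * C −1ᵗ + (+ 3) ^ n * C 0ᵗ + (+ 3) ^ n * C +1ᵗ)
      ≡⟨ lemma ((+ 3) ^ n) (C −1ᵗ) (C 0ᵗ) (C +1ᵗ) ⟩
    (+ 3) ^ suc n * cube (λ x → g x * g x) ∎
    where
    open ≡-Reasoning
    C : Trit → ℤ
    C t = cube (λ x → at t g x * at t g x)
    lemma : ∀ k a b c → + 3 * (k * a + k * b + k * c) ≡ + 3 * k * (a + b + c)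
    lemma = solve-∀

  -- 3 [a = b] - 1, which is three times the kernel of the projection of functions of one coordinate
  -- onto those of mean zero.
  character : Trit → Trit → ℤ
  character −1ᵗ −1ᵗ = + 2
  character 0ᵗ  0ᵗ  = + 2
  character +1ᵗ +1ᵗ = + 2
  character _   _   = -1ℤ

  -- 3ⁿ times the kernel of the projection onto the components of sets of
  -- fewer than d coordinates.
  kernel : ℕ → Point n → Point n → ℤ
  kernel zero    x       z       = 0ℤ
  kernel (suc d) []      []      = 1ℤ
  kernel (suc d) (a ∷ x) (b ∷ z) = kernel (suc d) x z + character a b * kernel d x z

  smooth : ℕ → Fn n → Fn n
  smooth d g x = cube (λ z → kernel d x z * g z)

  -- 3ⁿ times the part of g of degree at least d.
  residual : ℕ → Fn n → Fn n
  residual {n} d g x = (+ 3) ^ n * g x - smooth d g x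

  atLeast : ℕ → ℕ → ℤ
  atLeast zero    i       = 1ℤ
  atLeast (suc d) zero    = 0ℤ
  atLeast (suc d) (suc i) = atLeast d i

  highEnergy : ℕ → Fn n → ℤ
  highEnergy {n} d = energy n (λ i _ → atLeast d i)

  residual-linear : ∀ d j k l (p q r : Fn n) x →
    residual d (λ y → j * p y + k * q y + l * r y) x ≡ j * residual d p x + k * residual d q x + l * residual d r x
  residual-linear {n} d j k l p q r x = begin
    (+ 3) ^ n * (j * p x + k * q x + l * r x) - smooth d (λ y → j * p y + k * q y + l * r y) x
      ≡⟨ cong (λ t → (+ 3) ^ n * (j * p x + k * q x + l * r x) - t) smooth-linear ⟩
    (+ 3) ^ n * (j * p x + k * q x + l * r x) - (j * smooth d p x + k * smooth d q x + l * smooth d r x)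
      ≡⟨ lemma ((+ 3) ^ n) j k l (p x) (q x) (r x) (smooth d p x) (smooth d q x) (smooth d r x) ⟩
    j * residual d p x + k * residual d q x + l * residual d r x ∎
    where
    open ≡-Reasoning
    K : Point n → ℤ
    K = kernel d x
    expand : ∀ κ j k l a b c → κ * (j * a + k * b + l * c) ≡ j * (κ * a) + k * (κ * b) + l * (κ * c)
    expand = solve-∀
    smooth-linear : smooth d (λ y → j * p y + k * q y + l * r y) x ≡ j * smooth d p x + k * smooth d q x + l * smooth d r x
    smooth-linear = trans (cube-cong (λ z → expand (K z) j k l (p z) (q z) (r z)))
      (trans (cube-+ (λ z → j * (K z * p z) + k * (K z * q z)) (λ z → l * (K z * r z)))
        (cong₂ _+_ (trans (cube-+ (λ z → j * (K z * p z)) (λ z → k * (K z * q z)))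
                          (cong₂ _+_ (cube-* j (λ z → K z * p z)) (cube-* k (λ z → K z * q z))))
                   (cube-* l (λ z → K z * r z))))
    lemma : ∀ N j k l p q r p′ q′ r′ → N * (j * p + k * q + l * r) - (j * p′ + k * q′ + l * r′) ≡
                                       j * (N * p - p′) + k * (N * q - q′) + l * (N * r - r′)
    lemma = solve-∀

  deviation : Trit → Fn (suc n) → Fn n
  deviation a g x = character a −1ᵗ * at −1ᵗ g x + character a 0ᵗ * at 0ᵗ g x + character a +1ᵗ * at +1ᵗ g x

  -- Components of sets avoiding the first coordinate see only the sum over it, with the same degree
  -- bound; those of sets containing it see the deviation and use up one degree. At d = 0 everything
  -- vanishes, so `pred` covers that case too.
  smooth-∷ : ∀ d (g : Fn (suc n)) a x → smooth d g (a ∷ x) ≡ smooth d (sum₃ g) x + smooth (ℕ.pred d) (deviation a g) x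
  smooth-∷ {n} zero g a x = trans (cong₂ _+_ (cong₂ _+_ (zeros (at −1ᵗ g)) (zeros (at 0ᵗ g))) (zeros (at +1ᵗ g)))
    (sym (cong₂ _+_ (zeros (sum₃ g)) (zeros (deviation a g))))
    where
    zeros : ∀ (h : Fn n) → cube (λ z → 0ℤ * h z) ≡ 0ℤ
    zeros h = cube-* 0ℤ h
  smooth-∷ {n} (suc d) g a x = begin
    cube (λ z → (K z + character a −1ᵗ * L z) * at −1ᵗ g z) +
    cube (λ z → (K z + character a 0ᵗ * L z) * at 0ᵗ g z) +
    cube (λ z → (K z + character a +1ᵗ * L z) * at +1ᵗ g z)
      ≡⟨ trans (cong (_+ cube F₊) (sym (cube-+ F₋ F₀))) (sym (cube-+ (λ z → F₋ z + F₀ z) F₊)) ⟩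
    cube (λ z → F₋ z + F₀ z + F₊ z)
      ≡⟨ cube-cong (λ z → lemma (K z) (L z) (character a −1ᵗ) (character a 0ᵗ) (character a +1ᵗ)
                                (at −1ᵗ g z) (at 0ᵗ g z) (at +1ᵗ g z)) ⟩
    cube (λ z → K z * sum₃ g z + L z * deviation a g z)
      ≡⟨ cube-+ (λ z → K z * sum₃ g z) (λ z → L z * deviation a g z) ⟩
    smooth (suc d) (sum₃ g) x + smooth d (deviation a g) x ∎
    where
    open ≡-Reasoning
    K L F₋ F₀ F₊ : Fn n
    K = kernel (suc d) x
    L = kernel d x
    F₋ z = (K z + character a −1ᵗ * L z) * at −1ᵗ g z
    F₀ z = (K z + character a 0ᵗ * L z) * at 0ᵗ g z
    F₊ z = (K z + character a +1ᵗ * L z) * at +1ᵗ g z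
    lemma : ∀ k l c₁ c₂ c₃ p q r → (k + c₁ * l) * p + (k + c₂ * l) * q + (k + c₃ * l) * r ≡
                                   k * (p + q + r) + l * (c₁ * p + c₂ * q + c₃ * r)
    lemma = solve-∀

  residual-∷ : ∀ d (g : Fn (suc n)) a x →
               residual d g (a ∷ x) ≡ residual d (sum₃ g) x + residual (ℕ.pred d) (deviation a g) x
  residual-∷ {n} d g a x = trans (cong (λ t → (+ 3) ^ suc n * g (a ∷ x) - t) (smooth-∷ d g a x)) (go a)
    where
    S = smooth d (sum₃ g) x
    go : ∀ a → (+ 3) ^ suc n * g (a ∷ x) - (S + smooth (ℕ.pred d) (deviation a g) x) ≡
               ((+ 3) ^ n * sum₃ g x - S) + ((+ 3) ^ n * deviation a g x - smooth (ℕ.pred d) (deviation a g) x)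
    go −1ᵗ = lemma ((+ 3) ^ n) (at −1ᵗ g x) (at 0ᵗ g x) (at +1ᵗ g x) S (smooth (ℕ.pred d) (deviation −1ᵗ g) x)
      where
      lemma : ∀ N p q r s t → + 3 * N * p - (s + t) ≡
        (N * (p + q + r) - s) + (N * (+ 2 * p + -1ℤ * q + -1ℤ * r) - t)
      lemma = solve-∀
    go 0ᵗ = lemma ((+ 3) ^ n) (at −1ᵗ g x) (at 0ᵗ g x) (at +1ᵗ g x) S (smooth (ℕ.pred d) (deviation 0ᵗ g) x)
      where
      lemma : ∀ N p q r s t → + 3 * N * q - (s + t) ≡
        (N * (p + q + r) - s) + (N * (-1ℤ * p + + 2 * q + -1ℤ * r) - t)
      lemma = solve-∀
    go +1ᵗ = lemma ((+ 3) ^ n) (at −1ᵗ g x) (at 0ᵗ g x) (at +1ᵗ g x) S (smooth (ℕ.pred d) (deviation +1ᵗ g) x)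
      where
      lemma : ∀ N p q r s t → + 3 * N * r - (s + t) ≡
        (N * (p + q + r) - s) + (N * (-1ℤ * p + -1ℤ * q + + 2 * r) - t)
      lemma = solve-∀

  square : ℤ → ℤ
  square a = a * a

  -- The deviations of three values from their mean add up to zero, so their products with `ρ`
  -- cancel, and the sum of their squares is three times that of the pairwise differences. This
  -- matches the recursion of `energy`.
  residual-energy : ∀ n d (g : Fn n) → cube (λ x → square (residual d g x)) ≡ (+ 3) ^ n * highEnergy d g
  residual-energy zero zero g = lemma (g [])
    where
    lemma : ∀ a → (1ℤ * a - 0ℤ * a) * (1ℤ * a - 0ℤ * a) ≡ 1ℤ * (1ℤ * (a * a))
    lemma = solve-∀
  residual-energy zero (suc d) g = lemma (g [])
    where
    lemma : ∀ a → (1ℤ * a - 1ℤ * a) * (1ℤ * a - 1ℤ * a) ≡ 1ℤ * (0ℤ * (a * a))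
    lemma = solve-∀
  residual-energy (suc n) d g = begin
    cube (λ x → square (residual d g (−1ᵗ ∷ x))) + cube (λ x → square (residual d g (0ᵗ ∷ x))) +
    cube (λ x → square (residual d g (+1ᵗ ∷ x)))
      ≡⟨ trans (cong (_+ cube (sq +1ᵗ)) (sym (cube-+ (sq −1ᵗ) (sq 0ᵗ)))) (sym (cube-+ (λ x → sq −1ᵗ x + sq 0ᵗ x) (sq +1ᵗ))) ⟩
    cube (λ x → sq −1ᵗ x + sq 0ᵗ x + sq +1ᵗ x)
      ≡⟨ cube-cong pointwise ⟩
    cube (λ x → + 3 * (square (ρ x) + (square (Δ diff₁ x) + square (Δ diff₂ x) + square (Δ diff₃ x))))
      ≡⟨ cube-* (+ 3) (λ x → square (ρ x) + (square (Δ diff₁ x) + square (Δ diff₂ x) + square (Δ diff₃ x))) ⟩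
    + 3 * cube (λ x → square (ρ x) + (square (Δ diff₁ x) + square (Δ diff₂ x) + square (Δ diff₃ x)))
      ≡⟨ cong (+ 3 *_) (trans (cube-+ (λ x → square (ρ x)) _) (cong (λ t → cube (λ x → square (ρ x)) + t)
           (trans (cube-+ (λ x → square (Δ diff₁ x) + square (Δ diff₂ x)) (λ x → square (Δ diff₃ x)))
                  (cong (_+ cube (λ x → square (Δ diff₃ x))) (cube-+ (λ x → square (Δ diff₁ x)) (λ x → square (Δ diff₂ x))))))) ⟩
    + 3 * (cube (λ x → square (ρ x)) +
           (cube (λ x → square (Δ diff₁ x)) + cube (λ x → square (Δ diff₂ x)) + cube (λ x → square (Δ diff₃ x))))
      ≡⟨ cong (+ 3 *_) (cong₄ _ _ _ _ (residual-energy n d (sum₃ g)) (residual-energy n (ℕ.pred d) (diff₁ g))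
           (residual-energy n (ℕ.pred d) (diff₂ g)) (residual-energy n (ℕ.pred d) (diff₃ g))) ⟩
    + 3 * ((+ 3) ^ n * highEnergy d (sum₃ g) +
           ((+ 3) ^ n * highEnergy (ℕ.pred d) (diff₁ g) + (+ 3) ^ n * highEnergy (ℕ.pred d) (diff₂ g) + (+ 3) ^ n * highEnergy (ℕ.pred d) (diff₃ g)))
      ≡⟨ lemma ((+ 3) ^ n) (highEnergy d (sum₃ g)) (highEnergy (ℕ.pred d) (diff₁ g)) (highEnergy (ℕ.pred d) (diff₂ g)) (highEnergy (ℕ.pred d) (diff₃ g)) ⟩
    (+ 3) ^ suc n * (highEnergy d (sum₃ g) + (highEnergy (ℕ.pred d) (diff₁ g) + highEnergy (ℕ.pred d) (diff₂ g) + highEnergy (ℕ.pred d) (diff₃ g)))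
      ≡⟨ cong ((+ 3) ^ suc n *_) (cong₄ (highEnergy d (sum₃ g)) _ _ _ refl (shift (diff₁ g)) (shift (diff₂ g)) (shift (diff₃ g))) ⟩
    (+ 3) ^ suc n * highEnergy d g ∎
    where
    open ≡-Reasoning
    sq : Trit → Fn n
    sq a x = square (residual d g (a ∷ x))
    ρ : Fn n
    ρ = residual d (sum₃ g)
    Δ : (Fn (suc n) → Fn n) → Fn n
    Δ op = residual (ℕ.pred d) (op g)
    r : Trit → Fn n
    r a = residual (ℕ.pred d) (at a g)
    atLeast-suc : ∀ d i → atLeast (ℕ.pred d) i ≡ atLeast d (suc i)
    atLeast-suc zero    i = refl
    atLeast-suc (suc d) i = refl
    shift : ∀ (h : Fn n) → highEnergy (ℕ.pred d) h ≡ energy n (λ i _ → atLeast d (suc i)) h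
    shift h = energy-cong n (λ i _ → atLeast-suc d i) (λ _ → refl)
    lemma : ∀ N a b c e → + 3 * (N * a + (N * b + N * c + N * e)) ≡ + 3 * N * (a + (b + c + e))
    lemma = solve-∀
    residual-cong : ∀ {g h : Fn n} → (∀ x → g x ≡ h x) → ∀ x → residual (ℕ.pred d) g x ≡ residual (ℕ.pred d) h x
    residual-cong e x = cong₂ _-_ (cong ((+ 3) ^ n *_) (e x)) (cube-cong (λ z → cong (kernel (ℕ.pred d) x z *_) (e z)))
    combination : ∀ (h : Fn n) j k l → (∀ x → h x ≡ j * at −1ᵗ g x + k * at 0ᵗ g x + l * at +1ᵗ g x) → ∀ x →
                  residual (ℕ.pred d) h x ≡ j * r −1ᵗ x + k * r 0ᵗ x + l * r +1ᵗ x
    combination h j k l e x = trans (residual-cong e x) (residual-linear (ℕ.pred d) j k l (at −1ᵗ g) (at 0ᵗ g) (at +1ᵗ g) x)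
    split : ∀ a x → residual d g (a ∷ x) ≡
            ρ x + (character a −1ᵗ * r −1ᵗ x + character a 0ᵗ * r 0ᵗ x + character a +1ᵗ * r +1ᵗ x)
    split a x = trans (residual-∷ d g a x) (cong (λ t → ρ x + t)
      (combination (deviation a g) (character a −1ᵗ) (character a 0ᵗ) (character a +1ᵗ) (λ _ → refl) x))
    pointwise : ∀ x → sq −1ᵗ x + sq 0ᵗ x + sq +1ᵗ x ≡
      + 3 * (square (ρ x) + (square (Δ diff₁ x) + square (Δ diff₂ x) + square (Δ diff₃ x)))
    pointwise x = begin
      sq −1ᵗ x + sq 0ᵗ x + sq +1ᵗ x
        ≡⟨ cong₂ _+_ (cong₂ _+_ (cong square (split −1ᵗ x)) (cong square (split 0ᵗ x))) (cong square (split +1ᵗ x)) ⟩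
      _ ≡⟨ identity (ρ x) (r −1ᵗ x) (r 0ᵗ x) (r +1ᵗ x) ⟩
      + 3 * (square (ρ x) + (square (1ℤ * r −1ᵗ x + -1ℤ * r 0ᵗ x + 0ℤ * r +1ᵗ x) +
                             square (0ℤ * r −1ᵗ x + 1ℤ * r 0ᵗ x + -1ℤ * r +1ᵗ x) +
                             square (1ℤ * r −1ᵗ x + 0ℤ * r 0ᵗ x + -1ℤ * r +1ᵗ x)))
        ≡⟨ cong (λ t → + 3 * (square (ρ x) + t)) (cong₂ _+_ (cong₂ _+_
             (cong square (combination (diff₁ g) 1ℤ -1ℤ 0ℤ (λ y → d₁ (at −1ᵗ g y) (at 0ᵗ g y) (at +1ᵗ g y)) x))
             (cong square (combination (diff₂ g) 0ℤ 1ℤ -1ℤ (λ y → d₂ (at −1ᵗ g y) (at 0ᵗ g y) (at +1ᵗ g y)) x)))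
             (cong square (combination (diff₃ g) 1ℤ 0ℤ -1ℤ (λ y → d₃ (at −1ᵗ g y) (at 0ᵗ g y) (at +1ᵗ g y)) x))) ⟨
      + 3 * (square (ρ x) + (square (Δ diff₁ x) + square (Δ diff₂ x) + square (Δ diff₃ x))) ∎
      where
      identity : ∀ ρ p q r →
        (ρ + (+ 2 * p + -1ℤ * q + -1ℤ * r)) * (ρ + (+ 2 * p + -1ℤ * q + -1ℤ * r)) +
        (ρ + (-1ℤ * p + + 2 * q + -1ℤ * r)) * (ρ + (-1ℤ * p + + 2 * q + -1ℤ * r)) +
        (ρ + (-1ℤ * p + -1ℤ * q + + 2 * r)) * (ρ + (-1ℤ * p + -1ℤ * q + + 2 * r)) ≡
        + 3 * (ρ * ρ + ((1ℤ * p + -1ℤ * q + 0ℤ * r) * (1ℤ * p + -1ℤ * q + 0ℤ * r) +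
                        (0ℤ * p + 1ℤ * q + -1ℤ * r) * (0ℤ * p + 1ℤ * q + -1ℤ * r) +
                        (1ℤ * p + 0ℤ * q + -1ℤ * r) * (1ℤ * p + 0ℤ * q + -1ℤ * r)))
      identity = solve-∀
      d₁ : ∀ p q r → p - q ≡ 1ℤ * p + -1ℤ * q + 0ℤ * r
      d₁ = solve-∀
      d₂ : ∀ p q r → q - r ≡ 0ℤ * p + 1ℤ * q + -1ℤ * r
      d₂ = solve-∀
      d₃ : ∀ p q r → p - r ≡ 1ℤ * p + 0ℤ * q + -1ℤ * r
      d₃ = solve-∀

-- High-degree energy is bounded by noise sensitivity.

module EnergyTail where

  open import Data.Bool.Base using (Bool; true; false; _xor_)
  open import Data.Integer.Base hiding (suc; pred)
  open import Data.Integer.Properties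
  open import Data.Integer.Tactic.RingSolver using (solve-∀)
  open import Data.Nat.Base as ℕ using (ℕ; zero; suc)
  import Data.Nat.Properties as ℕ
  import Data.Nat.Tactic.RingSolver as ℕSolver
  open import Data.Vec.Base using ([]; _∷_)
  open import Function.Base using (_∘_)
  open import Relation.Binary.PropositionalEquality hiding ([_]; J)
  open import Relation.Nullary using (yes; no)
  open import Defs using (Point; Subset; Trit; −1ᵗ; 0ᵗ; +1ᵗ)
  open Words using (𝟙)
  open WindowAveraging using (pairSum; disagree; LinearlySeparable)
  open NoiseSensitivity using (slice; noise-bound)
  open EfronStein

  private variable
    n : ℕ

  Fn₂ : ℕ → Set
  Fn₂ n = Point n → Point n → ℤ

  at₂ : Trit → Trit → Fn₂ (suc n) → Fn₂ n
  at₂ s t q v x = q (s ∷ v) (t ∷ x)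

  -- The integer analogue of pairSum with weights k, 1 and k + 1.
  pairs : ℕ → Fn₂ n → ℤ
  pairs {zero}  k q = q [] []
  pairs {suc n} k q =
    + k * (pairs k (at₂ +1ᵗ +1ᵗ q) + pairs k (at₂ −1ᵗ −1ᵗ q)) +
    (pairs k (at₂ 0ᵗ +1ᵗ q) + pairs k (at₂ 0ᵗ −1ᵗ q)) +
    (1ℤ + + k) * pairs k (at₂ 0ᵗ 0ᵗ q)

  pairs-cong : ∀ k {q r : Fn₂ n} → (∀ v x → q v x ≡ r v x) → pairs k q ≡ pairs k r
  pairs-cong {zero}  k e = e [] []
  pairs-cong {suc n} k e = cong₂ _+_
    (cong₂ _+_
      (cong (+ k *_) (cong₂ _+_ (pairs-cong k (λ v x → e (+1ᵗ ∷ v) (+1ᵗ ∷ x))) (pairs-cong k (λ v x → e (−1ᵗ ∷ v) (−1ᵗ ∷ x)))))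
      (cong₂ _+_ (pairs-cong k (λ v x → e (0ᵗ ∷ v) (+1ᵗ ∷ x))) (pairs-cong k (λ v x → e (0ᵗ ∷ v) (−1ᵗ ∷ x)))))
    (cong ((1ℤ + + k) *_) (pairs-cong k (λ v x → e (0ᵗ ∷ v) (0ᵗ ∷ x))))

  pairs-+ : ∀ k (q r : Fn₂ n) → pairs k (λ v x → q v x + r v x) ≡ pairs k q + pairs k r
  pairs-+ {zero}  k q r = refl
  pairs-+ {suc n} k q r = trans
    (cong₂ _+_ (cong₂ _+_ (cong (+ k *_) (cong₂ _+_ (ih +1ᵗ +1ᵗ) (ih −1ᵗ −1ᵗ))) (cong₂ _+_ (ih 0ᵗ +1ᵗ) (ih 0ᵗ −1ᵗ)))
               (cong ((1ℤ + + k) *_) (ih 0ᵗ 0ᵗ)))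
    (lemma (+ k) (Q +1ᵗ +1ᵗ) (R +1ᵗ +1ᵗ) (Q −1ᵗ −1ᵗ) (R −1ᵗ −1ᵗ) (Q 0ᵗ +1ᵗ) (R 0ᵗ +1ᵗ) (Q 0ᵗ −1ᵗ) (R 0ᵗ −1ᵗ) (Q 0ᵗ 0ᵗ) (R 0ᵗ 0ᵗ))
    where
    Q R : Trit → Trit → ℤ
    Q s t = pairs k (at₂ s t q)
    R s t = pairs k (at₂ s t r)
    ih : ∀ s t → pairs k (at₂ s t (λ v x → q v x + r v x)) ≡ Q s t + R s t
    ih s t = pairs-+ k (at₂ s t q) (at₂ s t r)
    lemma : ∀ k a a′ b b′ c c′ d d′ e e′ →
      k * ((a + a′) + (b + b′)) + ((c + c′) + (d + d′)) + (1ℤ + k) * (e + e′) ≡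
      (k * (a + b) + (c + d) + (1ℤ + k) * e) + (k * (a′ + b′) + (c′ + d′) + (1ℤ + k) * e′)
    lemma = solve-∀

  pairs-* : ∀ k j (q : Fn₂ n) → pairs k (λ v x → j * q v x) ≡ j * pairs k q
  pairs-* {zero}  k j q = refl
  pairs-* {suc n} k j q = trans
    (cong₂ _+_ (cong₂ _+_ (cong (+ k *_) (cong₂ _+_ (ih +1ᵗ +1ᵗ) (ih −1ᵗ −1ᵗ))) (cong₂ _+_ (ih 0ᵗ +1ᵗ) (ih 0ᵗ −1ᵗ)))
               (cong ((1ℤ + + k) *_) (ih 0ᵗ 0ᵗ)))
    (lemma (+ k) j (Q +1ᵗ +1ᵗ) (Q −1ᵗ −1ᵗ) (Q 0ᵗ +1ᵗ) (Q 0ᵗ −1ᵗ) (Q 0ᵗ 0ᵗ))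
    where
    Q : Trit → Trit → ℤ
    Q s t = pairs k (at₂ s t q)
    ih : ∀ s t → pairs k (at₂ s t (λ v x → j * q v x)) ≡ j * Q s t
    ih s t = pairs-* k j (at₂ s t q)
    lemma : ∀ k j a b c d e → k * (j * a + j * b) + (j * c + j * d) + (1ℤ + k) * (j * e) ≡
                              j * (k * (a + b) + (c + d) + (1ℤ + k) * e)
    lemma = solve-∀

  pairs-upper : ∀ k (g : Fn n) → pairs k (λ v x → g x) ≡ (1ℤ + + k) ^ n * cube g
  pairs-upper {zero}  k g = sym (*-identityˡ (g []))
  pairs-upper {suc n} k g = trans
    (cong₂ _+_ (cong₂ _+_ (cong (+ k *_) (cong₂ _+_ (pairs-upper k (at +1ᵗ g)) (pairs-upper k (at −1ᵗ g))))
                          (cong₂ _+_ (pairs-upper k (at +1ᵗ g)) (pairs-upper k (at −1ᵗ g))))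
               (cong ((1ℤ + + k) *_) (pairs-upper k (at 0ᵗ g))))
    (lemma (+ k) ((1ℤ + + k) ^ n) (cube (at −1ᵗ g)) (cube (at 0ᵗ g)) (cube (at +1ᵗ g)))
    where
    lemma : ∀ k N a b c → k * (N * c + N * a) + (N * c + N * a) + (1ℤ + k) * (N * b) ≡ (1ℤ + k) * N * (a + b + c)
    lemma = solve-∀

  gap : Fn n → Fn n → Fn₂ n
  gap g h v x = square (g x - h v)

  -- A function of the lower point is at most as good an approximation of g
  -- as the conditional expectation of g given the unresampled coordinates.
  noise-energy : ∀ n k (g h : Fn n) →
    (1ℤ + + k) ^ n * ((+ 3) ^ n * cube (square ∘ g)) ≤
    energy n (λ i o → (+ k) ^ i * (1ℤ + + k) ^ o) g + (+ 3) ^ n * pairs k (gap g h)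
  noise-energy zero k g h = subst₂ _≤_ (lemma₁ (g []))
    (lemma₂ (g []) (h [])) (+-monoʳ-≤ (square (g [])) (square-nonNeg (g [] - h [])))
    where
    lemma₁ : ∀ a → a * a + 0ℤ ≡ 1ℤ * (1ℤ * (a * a))
    lemma₁ = solve-∀
    lemma₂ : ∀ a b → a * a + (a - b) * (a - b) ≡ 1ℤ * 1ℤ * (a * a) + 1ℤ * ((a - b) * (a - b))
    lemma₂ = solve-∀
  -- With weight k the first coordinate is kept, and the hypothesis applies to each restriction of
  -- g. With weight 1 it is resampled while the lower point has 0ᵗ there, and the hypothesis applies
  -- to the sum of the restrictions.
  noise-energy (suc n) k g h = begin
    (1ℤ + + k) ^ suc n * ((+ 3) ^ suc n * cube (square ∘ g))
      ≡⟨ lemma₁ (+ k) ((1ℤ + + k) ^ n) ((+ 3) ^ n) (C −1ᵗ) (C 0ᵗ) (C +1ᵗ) Cs ⟩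
    (+ 3 * + k) * (N * (M * C −1ᵗ) + N * (M * C 0ᵗ) + N * (M * C +1ᵗ)) + N * (M * Cs) + rest
      ≤⟨ +-monoˡ-≤ rest (+-mono-≤
           (*-monoˡ-≤-nonNeg (+ 3 * + k) {{nonneg}} (+-mono-≤ (+-mono-≤ (ih −1ᵗ) (ih 0ᵗ)) (ih +1ᵗ)))
           (noise-energy n k (sum₃ g) (λ v → + 3 * at 0ᵗ h v))) ⟩
    (+ 3 * + k) * ((H (at −1ᵗ g) + M * P −1ᵗ −1ᵗ) + (H (at 0ᵗ g) + M * P 0ᵗ 0ᵗ) + (H (at +1ᵗ g) + M * P +1ᵗ +1ᵗ)) +
    (H (sum₃ g) + M * pairs k (gap (sum₃ g) (λ v → + 3 * at 0ᵗ h v))) + rest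
      ≡⟨ lemma₂ (+ k) M N (H (at −1ᵗ g)) (H (at 0ᵗ g)) (H (at +1ᵗ g)) (H (sum₃ g))
                (P −1ᵗ −1ᵗ) (P 0ᵗ 0ᵗ) (P +1ᵗ +1ᵗ) (pairs k (gap (sum₃ g) (λ v → + 3 * at 0ᵗ h v)))
                (C −1ᵗ) (C 0ᵗ) (C +1ᵗ) Cs ⟩
    H (sum₃ g) + + k * (+ 3 * (H (at −1ᵗ g) + H (at 0ᵗ g) + H (at +1ᵗ g))) +
    M * (+ 3 * + k * (P −1ᵗ −1ᵗ + P 0ᵗ 0ᵗ + P +1ᵗ +1ᵗ) +
         (pairs k (gap (sum₃ g) (λ v → + 3 * at 0ᵗ h v)) + N * (+ 3 * (C −1ᵗ + C 0ᵗ + C +1ᵗ) - Cs)))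
      ≡⟨ cong₂ (λ s t → s + M * (+ 3 * + k * (P −1ᵗ −1ᵗ + P 0ᵗ 0ᵗ + P +1ᵗ +1ᵗ) + t)) energies cross ⟩
    energy (suc n) (λ i o → (+ k) ^ i * (1ℤ + + k) ^ o) g +
    M * (+ 3 * + k * (P −1ᵗ −1ᵗ + P 0ᵗ 0ᵗ + P +1ᵗ +1ᵗ) + + 3 * (P −1ᵗ 0ᵗ + P 0ᵗ 0ᵗ + P +1ᵗ 0ᵗ))
      ≡⟨ cong (λ t → energy (suc n) (λ i o → (+ k) ^ i * (1ℤ + + k) ^ o) g + t)
           (lemma₃ (+ k) M (P +1ᵗ +1ᵗ) (P −1ᵗ −1ᵗ) (P +1ᵗ 0ᵗ) (P −1ᵗ 0ᵗ) (P 0ᵗ 0ᵗ)) ⟩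
    energy (suc n) (λ i o → (+ k) ^ i * (1ℤ + + k) ^ o) g + (+ 3) ^ suc n * pairs k (gap g h) ∎
    where
    open ≤-Reasoning
    N M Cs rest : ℤ
    N = (1ℤ + + k) ^ n
    M = (+ 3) ^ n
    C : Trit → ℤ
    C a = cube (square ∘ at a g)
    Cs = cube (square ∘ sum₃ g)
    rest = N * (M * (+ 3 * (C −1ᵗ + C 0ᵗ + C +1ᵗ) - Cs))
    H : Fn n → ℤ
    H = energy n (λ i o → (+ k) ^ i * (1ℤ + + k) ^ o)
    P : Trit → Trit → ℤ
    P a b = pairs k (gap (at a g) (at b h))
    nonneg : NonNegative (+ 3 * + k)
    nonneg = nonNegative (subst (0ℤ ≤_) (pos-* 3 k) (+≤+ ℕ.z≤n))
    ih : ∀ a → N * (M * C a) ≤ H (at a g) + M * P a a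
    ih a = noise-energy n k (at a g) (at a h)
    lemma₁ : ∀ k N M a b c s → (1ℤ + k) * N * (+ 3 * M * (a + b + c)) ≡
      (+ 3 * k) * (N * (M * a) + N * (M * b) + N * (M * c)) + N * (M * s) + N * (M * (+ 3 * (a + b + c) - s))
    lemma₁ = solve-∀
    lemma₂ : ∀ k M N h₁ h₂ h₃ hₛ p₁ p₂ p₃ pₛ a b c s →
      (+ 3 * k) * ((h₁ + M * p₁) + (h₂ + M * p₂) + (h₃ + M * p₃)) + (hₛ + M * pₛ) + N * (M * (+ 3 * (a + b + c) - s)) ≡
      hₛ + k * (+ 3 * (h₁ + h₂ + h₃)) +
      M * (+ 3 * k * (p₁ + p₂ + p₃) + (pₛ + N * (+ 3 * (a + b + c) - s)))
    lemma₂ = solve-∀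
    lemma₃ : ∀ k M p q r s t → M * (+ 3 * k * (q + t + p) + + 3 * (s + t + r)) ≡
                               + 3 * M * (k * (p + q) + (r + s) + (1ℤ + k) * t)
    lemma₃ = solve-∀
    energies : H (sum₃ g) + + k * (+ 3 * (H (at −1ᵗ g) + H (at 0ᵗ g) + H (at +1ᵗ g))) ≡
               energy (suc n) (λ i o → (+ k) ^ i * (1ℤ + + k) ^ o) g
    energies = begin-equality
      H (sum₃ g) + + k * (+ 3 * (H (at −1ᵗ g) + H (at 0ᵗ g) + H (at +1ᵗ g)))
        ≡⟨ cong (λ t → H (sum₃ g) + + k * t) (energy-parallelogram n _ (at −1ᵗ g) (at 0ᵗ g) (at +1ᵗ g)) ⟨
      H (sum₃ g) + + k * (H (sum₃ g) + (H (diff₁ g) + H (diff₂ g) + H (diff₃ g)))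
        ≡⟨ lemma (+ k) (H (sum₃ g)) (H (diff₁ g)) (H (diff₂ g)) (H (diff₃ g)) ⟩
      (1ℤ + + k) * H (sum₃ g) + (+ k * H (diff₁ g) + + k * H (diff₂ g) + + k * H (diff₃ g))
        ≡⟨ cong₄ _ _ _ _
             (trans (sym (energy-* n (1ℤ + + k) _ (sum₃ g)))
                    (energy-cong n (λ i o → swap (1ℤ + + k) ((+ k) ^ i) ((1ℤ + + k) ^ o)) (λ _ → refl)))
             (up (diff₁ g)) (up (diff₂ g)) (up (diff₃ g)) ⟩
      energy (suc n) (λ i o → (+ k) ^ i * (1ℤ + + k) ^ o) g ∎
      where
      lemma : ∀ k s a b c → s + k * (s + (a + b + c)) ≡ (1ℤ + k) * s + (k * a + k * b + k * c)
      lemma = solve-∀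
      swap : ∀ κ a b → κ * (a * b) ≡ a * (κ * b)
      swap = solve-∀
      up : ∀ (e : Fn n) → + k * H e ≡ energy n (λ i o → (+ k) ^ suc i * (1ℤ + + k) ^ o) e
      up e = trans (sym (energy-* n (+ k) _ e))
                   (energy-cong n (λ i o → sym (*-assoc (+ k) ((+ k) ^ i) ((1ℤ + + k) ^ o))) (λ _ → refl))
    cross : pairs k (gap (sum₃ g) (λ v → + 3 * at 0ᵗ h v)) + N * (+ 3 * (C −1ᵗ + C 0ᵗ + C +1ᵗ) - Cs) ≡
            + 3 * (P −1ᵗ 0ᵗ + P 0ᵗ 0ᵗ + P +1ᵗ 0ᵗ)
    cross = begin-equality
      pairs k (gap (sum₃ g) (λ v → + 3 * at 0ᵗ h v)) + N * (+ 3 * (C −1ᵗ + C 0ᵗ + C +1ᵗ) - Cs)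
        ≡⟨ cong (λ t → pairs k (gap (sum₃ g) (λ v → + 3 * at 0ᵗ h v)) + N * t) marginal ⟨
      pairs k (gap (sum₃ g) (λ v → + 3 * at 0ᵗ h v)) + N * cube spread
        ≡⟨ cong (λ t → pairs k (gap (sum₃ g) (λ v → + 3 * at 0ᵗ h v)) + t) (pairs-upper k spread) ⟨
      pairs k (gap (sum₃ g) (λ v → + 3 * at 0ᵗ h v)) + pairs k (λ v x → spread x)
        ≡⟨ pairs-+ k (gap (sum₃ g) (λ v → + 3 * at 0ᵗ h v)) (λ v x → spread x) ⟨
      pairs k (λ v x → gap (sum₃ g) (λ v → + 3 * at 0ᵗ h v) v x + spread x)
        ≡⟨ pairs-cong k (λ v x → identity (at −1ᵗ g x) (at 0ᵗ g x) (at +1ᵗ g x) (at 0ᵗ h v)) ⟩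
      pairs k (λ v x → + 3 * (gap (at −1ᵗ g) (at 0ᵗ h) v x + gap (at 0ᵗ g) (at 0ᵗ h) v x + gap (at +1ᵗ g) (at 0ᵗ h) v x))
        ≡⟨ pairs-* k (+ 3) (λ v x → gap (at −1ᵗ g) (at 0ᵗ h) v x + gap (at 0ᵗ g) (at 0ᵗ h) v x + gap (at +1ᵗ g) (at 0ᵗ h) v x) ⟩
      + 3 * pairs k (λ v x → gap (at −1ᵗ g) (at 0ᵗ h) v x + gap (at 0ᵗ g) (at 0ᵗ h) v x + gap (at +1ᵗ g) (at 0ᵗ h) v x)
        ≡⟨ cong (+ 3 *_) (trans (pairs-+ k (λ v x → gap (at −1ᵗ g) (at 0ᵗ h) v x + gap (at 0ᵗ g) (at 0ᵗ h) v x) (gap (at +1ᵗ g) (at 0ᵗ h)))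
             (cong (_+ P +1ᵗ 0ᵗ) (pairs-+ k (gap (at −1ᵗ g) (at 0ᵗ h)) (gap (at 0ᵗ g) (at 0ᵗ h))))) ⟩
      + 3 * (P −1ᵗ 0ᵗ + P 0ᵗ 0ᵗ + P +1ᵗ 0ᵗ) ∎
      where
      q : Trit → Fn n
      q a = square ∘ at a g
      -- Nine times the variance of the three values at x. It is the difference between
      -- approximating each value by the same number and approximating their mean by it.
      spread : Fn n
      spread x = + 3 * (q −1ᵗ x + q 0ᵗ x + q +1ᵗ x) + -1ℤ * square (sum₃ g x)
      marginal : cube spread ≡ + 3 * (C −1ᵗ + C 0ᵗ + C +1ᵗ) - Cs
      marginal = begin-equality
        cube spread
          ≡⟨ cube-+ (λ x → + 3 * (q −1ᵗ x + q 0ᵗ x + q +1ᵗ x)) (λ x → -1ℤ * square (sum₃ g x)) ⟩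
        cube (λ x → + 3 * (q −1ᵗ x + q 0ᵗ x + q +1ᵗ x)) + cube (λ x → -1ℤ * square (sum₃ g x))
          ≡⟨ cong₂ _+_
               (trans (cube-* (+ 3) (λ x → q −1ᵗ x + q 0ᵗ x + q +1ᵗ x)) (cong (+ 3 *_) (trans (cube-+ (λ x → q −1ᵗ x + q 0ᵗ x) (q +1ᵗ))
                 (cong (_+ C +1ᵗ) (cube-+ (q −1ᵗ) (q 0ᵗ))))))
               (trans (cube-* -1ℤ (square ∘ sum₃ g)) (-1*i≡-i Cs)) ⟩
        + 3 * (C −1ᵗ + C 0ᵗ + C +1ᵗ) - Cs ∎
      identity : ∀ a b c h → (a + b + c - + 3 * h) * (a + b + c - + 3 * h) +
        (+ 3 * (a * a + b * b + c * c) + -1ℤ * ((a + b + c) * (a + b + c))) ≡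
        + 3 * ((a - h) * (a - h) + (b - h) * (b - h) + (c - h) * (c - h))
      identity = solve-∀

  energy-scale : ∀ n κ (c : ℕ → ℕ → ℤ) g → energy n (λ i o → κ ^ i * κ ^ o * c i o) g ≡ κ ^ n * energy n c g
  energy-scale zero    κ c g = lemma (c 0 0) (g [] * g [])
    where
    lemma : ∀ a b → 1ℤ * 1ℤ * a * b ≡ 1ℤ * (a * b)
    lemma = solve-∀
  energy-scale (suc n) κ c g = trans
    (cong₄ _ _ _ _ (step (λ i o → c i (suc o)) (λ i o → lemma₁ κ (κ ^ i) (κ ^ o) (c i (suc o))) (sum₃ g))
      (step (c ∘ suc) (λ i o → lemma₂ κ (κ ^ i) (κ ^ o) (c (suc i) o)) (diff₁ g))
      (step (c ∘ suc) (λ i o → lemma₂ κ (κ ^ i) (κ ^ o) (c (suc i) o)) (diff₂ g))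
      (step (c ∘ suc) (λ i o → lemma₂ κ (κ ^ i) (κ ^ o) (c (suc i) o)) (diff₃ g)))
    (collect κ (κ ^ n) (energy n (λ i o → c i (suc o)) (sum₃ g)) (energy n (c ∘ suc) (diff₁ g))
       (energy n (c ∘ suc) (diff₂ g)) (energy n (c ∘ suc) (diff₃ g)))
    where
    step : ∀ (d : ℕ → ℕ → ℤ) {e : ℕ → ℕ → ℤ} → (∀ i o → e i o ≡ κ * (κ ^ i * κ ^ o * d i o)) →
           ∀ h → energy n e h ≡ κ * (κ ^ n * energy n d h)
    step d eq h = trans (energy-cong n eq (λ _ → refl))
      (trans (energy-* n κ _ h) (cong (κ *_) (energy-scale n κ d h)))
    lemma₁ : ∀ κ a b c → a * (κ * b) * c ≡ κ * (a * b * c)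
    lemma₁ = solve-∀
    lemma₂ : ∀ κ a b c → κ * a * b * c ≡ κ * (a * b * c)
    lemma₂ = solve-∀
    collect : ∀ κ N a b c d → κ * (N * a) + (κ * (N * b) + κ * (N * c) + κ * (N * d)) ≡ κ * N * (a + (b + c + d))
    collect = solve-∀

  bernoulli : ∀ k i → k ℕ.^ i ℕ.* (k ℕ.+ i) ℕ.≤ suc k ℕ.^ i ℕ.* k
  bernoulli k zero    = ℕ.≤-reflexive (cong (1 ℕ.*_) (ℕ.+-identityʳ k))
  bernoulli k (suc i) = begin
    k ℕ.* k ℕ.^ i ℕ.* (k ℕ.+ suc i)
      ≤⟨ ℕ.m≤m+n _ (k ℕ.^ i ℕ.* i) ⟩
    k ℕ.* k ℕ.^ i ℕ.* (k ℕ.+ suc i) ℕ.+ k ℕ.^ i ℕ.* i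
      ≡⟨ lemma₁ k i (k ℕ.^ i) ⟩
    suc k ℕ.* (k ℕ.^ i ℕ.* (k ℕ.+ i))
      ≤⟨ ℕ.*-monoʳ-≤ (suc k) (bernoulli k i) ⟩
    suc k ℕ.* (suc k ℕ.^ i ℕ.* k)
      ≡⟨ ℕ.*-assoc (suc k) (suc k ℕ.^ i) k ⟨
    suc k ℕ.^ suc i ℕ.* k ∎
    where
    open ℕ.≤-Reasoning
    lemma₁ : ∀ k i x → k ℕ.* x ℕ.* (k ℕ.+ suc i) ℕ.+ x ℕ.* i ≡ suc k ℕ.* (x ℕ.* (k ℕ.+ i))
    lemma₁ = ℕSolver.solve-∀

  halving : ∀ k i → suc k ℕ.≤ i → 2 ℕ.* k ℕ.^ i ℕ.≤ suc k ℕ.^ i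
  halving zero    (suc i) _ = ℕ.z≤n
  halving (suc k) i       h = ℕ.*-cancelʳ-≤ _ _ (suc k) (begin
    2 ℕ.* suc k ℕ.^ i ℕ.* suc k         ≡⟨ lemma (suc k) (suc k ℕ.^ i) ⟩
    suc k ℕ.^ i ℕ.* (suc k ℕ.+ suc k)   ≤⟨ ℕ.*-monoʳ-≤ (suc k ℕ.^ i) (ℕ.+-monoʳ-≤ (suc k) (ℕ.<⇒≤ h)) ⟩
    suc k ℕ.^ i ℕ.* (suc k ℕ.+ i)       ≤⟨ bernoulli (suc k) i ⟩
    suc (suc k) ℕ.^ i ℕ.* suc k         ∎)
    where
    open ℕ.≤-Reasoning
    lemma : ∀ a b → 2 ℕ.* b ℕ.* a ≡ b ℕ.* (a ℕ.+ a)
    lemma = ℕSolver.solve-∀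

  pos-^ : ∀ m i → + (m ℕ.^ i) ≡ (+ m) ^ i
  pos-^ m zero    = refl
  pos-^ m (suc i) = trans (pos-* m (m ℕ.^ i)) (cong (+ m *_) (pos-^ m i))

  -- A set of i > k coordinates is kept entirely with probability (k/(k + 1))ⁱ ≤ 1/2, so twice what
  -- the noise takes from its component is at least the whole. For smaller sets it is enough that
  -- the loss is nonnegative.
  atLeast-halving : ∀ k i o →
    (1ℤ + + k) ^ i * (1ℤ + + k) ^ o * atLeast (suc k) i + + 2 * ((+ k) ^ i * (1ℤ + + k) ^ o) ≤
    + 2 * ((1ℤ + + k) ^ i * (1ℤ + + k) ^ o * 1ℤ)
  atLeast-halving k i o = subst₂ _≤_ (lemma₁ ((+ suc k) ^ i) ((+ suc k) ^ o) (atLeast (suc k) i) ((+ k) ^ i)) (lemma₂ ((+ suc k) ^ i) ((+ suc k) ^ o))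
    (*-monoʳ-≤-nonNeg ((+ suc k) ^ o) {{nonNegative (subst (0ℤ ≤_) (pos-^ (suc k) o) (+≤+ ℕ.z≤n))}} (go k i))
    where
    lemma₁ : ∀ a b l c → (a * l + + 2 * c) * b ≡ a * b * l + + 2 * (c * b)
    lemma₁ = solve-∀
    lemma₂ : ∀ a b → (+ 2 * a) * b ≡ + 2 * (a * b * 1ℤ)
    lemma₂ = solve-∀
    casts : ∀ k i l → + (suc k ℕ.^ i ℕ.* l ℕ.+ 2 ℕ.* k ℕ.^ i) ≡ (+ suc k) ^ i * + l + + 2 * (+ k) ^ i
    casts k i l = trans (pos-+ (suc k ℕ.^ i ℕ.* l) (2 ℕ.* k ℕ.^ i))
      (cong₂ _+_ (trans (pos-* (suc k ℕ.^ i) l) (cong (_* + l) (pos-^ (suc k) i)))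
                 (trans (pos-* 2 (k ℕ.^ i)) (cong (+ 2 *_) (pos-^ k i))))
    cast₂ : ∀ k i → + (2 ℕ.* suc k ℕ.^ i) ≡ + 2 * (+ suc k) ^ i
    cast₂ k i = trans (pos-* 2 (suc k ℕ.^ i)) (cong (+ 2 *_) (pos-^ (suc k) i))
    double : ∀ x → x ℕ.* 1 ℕ.+ x ≡ 2 ℕ.* x
    double = ℕSolver.solve-∀
    atLeast-≤ : ∀ d i → d ℕ.≤ i → atLeast d i ≡ 1ℤ
    atLeast-≤ zero    i       _         = refl
    atLeast-≤ (suc d) (suc i) (ℕ.s≤s h) = atLeast-≤ d i h
    atLeast-> : ∀ d i → i ℕ.< d → atLeast d i ≡ 0ℤ
    atLeast-> (suc d) zero    _         = refl
    atLeast-> (suc d) (suc i) (ℕ.s≤s h) = atLeast-> d i h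
    go : ∀ k i → (+ suc k) ^ i * atLeast (suc k) i + + 2 * (+ k) ^ i ≤ + 2 * (+ suc k) ^ i
    go k i with suc k ℕ.≤? i
    ... | yes h = subst₂ _≤_
      (trans (casts k i 1) (cong (λ l → (+ suc k) ^ i * l + + 2 * (+ k) ^ i) (sym (atLeast-≤ (suc k) i h))))
      (cast₂ k i)
      (+≤+ (ℕ.≤-trans (ℕ.+-monoʳ-≤ (suc k ℕ.^ i ℕ.* 1) (halving k i h)) (ℕ.≤-reflexive (double (suc k ℕ.^ i)))))
    ... | no ¬h = subst₂ _≤_
      (trans (casts k i 0) (cong (λ l → (+ suc k) ^ i * l + + 2 * (+ k) ^ i) (sym (atLeast-> (suc k) i (ℕ.≰⇒> ¬h)))))
      (cast₂ k i)
      (+≤+ (ℕ.≤-trans (ℕ.≤-reflexive (cong (ℕ._+ 2 ℕ.* k ℕ.^ i) (ℕ.*-zeroʳ (suc k ℕ.^ i))))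
                      (ℕ.*-monoʳ-≤ 2 (ℕ.^-monoˡ-≤ i (ℕ.n≤1+n k)))))

  +-cancelʳ-≤ : ∀ c {a b} → a + c ≤ b + c → a ≤ b
  +-cancelʳ-≤ c {a} {b} h = subst₂ _≤_ (lemma a c) (lemma b c) (+-monoˡ-≤ (- c) h)
    where
    lemma : ∀ a c → a + c + - c ≡ a
    lemma = solve-∀

  -- Parseval's identity and `noise-energy`, with g at the lower point as the approximation of g at
  -- the upper point, bound the energy taken by the noise; `atLeast-halving` compares it with the
  -- tail.
  tail-pairs : ∀ k (g : Fn n) → (+ suc k) ^ n * highEnergy (suc k) g ≤ + 2 * ((+ 3) ^ n * pairs k (gap g g))
  tail-pairs {n} k g = +-cancelʳ-≤ (+ 2 * H) (begin
    (+ suc k) ^ n * highEnergy (suc k) g + + 2 * H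
      ≡⟨ cong₂ _+_ (energy-scale n (+ suc k) _ g) (energy-* n (+ 2) _ g) ⟨
    energy n (λ i o → (+ suc k) ^ i * (+ suc k) ^ o * atLeast (suc k) i) g +
    energy n (λ i o → + 2 * ((+ k) ^ i * (+ suc k) ^ o)) g
      ≡⟨ energy-+ n _ _ g ⟨
    energy n (λ i o → (+ suc k) ^ i * (+ suc k) ^ o * atLeast (suc k) i + + 2 * ((+ k) ^ i * (+ suc k) ^ o)) g
      ≤⟨ energy-mono n (atLeast-halving k) g ⟩
    energy n (λ i o → + 2 * ((+ suc k) ^ i * (+ suc k) ^ o * 1ℤ)) g
      ≡⟨ trans (energy-* n (+ 2) _ g) (cong (+ 2 *_) (energy-scale n (+ suc k) _ g)) ⟩
    + 2 * ((+ suc k) ^ n * energy n (λ _ _ → 1ℤ) g)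
      ≡⟨ cong (λ t → + 2 * ((+ suc k) ^ n * t)) (parseval n g) ⟩
    + 2 * ((+ suc k) ^ n * ((+ 3) ^ n * cube (square ∘ g)))
      ≤⟨ *-monoˡ-≤-nonNeg (+ 2) (noise-energy n k g g) ⟩
    + 2 * (H + (+ 3) ^ n * pairs k (gap g g))
      ≡⟨ lemma H ((+ 3) ^ n * pairs k (gap g g)) ⟩
    + 2 * ((+ 3) ^ n * pairs k (gap g g)) + + 2 * H ∎)
    where
    open ≤-Reasoning
    H : ℤ
    H = energy n (λ i o → (+ k) ^ i * (+ suc k) ^ o) g
    lemma : ∀ a b → + 2 * (a + b) ≡ + 2 * b + + 2 * a
    lemma = solve-∀

  ±1 : Bool → ℤ
  ±1 true  = 1ℤ
  ±1 false = -1ℤ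

  pairs-disagree : ∀ k (q : Point n → Point n → ℕ) → pairs k (λ v x → + q v x) ≡ + pairSum k 1 (suc k) q
  pairs-disagree {zero}  k q = refl
  pairs-disagree {suc n} k q = trans
    (cong₂ _+_ (cong₂ _+_ (cong (+ k *_) (cong₂ _+_ (ih +1ᵗ +1ᵗ) (ih −1ᵗ −1ᵗ))) (cong₂ _+_ (ih 0ᵗ +1ᵗ) (ih 0ᵗ −1ᵗ)))
               (cong (+ suc k *_) (ih 0ᵗ 0ᵗ)))
    (cong₂ _+_ (cong₂ _+_ (sym (pos-* k _)) (cong +_ (sym (ℕ.*-identityˡ _)))) (sym (pos-* (suc k) _)))
    where
    ih : ∀ s t → pairs k (λ v x → + slice s t q v x) ≡ + pairSum k 1 (suc k) (slice s t q)
    ih s t = pairs-disagree k (slice s t q)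

  -- The factor 8 is the 2 of `tail-pairs` times the squared difference 4 of two unequal labels.
  tail-disagree : ∀ k (f : Subset n) →
    (+ suc k) ^ n * highEnergy (suc k) (±1 ∘ f) ≤ + (8 ℕ.* (3 ℕ.^ n ℕ.* pairSum k 1 (suc k) (disagree f)))
  tail-disagree {n} k f = ≤-trans (tail-pairs k (±1 ∘ f)) (≤-reflexive (begin
    + 2 * ((+ 3) ^ n * pairs k (gap (±1 ∘ f) (±1 ∘ f)))
      ≡⟨ cong (λ t → + 2 * ((+ 3) ^ n * t)) (trans (pairs-cong k (λ v x → squares (f v) (f x)))
           (trans (pairs-* k (+ 4) (λ v x → + disagree f v x)) (cong (+ 4 *_) (pairs-disagree k (disagree f))))) ⟩
    + 2 * ((+ 3) ^ n * (+ 4 * + p))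
      ≡⟨ lemma ((+ 3) ^ n) (+ p) ⟩
    + 8 * ((+ 3) ^ n * + p)
      ≡⟨ trans (pos-* 8 (3 ℕ.^ n ℕ.* p)) (cong (+ 8 *_) (trans (pos-* (3 ℕ.^ n) p) (cong (_* + p) (pos-^ 3 n)))) ⟨
    + (8 ℕ.* (3 ℕ.^ n ℕ.* p)) ∎))
    where
    open ≡-Reasoning
    p = pairSum k 1 (suc k) (disagree f)
    lemma : ∀ a b → + 2 * (a * (+ 4 * b)) ≡ + 8 * (a * b)
    lemma = solve-∀
    squares : ∀ a b → square (±1 b - ±1 a) ≡ + 4 * + 𝟙 (a xor b)
    squares true  true  = refl
    squares true  false = refl
    squares false true  = refl
    squares false false = refl

  tail-antitone : ∀ {d e} → d ℕ.≤ e → (g : Fn n) → highEnergy e g ≤ highEnergy d g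
  tail-antitone {n} d≤e g = energy-mono n (λ i _ → atLeast-antitone d≤e i) g
    where
    atLeast-≤1 : ∀ e i → atLeast e i ≤ 1ℤ
    atLeast-≤1 zero    i       = ≤-refl
    atLeast-≤1 (suc e) zero    = +≤+ ℕ.z≤n
    atLeast-≤1 (suc e) (suc i) = atLeast-≤1 e i
    atLeast-antitone : ∀ {d e} → d ℕ.≤ e → ∀ i → atLeast e i ≤ atLeast d i
    atLeast-antitone {e = e} ℕ.z≤n i       = atLeast-≤1 e i
    atLeast-antitone (ℕ.s≤s h)     zero    = ≤-refl
    atLeast-antitone (ℕ.s≤s h)     (suc i) = atLeast-antitone h i

  tail-beyond : ∀ {d} → n ℕ.< d → (g : Fn n) → highEnergy d g ≡ 0ℤ
  tail-beyond {zero}  (ℕ.s≤s _) g = refl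
  tail-beyond {suc n} {suc d} (ℕ.s≤s h) g = cong₄ _ _ _ _
    (tail-beyond (ℕ.m≤n⇒m≤1+n h) (sum₃ g)) (tail-beyond h (diff₁ g)) (tail-beyond h (diff₂ g)) (tail-beyond h (diff₃ g))

  -- The noise is available for even degrees 2 m only, so d is rounded down; since d ≤ 3 m, the
  -- hypothesis 18 n s⁴ ≤ d² leaves 2 n s⁴ ≤ m². The constant 72 is the 8 of `tail-disagree` times
  -- the 9 in 8 s + 1 ≤ 9 s.
  tail-bound : ∀ {f : Subset n} → LinearlySeparable f → ∀ s d → 1 ℕ.≤ n → 1 ℕ.≤ s → 2 ℕ.≤ d →
    18 ℕ.* n ℕ.* ((s ℕ.* s) ℕ.* (s ℕ.* s)) ℕ.≤ d ℕ.* d →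
    + s * highEnergy d (±1 ∘ f) ≤ + (72 ℕ.* 9 ℕ.^ n)
  tail-bound {n} {f} sep s d n>0 s>0 d≥2 small = go (ℕ.⌊ d /2⌋) (ℕ.⌊n/2⌋-mono d≥2) 2m≤d d≤2m+1
    where
    d≡ : ℕ.⌊ d /2⌋ ℕ.+ ℕ.⌈ d /2⌉ ≡ d
    d≡ = ℕ.⌊n/2⌋+⌈n/2⌉≡n d
    2m≤d : 2 ℕ.* ℕ.⌊ d /2⌋ ℕ.≤ d
    2m≤d = ℕ.≤-trans (ℕ.+-monoʳ-≤ ℕ.⌊ d /2⌋ (ℕ.≤-trans (ℕ.≤-reflexive (ℕ.+-identityʳ _)) (ℕ.⌊n/2⌋≤⌈n/2⌉ d))) (ℕ.≤-reflexive d≡)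
    d≤2m+1 : d ℕ.≤ 2 ℕ.* ℕ.⌊ d /2⌋ ℕ.+ 1
    d≤2m+1 = ℕ.≤-trans (ℕ.≤-reflexive (sym d≡)) (ℕ.≤-trans (ℕ.+-monoʳ-≤ ℕ.⌊ d /2⌋ (ceil d)) (ℕ.≤-reflexive (lemma ℕ.⌊ d /2⌋)))
      where
      ceil : ∀ d → ℕ.⌈ d /2⌉ ℕ.≤ ℕ.⌊ d /2⌋ ℕ.+ 1
      ceil zero          = ℕ.z≤n
      ceil (suc zero)    = ℕ.≤-refl
      ceil (suc (suc d)) = ℕ.s≤s (ceil d)
      lemma : ∀ m → m ℕ.+ (m ℕ.+ 1) ≡ 2 ℕ.* m ℕ.+ 1
      lemma = ℕSolver.solve-∀
    go : ∀ m → 1 ℕ.≤ m → 2 ℕ.* m ℕ.≤ d → d ℕ.≤ 2 ℕ.* m ℕ.+ 1 → + s * highEnergy d (±1 ∘ f) ≤ + (72 ℕ.* 9 ℕ.^ n)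
    go m@(suc m′) m>0 2m≤d d≤2m+1 = *-cancelˡ-≤-pos (+ s * highEnergy d (±1 ∘ f)) (+ (72 ℕ.* 9 ℕ.^ n)) (+ (K ℕ.^ n ℕ.* s)) {{factor}} (begin
      + (K ℕ.^ n ℕ.* s) * (+ s * highEnergy d g)
        ≤⟨ *-monoˡ-≤-nonNeg (+ (K ℕ.^ n ℕ.* s)) (*-monoˡ-≤-nonNeg (+ s) (tail-antitone 2m≤d g)) ⟩
      + (K ℕ.^ n ℕ.* s) * (+ s * highEnergy K g)
        ≡⟨ trans (cong (_* (+ s * highEnergy K g)) (trans (pos-* (K ℕ.^ n) s) (cong (_* + s) (pos-^ K n))))
                 (lemma₁ ((+ K) ^ n) (+ s) (highEnergy K g)) ⟩
      + s * + s * ((+ K) ^ n * highEnergy K g)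
        ≤⟨ *-monoˡ-≤-nonNeg (+ s * + s) {{subst NonNegative (pos-* s s) _}} (tail-disagree k f) ⟩
      + s * + s * + (8 ℕ.* (3 ℕ.^ n ℕ.* p))
        ≡⟨ trans (cong (_* + (8 ℕ.* (3 ℕ.^ n ℕ.* p))) (sym (pos-* s s))) (sym (pos-* (s ℕ.* s) (8 ℕ.* (3 ℕ.^ n ℕ.* p)))) ⟩
      + (s ℕ.* s ℕ.* (8 ℕ.* (3 ℕ.^ n ℕ.* p)))
        ≤⟨ +≤+ counts ⟩
      + (K ℕ.^ n ℕ.* s ℕ.* (72 ℕ.* 9 ℕ.^ n))
        ≡⟨ pos-* (K ℕ.^ n ℕ.* s) (72 ℕ.* 9 ℕ.^ n) ⟩
      + (K ℕ.^ n ℕ.* s) * + (72 ℕ.* 9 ℕ.^ n) ∎)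
      where
      open ≤-Reasoning
      g = ±1 ∘ f
      K = 2 ℕ.* m
      k = 2 ℕ.* m ℕ.∸ 1
      p = pairSum k 1 K (disagree f)
      factor : Positive (+ (K ℕ.^ n ℕ.* s))
      factor = positive (+<+ (ℕ.*-mono-≤ (ℕ.m^n>0 K n) s>0))
      lemma₁ : ∀ κ s t → κ * s * (s * t) ≡ s * s * (κ * t)
      lemma₁ = solve-∀
      d≤3m : d ℕ.≤ 3 ℕ.* m
      d≤3m = ℕ.≤-trans d≤2m+1 (ℕ.≤-trans (ℕ.+-monoʳ-≤ (2 ℕ.* m) m>0) (ℕ.≤-reflexive (three m)))
        where
        three : ∀ m → 2 ℕ.* m ℕ.+ m ≡ 3 ℕ.* m
        three = ℕSolver.solve-∀
      small′ : 2 ℕ.* n ℕ.* ((s ℕ.* s) ℕ.* (s ℕ.* s)) ℕ.≤ m ℕ.* m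
      small′ = ℕ.*-cancelˡ-≤ 9 (ℕ.≤-trans (ℕ.≤-reflexive (l₁ n _)) (ℕ.≤-trans small
        (ℕ.≤-trans (ℕ.*-mono-≤ d≤3m d≤3m) (ℕ.≤-reflexive (l₂ m)))))
        where
        l₁ : ∀ n x → 9 ℕ.* (2 ℕ.* n ℕ.* x) ≡ 18 ℕ.* n ℕ.* x
        l₁ = ℕSolver.solve-∀
        l₂ : ∀ m → 3 ℕ.* m ℕ.* (3 ℕ.* m) ≡ 9 ℕ.* (m ℕ.* m)
        l₂ = ℕSolver.solve-∀
      powers : ∀ i → 3 ℕ.^ i ℕ.* (6 ℕ.* m) ℕ.^ i ≡ K ℕ.^ i ℕ.* 9 ℕ.^ i
      powers zero    = refl
      powers (suc i) = trans (l (3 ℕ.^ i) m ((6 ℕ.* m) ℕ.^ i))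
        (trans (cong (18 ℕ.* m ℕ.*_) (powers i)) (r (K ℕ.^ i) m (9 ℕ.^ i)))
        where
        l : ∀ a m b → 3 ℕ.* a ℕ.* (6 ℕ.* m ℕ.* b) ≡ 18 ℕ.* m ℕ.* (a ℕ.* b)
        l = ℕSolver.solve-∀
        r : ∀ a m b → 18 ℕ.* m ℕ.* (a ℕ.* b) ≡ 2 ℕ.* m ℕ.* a ℕ.* (9 ℕ.* b)
        r = ℕSolver.solve-∀
      counts : s ℕ.* s ℕ.* (8 ℕ.* (3 ℕ.^ n ℕ.* p)) ℕ.≤ K ℕ.^ n ℕ.* s ℕ.* (72 ℕ.* 9 ℕ.^ n)
      counts = ℕ.≤-trans (ℕ.≤-reflexive (l₁ (s ℕ.* s) (3 ℕ.^ n) p))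
        (ℕ.≤-trans (ℕ.*-monoʳ-≤ (8 ℕ.* 3 ℕ.^ n) (ℕ.≤-trans (noise-bound sep s m n>0 s>0 small′)
            (ℕ.*-monoˡ-≤ ((6 ℕ.* m) ℕ.^ n) (ℕ.≤-trans (ℕ.+-monoʳ-≤ (8 ℕ.* s) s>0) (ℕ.≤-reflexive (nine s))))))
          (ℕ.≤-reflexive (trans (l₂ (3 ℕ.^ n) s ((6 ℕ.* m) ℕ.^ n))
            (trans (cong (72 ℕ.* s ℕ.*_) (powers n)) (l₃ s (K ℕ.^ n) (9 ℕ.^ n))))))
        where
        l₁ : ∀ a b c → a ℕ.* (8 ℕ.* (b ℕ.* c)) ≡ 8 ℕ.* b ℕ.* (a ℕ.* c)
        l₁ = ℕSolver.solve-∀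
        nine : ∀ s → 8 ℕ.* s ℕ.+ s ≡ 9 ℕ.* s
        nine = ℕSolver.solve-∀
        l₂ : ∀ a s b → 8 ℕ.* a ℕ.* (9 ℕ.* s ℕ.* b) ≡ 72 ℕ.* s ℕ.* (a ℕ.* b)
        l₂ = ℕSolver.solve-∀
        l₃ : ∀ s a b → 72 ℕ.* s ℕ.* (a ℕ.* b) ≡ a ℕ.* s ℕ.* (72 ℕ.* b)
        l₃ = ℕSolver.solve-∀

-- Expected error of the weighted vote.

module Sampling where

  open import Data.Bool.Base using (Bool; true; false; _xor_)
  import Data.Bool.Properties as Bool
  open import Data.Integer.Base hiding (suc; pred)
  open import Data.Integer.Properties
  open import Data.Integer.Tactic.RingSolver using (solve-∀)
  open import Data.List.Base using ([]; _∷_; filter; length)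
  open import Data.Nat.Base as ℕ using (ℕ; zero; suc)
  import Data.Nat.Properties as ℕ
  import Data.Nat.Tactic.RingSolver as ℕSolver
  open import Data.Vec.Base using (Vec; []; _∷_)
  open import Function.Base using (_∘_)
  open import Relation.Binary.PropositionalEquality hiding ([_]; J)
  open import Relation.Nullary using (does)
  open import Relation.Unary using (Pred; Decidable)
  open import Level using (0ℓ)
  open import Defs using (Point; Subset; Trit; −1ᵗ; 0ᵗ; +1ᵗ; points; vectors)
  open Words using (𝟙; Σ; Σ-vectors)
  open TieBreaking using (posℤ)
  open EfronStein
  open EnergyTail using (±1; pos-^)

  private variable
    n : ℕ

  cube-const : ∀ n (a : ℤ) → cube {n} (λ _ → a) ≡ (+ 3) ^ n * a
  cube-const zero    a = sym (*-identityˡ a)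
  cube-const (suc n) a = trans (cong (λ t → t + t + t) (cube-const n a)) (lemma ((+ 3) ^ n) a)
    where
    lemma : ∀ N a → N * a + N * a + N * a ≡ + 3 * N * a
    lemma = solve-∀

  cube-mono : {g h : Fn n} → (∀ x → g x ≤ h x) → cube g ≤ cube h
  cube-mono {zero}  le = le []
  cube-mono {suc n} le =
    +-mono-≤ (+-mono-≤ (cube-mono (le ∘ (−1ᵗ ∷_))) (cube-mono (le ∘ (0ᵗ ∷_)))) (cube-mono (le ∘ (+1ᵗ ∷_)))

  cube-swap : ∀ {a b} (F : Point a → Point b → ℤ) →
              cube (λ x → cube (λ y → F x y)) ≡ cube (λ y → cube (λ x → F x y))
  cube-swap {zero}  F = refl
  cube-swap {suc a} F = trans
    (cong₂ _+_ (cong₂ _+_ (cube-swap (F ∘ (−1ᵗ ∷_))) (cube-swap (F ∘ (0ᵗ ∷_)))) (cube-swap (F ∘ (+1ᵗ ∷_))))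
    (trans (cong (_+ cube (C +1ᵗ)) (sym (cube-+ (C −1ᵗ) (C 0ᵗ)))) (sym (cube-+ (λ y → C −1ᵗ y + C 0ᵗ y) (C +1ᵗ))))
    where
    C : Trit → Point _ → ℤ
    C t y = cube (λ x → F (t ∷ x) y)

  samples : ∀ {n} m → (Vec (Point n) m → ℤ) → ℤ
  samples zero    F = F []
  samples (suc m) F = cube (λ z → samples m (λ zs → F (z ∷ zs)))

  samples-mono : ∀ m {F G : Vec (Point n) m → ℤ} → (∀ zs → F zs ≤ G zs) → samples m F ≤ samples m G
  samples-mono zero    le = le []
  samples-mono (suc m) le = cube-mono (λ z → samples-mono m (le ∘ (z ∷_)))

  samples-cong : ∀ m {F G : Vec (Point n) m → ℤ} → (∀ zs → F zs ≡ G zs) → samples m F ≡ samples m G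
  samples-cong zero    e = e []
  samples-cong (suc m) e = cube-cong (λ z → samples-cong m (e ∘ (z ∷_)))

  samples-* : ∀ m k (F : Vec (Point n) m → ℤ) → samples m (λ zs → k * F zs) ≡ k * samples m F
  samples-* zero    k F = refl
  samples-* (suc m) k F = trans (cube-cong (λ z → samples-* m k (F ∘ (z ∷_))))
                                (cube-* k (λ z → samples m (F ∘ (z ∷_))))

  samples-cube : ∀ m (F : Vec (Point n) m → Point n → ℤ) →
                 samples m (λ zs → cube (F zs)) ≡ cube (λ x → samples m (λ zs → F zs x))
  samples-cube zero    F = refl
  samples-cube (suc m) F = trans (cube-cong (λ z → samples-cube m (F ∘ (z ∷_))))
                                 (cube-swap (λ z x → samples m (λ zs → F (z ∷ zs) x)))

  cube-points : ∀ n (h : Point n → ℕ) → cube (λ x → + h x) ≡ + Σ (points n) h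
  cube-points zero    h = cong +_ (sym (ℕ.+-identityʳ (h [])))
  cube-points (suc n) h = begin
    cube (λ x → + h (−1ᵗ ∷ x)) + cube (λ x → + h (0ᵗ ∷ x)) + cube (λ x → + h (+1ᵗ ∷ x))
      ≡⟨ cong₂ _+_ (cong₂ _+_ (cube-points n (h ∘ (−1ᵗ ∷_))) (cube-points n (h ∘ (0ᵗ ∷_)))) (cube-points n (h ∘ (+1ᵗ ∷_))) ⟩
    + (S −1ᵗ ℕ.+ S 0ᵗ ℕ.+ S +1ᵗ)
      ≡⟨ cong +_ (lemma (S −1ᵗ) (S 0ᵗ) (S +1ᵗ)) ⟩
    + (S −1ᵗ ℕ.+ (S 0ᵗ ℕ.+ (S +1ᵗ ℕ.+ 0)))
      ≡⟨ cong +_ (Σ-vectors (−1ᵗ ∷ 0ᵗ ∷ +1ᵗ ∷ []) n h) ⟨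
    + Σ (points (suc n)) h ∎
    where
    open ≡-Reasoning
    S : Trit → ℕ
    S t = Σ (points n) (λ x → h (t ∷ x))
    lemma : ∀ a b c → a ℕ.+ b ℕ.+ c ≡ a ℕ.+ (b ℕ.+ (c ℕ.+ 0))
    lemma = ℕSolver.solve-∀

  samples-vectors : ∀ m (h : Vec (Point n) m → ℕ) → samples m (λ zs → + h zs) ≡ + Σ (vectors (points n) m) h
  samples-vectors zero    h = cong +_ (sym (ℕ.+-identityʳ (h [])))
  samples-vectors {n} (suc m) h = trans (cube-cong (λ z → samples-vectors m (h ∘ (z ∷_))))
    (trans (cube-points n _) (cong +_ (sym (Σ-vectors (points n) m h))))

  length-filter : ∀ {A : Set} {P : Pred A 0ℓ} (P? : Decidable P) xs →
                  length (filter P? xs) ≡ Σ xs (λ x → 𝟙 (does (P? x)))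
  length-filter P? []       = refl
  length-filter P? (x ∷ xs) with does (P? x)
  ... | true  = cong suc (length-filter P? xs)
  ... | false = length-filter P? xs

  score : ∀ {n m} → ℕ → Fn n → Vec (Point n) m → Fn n
  score d g []       x = 0ℤ
  score d g (z ∷ zs) x = kernel d x z * g z + score d g zs x

  module _ (d : ℕ) (g : Fn n) (x : Point n) where

    private
      N c Q : ℤ
      N = (+ 3) ^ n
      k : Fn n
      k z = kernel d x z * g z
      c = smooth d g x
      Q = cube (square ∘ k)

    -- Squared bias plus variance of a sum of m independent terms with mean c/N and second moment
    -- Q/N. The target t is arbitrary because the induction shifts it by the term of the first
    -- sample.
    second-moment : ∀ m t → N * N * samples m (λ zs → square (score d g zs x - t)) ≡
      N ^ m * (square (+ m * c - N * t) + + m * (N * Q - square c))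
    second-moment zero    t = lemma N c t (N * Q - square c)
      where
      lemma : ∀ N c t r → N * N * ((0ℤ - t) * (0ℤ - t)) ≡ 1ℤ * ((0ℤ * c - N * t) * (0ℤ * c - N * t) + 0ℤ * r)
      lemma = solve-∀
    second-moment (suc m) t = begin
      N * N * cube (λ z → samples m (λ zs → square (k z + score d g zs x - t)))
        ≡⟨ cube-* (N * N) (λ z → samples m (λ zs → square (k z + score d g zs x - t))) ⟨
      cube (λ z → N * N * samples m (λ zs → square (k z + score d g zs x - t)))
        ≡⟨ cube-cong (λ z → trans (cong (N * N *_) (samples-cong m (λ zs → cong square (shift (k z) (score d g zs x) t))))
                                   (second-moment m (t - k z))) ⟩
      cube (λ z → N ^ m * (square (+ m * c - N * (t - k z)) + + m * (N * Q - square c)))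
        ≡⟨ cube-* (N ^ m) (λ z → square (+ m * c - N * (t - k z)) + + m * (N * Q - square c)) ⟩
      N ^ m * cube (λ z → square (+ m * c - N * (t - k z)) + + m * (N * Q - square c))
        ≡⟨ cong (N ^ m *_) (trans (cube-cong (λ z → expand (+ m) c N t (k z) (N * Q - square c)))
             (trans (cube-+ (λ z → A) (λ z → B * k z + N * N * square (k z)))
                    (cong₂ _+_ (cube-const n A)
                      (trans (cube-+ (λ z → B * k z) (λ z → N * N * square (k z)))
                             (cong₂ _+_ (cube-* B k) (cube-* (N * N) (square ∘ k))))))) ⟩
      N ^ m * (N * A + (B * c + N * N * Q))
        ≡⟨ collect (+ m) c N t Q (N ^ m) ⟩
      N ^ suc m * (square ((1ℤ + + m) * c - N * t) + (1ℤ + + m) * (N * Q - square c)) ∎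
      where
      open ≡-Reasoning
      A B : ℤ
      A = square (+ m * c - N * t) + + m * (N * Q - square c)
      B = + 2 * N * (+ m * c - N * t)
      shift : ∀ k s t → k + s - t ≡ s - (t - k)
      shift = solve-∀
      expand : ∀ m c N t k r → (m * c - N * (t - k)) * (m * c - N * (t - k)) + m * r ≡
        ((m * c - N * t) * (m * c - N * t) + m * r) + (+ 2 * N * (m * c - N * t) * k + N * N * (k * k))
      expand = solve-∀
      collect : ∀ m c N t Q P →
        P * (N * ((m * c - N * t) * (m * c - N * t) + m * (N * Q - c * c)) +
             (+ 2 * N * (m * c - N * t) * c + N * N * Q)) ≡
        N * P * (((1ℤ + m) * c - N * t) * ((1ℤ + m) * c - N * t) + (1ℤ + m) * (N * Q - c * c))
      collect = solve-∀

  -- The number of sets of fewer than d out of n coordinates, each counted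
  -- with weight 2 per coordinate.
  volume : ℕ → ℕ → ℕ
  volume n       zero    = 0
  volume zero    (suc d) = 1
  volume (suc n) (suc d) = volume n (suc d) ℕ.+ 2 ℕ.* volume n d

  -- Over the three values of a coordinate the characters add up to 0, which removes the cross
  -- terms, and their squares to 4 + 1 + 1 = 3 · 2, which is the weight 2 per coordinate in
  -- `volume`.
  kernel-norm : ∀ n d x → cube (λ z → square (kernel {n} d x z)) ≡ (+ 3) ^ n * + volume n d
  kernel-norm n       zero    x       = cube-const n 0ℤ
  kernel-norm zero    (suc d) []      = refl
  kernel-norm (suc n) (suc d) (a ∷ x) = begin
    cube (F −1ᵗ) + cube (F 0ᵗ) + cube (F +1ᵗ)
      ≡⟨ trans (cong (_+ cube (F +1ᵗ)) (sym (cube-+ (F −1ᵗ) (F 0ᵗ)))) (sym (cube-+ (λ z → F −1ᵗ z + F 0ᵗ z) (F +1ᵗ))) ⟩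
    cube (λ z → F −1ᵗ z + F 0ᵗ z + F +1ᵗ z)
      ≡⟨ cube-cong (λ z → pointwise a (kernel (suc d) x z) (kernel d x z)) ⟩
    cube (λ z → + 3 * square (kernel (suc d) x z) + + 6 * square (kernel d x z))
      ≡⟨ trans (cube-+ (λ z → + 3 * square (kernel (suc d) x z)) (λ z → + 6 * square (kernel d x z)))
           (cong₂ _+_ (trans (cube-* (+ 3) (λ z → square (kernel (suc d) x z))) (cong (+ 3 *_) (kernel-norm n (suc d) x)))
                      (trans (cube-* (+ 6) (λ z → square (kernel d x z))) (cong (+ 6 *_) (kernel-norm n d x)))) ⟩
    + 3 * ((+ 3) ^ n * + v₁) + + 6 * ((+ 3) ^ n * + v₂)
      ≡⟨ lemma ((+ 3) ^ n) (+ v₁) (+ v₂) ⟩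
    (+ 3) ^ suc n * (+ v₁ + + 2 * + v₂)
      ≡⟨ cong (λ t → (+ 3) ^ suc n * (+ v₁ + t)) (sym (pos-* 2 v₂)) ⟩
    (+ 3) ^ suc n * + volume (suc n) (suc d) ∎
    where
    open ≡-Reasoning
    v₁ v₂ : ℕ
    v₁ = volume n (suc d)
    v₂ = volume n d
    F : Trit → Fn n
    F b z = square (kernel (suc d) x z + character a b * kernel d x z)
    pointwise : ∀ a k l → square (k + character a −1ᵗ * l) + square (k + character a 0ᵗ * l) +
      square (k + character a +1ᵗ * l) ≡ + 3 * square k + + 6 * square l
    pointwise −1ᵗ = p where
      p : ∀ k l → (k + + 2 * l) * (k + + 2 * l) + (k + -1ℤ * l) * (k + -1ℤ * l) + (k + -1ℤ * l) * (k + -1ℤ * l) ≡ + 3 * (k * k) + + 6 * (l * l)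
      p = solve-∀
    pointwise 0ᵗ = p where
      p : ∀ k l → (k + -1ℤ * l) * (k + -1ℤ * l) + (k + + 2 * l) * (k + + 2 * l) + (k + -1ℤ * l) * (k + -1ℤ * l) ≡ + 3 * (k * k) + + 6 * (l * l)
      p = solve-∀
    pointwise +1ᵗ = p where
      p : ∀ k l → (k + -1ℤ * l) * (k + -1ℤ * l) + (k + -1ℤ * l) * (k + -1ℤ * l) + (k + + 2 * l) * (k + + 2 * l) ≡ + 3 * (k * k) + + 6 * (l * l)
      p = solve-∀
    lemma : ∀ N v w → + 3 * (N * v) + + 6 * (N * w) ≡ + 3 * N * (v + + 2 * w)
    lemma = solve-∀

  module _ (f : Subset n) (d : ℕ) where

    private
      g : Fn n
      g = ±1 ∘ f
      N : ℤ
      N = (+ 3) ^ n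

    hypothesis : ∀ {m} → Vec (Point n) m → Subset n
    hypothesis zs x = posℤ (score d g zs x)

    mistakes : ∀ {m} → Vec (Point n) m → ℕ
    mistakes zs = Σ (points n) (λ x → 𝟙 (f x xor hypothesis zs x))

    -- A score of the wrong sign is at distance at least m from m times the label. A zero score is
    -- read as nonmembership; if that is wrong, the distance is exactly m.
    mistake-cost : ∀ m b s → + m * + m * + 𝟙 (b xor posℤ s) ≤ square (s - + m * ±1 b)
    mistake-cost m true  +[1+ k ] = ≤-trans (≤-reflexive (*-zeroʳ (+ m * + m))) (square-nonNeg (+[1+ k ] - + m * 1ℤ))
    mistake-cost m true  (+ zero) = ≤-reflexive (lemma (+ m))
      where
      lemma : ∀ m → m * m * 1ℤ ≡ (0ℤ - m * 1ℤ) * (0ℤ - m * 1ℤ)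
      lemma = solve-∀
    mistake-cost m true  -[1+ k ] = subst₂ _≤_ (lemma₁ (+ m)) (lemma₂ (+ m) (+ suc k))
      (≤-trans (≤-reflexive (sym (+-identityʳ (+ m * + m)))) (+-monoʳ-≤ (+ m * + m) nonneg))
      where
      lemma₁ : ∀ m → m * m ≡ m * m * 1ℤ
      lemma₁ = solve-∀
      lemma₂ : ∀ m k → m * m + (k * k + + 2 * (m * k)) ≡ (- k - m * 1ℤ) * (- k - m * 1ℤ)
      lemma₂ = solve-∀
      nonneg : 0ℤ ≤ + suc k * + suc k + + 2 * (+ m * + suc k)
      nonneg = +-mono-≤ (square-nonNeg (+ suc k)) (subst (0ℤ ≤_) (trans (pos-* 2 (m ℕ.* suc k)) (cong (+ 2 *_) (pos-* m (suc k)))) (+≤+ ℕ.z≤n))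
    mistake-cost m false +[1+ k ] = subst₂ _≤_ (lemma₁ (+ m)) (lemma₂ (+ m) (+ suc k))
      (≤-trans (≤-reflexive (sym (+-identityʳ (+ m * + m)))) (+-monoʳ-≤ (+ m * + m) nonneg))
      where
      lemma₁ : ∀ m → m * m ≡ m * m * 1ℤ
      lemma₁ = solve-∀
      lemma₂ : ∀ m k → m * m + (k * k + + 2 * (m * k)) ≡ (k - m * -1ℤ) * (k - m * -1ℤ)
      lemma₂ = solve-∀
      nonneg : 0ℤ ≤ + suc k * + suc k + + 2 * (+ m * + suc k)
      nonneg = +-mono-≤ (square-nonNeg (+ suc k)) (subst (0ℤ ≤_) (trans (pos-* 2 (m ℕ.* suc k)) (cong (+ 2 *_) (pos-* m (suc k)))) (+≤+ ℕ.z≤n))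
    mistake-cost m false (+ zero) = ≤-trans (≤-reflexive (*-zeroʳ (+ m * + m))) (square-nonNeg (+ zero - + m * -1ℤ))
    mistake-cost m false -[1+ k ] = ≤-trans (≤-reflexive (*-zeroʳ (+ m * + m))) (square-nonNeg (-[1+ k ] - + m * -1ℤ))

    total-error : ∀ m → cube (λ x → N * N * samples m (λ zs → square (score d g zs x - + m * g x))) ≤
                        N ^ m * (+ m * + m * (N * highEnergy d g) + + m * (N * (N * (N * + volume n d))))
    total-error m = begin
      cube (λ x → N * N * samples m (λ zs → square (score d g zs x - + m * g x)))
        ≡⟨ cube-cong (λ x → second-moment d g x m (+ m * g x)) ⟩
      cube (λ x → N ^ m * (square (+ m * c x - N * (+ m * g x)) + + m * (N * Q x - square (c x))))
        ≡⟨ cube-* (N ^ m) (λ x → square (+ m * c x - N * (+ m * g x)) + + m * (N * Q x - square (c x))) ⟩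
      N ^ m * cube (λ x → square (+ m * c x - N * (+ m * g x)) + + m * (N * Q x - square (c x)))
        -- The variance is bounded by the second moment: the term - m c² is dropped.
        ≤⟨ *-monoˡ-≤-nonNeg (N ^ m) {{power}} (cube-mono drop) ⟩
      N ^ m * cube (λ x → + m * + m * square (residual d g x) + + m * (N * Q x))
        ≡⟨ cong (N ^ m *_) (trans (cube-+ (λ x → + m * + m * square (residual d g x)) (λ x → + m * (N * Q x)))
             (cong₂ _+_ (trans (cube-* (+ m * + m) (λ x → square (residual d g x))) (cong (+ m * + m *_) (residual-energy n d g)))
                        (trans (cube-* (+ m) (λ x → N * Q x)) (cong (+ m *_) (trans (cube-* N Q) (cong (N *_) norms)))))) ⟩
      N ^ m * (+ m * + m * (N * highEnergy d g) + + m * (N * (N * (N * + volume n d)))) ∎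
      where
      open ≤-Reasoning
      c Q : Fn n
      c = smooth d g
      Q x = cube (λ z → square (kernel d x z * g z))
      nonNeg-^ : ∀ k a → NonNegative ((+ k) ^ a)
      nonNeg-^ k a = subst NonNegative (pos-^ k a) _
      power : NonNegative (N ^ m)
      power = subst (λ t → NonNegative (t ^ m)) (pos-^ 3 n) (nonNeg-^ (3 ℕ.^ n) m)
      E : Fn n
      E x = square (+ m * c x - N * (+ m * g x)) + + m * (N * Q x - square (c x))
      drop : ∀ x → square (+ m * c x - N * (+ m * g x)) + + m * (N * Q x - square (c x)) ≤
                   + m * + m * square (residual d g x) + + m * (N * Q x)
      drop x = subst (square (+ m * c x - N * (+ m * g x)) + + m * (N * Q x - square (c x)) ≤_)
        (lemma (+ m) (c x) N (g x) (Q x))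
        (≤-trans (≤-reflexive (sym (+-identityʳ (E x)))) (+-monoʳ-≤ (E x)
          (≤-trans (≤-reflexive (sym (*-zeroʳ (+ m)))) (*-monoˡ-≤-nonNeg (+ m) (square-nonNeg (c x))))))
        where
        lemma : ∀ m c N g Q → ((m * c - N * (m * g)) * (m * c - N * (m * g)) + m * (N * Q - c * c)) + m * (c * c) ≡
                              m * m * ((N * g - c) * (N * g - c)) + m * (N * Q)
        lemma = solve-∀
      norms : cube Q ≡ N * (N * + volume n d)
      norms = trans (cube-cong (λ x → trans (cube-cong (λ z → unit (kernel d x z) (f z))) (kernel-norm n d x)))
                    (cube-const n ((+ 3) ^ n * + volume n d))
        where
        plus : ∀ k → (k * 1ℤ) * (k * 1ℤ) ≡ k * k
        plus = solve-∀
        minus : ∀ k → (k * -1ℤ) * (k * -1ℤ) ≡ k * k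
        minus = solve-∀
        unit : ∀ k b → square (k * ±1 b) ≡ square k
        unit k true  = plus k
        unit k false = minus k

    -- High-degree energy and sampling variance each account for at most 1/(6 q) of the points;
    -- together they leave 1/(3 q).
    expected-mistakes : ∀ m q .{{_ : ℕ.NonZero m}} →
      + (6 ℕ.* q) * highEnergy d g ≤ + (9 ℕ.^ n) → 6 ℕ.* q ℕ.* volume n d ℕ.≤ m →
      3 ℕ.* q ℕ.* Σ (vectors (points n) m) mistakes ℕ.≤ (3 ℕ.^ n) ℕ.^ m ℕ.* 3 ℕ.^ n
    expected-mistakes m q smallTail manySamples = drop‿+≤+ (*-cancelˡ-≤-pos (+ (3 ℕ.* q ℕ.* W)) (+ (P ℕ.^ m ℕ.* P)) (+ 2 * + (P ℕ.* P ℕ.* (m ℕ.* m))) {{factor}} (begin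
      + 2 * + (P ℕ.* P ℕ.* (m ℕ.* m)) * + (3 ℕ.* q ℕ.* W)
        ≡⟨ trans (cong₂ (λ a b → + 2 * a * b) (casts P (m ℕ.* m)) (pos-* (3 ℕ.* q) W))
                 (trans (cong₂ (λ a b → + 2 * (+ P * + P * a) * (b * + W)) (pos-* m m) (pos-* 3 q))
                        (lemma₁ (+ P) (+ m) (+ q) (+ W))) ⟩
      + 6 * + q * (+ P * + P * (+ m * + m * + W))
        ≤⟨ *-monoˡ-≤-nonNeg (+ 6 * + q) {{subst NonNegative (pos-* 6 q) _}} squares ⟩
      + 6 * + q * (N ^ m * (+ m * + m * (N * highEnergy d g) + + m * (N * (N * (N * + V)))))
        ≡⟨ lemma₂ (+ q) (N ^ m) (+ m) N (highEnergy d g) (+ V) ⟩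
      N ^ m * (+ m * + m * N * (+ 6 * + q * highEnergy d g) + + m * (N * (N * N)) * (+ 6 * + q * + V))
        ≡⟨ cong₂ (λ a b → N ^ m * (+ m * + m * N * (a * highEnergy d g) + + m * (N * (N * N)) * b)) (sym (pos-* 6 q))
                 (trans (cong (_* + V) (sym (pos-* 6 q))) (sym (pos-* (6 ℕ.* q) V))) ⟩
      N ^ m * (+ m * + m * N * (+ (6 ℕ.* q) * highEnergy d g) + + m * (N * (N * N)) * + (6 ℕ.* q ℕ.* V))
        ≤⟨ *-monoˡ-≤-nonNeg (N ^ m) {{nonNeg₁}} (+-mono-≤
             (*-monoˡ-≤-nonNeg (+ m * + m * N) {{nonNeg₂}} smallTail)
             (*-monoˡ-≤-nonNeg (+ m * (N * (N * N))) {{nonNeg₃}} (+≤+ manySamples))) ⟩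
      N ^ m * (+ m * + m * N * + (9 ℕ.^ n) + + m * (N * (N * N)) * + m)
        ≡⟨ cong (λ a → N ^ m * (+ m * + m * N * a + + m * (N * (N * N)) * + m)) nine ⟩
      N ^ m * (+ m * + m * N * (N * N) + + m * (N * (N * N)) * + m)
        ≡⟨ lemma₃ (N ^ m) (+ m) N ⟩
      + 2 * (N * N * (+ m * + m)) * (N ^ m * N)
        ≡⟨ cong₂ (λ a b → + 2 * a * b)
             (trans (casts P (m ℕ.* m)) (cong₂ _*_ (cong₂ _*_ (pos-^ 3 n) (pos-^ 3 n)) (pos-* m m)))
             (trans (pos-* (P ℕ.^ m) P) (cong₂ _*_ (trans (pos-^ P m) (cong (_^ m) (pos-^ 3 n))) (pos-^ 3 n))) ⟨
      + 2 * + (P ℕ.* P ℕ.* (m ℕ.* m)) * + (P ℕ.^ m ℕ.* P) ∎))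
      where
      open ≤-Reasoning
      P W V : ℕ
      P = 3 ℕ.^ n
      W = Σ (vectors (points n) m) mistakes
      V = volume n d
      factor : Positive (+ 2 * + (P ℕ.* P ℕ.* (m ℕ.* m)))
      factor = subst Positive (pos-* 2 (P ℕ.* P ℕ.* (m ℕ.* m))) (positive (+<+
        (ℕ.*-mono-≤ {1} {2} (ℕ.s≤s ℕ.z≤n) (ℕ.*-mono-≤ (ℕ.*-mono-≤ (ℕ.m^n>0 3 n) (ℕ.m^n>0 3 n))
          (ℕ.*-mono-≤ (ℕ.>-nonZero⁻¹ m) (ℕ.>-nonZero⁻¹ m))))))
      casts : ∀ a b → + (a ℕ.* a ℕ.* b) ≡ + a * + a * + b
      casts a b = trans (pos-* (a ℕ.* a) b) (cong (_* + b) (pos-* a a))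
      lemma₁ : ∀ p m q w → + 2 * (p * p * (m * m)) * (+ 3 * q * w) ≡ + 6 * q * (p * p * (m * m * w))
      lemma₁ = solve-∀
      lemma₂ : ∀ q P m N t v → + 6 * q * (P * (m * m * (N * t) + m * (N * (N * (N * v))))) ≡
        P * (m * m * N * (+ 6 * q * t) + m * (N * (N * N)) * (+ 6 * q * v))
      lemma₂ = solve-∀
      lemma₃ : ∀ P m N → P * (m * m * N * (N * N) + m * (N * (N * N)) * m) ≡ + 2 * (N * N * (m * m)) * (P * N)
      lemma₃ = solve-∀
      natN : + P ≡ N
      natN = pos-^ 3 n
      nonNeg₁ : NonNegative (N ^ m)
      nonNeg₁ = subst (λ t → NonNegative (t ^ m)) natN (subst NonNegative (pos-^ P m) _)
      nonNeg₂ : NonNegative (+ m * + m * N)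
      nonNeg₂ = subst NonNegative (trans (pos-* (m ℕ.* m) P) (cong₂ _*_ (pos-* m m) natN)) _
      nonNeg₃ : NonNegative (+ m * (N * (N * N)))
      nonNeg₃ = subst NonNegative (trans (pos-* m (P ℕ.* (P ℕ.* P))) (cong (+ m *_) (trans (pos-* P (P ℕ.* P)) (cong₂ _*_ natN
        (trans (pos-* P P) (cong₂ _*_ natN natN)))))) _
      nine : + (9 ℕ.^ n) ≡ N * N
      nine = trans (cong +_ (powers n)) (trans (pos-* P P) (cong₂ _*_ natN natN))
        where
        powers : ∀ i → 9 ℕ.^ i ≡ 3 ℕ.^ i ℕ.* 3 ℕ.^ i
        powers zero    = refl
        powers (suc i) = trans (cong (9 ℕ.*_) (powers i)) (l (3 ℕ.^ i))
          where
          l : ∀ a → 9 ℕ.* (a ℕ.* a) ≡ (3 ℕ.* a) ℕ.* (3 ℕ.* a)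
          l = ℕSolver.solve-∀
      squares : + P * + P * (+ m * + m * + W) ≤ N ^ m * (+ m * + m * (N * highEnergy d g) + + m * (N * (N * (N * + V))))
      squares = begin
        + P * + P * (+ m * + m * + W)
          ≡⟨ cong₂ (λ a b → a * (+ m * + m * b)) (cong₂ _*_ natN natN) (sym (samples-vectors m mistakes)) ⟩
        N * N * (+ m * + m * samples m (λ zs → + mistakes zs))
          ≡⟨ cong (N * N *_) (trans (sym (samples-* m (+ m * + m) (λ zs → + mistakes zs))) (samples-cong m (λ zs →
               trans (cong (+ m * + m *_) (sym (cube-points n (λ x → 𝟙 (f x xor hypothesis zs x)))))
                     (sym (cube-* (+ m * + m) (λ x → + 𝟙 (f x xor hypothesis zs x))))))) ⟩
        N * N * samples m (λ zs → cube (λ x → + m * + m * + 𝟙 (f x xor hypothesis zs x)))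
          ≤⟨ *-monoˡ-≤-nonNeg (N * N) {{subst NonNegative (trans (pos-* P P) (cong₂ _*_ natN natN)) _}}
               (samples-mono m (λ zs → cube-mono (λ x → mistake-cost m (f x) (score d g zs x)))) ⟩
        N * N * samples m (λ zs → cube (λ x → square (score d g zs x - + m * g x)))
          ≡⟨ trans (cong (N * N *_) (samples-cube m (λ zs x → square (score d g zs x - + m * g x)))) (sym (cube-* (N * N) (λ x → samples m (λ zs → square (score d g zs x - + m * g x))))) ⟩
        cube (λ x → N * N * samples m (λ zs → square (score d g zs x - + m * g x)))
          ≤⟨ total-error m ⟩
        N ^ m * (+ m * + m * (N * highEnergy d g) + + m * (N * (N * (N * + V)))) ∎

-- From expected error to probability 2/3.

module Markov where

  open import Data.Bool.Base using (Bool; true; false; _xor_; not)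
  import Data.Bool.Properties as Bool
  open import Data.Empty using (⊥-elim)
  open import Data.Integer.Base as ℤ using (+_)
  import Data.Integer.Properties as ℤ
  open import Data.List.Base using ([]; _∷_; filter; length)
  open import Data.Nat.Base
  open import Data.Nat.Properties
  open import Data.Nat.Tactic.RingSolver using (solve-∀)
  open import Data.Rational.Base as ℚ using (ℚ)
  import Data.Rational.Properties as ℚ
  open import Data.Vec.Base using (Vec; []; _∷_)
  open import Relation.Binary.PropositionalEquality hiding ([_]; J)
  open import Relation.Nullary using (yes; no; does)
  open import Relation.Unary using (Pred; Decidable)
  open import Level using (0ℓ)
  open import Defs using (Point; Subset; −1ᵗ; 0ᵗ; +1ᵗ; points; vectors; dist; Pr)
  open Words using (𝟙; Σ; Σ-cong; Σ-*ˡ; Σ-mono; Σ-+; Σ-const)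
  open WindowAveraging using (length-vectors)
  open Fractions
  open Sampling using (length-filter)

  distance-≤ : ∀ {n} (S T : Subset n) q .{{_ : NonZero q}} ε → (+ 1) ℚ./ q ℚ.≤ ε →
               q * Σ (points n) (λ x → 𝟙 (S x xor T x)) ≤ 3 ^ n → dist S T ℚ.≤ ε
  distance-≤ {n} S T q ε ε≥ h = ℚ.≤-trans
    (/-≤ (+ length wrong) (+ 1) (3 ^ n) q {{m^n≢0 3 n}} (subst₂ ℤ._≤_ (ℤ.pos-* (length wrong) q) (ℤ.pos-* 1 (3 ^ n))
      (ℤ.+≤+ (≤-trans (≤-reflexive (trans (*-comm (length wrong) q) (cong (q *_) count)))
                      (≤-trans h (≤-reflexive (sym (*-identityˡ (3 ^ n)))))))))
    ε≥
    where
    wrong = filter (λ x → (S x xor T x) Bool.≟ true) (points n)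
    does-true : ∀ b → 𝟙 (does (b Bool.≟ true)) ≡ 𝟙 b
    does-true true  = refl
    does-true false = refl
    count : length wrong ≡ Σ (points n) (λ x → 𝟙 (S x xor T x))
    count = trans (length-filter (λ x → (S x xor T x) Bool.≟ true) (points n))
                  (Σ-cong (points n) (λ x → does-true (S x xor T x)))

  -- Markov's inequality: a failing sample has loss above B, whereas the mean loss is at most B/3.
  mostly-good : ∀ {n m} {P : Pred (Vec (Point n) m) 0ℓ} (P? : Decidable P) (loss : Vec (Point n) m → ℕ) B .{{_ : NonZero B}} →
    (∀ zs → loss zs ≤ B → P zs) → 3 * Σ (vectors (points n) m) loss ≤ (3 ^ n) ^ m * B →
    (+ 2) ℚ./ 3 ℚ.≤ Pr P?
  mostly-good {n} {m} P? loss B good-if total =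
    /-≤ (+ 2) (+ length good) 3 ((3 ^ n) ^ m) {{_}} {{m^n≢0 (3 ^ n) m {{m^n≢0 3 n}}}}
      (subst₂ ℤ._≤_ (ℤ.pos-* 2 ((3 ^ n) ^ m)) (ℤ.pos-* (length good) 3) (ℤ.+≤+ enough))
    where
    all  = vectors (points n) m
    good = filter P? all
    bad : Vec (Point n) m → ℕ
    bad zs = 𝟙 (not (does (P? zs)))
    bad-loss : ∀ zs → B * bad zs ≤ loss zs
    bad-loss zs with P? zs
    ... | yes _ = ≤-trans (≤-reflexive (*-zeroʳ B)) z≤n
    ... | no ¬p with loss zs ≤? B
    ...   | yes le = ⊥-elim (¬p (good-if zs le))
    ...   | no ¬le = ≤-trans (≤-reflexive (*-identityʳ B)) (<⇒≤ (≰⇒> ¬le))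
    few-bad : 3 * Σ all bad ≤ (3 ^ n) ^ m
    few-bad = *-cancelʳ-≤ _ _ B (begin
      3 * Σ all bad * B                ≡⟨ lemma (Σ all bad) B ⟩
      3 * (B * Σ all bad)              ≡⟨ cong (3 *_) (Σ-*ˡ all B bad) ⟨
      3 * Σ all (λ zs → B * bad zs)    ≤⟨ *-monoʳ-≤ 3 (Σ-mono all bad-loss) ⟩
      3 * Σ all loss                   ≤⟨ total ⟩
      (3 ^ n) ^ m * B                  ∎)
      where
      open ≤-Reasoning
      lemma : ∀ a b → 3 * a * b ≡ 3 * (b * a)
      lemma = solve-∀
    everything : length good + Σ all bad ≡ (3 ^ n) ^ m
    everything = begin
      length good + Σ all bad
        ≡⟨ cong (_+ Σ all bad) (length-filter P? all) ⟩
      Σ all (λ zs → 𝟙 (does (P? zs))) + Σ all bad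
        ≡⟨ Σ-+ all _ _ ⟨
      Σ all (λ zs → 𝟙 (does (P? zs)) + bad zs)
        ≡⟨ Σ-cong all (λ zs → complement (does (P? zs))) ⟩
      Σ all (λ _ → 1)
        ≡⟨ trans (Σ-const all 1) (*-identityʳ _) ⟩
      length all
        ≡⟨ trans (length-vectors (points n) m) (cong (_^ m) (length-vectors (−1ᵗ ∷ 0ᵗ ∷ +1ᵗ ∷ []) n)) ⟩
      (3 ^ n) ^ m ∎
      where
      open ≡-Reasoning
      complement : ∀ b → 𝟙 b + 𝟙 (not b) ≡ 1
      complement true  = refl
      complement false = refl
    enough : 2 * (3 ^ n) ^ m ≤ length good * 3
    enough = +-cancelʳ-≤ (3 * Σ all bad) _ _ (begin
      2 * (3 ^ n) ^ m + 3 * Σ all bad          ≤⟨ +-monoʳ-≤ (2 * (3 ^ n) ^ m) few-bad ⟩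
      2 * (3 ^ n) ^ m + (3 ^ n) ^ m            ≡⟨ lemma₁ ((3 ^ n) ^ m) ⟩
      3 * (3 ^ n) ^ m                          ≡⟨ cong (3 *_) everything ⟨
      3 * (length good + Σ all bad)            ≡⟨ lemma₂ (length good) (Σ all bad) ⟩
      length good * 3 + 3 * Σ all bad          ∎)
      where
      open ≤-Reasoning
      lemma₁ : ∀ a → 2 * a + a ≡ 3 * a
      lemma₁ = solve-∀
      lemma₂ : ∀ a b → 3 * (a + b) ≡ a * 3 + 3 * b
      lemma₂ = solve-∀

-- Timed total correctness of programs.

module TotalCorrectness where

  open import Data.Bool.Base using (true; false)
  open import Data.List.Base using (List; []; _∷_)
  open import Data.Nat.Base
  open import Data.Nat.Properties
  open import Data.Product.Base using (_,_)
  open import Data.Vec.Base using (Vec; _[_]≔_)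
  open import Relation.Binary.PropositionalEquality
  open import Defs

  private variable
    k : ℕ
    c d : Cmd k
    e : Exp k
    ρ : Vec Tree k
    es : List Tree
    s : State k
    b b′ : ℕ
    Q Q′ : State k → Set

  -- A Hoare triple for total correctness with a time bound and a fixed initial state. The
  -- postcondition may again be of the form `Halts`, so that loops can be verified in
  -- continuation-passing style.
  record Halts {k} (c : Cmd k) (s : State k) (b : ℕ) (Q : State k → Set) : Set where
    constructor halts
    field
      {time}  : ℕ
      {final} : State k
      bounded : time ≤ b
      runs    : ⟨ c , s ⟩⇓[ time ] final
      post    : Q final

  weaken : b ≤ b′ → Halts c s b Q → Halts c s b′ Q
  weaken le (halts l r q) = halts (≤-trans l le) r q

  assignᴴ : ∀ {i} → Q ((ρ [ i ]≔ eval e ρ) ∣ es) → Halts (i ≔ e) (ρ ∣ es) (suc (cost e)) Q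
  assignᴴ q = halts ≤-refl assign q

  drawᴴ : ∀ {i x} → Q ((ρ [ i ]≔ x) ∣ es) → Halts (draw i) (ρ ∣ x ∷ es) 1 Q
  drawᴴ q = halts ≤-refl draw q

  infixr 4 _⨾ᴴ_
  _⨾ᴴ_ : Halts c s b Q → (∀ {s′} → Q s′ → Halts d s′ b′ Q′) → Halts (c ⨾ d) s (b + b′) Q′
  halts l r q ⨾ᴴ h with h q
  ... | halts l′ r′ q′ = halts (+-mono-≤ l l′) (seq r r′) q′

  assignThen : ∀ {i} → Halts d ((ρ [ i ]≔ eval e ρ) ∣ es) b Q → Halts (i ≔ e ⨾ d) (ρ ∣ es) (suc (cost e) + b) Q
  assignThen (halts l r q) = halts (+-monoʳ-≤ _ l) (seq assign r) q

  ifTrue : truth (eval e ρ) ≡ true → Halts c (ρ ∣ es) b Q → Halts (if e then c else d) (ρ ∣ es) (suc (cost e + b)) Q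
  ifTrue {e = e} t (halts l r q) = halts (s≤s (+-monoʳ-≤ (cost e) l)) (if-true t r) q

  ifFalse : truth (eval e ρ) ≡ false → Halts d (ρ ∣ es) b Q → Halts (if e then c else d) (ρ ∣ es) (suc (cost e + b)) Q
  ifFalse {e = e} t (halts l r q) = halts (s≤s (+-monoʳ-≤ (cost e) l)) (if-false t r) q

  whileTrue : truth (eval e ρ) ≡ true → Halts c (ρ ∣ es) b (λ s′ → Halts (while e loop c) s′ b′ Q) →
              Halts (while e loop c) (ρ ∣ es) (suc (cost e + b + b′)) Q
  whileTrue {e = e} t (halts l r (halts l′ r′ q)) =
    halts (s≤s (+-mono-≤ (+-monoʳ-≤ (cost e) l) l′)) (while-true t r r′) q

  whileFalse : truth (eval e ρ) ≡ false → Q (ρ ∣ es) → Halts (while e loop c) (ρ ∣ es) (suc (cost e)) Q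
  whileFalse t q = halts ≤-refl (while-false t) q

  treeList : List Tree → Tree
  treeList []       = nil
  treeList (t ∷ ts) = t ∙ treeList ts

-- The evaluator: computing the vote with a stack.

module Evaluator where

  open import Data.Bool.Base using (Bool; true; false; not)
  open import Data.Fin.Base using (Fin)
  open import Data.Fin.Patterns
  open import Data.Integer.Base as ℤ using (ℤ; +_; 1ℤ; 0ℤ)
  import Data.Integer.Properties as ℤ
  import Data.Integer.Tactic.RingSolver as ℤSolver
  open import Data.List.Base using (List; []; _∷_; map; length)
  open import Data.Nat.Base hiding (compare)
  open import Data.Nat.Properties
  open import Data.Nat.Tactic.RingSolver using (solve-∀)
  open import Data.Product.Base using (∃-syntax; _×_; _,_; proj₁; proj₂)
  open import Data.Unit.Base using (tt)
  open import Data.Vec.Base using (Vec; []; _∷_)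
  open import Relation.Binary.PropositionalEquality hiding ([_]; J)
  open import Defs
  open TieBreaking using (posℤ)
  open EfronStein using (kernel; character)
  open EnergyTail using (±1)
  open TotalCorrectness

  -- A work item is ((x ∙ z) ∙ (d ∙ s)) and stands for the term s · kernel d x z.
  item : ∀ {n} → ℕ → Point n → Point n → Bool → Tree
  item d x z s = (encodePoint x ∙ encodePoint z) ∙ (encodeℕ d ∙ encodeBool s)

  -- Registers: 0 input and output, 1 the point to classify, 2 the remaining samples, 3 the degree
  -- bound, 4 the stack of work items, 5 and 6 unary counts of positive and negative votes, 7 the
  -- current item, 8 a flag.
  xsᴱ zsᴱ dᴱ sᴱ : Exp 9
  xsᴱ = hd (hd (var 7F))
  zsᴱ = tl (hd (var 7F))
  dᴱ  = hd (tl (var 7F))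
  sᴱ  = tl (tl (var 7F))

  trueᴱ : Exp 9
  trueᴱ = cons nil nil

  push : Exp 9 → Exp 9 → Cmd 9
  push d s = 4F ≔ cons (cons (cons (tl xsᴱ) (tl zsᴱ)) (cons d s)) (var 4F)

  -- Sets the flag if the leading trits agree. The three codes are told apart by whether they are
  -- nil and whether their head is nil.
  compare : Cmd 9
  compare =
    if hd xsᴱ
    then (if hd (hd xsᴱ)
          then (if hd (hd zsᴱ) then 8F ≔ trueᴱ else (8F ≔ nil))
          else (if hd zsᴱ
                then (if hd (hd zsᴱ) then 8F ≔ nil else (8F ≔ trueᴱ))
                else (8F ≔ nil)))
    else (if hd zsᴱ then 8F ≔ nil else (8F ≔ trueᴱ))

  -- One unfolding of the recursion of `kernel`, without integer arithmetic: a character 2 pushes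
  -- the item of lower degree twice, a character -1 pushes it once with the opposite sign, an
  -- exhausted item is one vote, and an item of degree bound 0 is discarded.
  process : Cmd 9
  process =
    7F ≔ hd (var 4F) ⨾
    4F ≔ tl (var 4F) ⨾
    (if dᴱ
     then (if xsᴱ
           then (push dᴱ sᴱ ⨾
                 compare ⨾
                 (if var 8F
                  then (push (tl dᴱ) sᴱ ⨾ push (tl dᴱ) sᴱ)
                  else (if sᴱ then push (tl dᴱ) nil else push (tl dᴱ) trueᴱ)))
           else (if sᴱ then 5F ≔ cons nil (var 5F) else (6F ≔ cons nil (var 6F))))
     else (8F ≔ nil))

  drain : Cmd 9
  drain = while var 4F loop process

  perSample : Cmd 9
  perSample =
    4F ≔ cons (cons (cons (var 1F) (hd (hd (var 2F)))) (cons (var 3F) (tl (hd (var 2F))))) nil ⨾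
    2F ≔ tl (var 2F) ⨾
    drain

  subtract : Cmd 9
  subtract = while var 6F loop (6F ≔ tl (var 6F) ⨾ 5F ≔ tl (var 5F))

  evaluatorBody : Cmd 9
  evaluatorBody =
    1F ≔ tl (var 0F) ⨾
    2F ≔ tl (hd (var 0F)) ⨾
    3F ≔ hd (hd (var 0F)) ⨾
    (while var 2F loop perSample) ⨾
    subtract ⨾
    0F ≔ var 5F

  evaluatorProgram : Program
  evaluatorProgram = record { auxiliary = 8 ; body = evaluatorBody }

  equal? : Trit → Trit → Bool
  equal? −1ᵗ −1ᵗ = true
  equal? 0ᵗ  0ᵗ  = true
  equal? +1ᵗ +1ᵗ = true
  equal? _   _   = false

  Count : Set
  Count = ℕ × ℕ

  -- The vote counts after an item has been worked off. The nesting follows the stack: the items of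
  -- lower degree are pushed last and therefore counted first.
  tally : ∀ {n} → ℕ → Point n → Point n → Bool → Count → Count
  kids : ∀ {n} → Bool → ℕ → Point n → Point n → Bool → Count → Count
  tally zero    x       z       s     c       = c
  tally (suc d) []      []      true  (p , q) = suc p , q
  tally (suc d) []      []      false (p , q) = p , suc q
  tally (suc d) (a ∷ x) (b ∷ z) s     c       = tally (suc d) x z s (kids (equal? a b) d x z s c)
  kids true  d x z s c = tally d x z s (tally d x z s c)
  kids false d x z s c = tally d x z (not s) c

  -- Bounds the number of items arising from one item, as though every character were 2.
  nodes : ℕ → ℕ → ℕ
  nodes n       zero    = 1
  nodes zero    (suc d) = 1
  nodes (suc n) (suc d) = 1 + nodes n (suc d) + 2 * nodes n d

  module _ (r₀ r₁ r₂ r₃ : Tree) where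

    regs : Tree → Count → Tree → Tree → Vec Tree 9
    regs σ (p , q) i f = r₀ ∷ r₁ ∷ r₂ ∷ r₃ ∷ σ ∷ encodeℕ p ∷ encodeℕ q ∷ i ∷ f ∷ []

    compareᴴ : ∀ {n} a b (x z : Point n) d s σ c f {Q : State 9 → Set} →
      Q (regs σ c (item d (a ∷ x) (b ∷ z) s) (encodeBool (equal? a b)) ∣ []) →
      Halts compare (regs σ c (item d (a ∷ x) (b ∷ z) s) f ∣ []) 40 Q
    compareᴴ −1ᵗ −1ᵗ x z d s σ c f q = weaken (≤ᵇ⇒≤ _ _ tt) (ifTrue refl (ifTrue refl (ifTrue refl (assignᴴ q))))
    compareᴴ −1ᵗ 0ᵗ  x z d s σ c f q = weaken (≤ᵇ⇒≤ _ _ tt) (ifTrue refl (ifTrue refl (ifFalse refl (assignᴴ q))))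
    compareᴴ −1ᵗ +1ᵗ x z d s σ c f q = weaken (≤ᵇ⇒≤ _ _ tt) (ifTrue refl (ifTrue refl (ifFalse refl (assignᴴ q))))
    compareᴴ 0ᵗ  −1ᵗ x z d s σ c f q = weaken (≤ᵇ⇒≤ _ _ tt) (ifFalse refl (ifTrue refl (assignᴴ q)))
    compareᴴ 0ᵗ  0ᵗ  x z d s σ c f q = weaken (≤ᵇ⇒≤ _ _ tt) (ifFalse refl (ifFalse refl (assignᴴ q)))
    compareᴴ 0ᵗ  +1ᵗ x z d s σ c f q = weaken (≤ᵇ⇒≤ _ _ tt) (ifFalse refl (ifTrue refl (assignᴴ q)))
    compareᴴ +1ᵗ −1ᵗ x z d s σ c f q = weaken (≤ᵇ⇒≤ _ _ tt) (ifTrue refl (ifFalse refl (ifTrue refl (ifTrue refl (assignᴴ q)))))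
    compareᴴ +1ᵗ 0ᵗ  x z d s σ c f q = weaken (≤ᵇ⇒≤ _ _ tt) (ifTrue refl (ifFalse refl (ifFalse refl (assignᴴ q))))
    compareᴴ +1ᵗ +1ᵗ x z d s σ c f q = weaken (≤ᵇ⇒≤ _ _ tt) (ifTrue refl (ifFalse refl (ifTrue refl (ifFalse refl (assignᴴ q)))))

    stepCost : ℕ
    -- Covers the loop test and at most 190 units for the body.
    stepCost = 200

    Drains : Tree → Count → ℕ → (State 9 → Set) → Set
    Drains σ c b Q = ∀ i f → Halts drain (regs σ c i f ∣ []) b Q

    loop-step : ∀ {σ c b Q} → truth σ ≡ true →
      (∀ i f → Halts process (regs σ c i f ∣ []) 190 (λ s′ → Halts drain s′ b Q)) → Drains σ c (stepCost + b) Q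
    loop-step {b = b} t h i f = weaken (+-monoˡ-≤ b {1 + (1 + 190)} {stepCost} (≤ᵇ⇒≤ _ _ tt)) (whileTrue t (h i f))

    -- The rest of the stack is treated as a continuation, so that the items pushed while one item
    -- is processed can be handled by the same statement, one inside the other.
    itemᴴ : ∀ {n} d (x z : Point n) s {σ c b Q} →
      Drains σ (tally d x z s c) b Q → Drains (item d x z s ∙ σ) c (nodes n d * stepCost + b) Q
    itemᴴ zero x z s {b = b} rest = loop-step refl (λ i f →
      weaken (≤ᵇ⇒≤ _ _ tt) (assignThen (assignThen (ifFalse refl (assignᴴ (rest _ _))))))
    itemᴴ (suc d) [] [] true rest = loop-step refl (λ i f →
      weaken (≤ᵇ⇒≤ _ _ tt) (assignThen (assignThen (ifTrue refl (ifFalse refl (ifTrue refl (assignᴴ (rest _ _))))))))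
    itemᴴ (suc d) [] [] false rest = loop-step refl (λ i f →
      weaken (≤ᵇ⇒≤ _ _ tt) (assignThen (assignThen (ifTrue refl (ifFalse refl (ifFalse refl (assignᴴ (rest _ _))))))))
    itemᴴ {suc n} (suc d) (a ∷ x) (b ∷ z) s {σ} {c} {t} {Q} rest i f = weaken bound
      (loop-step {b = 2 * (nodes n d * stepCost) + (nodes n (suc d) * stepCost + t)} refl (λ i f →
        weaken (≤ᵇ⇒≤ _ _ tt) (assignThen (assignThen (ifTrue refl (ifTrue refl (assignThen
          (compareᴴ a b x z (suc d) s (item (suc d) x z s ∙ σ) c f (branch (equal? a b) s same) ⨾ᴴ (λ h → h)))))))) i f)
      where
      same : Drains (item (suc d) x z s ∙ σ) (kids (equal? a b) d x z s c) (nodes n (suc d) * stepCost + t) Q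
      same = itemᴴ (suc d) x z s rest
      lemma : ∀ a b c t → c + (2 * (a * c) + (b * c + t)) ≡ (1 + b + 2 * a) * c + t
      lemma = solve-∀
      bound : stepCost + (2 * (nodes n d * stepCost) + (nodes n (suc d) * stepCost + t)) ≤
              nodes (suc n) (suc d) * stepCost + t
      bound = ≤-reflexive (lemma (nodes n d) (nodes n (suc d)) stepCost t)
      branch : ∀ e s → Drains (item (suc d) x z s ∙ σ) (kids e d x z s c) (nodes n (suc d) * stepCost + t) Q →
        Halts (if var 8F then (push (tl dᴱ) sᴱ ⨾ push (tl dᴱ) sᴱ)
               else (if sᴱ then push (tl dᴱ) nil else push (tl dᴱ) trueᴱ))
          (regs (item (suc d) x z s ∙ σ) c (item (suc d) (a ∷ x) (b ∷ z) s) (encodeBool e) ∣ []) 80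
          (λ s′ → Halts drain s′ (2 * (nodes n d * stepCost) + (nodes n (suc d) * stepCost + t)) Q)
      branch true s h = weaken (≤ᵇ⇒≤ _ _ tt) (ifTrue refl (assignThen (assignᴴ
        (weaken (≤-reflexive (shape (nodes n d * stepCost) _)) (itemᴴ d x z s (itemᴴ d x z s h) _ _)))))
        where
        shape : ∀ a b → a + (a + b) ≡ 2 * a + b
        shape = solve-∀
      branch false true  h = weaken (≤ᵇ⇒≤ _ _ tt) (ifFalse refl (ifTrue refl (assignᴴ
        (weaken (+-monoˡ-≤ _ (m≤m+n (nodes n d * stepCost) _)) (itemᴴ d x z false h _ _)))))
      branch false false h = weaken (≤ᵇ⇒≤ _ _ tt) (ifFalse refl (ifFalse refl (assignᴴ
        (weaken (+-monoˡ-≤ _ (m≤m+n (nodes n d * stepCost) _)) (itemᴴ d x z true h _ _)))))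

  value : Count → ℤ
  value (p , q) = + p ℤ.- + q

  value-tally : ∀ {n} d (x z : Point n) s c → value (tally d x z s c) ≡ value c ℤ.+ ±1 s ℤ.* kernel d x z
  value-kids : ∀ {n} a b d (x z : Point n) s c →
    value (kids (equal? a b) d x z s c) ≡ value c ℤ.+ ±1 s ℤ.* (character a b ℤ.* kernel d x z)
  value-tally zero x z s c = lemma (value c) (±1 s)
    where
    lemma : ∀ v s → v ≡ v ℤ.+ s ℤ.* 0ℤ
    lemma = ℤSolver.solve-∀
  value-tally (suc d) [] [] true (p , q) = lemma (+ p) (+ q)
    where
    lemma : ∀ p q → (1ℤ ℤ.+ p) ℤ.- q ≡ (p ℤ.- q) ℤ.+ 1ℤ ℤ.* 1ℤ
    lemma = ℤSolver.solve-∀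
  value-tally (suc d) [] [] false (p , q) = lemma (+ p) (+ q)
    where
    lemma : ∀ p q → p ℤ.- (1ℤ ℤ.+ q) ≡ (p ℤ.- q) ℤ.+ ℤ.-1ℤ ℤ.* 1ℤ
    lemma = ℤSolver.solve-∀
  value-tally (suc d) (a ∷ x) (b ∷ z) s c =
    trans (value-tally (suc d) x z s (kids (equal? a b) d x z s c))
      (trans (cong (λ v → v ℤ.+ ±1 s ℤ.* kernel (suc d) x z) (value-kids a b d x z s c))
             (lemma (value c) (±1 s) (kernel (suc d) x z) (character a b ℤ.* kernel d x z)))
    where
    lemma : ∀ v s k l → v ℤ.+ s ℤ.* l ℤ.+ s ℤ.* k ≡ v ℤ.+ s ℤ.* (k ℤ.+ l)
    lemma = ℤSolver.solve-∀
  value-kids a b d x z s c = table a b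
    where
    K = kernel d x z
    same : value (tally d x z s (tally d x z s c)) ≡ value c ℤ.+ ±1 s ℤ.* ((+ 2) ℤ.* K)
    same = trans (value-tally d x z s (tally d x z s c))
      (trans (cong (λ v → v ℤ.+ ±1 s ℤ.* K) (value-tally d x z s c)) (lemma (value c) (±1 s) K))
      where
      lemma : ∀ v s k → v ℤ.+ s ℤ.* k ℤ.+ s ℤ.* k ≡ v ℤ.+ s ℤ.* ((+ 2) ℤ.* k)
      lemma = ℤSolver.solve-∀
    flipped : value (tally d x z (not s) c) ≡ value c ℤ.+ ±1 s ℤ.* (ℤ.-1ℤ ℤ.* K)
    flipped = trans (value-tally d x z (not s) c) (go s)
      where
      up : ∀ v k → v ℤ.+ ℤ.-1ℤ ℤ.* k ≡ v ℤ.+ 1ℤ ℤ.* (ℤ.-1ℤ ℤ.* k)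
      up = ℤSolver.solve-∀
      down : ∀ v k → v ℤ.+ 1ℤ ℤ.* k ≡ v ℤ.+ ℤ.-1ℤ ℤ.* (ℤ.-1ℤ ℤ.* k)
      down = ℤSolver.solve-∀
      go : ∀ s → value c ℤ.+ ±1 (not s) ℤ.* K ≡ value c ℤ.+ ±1 s ℤ.* (ℤ.-1ℤ ℤ.* K)
      go true  = up (value c) K
      go false = down (value c) K
    table : ∀ a b → value (kids (equal? a b) d x z s c) ≡ value c ℤ.+ ±1 s ℤ.* (character a b ℤ.* K)
    table −1ᵗ −1ᵗ = same
    table −1ᵗ 0ᵗ  = flipped
    table −1ᵗ +1ᵗ = flipped
    table 0ᵗ  −1ᵗ = flipped
    table 0ᵗ  0ᵗ  = same
    table 0ᵗ  +1ᵗ = flipped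
    table +1ᵗ −1ᵗ = flipped
    table +1ᵗ 0ᵗ  = flipped
    table +1ᵗ +1ᵗ = same

  -- The number of negative votes is the number of rounds of the final subtraction and so enters the
  -- running time.
  votes-bound : ∀ {n} d (x z : Point n) s c → proj₂ (tally d x z s c) ≤ nodes n d + proj₂ c
  votes-bound zero    x       z       s     c       = m≤n+m _ 1
  votes-bound (suc d) []      []      true  (p , q) = m≤n+m _ 1
  votes-bound (suc d) []      []      false (p , q) = ≤-refl
  votes-bound {suc n} (suc d) (a ∷ x) (b ∷ z) s c = begin
    proj₂ (tally (suc d) x z s (kids (equal? a b) d x z s c))
      ≤⟨ votes-bound (suc d) x z s _ ⟩
    nodes n (suc d) + proj₂ (kids (equal? a b) d x z s c)
      ≤⟨ +-monoʳ-≤ (nodes n (suc d)) (kids-bound (equal? a b)) ⟩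
    nodes n (suc d) + (2 * nodes n d + proj₂ c)
      ≤⟨ n≤1+n _ ⟩
    1 + (nodes n (suc d) + (2 * nodes n d + proj₂ c))
      ≡⟨ cong suc (+-assoc (nodes n (suc d)) _ _) ⟨
    nodes (suc n) (suc d) + proj₂ c ∎
    where
    open ≤-Reasoning
    kids-bound : ∀ e → proj₂ (kids e d x z s c) ≤ 2 * nodes n d + proj₂ c
    kids-bound true  = ≤-trans (votes-bound d x z s (tally d x z s c))
      (≤-trans (+-monoʳ-≤ (nodes n d) (votes-bound d x z s c)) (≤-reflexive (lemma (nodes n d) (proj₂ c))))
      where
      lemma : ∀ a b → a + (a + b) ≡ 2 * a + b
      lemma = solve-∀
    kids-bound false = ≤-trans (votes-bound d x z (not s) c) (+-monoˡ-≤ (proj₂ c) (m≤m+n (nodes n d) _))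

  example : ∀ {n} → Subset n → Point n → Tree
  example S z = encodePoint z ∙ encodeBool (S z)

  module _ {n : ℕ} (S : Subset n) (d : ℕ) (x : Point n) where

    tallyAll : List (Point n) → Count → Count
    tallyAll []       c = c
    tallyAll (z ∷ zs) c = tallyAll zs (tally d x z (S z) c)

    scoreSum : List (Point n) → ℤ
    scoreSum []       = 0ℤ
    scoreSum (z ∷ zs) = kernel d x z ℤ.* ±1 (S z) ℤ.+ scoreSum zs

    value-tallyAll : ∀ zs c → value (tallyAll zs c) ≡ value c ℤ.+ scoreSum zs
    value-tallyAll []       c = sym (ℤ.+-identityʳ _)
    value-tallyAll (z ∷ zs) c = trans (value-tallyAll zs _)
      (trans (cong (λ v → v ℤ.+ scoreSum zs) (value-tally d x z (S z) c))
             (lemma (value c) (±1 (S z)) (kernel d x z) (scoreSum zs)))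
      where
      lemma : ∀ v s k t → v ℤ.+ s ℤ.* k ℤ.+ t ≡ v ℤ.+ (k ℤ.* s ℤ.+ t)
      lemma = ℤSolver.solve-∀

    allVotes-bound : ∀ zs c → proj₂ (tallyAll zs c) ≤ length zs * nodes n d + proj₂ c
    allVotes-bound []       c = ≤-refl
    allVotes-bound (z ∷ zs) c = ≤-trans (allVotes-bound zs _)
      (≤-trans (+-monoʳ-≤ (length zs * nodes n d) (votes-bound d x z (S z) c))
               (≤-reflexive (lemma (nodes n d) (length zs * nodes n d) (proj₂ c))))
      where
      lemma : ∀ a b c → b + (a + c) ≡ (a + b) + c
      lemma = solve-∀

    sampleCost : ℕ
    sampleCost = nodes n d * 200 + 60

    samplesᴴ : ∀ r₀ zs σ c i f {Q : State 9 → Set} →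
      (∀ σ i f → Q (regs r₀ (encodePoint x) nil (encodeℕ d) σ (tallyAll zs c) i f ∣ [])) →
      Halts (while var 2F loop perSample)
        (regs r₀ (encodePoint x) (treeList (map (example S) zs)) (encodeℕ d) σ c i f ∣ [])
        (length zs * sampleCost + 2) Q
    samplesᴴ r₀ []       σ c i f q = whileFalse refl (q _ _ _)
    samplesᴴ r₀ (z ∷ zs) σ c i f q = weaken (≤-trans (m≤m+n _ 39) (≤-reflexive (lemma (nodes n d * 200) (length zs * sampleCost))))
      (whileTrue refl (assignThen (assignThen
        (itemᴴ r₀ (encodePoint x) (treeList (map (example S) zs)) (encodeℕ d) d x z (S z)
          (λ i f → whileFalse refl (samplesᴴ r₀ zs nil _ i f q)) i f))))
      where
      lemma : ∀ a t → suc (1 + (14 + (3 + (a + 2))) + (t + 2)) + 39 ≡ a + 60 + t + 2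
      lemma = solve-∀

  -- The tail of nil is nil, so the loop computes truncated subtraction, and the result is nonzero
  -- just if the score is positive.
  subtractᴴ : ∀ r₀ r₁ r₂ r₃ σ p q i f {Q : State 9 → Set} →
    Q (regs r₀ r₁ r₂ r₃ σ (p ∸ q , 0) i f ∣ []) → Halts subtract (regs r₀ r₁ r₂ r₃ σ (p , q) i f ∣ []) (q * 10 + 2) Q
  subtractᴴ r₀ r₁ r₂ r₃ σ p       zero    i f h = whileFalse refl h
  subtractᴴ r₀ r₁ r₂ r₃ σ zero    (suc q) i f {Q} h = weaken (+-monoˡ-≤ (q * 10 + 2) {8} {10} (≤ᵇ⇒≤ _ _ tt))
    (whileTrue refl (assignThen (assignᴴ (subtractᴴ r₀ r₁ r₂ r₃ σ zero q i f
      (subst (λ k → Q (regs r₀ r₁ r₂ r₃ σ (k , 0) i f ∣ [])) (sym (0∸n≡0 q)) h)))))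
  subtractᴴ r₀ r₁ r₂ r₃ σ (suc p) (suc q) i f h = weaken (+-monoˡ-≤ (q * 10 + 2) {8} {10} (≤ᵇ⇒≤ _ _ tt))
    (whileTrue refl (assignThen (assignᴴ (subtractᴴ r₀ r₁ r₂ r₃ σ p q i f h))))

  truth-∸ : ∀ p q → truth (encodeℕ (p ∸ q)) ≡ posℤ (+ p ℤ.- + q)
  truth-∸ zero    zero    = refl
  truth-∸ (suc p) zero    = refl
  truth-∸ zero    (suc q) = refl
  truth-∸ (suc p) (suc q) = trans (truth-∸ p q) (cong posℤ (lemma (+ p) (+ q)))
    where
    lemma : ∀ p q → p ℤ.- q ≡ (1ℤ ℤ.+ p) ℤ.- (1ℤ ℤ.+ q)
    lemma = ℤSolver.solve-∀

  evaluate : ∀ {n} (S : Subset n) d x zs →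
    ∃[ answer ] (Computes evaluatorProgram ((encodeℕ d ∙ treeList (map (example S) zs)) ∙ encodePoint x) []
                   (length zs * (nodes n d * 210 + 60) + 50) answer
                 × truth answer ≡ posℤ (scoreSum S d x zs))
  evaluate {n} S d x zs = _ , finish run , trans (truth-∸ p q) (cong posℤ (trans (value-tallyAll S d x zs (0 , 0)) (ℤ.+-identityˡ _)))
    where
    c = tallyAll S d x zs (0 , 0)
    p = proj₁ c
    q = proj₂ c
    input = (encodeℕ d ∙ treeList (map (example S) zs)) ∙ encodePoint x
    L = length zs
    Out : State 9 → Set
    Out s = ∃[ ρ ] s ≡ ((encodeℕ (p ∸ q) ∷ ρ) ∣ [])
    bound : 3 + (4 + (4 + ((L * (nodes n d * 200 + 60) + 2) + ((q * 10 + 2) + 2)))) ≤ L * (nodes n d * 210 + 60) + 50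
    bound = begin
      3 + (4 + (4 + ((L * (nodes n d * 200 + 60) + 2) + ((q * 10 + 2) + 2))))
        ≤⟨ m≤m+n _ 33 ⟩
      3 + (4 + (4 + ((L * (nodes n d * 200 + 60) + 2) + ((q * 10 + 2) + 2)))) + 33
        ≡⟨ lemma₁ L (nodes n d) q ⟩
      L * (nodes n d * 200 + 60) + q * 10 + 50
        ≤⟨ +-monoˡ-≤ 50 (+-monoʳ-≤ (L * (nodes n d * 200 + 60)) (*-monoˡ-≤ 10
             (≤-trans (allVotes-bound S d x zs (0 , 0)) (≤-reflexive (+-identityʳ _))))) ⟩
      L * (nodes n d * 200 + 60) + L * nodes n d * 10 + 50
        ≡⟨ lemma₂ L (nodes n d) ⟩
      L * (nodes n d * 210 + 60) + 50 ∎
      where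
      open ≤-Reasoning
      lemma₁ : ∀ L N q → 3 + (4 + (4 + ((L * (N * 200 + 60) + 2) + ((q * 10 + 2) + 2)))) + 33 ≡
                         L * (N * 200 + 60) + q * 10 + 50
      lemma₁ = solve-∀
      lemma₂ : ∀ L N → L * (N * 200 + 60) + L * N * 10 + 50 ≡ L * (N * 210 + 60) + 50
      lemma₂ = solve-∀
    run : Halts evaluatorBody ((input ∷ nil ∷ nil ∷ nil ∷ nil ∷ nil ∷ nil ∷ nil ∷ nil ∷ []) ∣ [])
            (L * (nodes n d * 210 + 60) + 50) Out
    run = weaken bound (assignThen (assignThen (assignThen
      (samplesᴴ S d x input zs nil (0 , 0) nil nil
        (λ σ i f → subtractᴴ input (encodePoint x) nil (encodeℕ d) σ p q i f (assignᴴ (_ , refl)) ⨾ᴴ (λ h → h)) ⨾ᴴ (λ h → h)))))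
    finish : ∀ {t} → Halts evaluatorBody ((input ∷ nil ∷ nil ∷ nil ∷ nil ∷ nil ∷ nil ∷ nil ∷ nil ∷ []) ∣ []) t Out →
             Computes evaluatorProgram input [] t (encodeℕ (p ∸ q))
    finish (halts le r (ρ , refl)) = _ , ρ , [] , le , r

-- The learner: parameters by halving, and sampling.

module Learner where

  open import Data.Bool.Base using (true)
  open import Data.Fin.Base using (Fin; zero; suc)
  open import Data.Fin.Patterns
  open import Data.List.Base using (List; []; _∷_; _++_; length; _ʳ++_)
  open import Data.List.Properties using (++-assoc; ++-ʳ++)
  open import Data.Nat.Base
  open import Data.Nat.Properties
  open import Data.Nat.Tactic.RingSolver using (solve-∀)
  open import Data.Product.Base using (∃-syntax; _×_; _,_)
  open import Data.Unit.Base using (tt)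
  open import Data.Vec.Base using ([]; _∷_)
  open import Relation.Binary.PropositionalEquality hiding ([_]; J)
  open import Defs
  open TotalCorrectness

  dropᴱ : ∀ {k} → ℕ → Exp k → Exp k
  dropᴱ zero    e = e
  dropᴱ (suc j) e = tl (dropᴱ j e)

  addᴱ : ∀ {k} → ℕ → Exp k → Exp k
  addᴱ zero    e = e
  addᴱ (suc j) e = cons nil (addᴱ j e)

  copiesᴱ : ∀ {k} → ℕ → Exp k → Exp k → Exp k
  copiesᴱ zero    e e′ = e′
  copiesᴱ (suc j) e e′ = cons e (copiesᴱ j e e′)

  -- Registers: 0 the dimension n and the output, 1 to 3 the quotients of n by 16ᵃ, 4ᵃ and 2ᵃ, 4
  -- scratch for halving, 5 a stack of exponents, 6 the current exponent, 7 the samples so far, 8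
  -- the latest sample.
  halveLoop : Fin 9 → Cmd 9
  halveLoop i = while tl (var i) loop (4F ≔ cons nil (var 4F) ⨾ i ≔ tl (tl (var i)))

  halve : Fin 9 → Cmd 9
  halve i = 4F ≔ nil ⨾ halveLoop i ⨾ i ≔ var 4F

  divide : Cmd 9
  divide = halve 1F ⨾ halve 1F ⨾ halve 1F ⨾ halve 1F ⨾ halve 2F ⨾ halve 2F ⨾ halve 3F

  -- The test removes R units, so it succeeds while n/16ᵃ > R. In this way 2ᵃ reaches the order of
  -- (n/R)^(1/4), a fourth root obtained by halving alone.
  parameters : ℕ → Cmd 9
  parameters R = while dropᴱ R (var 1F) loop divide

  -- An exponent E on the stack stands for 16ᴱ draws: a positive one is replaced by 16 copies of its
  -- predecessor, and a zero draws one example. The number 16ᴱ itself is never written down.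
  drawOrSplit : Cmd 9
  drawOrSplit =
    6F ≔ hd (var 5F) ⨾
    5F ≔ tl (var 5F) ⨾
    (if var 6F
     then 5F ≔ copiesᴱ 16 (tl (var 6F)) (var 5F)
     else (draw 8F ⨾ 7F ≔ cons (var 8F) (var 7F)))

  collect : Cmd 9
  collect = while var 5F loop drawOrSplit

  learnerBody : ℕ → ℕ → Cmd 9
  learnerBody R q =
    1F ≔ var 0F ⨾
    2F ≔ var 0F ⨾
    3F ≔ var 0F ⨾
    parameters R ⨾
    5F ≔ cons (addᴱ q (cons nil (var 3F))) nil ⨾
    collect ⨾
    0F ≔ cons (cons nil (var 2F)) (var 7F)

  learnerProgram : ℕ → ℕ → Program
  learnerProgram R q = record { auxiliary = 8 ; body = learnerBody R q }

  half : ℕ → ℕ → ℕ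
  half zero    n = n
  half (suc k) n = ⌊ half k n /2⌋

  half-≤ : ∀ k n → half k n ≤ n
  half-≤ zero    n = ≤-refl
  half-≤ (suc k) n = ≤-trans (⌊n/2⌋≤n (half k n)) (half-≤ k n)

  cost-drop : ∀ R (e : Exp 9) → cost (dropᴱ R e) ≡ R + cost e
  cost-drop zero    e = refl
  cost-drop (suc R) e = cong suc (cost-drop R e)

  eval-drop : ∀ R (e : Exp 9) ρ v → eval e ρ ≡ encodeℕ v → eval (dropᴱ R e) ρ ≡ encodeℕ (v ∸ R)
  eval-drop zero    e ρ v h = h
  eval-drop (suc R) e ρ v h = trans (cong tail (eval-drop R e ρ v h))
    (trans (tail-encode (v ∸ R)) (cong encodeℕ (trans (pred[m∸n]≡m∸[1+n] v R) refl)))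
    where
    tail-encode : ∀ k → tail (encodeℕ k) ≡ encodeℕ (pred k)
    tail-encode zero    = refl
    tail-encode (suc k) = refl

  truth-encode : ∀ {k} → 0 < k → truth (encodeℕ k) ≡ true
  truth-encode (s≤s _) = refl

  round : ℕ → ℕ → ℕ
  round R n = suc ((R + 1) + 7 * (n * 7 + 8))

  module _ (r₀ : Tree) (es : List Tree) where

    regs : ℕ → ℕ → ℕ → ℕ → State 9
    regs v D e h = (r₀ ∷ encodeℕ v ∷ encodeℕ D ∷ encodeℕ e ∷ encodeℕ h ∷ nil ∷ nil ∷ nil ∷ nil ∷ []) ∣ es

    halveLoop₁ : ∀ k h D e {Q : State 9 → Set} → (∀ r → Q (regs r D e (h + ⌊ k /2⌋))) →
      Halts (halveLoop 1F) (regs k D e h) (k * 7 + 3) Q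
    halveLoop₁ zero          h D e {Q} q = whileFalse refl (subst (λ z → Q (regs 0 D e z)) (+-identityʳ h) (q 0))
    halveLoop₁ (suc zero)    h D e {Q} q = weaken (≤ᵇ⇒≤ _ _ tt)
      (whileFalse refl (subst (λ z → Q (regs 1 D e z)) (+-identityʳ h) (q 1)))
    halveLoop₁ (suc (suc k)) h D e {Q} q = weaken (+-monoˡ-≤ (k * 7 + 3) {suc (2 + (4 + 4))} {14} (≤ᵇ⇒≤ _ _ tt))
      (whileTrue refl (assignThen (assignᴴ (halveLoop₁ k (suc h) D e
        (λ r → subst (λ z → Q (regs r D e z)) (+-suc h ⌊ k /2⌋) (q r))))))

    halveLoop₂ : ∀ k h v e {Q : State 9 → Set} → (∀ r → Q (regs v r e (h + ⌊ k /2⌋))) →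
      Halts (halveLoop 2F) (regs v k e h) (k * 7 + 3) Q
    halveLoop₂ zero          h v e {Q} q = whileFalse refl (subst (λ z → Q (regs v 0 e z)) (+-identityʳ h) (q 0))
    halveLoop₂ (suc zero)    h v e {Q} q = weaken (≤ᵇ⇒≤ _ _ tt)
      (whileFalse refl (subst (λ z → Q (regs v 1 e z)) (+-identityʳ h) (q 1)))
    halveLoop₂ (suc (suc k)) h v e {Q} q = weaken (+-monoˡ-≤ (k * 7 + 3) {suc (2 + (4 + 4))} {14} (≤ᵇ⇒≤ _ _ tt))
      (whileTrue refl (assignThen (assignᴴ (halveLoop₂ k (suc h) v e
        (λ r → subst (λ z → Q (regs v r e z)) (+-suc h ⌊ k /2⌋) (q r))))))

    halveLoop₃ : ∀ k h v D {Q : State 9 → Set} → (∀ r → Q (regs v D r (h + ⌊ k /2⌋))) →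
      Halts (halveLoop 3F) (regs v D k h) (k * 7 + 3) Q
    halveLoop₃ zero          h v D {Q} q = whileFalse refl (subst (λ z → Q (regs v D 0 z)) (+-identityʳ h) (q 0))
    halveLoop₃ (suc zero)    h v D {Q} q = weaken (≤ᵇ⇒≤ _ _ tt)
      (whileFalse refl (subst (λ z → Q (regs v D 1 z)) (+-identityʳ h) (q 1)))
    halveLoop₃ (suc (suc k)) h v D {Q} q = weaken (+-monoˡ-≤ (k * 7 + 3) {suc (2 + (4 + 4))} {14} (≤ᵇ⇒≤ _ _ tt))
      (whileTrue refl (assignThen (assignᴴ (halveLoop₃ k (suc h) v D
        (λ r → subst (λ z → Q (regs v D r z)) (+-suc h ⌊ k /2⌋) (q r))))))

    halve₁ : ∀ {v D e} h n → v ≤ n → {Q : State 9 → Set} → (∀ h′ → Q (regs ⌊ v /2⌋ D e h′)) →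
      Halts (halve 1F) (regs v D e h) (n * 7 + 8) Q
    halve₁ {v} {D} {e} h n le q = weaken
      (≤-trans (+-monoˡ-≤ 4 (+-monoˡ-≤ 3 (*-monoˡ-≤ 7 le))) (≤-trans (n≤1+n _) (≤-reflexive (lemma n))))
      (weaken (≤-reflexive (shape v)) (assignThen (halveLoop₁ v 0 D e (λ r → assignᴴ (q ⌊ v /2⌋)) ⨾ᴴ (λ z → z))))
      where
      lemma : ∀ n → suc (n * 7 + 3 + 4) ≡ n * 7 + 8
      lemma = solve-∀
      shape : ∀ k → 2 + (k * 7 + 3 + 2) ≡ k * 7 + 3 + 4
      shape = solve-∀

    halve₂ : ∀ {v D e} h n → D ≤ n → {Q : State 9 → Set} → (∀ h′ → Q (regs v ⌊ D /2⌋ e h′)) →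
      Halts (halve 2F) (regs v D e h) (n * 7 + 8) Q
    halve₂ {v} {D} {e} h n le q = weaken
      (≤-trans (+-monoˡ-≤ 4 (+-monoˡ-≤ 3 (*-monoˡ-≤ 7 le))) (≤-trans (n≤1+n _) (≤-reflexive (lemma n))))
      (weaken (≤-reflexive (shape D)) (assignThen (halveLoop₂ D 0 v e (λ r → assignᴴ (q ⌊ D /2⌋)) ⨾ᴴ (λ z → z))))
      where
      lemma : ∀ n → suc (n * 7 + 3 + 4) ≡ n * 7 + 8
      lemma = solve-∀
      shape : ∀ k → 2 + (k * 7 + 3 + 2) ≡ k * 7 + 3 + 4
      shape = solve-∀

    halve₃ : ∀ {v D e} h n → e ≤ n → {Q : State 9 → Set} → (∀ h′ → Q (regs v D ⌊ e /2⌋ h′)) →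
      Halts (halve 3F) (regs v D e h) (n * 7 + 8) Q
    halve₃ {v} {D} {e} h n le q = weaken
      (≤-trans (+-monoˡ-≤ 4 (+-monoˡ-≤ 3 (*-monoˡ-≤ 7 le))) (≤-trans (n≤1+n _) (≤-reflexive (lemma n))))
      (weaken (≤-reflexive (shape e)) (assignThen (halveLoop₃ e 0 v D (λ r → assignᴴ (q ⌊ e /2⌋)) ⨾ᴴ (λ z → z))))
      where
      lemma : ∀ n → suc (n * 7 + 3 + 4) ≡ n * 7 + 8
      lemma = solve-∀
      shape : ∀ k → 2 + (k * 7 + 3 + 2) ≡ k * 7 + 3 + 4
      shape = solve-∀

    divideᴴ : ∀ n {v D e} h → v ≤ n → D ≤ n → e ≤ n → {Q : State 9 → Set} →
      (∀ h′ → Q (regs (half 4 v) (half 2 D) (half 1 e) h′)) →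
      Halts divide (regs v D e h) (7 * (n * 7 + 8)) Q
    divideᴴ n {v} {D} {e} h hv hD he q = weaken (≤-reflexive (lemma (n * 7 + 8)))
      (halve₁ h n hv (λ h →
       halve₁ h n (≤-trans (half-≤ 1 v) hv) (λ h →
       halve₁ h n (≤-trans (half-≤ 2 v) hv) (λ h →
       halve₁ h n (≤-trans (half-≤ 3 v) hv) (λ h →
       halve₂ h n hD (λ h →
       halve₂ h n (≤-trans (half-≤ 1 D) hD) (λ h →
       halve₃ h n he q) ⨾ᴴ λ z → z) ⨾ᴴ λ z → z) ⨾ᴴ λ z → z) ⨾ᴴ λ z → z) ⨾ᴴ λ z → z) ⨾ᴴ λ z → z)
      where
      lemma : ∀ c → c + (c + (c + (c + (c + (c + c))))) ≡ 7 * c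
      lemma = solve-∀

    parametersᴴ : ∀ R n k a h → (∀ j → j < k → R < half ((j + a) * 4) n) → half ((k + a) * 4) n ≤ R →
      {Q : State 9 → Set} → (∀ h′ → Q (regs (half ((k + a) * 4) n) (half ((k + a) * 2) n) (half (k + a) n) h′)) →
      Halts (parameters R) (regs (half (a * 4) n) (half (a * 2) n) (half a n) h) (k * round R n + suc (R + 1)) Q
    parametersᴴ R n zero a h big small q = weaken (s≤s (≤-reflexive (cost-drop R (var 1F))))
      (whileFalse (cong truth (trans (eval-drop R (var 1F) (State.registers (regs v D e h)) v refl)
                                     (cong encodeℕ (m≤n⇒m∸n≡0 small)))) (q h))
      where
      v = half (a * 4) n
      D = half (a * 2) n
      e = half a n
    parametersᴴ R n (suc k) a h big small {Q} q =
      weaken (≤-reflexive (trans (cong (λ c → suc (c + 7 * (n * 7 + 8) + (k * round R n + suc (R + 1)))) (cost-drop R (var 1F)))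
                                 (sym (+-assoc (round R n) (k * round R n) _))))
        (whileTrue (trans (cong truth (eval-drop R (var 1F) (State.registers (regs v D e h)) v refl))
                          (truth-encode (m<n⇒0<n∸m (big 0 (s≤s z≤n)))))
          (divideᴴ n h (half-≤ (a * 4) n) (half-≤ (a * 2) n) (half-≤ a n) (λ h′ →
            parametersᴴ R n k (suc a) h′
              (λ j j<k → subst (λ b → R < half (b * 4) n) (sym (+-suc j a)) (big (suc j) (s≤s j<k)))
              (subst (λ b → half (b * 4) n ≤ R) (sym (+-suc k a)) small)
              (λ h″ → subst (λ b → Q (regs (half (b * 4) n) (half (b * 2) n) (half b n) h″)) (sym (+-suc k a)) (q h″)))))
      where
      v = half (a * 4) n
      D = half (a * 2) n
      e = half a n

  split-length : ∀ {A : Set} (xs : List A) a b → length xs ≡ a + b →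
                 ∃[ ys ] ∃[ zs ] (xs ≡ ys ++ zs × length ys ≡ a × length zs ≡ b)
  split-length xs       zero    b e = [] , xs , refl , refl , e
  split-length (x ∷ xs) (suc a) b e with split-length xs a b (suc-injective e)
  ... | ys , zs , refl , ea , eb = x ∷ ys , zs , refl , cong suc ea , eb

  drawCost : ℕ → ℕ
  drawCost zero    = 60
  drawCost (suc E) = 60 + 16 * drawCost E

  -- The surplus 60 strengthens the claim so that the geometric recursion closes: the fixed cost of
  -- a split is absorbed in 16 times the surplus.
  drawCost-bound : ∀ E → drawCost E + 60 ≤ 120 * 16 ^ E
  drawCost-bound zero    = ≤-refl
  drawCost-bound (suc E) = begin
    60 + 16 * drawCost E + 60          ≤⟨ m≤m+n _ 840 ⟩
    60 + 16 * drawCost E + 60 + 840    ≡⟨ lemma₁ (drawCost E) ⟩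
    16 * (drawCost E + 60)             ≤⟨ *-monoʳ-≤ 16 (drawCost-bound E) ⟩
    16 * (120 * 16 ^ E)                ≡⟨ lemma₂ (16 ^ E) ⟩
    120 * 16 ^ suc E                   ∎
    where
    open ≤-Reasoning
    lemma₁ : ∀ a → 60 + 16 * a + 60 + 840 ≡ 16 * (a + 60)
    lemma₁ = solve-∀
    lemma₂ : ∀ a → 16 * (120 * a) ≡ 120 * (16 * a)
    lemma₂ = solve-∀

  module _ (r₀ r₁ r₂ r₃ r₄ : Tree) where

    drawing : Tree → Tree → List Tree → Tree → List Tree → State 9
    drawing σ i acc x es = (r₀ ∷ r₁ ∷ r₂ ∷ r₃ ∷ r₄ ∷ σ ∷ i ∷ treeList acc ∷ x ∷ []) ∣ es

    copies : ℕ → ℕ → Tree → Tree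
    copies zero    E σ = σ
    copies (suc k) E σ = encodeℕ E ∙ copies k E σ

    -- The examples consumed are divided among the copies along the recursion. They are put in front
    -- of the accumulator one by one, hence the reversal.
    drawsᴴ : ∀ E k σ pre {post acc b} {Q : State 9 → Set} → length pre ≡ k * 16 ^ E →
      (∀ i x → Halts collect (drawing σ i (pre ʳ++ acc) x post) b Q) →
      ∀ i x → Halts collect (drawing (copies k E σ) i acc x (pre ++ post)) (k * drawCost E + b) Q
    drawsᴴ E zero    σ []  len rest i x = rest i x
    drawsᴴ E (suc k) σ pre len rest i x with split-length pre (16 ^ E) (k * 16 ^ E) len
    drawsᴴ zero (suc k) σ _ {b = b} len rest i x | y ∷ [] , zs , refl , _ , len′ =
      weaken (≤-trans (+-monoˡ-≤ (k * 60 + b) {15} {60} (≤ᵇ⇒≤ _ _ tt)) (≤-reflexive (sym (+-assoc 60 (k * 60) b))))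
        (whileTrue refl (assignThen (assignThen (ifFalse refl (drawᴴ (assignᴴ (drawsᴴ zero k σ zs len′ rest _ _)) ⨾ᴴ (λ h → h))))))
    drawsᴴ (suc E) (suc k) σ _ {post} {acc} {b} {Q} len rest i x | ys , zs , refl , len₁ , len₂ =
      weaken (≤-trans (+-monoˡ-≤ (16 * drawCost E + (k * drawCost (suc E) + b)) {60} {60} ≤-refl)
                      (≤-reflexive (shape (16 * drawCost E) (k * drawCost (suc E)) b)))
        (whileTrue refl (assignThen (assignThen (ifTrue refl (assignᴴ
          (subst (λ es → Halts collect (drawing (copies 16 E (copies k (suc E) σ)) _ acc _ es) _ Q)
            (sym (++-assoc ys zs post))
            (drawsᴴ E 16 (copies k (suc E) σ) ys len₁
              (drawsᴴ (suc E) k σ zs len₂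
                (λ i x → subst (λ acc′ → Halts collect (drawing σ i acc′ x post) b Q) (++-ʳ++ ys) (rest i x))) _ _)))))))
      where
      shape : ∀ a c b → 60 + (a + (c + b)) ≡ 60 + a + c + b
      shape = solve-∀

  cost-add : ∀ q (e : Exp 9) → cost (addᴱ q e) ≡ 2 * q + cost e
  cost-add zero    e = refl
  cost-add (suc q) e = trans (cong (λ z → suc (suc z)) (cost-add q e)) (lemma q (cost e))
    where
    lemma : ∀ q c → suc (suc (2 * q + c)) ≡ 2 * suc q + c
    lemma = solve-∀

  eval-add : ∀ q (e : Exp 9) ρ k → eval e ρ ≡ encodeℕ k → eval (addᴱ q e) ρ ≡ encodeℕ (q + k)
  eval-add zero    e ρ k h = h
  eval-add (suc q) e ρ k h = cong (nil ∙_) (eval-add q e ρ k h)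

  learnTime : ℕ → ℕ → ℕ → ℕ → ℕ → ℕ
  learnTime R q n a E = a * round R n + R + 2 * q + 120 * 16 ^ E + 40

  -- After a rounds of division the sample size is 16ᴱ with E = q + 1 + n / 2ᵃ,
  -- and the degree is 1 + n / 4ᵃ.
  learn : ∀ R q n a → (∀ j → j < a → R < half (j * 4) n) → half (a * 4) n ≤ R →
    ∀ es → length es ≡ 16 ^ (q + suc (half a n)) →
    Computes (learnerProgram R q) (encodeℕ n) es (learnTime R q n a (q + suc (half a n)))
      (encodeℕ (suc (half (a * 2) n)) ∙ treeList (es ʳ++ []))
  learn R q n a big small es len = finish run
    where
    E = q + suc (half a n)
    D = half (a * 2) n
    answer = encodeℕ (suc D) ∙ treeList (es ʳ++ [])
    Out : State 9 → Set
    Out s = ∃[ ρ ] s ≡ ((answer ∷ ρ) ∣ [])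
    init : State 9
    init = (encodeℕ n ∷ nil ∷ nil ∷ nil ∷ nil ∷ nil ∷ nil ∷ nil ∷ nil ∷ []) ∣ es
    a+0 : a + 0 ≡ a
    a+0 = +-identityʳ a
    sampling : ∀ v e h → e ≡ half a n →
      Halts (5F ≔ cons (addᴱ q (cons nil (var 3F))) nil ⨾ collect ⨾ 0F ≔ cons (cons nil (var 2F)) (var 7F))
        (regs (encodeℕ n) es v D e h) ((2 * q + 6) + ((1 * drawCost E + 2) + 6)) Out
    sampling v e h refl = weaken (+-monoˡ-≤ ((1 * drawCost E + 2) + 6) (≤-reflexive costEq)) (assignThen
      (subst (λ σ → Halts (collect ⨾ 0F ≔ cons (cons nil (var 2F)) (var 7F))
               ((encodeℕ n ∷ encodeℕ v ∷ encodeℕ D ∷ encodeℕ e ∷ encodeℕ h ∷ (σ ∙ nil) ∷ nil ∷ nil ∷ nil ∷ []) ∣ es)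
               ((1 * drawCost E + 2) + 6) Out)
        (sym (eval-add q (cons nil (var 3F)) _ (suc (half a n)) refl))
        (subst (λ es′ → Halts collect (drawing (encodeℕ n) (encodeℕ v) (encodeℕ D) (encodeℕ e) (encodeℕ h) (encodeℕ E ∙ nil) nil [] nil es′)
                   (1 * drawCost E + 2) Ready)
          (++-identityʳ′ es)
          (drawsᴴ (encodeℕ n) (encodeℕ v) (encodeℕ D) (encodeℕ e) (encodeℕ h) E 1 nil es
            (trans len (sym (+-identityʳ _))) (λ i x → whileFalse refl (ready i x)) nil nil)
         ⨾ᴴ (λ { (i , x , refl) → assignᴴ (_ , refl) }))))
      where
      Ready : State 9 → Set
      Ready s = ∃[ i ] ∃[ x ] s ≡ drawing (encodeℕ n) (encodeℕ v) (encodeℕ D) (encodeℕ e) (encodeℕ h) nil i (es ʳ++ []) x []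
      ready : ∀ i x → Ready (drawing (encodeℕ n) (encodeℕ v) (encodeℕ D) (encodeℕ e) (encodeℕ h) nil i (es ʳ++ []) x [])
      ready i x = i , x , refl
      ++-identityʳ′ : ∀ (xs : List Tree) → xs ++ [] ≡ xs
      ++-identityʳ′ []       = refl
      ++-identityʳ′ (x ∷ xs) = cong (x ∷_) (++-identityʳ′ xs)
      costEq : suc (suc (cost (addᴱ q (cons nil (var 3F))) + 1)) ≡ 2 * q + 6
      costEq = trans (cong (λ c → suc (suc (c + 1))) (cost-add q (cons nil (var 3F)))) (lemma q)
        where
        lemma : ∀ q → suc (suc (2 * q + 3 + 1)) ≡ 2 * q + 6
        lemma = solve-∀
    bound : 2 + (2 + (2 + ((a * round R n + suc (R + 1)) + ((2 * q + 6) + ((1 * drawCost E + 2) + 6))))) ≤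
            learnTime R q n a E
    bound = begin
      2 + (2 + (2 + ((a * round R n + suc (R + 1)) + ((2 * q + 6) + ((1 * drawCost E + 2) + 6)))))
        ≤⟨ m≤m+n _ 78 ⟩
      2 + (2 + (2 + ((a * round R n + suc (R + 1)) + ((2 * q + 6) + ((1 * drawCost E + 2) + 6))))) + 78
        ≡⟨ lemma (a * round R n) R q (drawCost E) ⟩
      a * round R n + R + 2 * q + (drawCost E + 60) + 40
        ≤⟨ +-monoˡ-≤ 40 (+-monoʳ-≤ (a * round R n + R + 2 * q) (drawCost-bound E)) ⟩
      learnTime R q n a E ∎
      where
      open ≤-Reasoning
      lemma : ∀ A R q c → 2 + (2 + (2 + ((A + suc (R + 1)) + ((2 * q + 6) + ((1 * c + 2) + 6))))) + 78 ≡ A + R + 2 * q + (c + 60) + 40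
      lemma = solve-∀
    run : Halts (learnerBody R q) init (learnTime R q n a E) Out
    run = weaken bound (assignThen (assignThen (assignThen
      (parametersᴴ (encodeℕ n) es R n a 0 0
        (λ j j<a → subst (λ b → R < half (b * 4) n) (sym (+-identityʳ j)) (big j j<a))
        (subst (λ b → half (b * 4) n ≤ R) (sym a+0) small)
        (λ h → subst (λ b → Halts (5F ≔ cons (addᴱ q (cons nil (var 3F))) nil ⨾ collect ⨾ 0F ≔ cons (cons nil (var 2F)) (var 7F))
                          (regs (encodeℕ n) es (half ((a + 0) * 4) n) b (half (a + 0) n) h)
                          ((2 * q + 6) + ((1 * drawCost E + 2) + 6)) Out)
                 (cong (λ b → half (b * 2) n) (sym a+0))
                 (sampling (half ((a + 0) * 4) n) (half (a + 0) n) h (cong (λ b → half b n) a+0)))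
       ⨾ᴴ (λ z → z)))))
    finish : ∀ {t} → Halts (learnerBody R q) init t Out → Computes (learnerProgram R q) (encodeℕ n) es t answer
    finish (halts le r (ρ , refl)) = _ , ρ , [] , le , r

-- Size of the kernel and of the parameters.

module Estimates where

  open import Data.Nat.Base
  open import Data.Nat.Properties
  open import Data.Nat.Tactic.RingSolver using (solve-∀)
  open import Data.Product.Base using (∃-syntax; _×_; _,_)
  open import Data.Sum.Base using (inj₁; inj₂)
  open import Relation.Binary.PropositionalEquality hiding ([_]; J)
  open import Relation.Nullary using (yes; no)
  open Sampling using (volume)
  open Evaluator using (nodes)
  open Learner using (half)

  half-upper : ∀ k n → 2 ^ k * half k n ≤ n
  half-upper zero    n = ≤-reflexive (+-identityʳ n)
  half-upper (suc k) n = begin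
    2 * 2 ^ k * ⌊ half k n /2⌋           ≡⟨ lemma (2 ^ k) ⌊ half k n /2⌋ ⟩
    2 ^ k * (⌊ half k n /2⌋ + ⌊ half k n /2⌋) ≤⟨ *-monoʳ-≤ (2 ^ k) (≤-trans (+-monoʳ-≤ ⌊ half k n /2⌋ (⌊n/2⌋≤⌈n/2⌉ (half k n)))
                                                                    (≤-reflexive (⌊n/2⌋+⌈n/2⌉≡n (half k n)))) ⟩
    2 ^ k * half k n                     ≤⟨ half-upper k n ⟩
    n                                    ∎
    where
    open ≤-Reasoning
    lemma : ∀ a b → 2 * a * b ≡ a * (b + b)
    lemma = solve-∀

  half-lower : ∀ k n → n < 2 ^ k * suc (half k n)
  half-lower zero    n = ≤-reflexive (sym (+-identityʳ (suc n)))
  half-lower (suc k) n = begin-strict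
    n                                        <⟨ half-lower k n ⟩
    2 ^ k * suc (half k n)                   ≤⟨ *-monoʳ-≤ (2 ^ k) (twice (half k n)) ⟩
    2 ^ k * (2 * suc ⌊ half k n /2⌋)         ≡⟨ lemma (2 ^ k) (suc ⌊ half k n /2⌋) ⟩
    2 * 2 ^ k * suc ⌊ half k n /2⌋           ∎
    where
    open ≤-Reasoning
    twice : ∀ m → suc m ≤ 2 * suc ⌊ m /2⌋
    twice zero          = s≤s z≤n
    twice (suc zero)    = ≤-refl
    twice (suc (suc m)) = ≤-trans (s≤s (s≤s (twice m))) (≤-reflexive (l ⌊ m /2⌋))
      where
      l : ∀ a → suc (suc (2 * suc a)) ≡ 2 * suc (suc a)
      l = solve-∀
    lemma : ∀ a b → a * (2 * b) ≡ 2 * a * b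
    lemma = solve-∀

  half-+ : ∀ j k n → half (j + k) n ≡ half j (half k n)
  half-+ zero    k n = refl
  half-+ (suc j) k n = cong ⌊_/2⌋ (half-+ j k n)

  n<2^n : ∀ n → n < 2 ^ n
  n<2^n zero    = s≤s z≤n
  n<2^n (suc n) = ≤-trans (+-mono-≤ (m^n>0 2 n) (n<2^n n)) (≤-reflexive (cong (2 ^ n +_) (sym (+-identityʳ (2 ^ n)))))

  -- The rounds are searched one after the other; n of them are enough, since n < 2ⁿ makes the
  -- quotient vanish.
  stopping : ∀ R n → ∃[ a ] ((∀ j → j < a → R < half (j * 4) n) × half (a * 4) n ≤ R)
  stopping R n = search n 0 (λ _ ()) (subst (λ b → half (b * 4) n ≤ R) (sym (+-identityʳ n)) vanishes)
    where
    vanishes : half (n * 4) n ≤ R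
    vanishes = ≤-trans (≤-reflexive (n≤0⇒n≡0 (≮⇒≥ (λ pos → <-irrefl refl (begin-strict
      n                              <⟨ n<2^n n ⟩
      2 ^ n                          ≤⟨ ^-monoʳ-≤ 2 (m≤m*n n 4) ⟩
      2 ^ (n * 4)                    ≡⟨ *-identityʳ (2 ^ (n * 4)) ⟨
      2 ^ (n * 4) * 1                ≤⟨ *-monoʳ-≤ (2 ^ (n * 4)) pos ⟩
      2 ^ (n * 4) * half (n * 4) n   ≤⟨ half-upper (n * 4) n ⟩
      n                              ∎))))) z≤n
      where open ≤-Reasoning
    search : ∀ k a → (∀ j → j < a → R < half (j * 4) n) → half ((k + a) * 4) n ≤ R →
             ∃[ a ] ((∀ j → j < a → R < half (j * 4) n) × half (a * 4) n ≤ R)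
    search zero    a big small = a , big , small
    search (suc k) a big small with half (a * 4) n ≤? R
    ... | yes le = a , big , le
    ... | no ¬le = search k (suc a) big′ (subst (λ b → half (b * 4) n ≤ R) (sym (+-suc k a)) small)
      where
      big′ : ∀ j → j < suc a → R < half (j * 4) n
      big′ j (s≤s j≤a) with m≤n⇒m<n∨m≡n j≤a
      ... | inj₁ j<a  = big j j<a
      ... | inj₂ refl = ≰⇒> ¬le

  -- The exponential-moment bound: a set of i ≤ D coordinates has ℓ^(D - i) ≥ 1, so the volume is at
  -- most ℓᴰ times the sum of C(n, i) (2/ℓ)ⁱ over all i.
  volume-bound : ∀ n D ℓ → 1 ≤ ℓ → volume n (suc D) * ℓ ^ n ≤ ℓ ^ D * (ℓ + 2) ^ n
  volume-bound zero    D ℓ ℓ>0 = ≤-trans (m^n>0 ℓ {{>-nonZero ℓ>0}} D) (≤-reflexive (sym (*-identityʳ (ℓ ^ D))))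
  volume-bound (suc n) D ℓ ℓ>0 = begin
    (volume n (suc D) + 2 * volume n D) * (ℓ * ℓ ^ n)
      ≡⟨ lemma₁ (volume n (suc D)) (volume n D) ℓ (ℓ ^ n) ⟩
    ℓ * (volume n (suc D) * ℓ ^ n) + 2 * (ℓ * (volume n D * ℓ ^ n))
      ≤⟨ +-mono-≤ (*-monoʳ-≤ ℓ (volume-bound n D ℓ ℓ>0)) (*-monoʳ-≤ 2 (lower D)) ⟩
    ℓ * (ℓ ^ D * (ℓ + 2) ^ n) + 2 * (ℓ ^ D * (ℓ + 2) ^ n)
      ≡⟨ lemma₂ ℓ (ℓ ^ D) ((ℓ + 2) ^ n) ⟩
    ℓ ^ D * ((ℓ + 2) * (ℓ + 2) ^ n) ∎
    where
    open ≤-Reasoning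
    lemma₁ : ∀ v w l x → (v + 2 * w) * (l * x) ≡ l * (v * x) + 2 * (l * (w * x))
    lemma₁ = solve-∀
    lemma₂ : ∀ l d x → l * (d * x) + 2 * (d * x) ≡ d * ((l + 2) * x)
    lemma₂ = solve-∀
    lower : ∀ D → ℓ * (volume n D * ℓ ^ n) ≤ ℓ ^ D * (ℓ + 2) ^ n
    lower zero     = ≤-trans (≤-reflexive (*-zeroʳ ℓ)) z≤n
    lower (suc D)  = ≤-trans (*-monoʳ-≤ ℓ (volume-bound n D ℓ ℓ>0)) (≤-reflexive (sym (*-assoc ℓ (ℓ ^ D) _)))

  -- 2 `nodes` + 1 satisfies the same homogeneous recursion as `volume`, so the same weighting by
  -- powers of ℓ applies.
  nodes-bound : ∀ n d ℓ → 1 ≤ ℓ → (2 * nodes n d + 1) * ℓ ^ n ≤ 3 * (ℓ ^ d * (ℓ + 2) ^ n)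
  nodes-bound n zero ℓ ℓ>0 = begin
    (2 * nodes n 0 + 1) * ℓ ^ n        ≡⟨ cong (λ z → (2 * z + 1) * ℓ ^ n) (base n) ⟩
    3 * ℓ ^ n                          ≤⟨ *-monoʳ-≤ 3 (^-monoˡ-≤ n (m≤m+n ℓ 2)) ⟩
    3 * (ℓ + 2) ^ n                    ≡⟨ cong (3 *_) (sym (*-identityˡ ((ℓ + 2) ^ n))) ⟩
    3 * (ℓ ^ 0 * (ℓ + 2) ^ n)          ∎
    where
    open ≤-Reasoning
    base : ∀ n → nodes n 0 ≡ 1
    base zero    = refl
    base (suc n) = refl
  nodes-bound zero (suc d) ℓ ℓ>0 = *-monoʳ-≤ 3 (≤-trans (m^n>0 ℓ {{>-nonZero ℓ>0}} (suc d)) (≤-reflexive (sym (*-identityʳ (ℓ ^ suc d)))))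
  nodes-bound (suc n) (suc d) ℓ ℓ>0 = begin
    (2 * (1 + nodes n (suc d) + 2 * nodes n d) + 1) * (ℓ * ℓ ^ n)
      ≡⟨ lemma₁ (nodes n (suc d)) (nodes n d) ℓ (ℓ ^ n) ⟩
    ℓ * ((2 * nodes n (suc d) + 1) * ℓ ^ n) + 2 * (ℓ * ((2 * nodes n d + 1) * ℓ ^ n))
      ≤⟨ +-mono-≤ (*-monoʳ-≤ ℓ (nodes-bound n (suc d) ℓ ℓ>0)) (*-monoʳ-≤ 2 (*-monoʳ-≤ ℓ (nodes-bound n d ℓ ℓ>0))) ⟩
    ℓ * (3 * (ℓ ^ suc d * (ℓ + 2) ^ n)) + 2 * (ℓ * (3 * (ℓ ^ d * (ℓ + 2) ^ n)))
      ≡⟨ lemma₂ ℓ (ℓ ^ d) ((ℓ + 2) ^ n) ⟩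
    3 * (ℓ ^ suc d * (ℓ + 2) ^ suc n) ∎
    where
    open ≤-Reasoning
    lemma₁ : ∀ v w l x → (2 * (1 + v + 2 * w) + 1) * (l * x) ≡ l * ((2 * v + 1) * x) + 2 * (l * ((2 * w + 1) * x))
    lemma₁ = solve-∀
    lemma₂ : ∀ l d x → l * (3 * (l * d * x)) + 2 * (l * (3 * (d * x))) ≡ 3 * (l * d * ((l + 2) * x))
    lemma₂ = solve-∀

  reverse-bernoulli : ∀ k i → suc k ^ i * suc k ≤ k ^ i * suc k + i * suc k ^ i
  reverse-bernoulli k zero    = m≤m+n _ 0
  reverse-bernoulli k (suc i) = begin
    suc k * suc k ^ i * suc k
      ≡⟨ *-assoc (suc k) (suc k ^ i) (suc k) ⟩
    suc k * (suc k ^ i * suc k)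
      ≤⟨ *-monoʳ-≤ (suc k) (reverse-bernoulli k i) ⟩
    suc k * (k ^ i * suc k + i * suc k ^ i)
      ≡⟨ lemma₁ k (k ^ i) i (suc k ^ i) ⟩
    k * k ^ i * suc k + (k ^ i * suc k + i * (suc k * suc k ^ i))
      ≤⟨ +-monoʳ-≤ (k * k ^ i * suc k) (+-monoˡ-≤ (i * (suc k * suc k ^ i))
           (≤-trans (*-monoˡ-≤ (suc k) (^-monoˡ-≤ i (n≤1+n k))) (≤-reflexive (*-comm (suc k ^ i) (suc k))))) ⟩
    k * k ^ i * suc k + suc i * (suc k * suc k ^ i) ∎
    where
    open ≤-Reasoning
    lemma₁ : ∀ k x i y → suc k * (x * suc k + i * y) ≡ k * x * suc k + (x * suc k + i * (suc k * y))
    lemma₁ = solve-∀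

  -- By `reverse-bernoulli`, (1 - 1/(k + 1))ⁱ is at least 1 - i/(k + 1), which is 1/2 here.
  doubling : ∀ k i → 1 ≤ i → 2 * i ≡ suc k → suc k ^ i ≤ 2 * k ^ i
  doubling k i i>0 e = *-cancelˡ-≤ i {{>-nonZero i>0}} (+-cancelʳ-≤ (i * suc k ^ i) _ _ (begin
    i * suc k ^ i + i * suc k ^ i      ≡⟨ lemma₁ i (suc k ^ i) ⟩
    suc k ^ i * (2 * i)                ≡⟨ cong (suc k ^ i *_) e ⟩
    suc k ^ i * suc k                  ≤⟨ reverse-bernoulli k i ⟩
    k ^ i * suc k + i * suc k ^ i      ≡⟨ cong (λ z → k ^ i * z + i * suc k ^ i) e ⟨
    k ^ i * (2 * i) + i * suc k ^ i    ≡⟨ cong (_+ i * suc k ^ i) (lemma₂ i (k ^ i)) ⟩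
    i * (2 * k ^ i) + i * suc k ^ i    ∎))
    where
    open ≤-Reasoning
    lemma₁ : ∀ i x → i * x + i * x ≡ x * (2 * i)
    lemma₁ = solve-∀
    lemma₂ : ∀ i x → x * (2 * i) ≡ i * (2 * x)
    lemma₂ = solve-∀

  ^-distribʳ-* : ∀ k a b → (a * b) ^ k ≡ a ^ k * b ^ k
  ^-distribʳ-* zero    a b = refl
  ^-distribʳ-* (suc k) a b = trans (cong (a * b *_) (^-distribʳ-* k a b)) (lemma a b (a ^ k) (b ^ k))
    where
    lemma : ∀ a b x y → a * b * (x * y) ≡ (a * x) * (b * y)
    lemma = solve-∀

  doubling-blocks : ∀ k i b n → 1 ≤ k → 1 ≤ i → 2 * i ≡ suc k → n ≤ i * b → suc k ^ n ≤ 2 ^ b * k ^ n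
  doubling-blocks k i b n k>0 i>0 e n≤ = *-cancelʳ-≤ _ _ (k ^ r) {{m^n≢0 k r {{>-nonZero k>0}}}} (begin
    suc k ^ n * k ^ r             ≤⟨ *-monoʳ-≤ (suc k ^ n) (^-monoˡ-≤ r (n≤1+n k)) ⟩
    suc k ^ n * suc k ^ r         ≡⟨ ^-distribˡ-+-* (suc k) n r ⟨
    suc k ^ (n + r)               ≡⟨ cong (suc k ^_) n+r ⟩
    suc k ^ (i * b)               ≡⟨ ^-*-assoc (suc k) i b ⟨
    (suc k ^ i) ^ b               ≤⟨ ^-monoˡ-≤ b (doubling k i i>0 e) ⟩
    (2 * k ^ i) ^ b               ≡⟨ ^-distribʳ-* b 2 (k ^ i) ⟩
    2 ^ b * (k ^ i) ^ b           ≡⟨ cong (2 ^ b *_) (^-*-assoc k i b) ⟩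
    2 ^ b * k ^ (i * b)           ≡⟨ cong (λ z → 2 ^ b * k ^ z) n+r ⟨
    2 ^ b * k ^ (n + r)           ≡⟨ cong (2 ^ b *_) (^-distribˡ-+-* k n r) ⟩
    2 ^ b * (k ^ n * k ^ r)       ≡⟨ *-assoc (2 ^ b) (k ^ n) (k ^ r) ⟨
    2 ^ b * k ^ n * k ^ r         ∎)
    where
    open ≤-Reasoning
    r = i * b ∸ n
    n+r : n + r ≡ i * b
    n+r = m+[n∸m]≡n n≤

  -- With ℓ = 2 (2ᵃ⁺¹ − 1) the ratio ((ℓ + 2) / ℓ)ⁿ is at most 2 to the
  -- power of the number of blocks of length 2ᵃ covering n.
  module Parameters (n a : ℕ) where

    e D λᵃ k ℓ : ℕ
    e  = half a n
    D  = half (a * 2) n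
    λᵃ = 2 ^ a
    k  = pred (2 * λᵃ)
    ℓ  = 2 * k

    λ>0 : 1 ≤ λᵃ
    λ>0 = m^n>0 2 a

    suc-k : 2 * λᵃ ≡ suc k
    suc-k = sym (suc-pred (2 * λᵃ) {{m*n≢0 2 λᵃ {{_}} {{m^n≢0 2 a}}}})

    k>0 : 1 ≤ k
    k>0 = s≤s⁻¹ (≤-trans (*-monoʳ-≤ 2 λ>0) (≤-reflexive suc-k))

    ℓ>0 : 1 ≤ ℓ
    ℓ>0 = ≤-trans k>0 (m≤m+n k _)

    ratio : (ℓ + 2) ^ n ≤ 2 ^ suc e * ℓ ^ n
    ratio = begin
      (ℓ + 2) ^ n                   ≡⟨ cong (_^ n) (lemma₁ k) ⟩
      (2 * suc k) ^ n               ≡⟨ ^-distribʳ-* n 2 (suc k) ⟩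
      2 ^ n * suc k ^ n             ≤⟨ *-monoʳ-≤ (2 ^ n) (doubling-blocks k λᵃ (suc e) n k>0 λ>0 suc-k (<⇒≤ (half-lower a n))) ⟩
      2 ^ n * (2 ^ suc e * k ^ n)   ≡⟨ lemma₂ (2 ^ n) (2 ^ suc e) (k ^ n) ⟩
      2 ^ suc e * (2 ^ n * k ^ n)   ≡⟨ cong (2 ^ suc e *_) (^-distribʳ-* n 2 k) ⟨
      2 ^ suc e * ℓ ^ n             ∎
      where
      open ≤-Reasoning
      lemma₁ : ∀ k → 2 * k + 2 ≡ 2 * suc k
      lemma₁ = solve-∀
      lemma₂ : ∀ a b c → a * (b * c) ≡ b * (a * c)
      lemma₂ = solve-∀

    ℓ≤ : ℓ ≤ 2 ^ (a + 2)
    ℓ≤ = begin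
      2 * k             ≤⟨ *-monoʳ-≤ 2 (pred[n]≤n {2 * λᵃ}) ⟩
      2 * (2 * λᵃ)      ≡⟨ lemma λᵃ ⟩
      λᵃ * 2 ^ 2        ≡⟨ ^-distribˡ-+-* 2 a 2 ⟨
      2 ^ (a + 2)       ∎
      where
      open ≤-Reasoning
      lemma : ∀ x → 2 * (2 * x) ≡ x * 4
      lemma = solve-∀

    λD≤e : λᵃ * D ≤ e
    λD≤e = ≤-trans (≤-reflexive (cong (λᵃ *_) (trans (cong (λ b → half b n) (double a)) (half-+ a a n)))) (half-upper a (half a n))
      where
      double : ∀ a → a * 2 ≡ a + a
      double = solve-∀

    -- Here a logarithm could enter, but it is absorbed: log₂ ℓ is at most a + 2 ≤ 2 · 2ᵃ, while D
    -- is at most e/2ᵃ, so that their product is at most 2 e.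
    ℓ^D : ℓ ^ D ≤ 4 ^ e
    ℓ^D = begin
      ℓ ^ D                   ≤⟨ ^-monoˡ-≤ D ℓ≤ ⟩
      (2 ^ (a + 2)) ^ D       ≡⟨ ^-*-assoc 2 (a + 2) D ⟩
      2 ^ ((a + 2) * D)       ≤⟨ ^-monoʳ-≤ 2 exponent ⟩
      2 ^ (2 * e)             ≡⟨ ^-*-assoc 2 2 e ⟨
      4 ^ e                   ∎
      where
      open ≤-Reasoning
      a+2≤ : a + 2 ≤ 2 * λᵃ
      a+2≤ = ≤-trans (≤-reflexive (+-comm a 2)) (≤-trans (+-mono-≤ {1} λ>0 (n<2^n a)) (≤-reflexive (cong (λᵃ +_) (sym (+-identityʳ λᵃ)))))
      exponent : (a + 2) * D ≤ 2 * e
      exponent = ≤-trans (*-monoˡ-≤ D a+2≤) (≤-trans (≤-reflexive (*-assoc 2 λᵃ D)) (*-monoʳ-≤ 2 λD≤e))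

    cancel-ℓ : ∀ {x y} → x * ℓ ^ n ≤ y * (ℓ + 2) ^ n → x ≤ y * 2 ^ suc e
    cancel-ℓ {x} {y} h = *-cancelʳ-≤ _ _ (ℓ ^ n) {{m^n≢0 ℓ n {{>-nonZero ℓ>0}}}}
      (≤-trans h (≤-trans (*-monoʳ-≤ y ratio) (≤-reflexive (sym (*-assoc y (2 ^ suc e) (ℓ ^ n))))))

    volume-small : volume n (suc D) ≤ 16 ^ suc e
    volume-small = begin
      volume n (suc D)         ≤⟨ cancel-ℓ {y = ℓ ^ D} (volume-bound n D ℓ ℓ>0) ⟩
      ℓ ^ D * 2 ^ suc e        ≤⟨ *-monoˡ-≤ (2 ^ suc e) (≤-trans ℓ^D (^-monoʳ-≤ 4 (n≤1+n e))) ⟩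
      4 ^ suc e * 2 ^ suc e    ≤⟨ *-monoʳ-≤ (4 ^ suc e) (^-monoˡ-≤ (suc e) {2} {4} (s≤s (s≤s z≤n))) ⟩
      4 ^ suc e * 4 ^ suc e    ≡⟨ ^-distribʳ-* (suc e) 4 4 ⟨
      16 ^ suc e               ∎
      where open ≤-Reasoning

    -- Compared with `volume-small` there is one more factor ℓ, of order 2ᵃ; the hypothesis lets
    -- 2^(e + 1) absorb it.
    nodes-small : λᵃ ≤ suc e → nodes n (suc D) ≤ 12 * 16 ^ suc e
    nodes-small λ≤ = begin
      nodes n (suc D)                                   ≤⟨ m≤m+n _ _ ⟩
      nodes n (suc D) + (nodes n (suc D) + 0)           ≤⟨ m≤m+n _ 1 ⟩
      2 * nodes n (suc D) + 1
        ≤⟨ cancel-ℓ {y = 3 * ℓ ^ suc D} (≤-trans (nodes-bound n (suc D) ℓ ℓ>0) (≤-reflexive (sym (*-assoc 3 (ℓ ^ suc D) _)))) ⟩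
      3 * (ℓ * ℓ ^ D) * 2 ^ suc e
        ≤⟨ *-monoˡ-≤ (2 ^ suc e) (*-monoʳ-≤ 3 (*-mono-≤ ℓ≤′ (≤-trans ℓ^D (^-monoʳ-≤ 4 (n≤1+n e))))) ⟩
      3 * (4 * 2 ^ suc e * 4 ^ suc e) * 2 ^ suc e
        ≡⟨ lemma (2 ^ suc e) (4 ^ suc e) ⟩
      12 * (2 ^ suc e * 2 ^ suc e * 4 ^ suc e)
        ≡⟨ cong (λ z → 12 * (z * 4 ^ suc e)) (^-distribʳ-* (suc e) 2 2) ⟨
      12 * (4 ^ suc e * 4 ^ suc e)
        ≡⟨ cong (12 *_) (^-distribʳ-* (suc e) 4 4) ⟨
      12 * 16 ^ suc e ∎
      where
      open ≤-Reasoning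
      lemma : ∀ x y → 3 * (4 * x * y) * x ≡ 12 * (x * x * y)
      lemma = solve-∀
      ℓ≤′ : ℓ ≤ 4 * 2 ^ suc e
      ℓ≤′ = ≤-trans ℓ≤ (≤-trans (≤-reflexive (trans (^-distribˡ-+-* 2 a 2) (*-comm λᵃ 4)))
              (*-monoʳ-≤ 4 (≤-trans λ≤ (<⇒≤ (n<2^n (suc e))))))

    module Stopped (R : ℕ) (n>0 : 1 ≤ n) (big : ∀ j → j < a → R < half (j * 4) n) (small : half (a * 4) n ≤ R) where

      16^a : ∀ b → 2 ^ (b * 4) ≡ 16 ^ b
      16^a b = trans (cong (2 ^_) (*-comm b 4)) (sym (^-*-assoc 2 4 b))

      n<16^aQ : n < 16 ^ a * suc R
      n<16^aQ = <-≤-trans (half-lower (a * 4) n)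
        (≤-trans (≤-reflexive (cong (_* suc (half (a * 4) n)) (16^a a))) (*-monoʳ-≤ (16 ^ a) (s≤s small)))

      last-round : ∀ b → a ≡ suc b → 16 ^ b * suc R ≤ n
      last-round b refl = ≤-trans (*-monoʳ-≤ (16 ^ b) (big b ≤-refl))
        (≤-trans (≤-reflexive (cong (_* half (b * 4) n) (sym (16^a b)))) (half-upper (b * 4) n))

      16^a≤n : 15 ≤ R → 16 ^ a ≤ n
      16^a≤n R≥ = go a refl
        where
        go : ∀ b → a ≡ b → 16 ^ a ≤ n
        go zero    eq = subst (λ b → 16 ^ b ≤ n) (sym eq) n>0
        -- R + 1 ≥ 16 pays for the round from b to b + 1.
        go (suc b) eq = ≤-trans (≤-trans (≤-reflexive (trans (cong (16 ^_) eq) (*-comm 16 (16 ^ b)))) (*-monoʳ-≤ (16 ^ b) (s≤s R≥))) (last-round b eq)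

      8^a≤ : 15 ≤ R → 8 ^ a ≤ suc e
      8^a≤ R≥ = *-cancelˡ-≤ λᵃ {{m^n≢0 2 a}} (begin
        λᵃ * 8 ^ a          ≡⟨ ^-distribʳ-* a 2 8 ⟨
        16 ^ a              ≤⟨ 16^a≤n R≥ ⟩
        n                   ≤⟨ <⇒≤ (half-lower a n) ⟩
        λᵃ * suc e          ∎)
        where open ≤-Reasoning

      λ≤ : 15 ≤ R → λᵃ ≤ suc e
      λ≤ R≥ = ≤-trans (^-monoˡ-≤ a {2} {8} (s≤s (s≤s z≤n))) (8^a≤ R≥)

      -- The last round was entered with n/16ᵇ > R, so 16ᵇ · 288 s⁴ ≤ n. As a = b + 1 and 288 = 16 ·
      -- 18, this says 16ᵃ · 18 n s⁴ ≤ n², and n < 4ᵃ d.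
      degree-large : ∀ s b → a ≡ suc b → suc R ≡ 288 * ((s * s) * (s * s)) → 18 * n * ((s * s) * (s * s)) ≤ suc D * suc D
      degree-large s b eq Q≡ = *-cancelˡ-≤ (16 ^ a) {{m^n≢0 16 a}} (begin
        16 ^ a * (18 * n * s⁴)         ≡⟨ cong (λ z → 16 ^ z * (18 * n * s⁴)) eq ⟩
        16 * 16 ^ b * (18 * n * s⁴)    ≡⟨ lemma₁ (16 ^ b) n s⁴ ⟩
        n * (16 ^ b * (288 * s⁴))      ≡⟨ cong (λ z → n * (16 ^ b * z)) (sym Q≡) ⟩
        n * (16 ^ b * suc R)           ≤⟨ *-monoʳ-≤ n (last-round b eq) ⟩
        n * n                          ≤⟨ *-mono-≤ (<⇒≤ (half-lower (a * 2) n)) (<⇒≤ (half-lower (a * 2) n)) ⟩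
        (2 ^ (a * 2) * suc D) * (2 ^ (a * 2) * suc D) ≡⟨ lemma₂ (2 ^ (a * 2)) (suc D) ⟩
        (2 ^ (a * 2) * 2 ^ (a * 2)) * (suc D * suc D) ≡⟨ cong (_* (suc D * suc D)) squares ⟩
        16 ^ a * (suc D * suc D)       ∎)
        where
        open ≤-Reasoning
        s⁴ = (s * s) * (s * s)
        lemma₁ : ∀ x n s → 16 * x * (18 * n * s) ≡ n * (x * (288 * s))
        lemma₁ = solve-∀
        lemma₂ : ∀ x d → (x * d) * (x * d) ≡ (x * x) * (d * d)
        lemma₂ = solve-∀
        squares : 2 ^ (a * 2) * 2 ^ (a * 2) ≡ 16 ^ a
        squares = trans (sym (^-distribˡ-+-* 2 (a * 2) (a * 2))) (trans (cong (2 ^_) (l a)) (16^a a))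
          where
          l : ∀ a → a * 2 + a * 2 ≡ a * 4
          l = solve-∀

      -- From 2ᵃ e ≤ n and n < 16ᵃ (R + 1) follows n e⁴ ≤ n⁴ (R + 1). This is the exponent n^(3/4),
      -- with a factor (R + 1)^(1/4) proportional to s.
      e⁴-bound : (e * e) * (e * e) ≤ n * n * n * suc R
      e⁴-bound = *-cancelˡ-≤ n {{>-nonZero n>0}} (begin
        n * (e * e * (e * e))
          ≤⟨ *-monoˡ-≤ (e * e * (e * e)) (<⇒≤ n<16^aQ) ⟩
        16 ^ a * suc R * (e * e * (e * e))
          ≡⟨ cong (λ z → z * suc R * (e * e * (e * e))) powers ⟩
        (λᵃ * λᵃ * (λᵃ * λᵃ)) * suc R * (e * e * (e * e))
          ≡⟨ lemma₁ λᵃ e (suc R) ⟩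
        (λᵃ * e) * (λᵃ * e) * ((λᵃ * e) * (λᵃ * e)) * suc R
          ≤⟨ *-monoˡ-≤ (suc R) (*-mono-≤ (*-mono-≤ (half-upper a n) (half-upper a n)) (*-mono-≤ (half-upper a n) (half-upper a n))) ⟩
        n * n * (n * n) * suc R
          ≡⟨ lemma₂ n (suc R) ⟩
        n * (n * n * n * suc R) ∎)
        where
        open ≤-Reasoning
        powers : 16 ^ a ≡ λᵃ * λᵃ * (λᵃ * λᵃ)
        powers = trans (^-distribʳ-* a 4 4) (cong (λ z → z * z) (^-distribʳ-* a 2 2))
        lemma₁ : ∀ l e q → (l * l * (l * l)) * q * (e * e * (e * e)) ≡ (l * e) * (l * e) * ((l * e) * (l * e)) * q
        lemma₁ = solve-∀
        lemma₂ : ∀ n q → n * n * (n * n) * q ≡ n * (n * n * n * q)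
        lemma₂ = solve-∀

-- Assembling the algorithm and its complexity.

module Learning where

  open import Algebra.Definitions.RawSemiring using () renaming (_^_ to power)
  open import Data.Bool.Base using (Bool; true; false; _xor_)
  open import Data.Empty using (⊥-elim)
  open import Data.Fin.Patterns
  open import Data.Integer.Base as ℤ using (ℤ; +[1+_]; -[1+_]; 1ℤ)
  import Data.Integer.Properties as ℤ
  import Data.Integer.Tactic.RingSolver as ℤSolver
  open import Data.List.Base using (List; []; _∷_; map; length; _ʳ++_)
  open import Data.List.Properties using (map-ʳ++; length-ʳ++; length-map)
  open import Data.Nat.Base
  open import Data.Nat.DivMod using (m≡m%n+[m/n]*n; m%n<n; m/n*n≤m)
  open import Data.Nat.Logarithm using (⌈log₂_⌉; ⌈log₂⌉-mono-≤; ⌈log₂2^n⌉≡n)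
  open import Data.Nat.Properties
  open import Data.Nat.Tactic.RingSolver using (solve-∀)
  open import Data.Product.Base using (Σ-syntax; ∃-syntax; _×_; _,_; proj₁; proj₂)
  open import Data.Rational.Base as ℚ using (ℚ; 0ℚ; 1ℚ; mkℚ)
  import Data.Rational.Properties as ℚ
  open import Data.Vec.Base as Vec using (Vec; []; _∷_)
  open import Data.Vec.Properties using (toList-map; length-toList)
  open import Function.Base using (_∘_)
  open import Relation.Binary.PropositionalEquality hiding ([_]; J)
  open import Relation.Nullary using (Dec; yes; no)
  open import Defs
  open Words using (𝟙; Σ; Σ-mono; Σ-const; Σ-*ˡ)
  open TieBreaking using (posℤ)
  open WindowAveraging using (length-vectors)
  open Fractions
  open Separation using (convex⇒separable)
  open NoiseSensitivity using (am-gm)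
  open EfronStein using (highEnergy; kernel)
  open EnergyTail using (±1; tail-bound; tail-beyond)
  open Sampling using (score; hypothesis; mistakes; expected-mistakes; volume)
  open Markov
  open TotalCorrectness
  open Evaluator using (evaluatorProgram; evaluate; example; scoreSum; nodes)
  open Learner using (learnerProgram; learn; learnTime; half; round)
  open Estimates

  -- The learner hands over the samples in reverse, and the score does not depend on their order.
  scoreSum-ʳ++ : ∀ {n} (S : Subset n) d x xs ys →
    scoreSum S d x (xs ʳ++ ys) ≡ scoreSum S d x xs ℤ.+ scoreSum S d x ys
  scoreSum-ʳ++ S d x []       ys = sym (ℤ.+-identityˡ _)
  scoreSum-ʳ++ S d x (z ∷ xs) ys = trans (scoreSum-ʳ++ S d x xs (z ∷ ys))
    (lemma (scoreSum S d x xs) (kernel d x z ℤ.* ±1 (S z)) (scoreSum S d x ys))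
    where
    lemma : ∀ a b c → a ℤ.+ (b ℤ.+ c) ≡ b ℤ.+ a ℤ.+ c
    lemma = ℤSolver.solve-∀

  scoreSum-score : ∀ {n m} (S : Subset n) d x (xs : Vec (Point n) m) →
                   scoreSum S d x (Vec.toList xs) ≡ score d (±1 ∘ S) xs x
  scoreSum-score S d x []       = refl
  scoreSum-score S d x (z ∷ xs) = cong (λ t → kernel d x z ℤ.* ±1 (S z) ℤ.+ t) (scoreSum-score S d x xs)

  Computes-≤ : ∀ {P input supply t u output} → t ≤ u → Computes P input supply t output → Computes P input supply u output
  Computes-≤ t≤u (_ , ρ , unused , le , run) = _ , ρ , unused , ≤-trans le t≤u , run

  fourth-power : ∀ x y → (x + y) * (x + y) * ((x + y) * (x + y)) ≤ 8 * (x * x * (x * x) + y * y * (y * y))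
  fourth-power x y = begin
    (x + y) * (x + y) * ((x + y) * (x + y))
      ≤⟨ *-mono-≤ (squares x y) (squares x y) ⟩
    2 * (x * x + y * y) * (2 * (x * x + y * y))
      ≡⟨ lemma₁ (x * x + y * y) ⟩
    4 * ((x * x + y * y) * (x * x + y * y))
      ≤⟨ *-monoʳ-≤ 4 (squares (x * x) (y * y)) ⟩
    4 * (2 * (x * x * (x * x) + y * y * (y * y)))
      ≡⟨ *-assoc 4 2 (x * x * (x * x) + y * y * (y * y)) ⟨
    8 * (x * x * (x * x) + y * y * (y * y)) ∎
    where
    open ≤-Reasoning
    lemma₁ : ∀ a → 2 * a * (2 * a) ≡ 4 * (a * a)
    lemma₁ = solve-∀
    squares : ∀ x y → (x + y) * (x + y) ≤ 2 * (x * x + y * y)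
    squares x y = +-cancelʳ-≤ ((x + y) * (x + y)) _ _ (begin
      (x + y) * (x + y) + (x + y) * (x + y)    ≡⟨ l₁ x y ⟩
      2 * (x * x + y * y) + 4 * (x * y)        ≤⟨ +-monoʳ-≤ (2 * (x * x + y * y)) (am-gm x y) ⟩
      2 * (x * x + y * y) + (x + y) * (x + y)  ∎)
      where
      l₁ : ∀ x y → (x + y) * (x + y) + (x + y) * (x + y) ≡ 2 * (x * x + y * y) + 4 * (x * y)
      l₁ = solve-∀

  4th : ℕ → ℕ
  4th x = x * x * (x * x)

  4th-* : ∀ x y → 4th (x * y) ≡ 4th x * 4th y
  4th-* = lemma
    where
    lemma : ∀ x y → (x * y) * (x * y) * ((x * y) * (x * y)) ≡ x * x * (x * x) * (y * y * (y * y))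
    lemma = solve-∀

  power₄ : ∀ x p b .{{_ : NonZero b}} .{{_ : NonZero (4th b)}} →
    power ℚ.+-*-rawSemiring ((ℤ.+ x ℚ./ 1) ℚ.* (ℤ.+ p ℚ./ b)) 4 ≡ ℤ.+ (4th (x * p)) ℚ./ 4th b
  power₄ x p (suc b) = begin
    r ℚ.* (r ℚ.* (r ℚ.* (r ℚ.* 1ℚ)))
      ≡⟨ trans (cong (λ z → r ℚ.* (r ℚ.* (r ℚ.* z))) (ℚ.*-identityʳ r)) (sym (ℚ.*-assoc r r (r ℚ.* r))) ⟩
    (r ℚ.* r) ℚ.* (r ℚ.* r)
      ≡⟨ cong (λ z → (z ℚ.* z) ℚ.* (z ℚ.* z)) r≡ ⟩
    (y ℚ.* y) ℚ.* (y ℚ.* y)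
      ≡⟨ cong (λ z → z ℚ.* z) (trans (/-* (ℤ.+ (x * p)) (ℤ.+ (x * p)) (suc b) (suc b))
           (cong (ℚ._/ (suc b * suc b)) (sym (ℤ.pos-* (x * p) (x * p))))) ⟩
    (ℤ.+ (x * p * (x * p)) ℚ./ (suc b * suc b)) ℚ.* (ℤ.+ (x * p * (x * p)) ℚ./ (suc b * suc b))
      ≡⟨ trans (/-* (ℤ.+ (x * p * (x * p))) (ℤ.+ (x * p * (x * p))) (suc b * suc b) (suc b * suc b))
           (cong (ℚ._/ 4th (suc b)) (sym (ℤ.pos-* (x * p * (x * p)) (x * p * (x * p))))) ⟩
    ℤ.+ (4th (x * p)) ℚ./ 4th (suc b) ∎
    where
    open ≡-Reasoning
    r y : ℚ
    r = (ℤ.+ x ℚ./ 1) ℚ.* (ℤ.+ p ℚ./ suc b)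
    y = ℤ.+ (x * p) ℚ./ suc b
    r≡ : r ≡ y
    r≡ = trans (/-* (ℤ.+ x) (ℤ.+ p) 1 (suc b)) (/-≡ (ℤ.+ x ℤ.* ℤ.+ p) (ℤ.+ (x * p)) (1 * suc b) (suc b)
      (cong₂ ℤ._*_ (sym (ℤ.pos-* x p)) (cong ℤ.+_ (sym (*-identityˡ (suc b))))))

  log-positive : ∀ n → 1 ≤ n → 1 ≤ ⌈log₂ suc n ⌉
  log-positive n n>0 = ≤-trans (≤-reflexive (sym (⌈log₂2^n⌉≡n 1))) (⌈log₂⌉-mono-≤ (s≤s n>0))

  exponent-bound : ∀ C x p b n .{{_ : NonZero b}} → 1 ≤ n → 1 ≤ C → 4th (x * p) ≤ C * (n * n * n) * 4th b →
    power ℚ.+-*-rawSemiring ((ℤ.+ x ℚ./ 1) ℚ.* (ℤ.+ p ℚ./ b)) 4 ℚ.≤ (ℤ.+ (C ^ 4 * n ^ 3 * ⌈log₂ suc n ⌉) ℚ./ 1)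
  exponent-bound C x p b@(suc _) n n>0 C>0 h = ℚ.≤-trans (ℚ.≤-reflexive (power₄ x p b))
    (/-≤ (ℤ.+ 4th (x * p)) (ℤ.+ (C ^ 4 * n ^ 3 * ⌈log₂ suc n ⌉)) (4th b) 1
      (subst₂ ℤ._≤_ (sym (ℤ.*-identityʳ _)) (ℤ.pos-* (C ^ 4 * n ^ 3 * ⌈log₂ suc n ⌉) (4th b)) (ℤ.+≤+ (begin
        4th (x * p)                                     ≤⟨ h ⟩
        C * (n * n * n) * 4th b                         ≤⟨ *-monoˡ-≤ (4th b) (*-mono-≤ C≤C⁴ (≤-reflexive (cube n))) ⟩
        C ^ 4 * n ^ 3 * 4th b                           ≡⟨ cong (_* 4th b) (*-identityʳ (C ^ 4 * n ^ 3)) ⟨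
        -- For n ≥ 1 the logarithm is at least 1, so it only enlarges the right side.
        C ^ 4 * n ^ 3 * 1 * 4th b                       ≤⟨ *-monoˡ-≤ (4th b) (*-monoʳ-≤ (C ^ 4 * n ^ 3) (log-positive n n>0)) ⟩
        C ^ 4 * n ^ 3 * ⌈log₂ suc n ⌉ * 4th b           ∎))))
    where
    open ≤-Reasoning
    cube : ∀ n → n * n * n ≡ n ^ 3
    cube = lemma
      where
      lemma : ∀ n → n * n * n ≡ n * (n * (n * 1))
      lemma = solve-∀
    C≤C⁴ : C ≤ C ^ 4
    C≤C⁴ = ≤-trans (≤-reflexive (sym (*-identityʳ C))) (*-monoʳ-≤ C (m^n>0 C {{>-nonZero C>0}} 3))

  ≤-product : ∀ l k x → l ≤ k → 1 ≤ x → l ≤ k * x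
  ≤-product l k x l≤k x>0 = ≤-trans l≤k (m≤m*n k x {{>-nonZero x>0}})

  -- R + 1 = 288 s⁴ with s = 432 q is this number times q⁴. Here 432 = 72 · 6, with 72 from
  -- `tail-bound` and 6 from `expected-mistakes`.
  constant : ℕ
  constant = 288 * 4th 432

  -- 165888 = 6⁴ · 8 · 2⁴ comes from the exponent 6 E, from `fourth-power`, and from q p ≤ 2 b, the
  -- price of rounding ε = p/b to 1/q. The 16 beside K is the fourth power of the 2 in E ≤ e + 2 q.
  leading : ℕ → ℕ
  leading K = 165888 * (K + 16)

  module Construction (K q s R : ℕ) (q>0 : 1 ≤ q) (s>0 : 1 ≤ s) (R≥15 : 15 ≤ R)
                      (s≡ : s ≡ 72 * (6 * q)) (Q≡ : suc R ≡ 288 * 4th s) (Q-K : suc R ≡ K * 4th q) where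

    algorithm : Algorithm
    algorithm = record { learner = learnerProgram R q ; evaluator = evaluatorProgram }

    module Dimension (n : ℕ) (n>0 : 1 ≤ n) where

      a : ℕ
      a = proj₁ (stopping R n)
      big : ∀ j → j < a → R < half (j * 4) n
      big = proj₁ (proj₂ (stopping R n))
      small : half (a * 4) n ≤ R
      small = proj₂ (proj₂ (stopping R n))

      open Parameters n a
      open Stopped R n>0 big small

      E d m t : ℕ
      E = q + suc e
      d = suc D
      m = 16 ^ E
      -- Evaluation handles 16ᴱ samples with at most 12 · 16ᴱ items each, hence the base 256 = 16²;
      -- learning fits into the same bound.
      t = (2 * K + 3000) * 256 ^ E

      suc-e≤E : suc e ≤ E
      suc-e≤E = m≤n+m (suc e) q

      e+1≤2^E : suc e ≤ 2 ^ E
      e+1≤2^E = ≤-trans suc-e≤E (<⇒≤ (n<2^n E))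

      2-powers : ∀ b → 2 ^ E * b ^ E ≡ (2 * b) ^ E
      2-powers b = sym (^-distribʳ-* E 2 b)

      ≤256 : ∀ b → b ≤ 256 → b ^ E ≤ 256 ^ E
      ≤256 b = ^-monoˡ-≤ E

      1≤256 : 1 ≤ 256 ^ E
      1≤256 = m^n>0 256 E

      evaluation-time : m * (nodes n d * 210 + 60) + 50 ≤ t
      evaluation-time = begin
        16 ^ E * (nodes n d * 210 + 60) + 50
          ≤⟨ +-mono-≤ (*-monoʳ-≤ (16 ^ E) (+-mono-≤ (*-monoˡ-≤ 210 (≤-trans (nodes-small (λ≤ R≥15)) (*-monoʳ-≤ 12 (^-monoʳ-≤ 16 suc-e≤E))))
               (*-monoʳ-≤ 60 (m^n>0 16 E)))) (*-monoʳ-≤ 50 1≤256) ⟩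
        16 ^ E * (12 * 16 ^ E * 210 + 60 * 16 ^ E) + 50 * 256 ^ E
          ≡⟨ lemma 12 210 60 (16 ^ E) (50 * 256 ^ E) ⟩
        2580 * (16 ^ E * 16 ^ E) + 50 * 256 ^ E
          ≡⟨ cong (λ z → 2580 * z + 50 * 256 ^ E) (^-distribʳ-* E 16 16) ⟨
        2580 * 256 ^ E + 50 * 256 ^ E
          ≡⟨ *-distribʳ-+ (256 ^ E) 2580 50 ⟨
        2630 * 256 ^ E
          ≤⟨ *-monoˡ-≤ (256 ^ E) (≤-trans (≤ᵇ⇒≤ 2630 3000 _) (m≤n+m 3000 (2 * K))) ⟩
        t ∎
        where
        open ≤-Reasoning
        lemma : ∀ a b c x y → x * (a * x * b + c * x) + y ≡ (a * b + c) * (x * x) + y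
        lemma = solve-∀

      R-bound : R ≤ K * 16 ^ E
      R-bound = begin
        R                          ≤⟨ n≤1+n R ⟩
        suc R                      ≡⟨ Q-K ⟩
        K * 4th q                  ≤⟨ *-monoʳ-≤ K (*-mono-≤ (*-mono-≤ q≤ q≤) (*-mono-≤ q≤ q≤)) ⟩
        K * 4th (2 ^ E)            ≡⟨ cong (K *_) (trans (cong₂ _*_ (2-powers 2) (2-powers 2)) (sym (^-distribʳ-* E 4 4))) ⟩
        K * 16 ^ E                 ∎
        where
        open ≤-Reasoning
        q≤ : q ≤ 2 ^ E
        q≤ = ≤-trans (m≤m+n q (suc e)) (<⇒≤ (n<2^n E))

      n-bound : n ≤ 4 ^ E
      n-bound = ≤-trans (<⇒≤ (half-lower a n)) (≤-trans (*-mono-≤ (≤-trans (λ≤ R≥15) e+1≤2^E) e+1≤2^E) (≤-reflexive (2-powers 2)))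

      a-bound : a ≤ 2 ^ E
      a-bound = ≤-trans (<⇒≤ (n<2^n a)) (≤-trans (λ≤ R≥15) e+1≤2^E)

      learning-time : learnTime R q n a E ≤ t
      learning-time = begin
        a * round R n + R + 2 * q + 120 * 16 ^ E + 40
          ≤⟨ +-mono-≤ (+-monoˡ-≤ (120 * 16 ^ E) (+-mono-≤ (+-mono-≤ rounds R-bound) (*-monoʳ-≤ 2 (≤-trans q≤ (^-monoˡ-≤ E {2} {16} (s≤s (s≤s z≤n)))))))
                      (*-monoʳ-≤ 40 (m^n>0 16 E)) ⟩
        (K + 107) * 256 ^ E + K * 16 ^ E + 2 * 16 ^ E + 120 * 16 ^ E + 40 * 16 ^ E
          ≡⟨ lemma₁ K (256 ^ E) (16 ^ E) ⟩
        (K + 107) * 256 ^ E + (K + 162) * 16 ^ E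
          ≤⟨ +-monoʳ-≤ ((K + 107) * 256 ^ E) (*-monoʳ-≤ (K + 162) (≤256 16 (≤ᵇ⇒≤ 16 256 _))) ⟩
        (K + 107) * 256 ^ E + (K + 162) * 256 ^ E
          ≡⟨ lemma₂ K (256 ^ E) ⟩
        (2 * K + 269) * 256 ^ E
          ≤⟨ *-monoˡ-≤ (256 ^ E) (+-monoʳ-≤ (2 * K) (≤ᵇ⇒≤ 269 3000 _)) ⟩
        t ∎
        where
        open ≤-Reasoning
        q≤ : q ≤ 2 ^ E
        q≤ = ≤-trans (m≤m+n q (suc e)) (<⇒≤ (n<2^n E))
        lemma₁ : ∀ K x y → (K + 107) * x + K * y + 2 * y + 120 * y + 40 * y ≡ (K + 107) * x + (K + 162) * y
        lemma₁ = solve-∀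
        lemma₂ : ∀ K x → (K + 107) * x + (K + 162) * x ≡ (2 * K + 269) * x
        lemma₂ = solve-∀
        shape : ∀ R n → suc ((R + 1) + 7 * (n * 7 + 8)) ≡ R + 49 * n + 58
        shape = solve-∀
        collect : ∀ K x → K * x + 49 * x + 58 * x ≡ (K + 107) * x
        collect = solve-∀
        swap : ∀ x y z → x * (y * z) ≡ y * (x * z)
        swap = solve-∀
        rounds : a * round R n ≤ (K + 107) * 256 ^ E
        rounds = begin
          a * round R n
            ≡⟨ cong (a *_) (shape R n) ⟩
          a * (R + 49 * n + 58)
            ≤⟨ *-mono-≤ a-bound (+-mono-≤ (+-mono-≤ R-bound (*-monoʳ-≤ 49 (≤-trans n-bound (^-monoˡ-≤ E {4} {16} (≤ᵇ⇒≤ 4 16 _))))) (*-monoʳ-≤ 58 (m^n>0 16 E))) ⟩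
          2 ^ E * (K * 16 ^ E + 49 * 16 ^ E + 58 * 16 ^ E)
            ≡⟨ cong (2 ^ E *_) (collect K (16 ^ E)) ⟩
          2 ^ E * ((K + 107) * 16 ^ E)
            ≡⟨ trans (swap (2 ^ E) (K + 107) (16 ^ E)) (cong ((K + 107) *_) (2-powers 16)) ⟩
          (K + 107) * 32 ^ E
            ≤⟨ *-monoʳ-≤ (K + 107) (≤256 32 (≤ᵇ⇒≤ 32 256 _)) ⟩
          (K + 107) * 256 ^ E ∎

      E⁴-bound : 4th E ≤ 8 * (K + 16) * (n * n * n) * 4th q
      E⁴-bound = begin
        4th E
          ≤⟨ *-mono-≤ (*-mono-≤ E≤ E≤) (*-mono-≤ E≤ E≤) ⟩
        4th (e + 2 * q)
          ≤⟨ fourth-power e (2 * q) ⟩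
        8 * (4th e + 4th (2 * q))
          ≤⟨ *-monoʳ-≤ 8 (+-mono-≤ (≤-trans e⁴-bound (≤-reflexive (cong (n * n * n *_) Q-K)))
               (≤-trans (≤-reflexive (trans (4th-* 2 q) (sym (*-identityˡ (16 * 4th q))))) (*-monoˡ-≤ (16 * 4th q) (*-mono-≤ (*-mono-≤ n>0 n>0) n>0)))) ⟩
        8 * (n * n * n * (K * 4th q) + n * n * n * (16 * 4th q))
          ≡⟨ lemma (n * n * n) K (4th q) ⟩
        8 * (K + 16) * (n * n * n) * 4th q ∎
        where
        open ≤-Reasoning
        E≤ : E ≤ e + 2 * q
        E≤ = ≤-trans (≤-reflexive (trans (+-suc q e) (+-comm (suc q) e))) (+-monoʳ-≤ e (+-mono-≤ {1} {q} q>0 (m≤m+n q 0)))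
        lemma : ∀ N K Q → 8 * (N * (K * Q) + N * (16 * Q)) ≡ 8 * (K + 16) * N * Q
        lemma = solve-∀

      module _ (S : Subset n) (convex : Convex S) where

        small-tail : ℤ.+ (6 * q) ℤ.* highEnergy d (±1 ∘ S) ℤ.≤ ℤ.+ (9 ^ n)
        small-tail = go a refl
          where
          go : ∀ b → a ≡ b → ℤ.+ (6 * q) ℤ.* highEnergy d (±1 ∘ S) ℤ.≤ ℤ.+ (9 ^ n)
          -- No round was run, so D = n and the degree bound n + 1 leaves no energy at all above it.
          go zero eq = ℤ.≤-trans (ℤ.≤-reflexive (trans (cong (ℤ.+ (6 * q) ℤ.*_) (tail-beyond n<d (±1 ∘ S))) (ℤ.*-zeroʳ (ℤ.+ (6 * q))))) (ℤ.+≤+ z≤n)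
            where
            n<d : n < d
            n<d = subst (λ b → n < suc (half (b * 2) n)) (sym eq) ≤-refl
          go (suc b) eq = ℤ.*-cancelˡ-≤-pos (ℤ.+ (6 * q) ℤ.* highEnergy d (±1 ∘ S)) (ℤ.+ (9 ^ n)) (ℤ.+ 72)
            (subst₂ ℤ._≤_
              (trans (cong (ℤ._* highEnergy d (±1 ∘ S)) (trans (cong ℤ.+_ s≡) (ℤ.pos-* 72 (6 * q)))) (ℤ.*-assoc (ℤ.+ 72) (ℤ.+ (6 * q)) (highEnergy d (±1 ∘ S))))
              (ℤ.pos-* 72 (9 ^ n))
              (tail-bound (convex⇒separable convex) s d n>0 s>0 d≥2 large))
            where
            large : 18 * n * 4th s ≤ d * d
            large = degree-large s b eq Q≡
            d≥2 : 2 ≤ d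
            d≥2 with 2 ≤? d
            ... | yes le = le
            ... | no ¬le = ⊥-elim (<⇒≱ {1} {18} (≤ᵇ⇒≤ 2 18 _) (≤-trans
              (*-mono-≤ (*-mono-≤ (≤-refl {18}) n>0) (*-mono-≤ (*-mono-≤ s>0 s>0) (*-mono-≤ s>0 s>0)))
              (≤-trans large (*-mono-≤ (s≤s⁻¹ (≰⇒> ¬le)) (s≤s⁻¹ (≰⇒> ¬le))))))

        -- The summand q in the exponent E pays for the factor 6 q, since 6 q ≤ 16^q; the other
        -- summand pays for the volume.
        enough-samples : 6 * q * volume n d ≤ m
        enough-samples = ≤-trans (*-mono-≤ (6q≤ q) volume-small) (≤-reflexive (sym (^-distribˡ-+-* 16 q (suc e))))
          where
          6q≤ : ∀ q → 6 * q ≤ 16 ^ q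
          6q≤ zero    = z≤n
          6q≤ (suc q) = ≤-trans (≤-reflexive (*-suc 6 q)) (≤-trans (+-mono-≤ (*-monoʳ-≤ 6 (m^n>0 16 q)) (6q≤ q))
            (≤-trans (≤-reflexive (+-comm (6 * 16 ^ q) (16 ^ q))) (*-monoˡ-≤ (16 ^ q) {7} {16} (≤ᵇ⇒≤ 7 16 _))))

        representation : Vec (Point n) m → Tree
        representation xs = encodeℕ d ∙ treeList (examples S xs ʳ++ [])

        examples≡ : ∀ (xs : Vec (Point n) m) → examples S xs ≡ map (example S) (Vec.toList xs)
        examples≡ xs = toList-map (example S) xs
        length-xs : ∀ (xs : Vec (Point n) m) → length (Vec.toList xs) ≡ m
        length-xs xs = trans (length-toList xs) (vec-length xs)
          where
          vec-length : ∀ {k} (ys : Vec (Point n) k) → Vec.length ys ≡ k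
          vec-length []       = refl
          vec-length (y ∷ ys) = cong suc (vec-length ys)
        learnt : ∀ (xs : Vec (Point n) m) → Computes (learnerProgram R q) (encodeℕ n) (examples S xs) t (representation xs)
        learnt xs = Computes-≤ {P = learnerProgram R q} learning-time (learn R q n a big small (examples S xs)
          (trans (cong length (examples≡ xs)) (trans (length-map (example S) (Vec.toList xs)) (length-xs xs))))
        evaluated : ∀ (xs : Vec (Point n) m) x →
          ∃[ answer ] (Computes evaluatorProgram (representation xs ∙ encodePoint x) [] t answer × truth answer ≡ hypothesis S d xs x)
        evaluated xs x = convert (evaluate S d x (Vec.toList xs ʳ++ []))
          where
          samples≡ : map (example S) (Vec.toList xs ʳ++ []) ≡ examples S xs ʳ++ []
          samples≡ = trans (map-ʳ++ (example S) (Vec.toList xs)) (cong (_ʳ++ []) (sym (examples≡ xs)))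
          time : length (Vec.toList xs ʳ++ []) * (nodes n d * 210 + 60) + 50 ≤ t
          time = ≤-trans (≤-reflexive (cong (λ l → l * (nodes n d * 210 + 60) + 50)
            (trans (length-ʳ++ (Vec.toList xs)) (trans (+-identityʳ _) (length-xs xs))))) evaluation-time
          correct : posℤ (scoreSum S d x (Vec.toList xs ʳ++ [])) ≡ hypothesis S d xs x
          correct = cong posℤ (trans (scoreSum-ʳ++ S d x (Vec.toList xs) []) (trans (ℤ.+-identityʳ _) (scoreSum-score S d x xs)))
          convert : ∃[ answer ] (Computes evaluatorProgram ((encodeℕ d ∙ treeList (map (example S) (Vec.toList xs ʳ++ []))) ∙ encodePoint x) []
                                   (length (Vec.toList xs ʳ++ []) * (nodes n d * 210 + 60) + 50) answer
                                 × truth answer ≡ posℤ (scoreSum S d x (Vec.toList xs ʳ++ []))) →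
                    ∃[ answer ] (Computes evaluatorProgram (representation xs ∙ encodePoint x) [] t answer × truth answer ≡ hypothesis S d xs x)
          convert (answer , run , truth≡) = answer
            , Computes-≤ {P = evaluatorProgram} time (subst (λ l → Computes evaluatorProgram ((encodeℕ d ∙ treeList l) ∙ encodePoint x) []
                (length (Vec.toList xs ʳ++ []) * (nodes n d * 210 + 60) + 50) answer) samples≡ run)
            , trans truth≡ correct

        probable : ∀ ε → (1ℤ ℚ./ q) {{>-nonZero q>0}} ℚ.≤ ε → (ℤ.+ 2 ℚ./ 3) ℚ.≤ Pr (λ (xs : Vec (Point n) m) → dist S (hypothesis S d xs) ℚ.≤? ε)
        probable ε ε≥ = mostly-good {m = m} (λ xs → dist S (hypothesis S d xs) ℚ.≤? ε) (λ xs → q * mistakes S d xs) (3 ^ n) {{m^n≢0 3 n}}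
          (λ xs le → distance-≤ S (hypothesis S d xs) q {{>-nonZero q>0}} ε ε≥ le)
          (≤-trans (≤-reflexive (trans (cong (3 *_) (Σ-*ˡ (vectors (points n) m) q (mistakes S d)))
                                       (sym (*-assoc 3 q (Σ (vectors (points n) m) (mistakes S d))))))
                   (expected-mistakes S d m q {{m^n≢0 16 E}} small-tail enough-samples))

        learns : ∀ ε → (1ℤ ℚ./ q) {{>-nonZero q>0}} ℚ.≤ ε →
          Σ[ rep ∈ (Vec (Point n) m → Tree) ] Σ[ T ∈ (Vec (Point n) m → Subset n) ]
            (∀ (xs : Vec (Point n) m) → Computes (learnerProgram R q) (encodeℕ n) (examples S xs) t (rep xs))
          × (∀ (xs : Vec (Point n) m) x → ∃[ answer ] (Computes evaluatorProgram (rep xs ∙ encodePoint x) [] t answer × truth answer ≡ T xs x))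
          × (ℤ.+ 2 ℚ./ 3) ℚ.≤ Pr (λ xs → dist S (T xs) ℚ.≤? ε)
        learns ε ε≥ = representation , hypothesis S d , learnt , evaluated , probable ε ε≥

    -- The exponent of 3 is 6 E because 3⁶ = 729 exceeds the bases 16 and 256 of the sample size and
    -- the running time.
    Bounded-≤ : ∀ C ε n (n>0 : 1 ≤ n) p b .{{_ : NonZero b}} → ε ≡ ℤ.+ p ℚ./ b → q * p ≤ 2 * b →
      leading K ≤ C → ∀ N → N ≤ C * 729 ^ Dimension.E n n>0 → Bounded C ε n N
    Bounded-≤ C ε n n>0 p b refl qp≤ C≥ N N≤ = 6 * E
      , ≤-trans N≤ (≤-reflexive (cong (C *_) (^-*-assoc 3 6 E)))
      , exponent-bound C (6 * E) p b n n>0 (≤-trans (≤-product 1 165888 (K + 16) (≤ᵇ⇒≤ 1 165888 _) (≤-trans (≤ᵇ⇒≤ 1 16 _) (m≤n+m 16 K))) C≥) (begin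
          4th (6 * E * p)
            ≡⟨ trans (4th-* (6 * E) p) (cong (_* 4th p) (4th-* 6 E)) ⟩
          1296 * 4th E * 4th p
            ≤⟨ *-monoˡ-≤ (4th p) (*-monoʳ-≤ 1296 E⁴-bound) ⟩
          1296 * (8 * (K + 16) * (n * n * n) * 4th q) * 4th p
            ≡⟨ trans (shape 1296 8 (K + 16) (n * n * n) (4th q) (4th p)) (cong (10368 * (K + 16) * (n * n * n) *_) (sym (4th-* q p))) ⟩
          10368 * (K + 16) * (n * n * n) * 4th (q * p)
            ≤⟨ *-monoʳ-≤ (10368 * (K + 16) * (n * n * n)) (*-mono-≤ (*-mono-≤ qp≤ qp≤) (*-mono-≤ qp≤ qp≤)) ⟩
          10368 * (K + 16) * (n * n * n) * 4th (2 * b)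
            ≡⟨ trans (cong (10368 * (K + 16) * (n * n * n) *_) (4th-* 2 b)) (shape′ 10368 16 (K + 16) (n * n * n) (4th b)) ⟩
          leading K * (n * n * n) * 4th b
            ≤⟨ *-monoˡ-≤ (4th b) (*-monoˡ-≤ (n * n * n) C≥) ⟩
          C * (n * n * n) * 4th b ∎)
      where
      open Dimension n n>0
      open ≤-Reasoning
      shape : ∀ a b K N Q P → a * (b * K * N * Q) * P ≡ a * b * K * N * (Q * P)
      shape = solve-∀
      shape′ : ∀ a b K N B → a * K * N * (b * B) ≡ a * b * K * N * B
      shape′ = solve-∀

  constantProgram : Program
  constantProgram = record { auxiliary = 0 ; body = 0F ≔ nil }

  constantly-nil : ∀ input supply → Computes constantProgram input supply 2 nil
  constantly-nil input supply = 2 , [] , supply , ≤-refl , assign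

  Σ-𝟙≤length : ∀ {A : Set} (xs : List A) (f : A → Bool) → Σ xs (𝟙 ∘ f) ≤ length xs
  Σ-𝟙≤length xs f = ≤-trans (Σ-mono xs (λ x → 𝟙≤1 (f x))) (≤-reflexive (trans (Σ-const xs 1) (*-identityʳ _)))
    where
    𝟙≤1 : ∀ b → 𝟙 b ≤ 1
    𝟙≤1 true  = ≤-refl
    𝟙≤1 false = z≤n

  Goal : ℕ → ℚ → Set
  Goal C ε = Σ[ A ∈ Algorithm ] ((n : ℕ) → 1 ≤ n → ∃[ m ] ∃[ t ] (Bounded C ε n m × Bounded C ε n t × Learns A ε n m t))

  -- Distances are at most 1, so the empty set is good enough and the exponent can be 0. The case is
  -- separate because no q ≥ 1 satisfies q ε ≤ 2 when ε is large.
  large-error : ∀ C ε p b .{{_ : NonZero b}} → 2 ≤ C → ε ≡ ℤ.+ p ℚ./ b → 1ℚ ℚ.≤ ε → Goal C ε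
  large-error C ε p b C≥2 refl ε≥1 = record { learner = constantProgram ; evaluator = constantProgram } , λ n n>0 →
    0 , 2 , bounded n n>0 0 z≤n , bounded n n>0 2 (≤-trans C≥2 (≤-reflexive (sym (*-identityʳ C)))) , λ S convex →
      (λ _ → nil) , (λ _ _ → false)
      , (λ xs → constantly-nil _ _)
      , (λ xs x → nil , constantly-nil _ _ , refl)
      , mostly-good {n} {0} (λ xs → dist S (λ _ → false) ℚ.≤? ε) (λ _ → 0) 1
          (λ _ _ → distance-≤ S (λ _ → false) 1 ε ε≥1
            (≤-trans (≤-reflexive (*-identityˡ (Σ (points n) (λ x → 𝟙 (S x xor false)))))
              (≤-trans (Σ-𝟙≤length (points n) (λ x → S x xor false)) (≤-reflexive (length-vectors (−1ᵗ ∷ 0ᵗ ∷ +1ᵗ ∷ []) n)))))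
          z≤n
    where
    bounded : ∀ n → 1 ≤ n → ∀ N → N ≤ C * 1 → Bounded C ε n N
    bounded n n>0 N le = 0 , le , exponent-bound C 0 p b n n>0 (≤-trans (s≤s z≤n) C≥2) z≤n

  small-error : ∀ K q s R ε p b .{{_ : NonZero b}} (q>0 : 1 ≤ q) → 1 ≤ s → 15 ≤ R →
    s ≡ 72 * (6 * q) → suc R ≡ 288 * 4th s → suc R ≡ K * 4th q →
    ε ≡ ℤ.+ p ℚ./ b → q * p ≤ 2 * b → b ≤ q * p → Goal (leading K) ε
  small-error K q s R ε p b q>0 s>0 R≥15 s≡ Q≡ Q-K refl qp≤ b≤qp = algorithm , λ n n>0 →
    Dimension.m n n>0 , Dimension.t n n>0 ,
    Bounded-≤ C ε n n>0 p b refl qp≤ ≤-refl (Dimension.m n n>0)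
      (≤-trans (^-monoˡ-≤ (Dimension.E n n>0) {16} {729} (≤ᵇ⇒≤ 16 729 _)) (m≤n*m (729 ^ Dimension.E n n>0) C {{>-nonZero C>0}})) ,
    Bounded-≤ C ε n n>0 p b refl qp≤ ≤-refl (Dimension.t n n>0)
      (*-mono-≤ C≥ (^-monoˡ-≤ (Dimension.E n n>0) {256} {729} (≤ᵇ⇒≤ 256 729 _))) ,
    λ S convex → Dimension.learns n n>0 S convex ε ε≥
    where
    open Construction K q s R q>0 s>0 R≥15 s≡ Q≡ Q-K
    C : ℕ
    C = leading K
    C>0 : 1 ≤ C
    C>0 = ≤-product 1 165888 (K + 16) (≤ᵇ⇒≤ 1 165888 _) (≤-trans (≤ᵇ⇒≤ 1 16 _) (m≤n+m 16 K))
    C≥ : 2 * K + 3000 ≤ C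
    C≥ = ≤-trans (+-mono-≤ (*-monoˡ-≤ K {2} {165888} (≤ᵇ⇒≤ 2 165888 _)) (≤ᵇ⇒≤ 3000 (165888 * 16) _))
                 (≤-reflexive (sym (*-distribˡ-+ 165888 K 16)))
    ε≥ : (1ℤ ℚ./ q) {{>-nonZero q>0}} ℚ.≤ ε
    ε≥ = /-≤ 1ℤ (ℤ.+ p) q b {{>-nonZero q>0}} (subst₂ ℤ._≤_ (ℤ.pos-* 1 b) (ℤ.pos-* p q)
      (ℤ.+≤+ (≤-trans (≤-reflexive (*-identityˡ b)) (≤-trans b≤qp (≤-reflexive (*-comm q p))))))

  small-error′ : ∀ K q ε p b .{{_ : NonZero b}} → K ≡ constant → 1 ≤ q →
    ε ≡ ℤ.+ p ℚ./ b → q * p ≤ 2 * b → b ≤ q * p → Goal (leading K) ε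
  small-error′ K q ε p b K≡ q>0 = small-error K q s R ε p b q>0 s>0 R≥15 (*-assoc 72 6 q) Q≡ Q-K
    where
    s R : ℕ
    s = 432 * q
    R = pred (288 * 4th s)
    s>0 : 1 ≤ s
    s>0 = ≤-product 1 432 q (≤ᵇ⇒≤ 1 432 _) q>0
    4th>0 : 1 ≤ 4th s
    4th>0 = *-mono-≤ (*-mono-≤ s>0 s>0) (*-mono-≤ s>0 s>0)
    Q≡ : suc R ≡ 288 * 4th s
    Q≡ = suc-pred (288 * 4th s) {{>-nonZero (≤-product 1 288 (4th s) (≤ᵇ⇒≤ 1 288 _) 4th>0)}}
    R≥15 : 15 ≤ R
    R≥15 = s≤s⁻¹ (≤-trans (≤ᵇ⇒≤ 16 288 _) (≤-trans (*-monoʳ-≤ 288 4th>0) (≤-reflexive (sym Q≡))))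
    Q-K : suc R ≡ K * 4th q
    Q-K = trans Q≡ (trans (cong (288 *_) (4th-* 432 q)) (trans (sym (*-assoc 288 (4th 432) (4th q))) (cong (_* 4th q) (sym K≡))))

  -- K is a variable known to equal `constant` rather than the numeral itself, which keeps that
  -- large number from being computed with.
  all-errors : ∀ K → K ≡ constant → ∀ ε → 0ℚ ℚ.< ε → Goal (leading K) ε
  all-errors K K≡ (mkℚ (ℤ.+ zero)  b c) ε>0 = ⊥-elim (ℤ.<-irrefl refl (ℚ.drop-*<* ε>0))
  all-errors K K≡ (mkℚ (-[1+ p ]) b c) ε>0 = ⊥-elim (ℤ.<⇒≱ (ℚ.drop-*<* ε>0) ℤ.-≤+)
  all-errors K K≡ ε@(mkℚ (+[1+ p′ ]) b′ c) ε>0 = split (suc p′) (suc b′) (sym (ℚ.↥p/↧p≡p ε)) (suc b′ ≤? suc p′)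
    where
    split : ∀ p b .{{_ : NonZero p}} .{{_ : NonZero b}} → ε ≡ ℤ.+ p ℚ./ b → Dec (b ≤ p) → Goal (leading K) ε
    split p b ε≡ (yes b≤p) = large-error (leading K) ε p b
          (≤-product 2 165888 (K + 16) (≤ᵇ⇒≤ 2 165888 _) (≤-trans (≤ᵇ⇒≤ 1 16 _) (m≤n+m 16 K))) ε≡
          (subst (1ℚ ℚ.≤_) (sym ε≡) (/-≤ 1ℤ (ℤ.+ p) 1 b
            (subst₂ ℤ._≤_ (ℤ.pos-* 1 b) (ℤ.pos-* p 1)
              (ℤ.+≤+ (≤-trans (≤-reflexive (*-identityˡ b)) (≤-trans b≤p (≤-reflexive (sym (*-identityʳ p)))))))))
    -- q = ⌊1/ε⌋ + 1, so that 1/q ≤ ε ≤ 2/q, the upper bound because ε < 1.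
    split p b ε≡ (no b≰p) = small-error′ K (suc (b / p)) ε p b K≡ (s≤s z≤n) ε≡
          (≤-trans (+-mono-≤ (<⇒≤ (≰⇒> b≰p)) (m/n*n≤m b p)) (≤-reflexive (cong (b +_) (sym (+-identityʳ b)))))
          (≤-trans (≤-reflexive (m≡m%n+[m/n]*n b p)) (+-monoˡ-≤ (b / p * p) (<⇒≤ (m%n<n b p))))

-- The learning theorem for convex sets.

open import Defs
open import Data.Nat.Base using (ℕ; _≤_)
open import Data.Product.Base using (Σ-syntax; ∃-syntax; _×_; _,_)
open import Data.Rational.Base using (ℚ; 0ℚ) renaming (_<_ to _<ℚ_)
open import Relation.Binary.PropositionalEquality.Core using (refl)
open Learning using (constant; leading; all-errors)

theorem1p5 : ∃[ C ] ((ε : ℚ) → 0ℚ <ℚ ε →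
    Σ[ A ∈ Algorithm ] ((n : ℕ) → 1 ≤ n →
    ∃[ m ] ∃[ t ] (Bounded C ε n m × Bounded C ε n t × Learns A ε n m t)))
theorem1p5 = leading constant , all-errors constant refl
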